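{- Let $\mathcal{A}$ be an irreducible simplicial hyperplane arrangement in $\mathbb{P}^3(\mathbb{R})$. If $m(\mathcal{A})=6$, then $\mathcal{A}$ is isomorphic to $\mathcal{A}(A_4)$ or to $\mathcal{A}(D_4)$. In particular, $\mathcal{A}$ is a simply laced Grünbaum–Shephard arrangement whose characteristic polynomial splits over $\mathbb{R}$.
   Context: An arrangement in $\mathbb{P}^3(\mathbb{R})$ is a finite set of projective hyperplanes (images of linear hyperplanes of $\mathbb{R}^4$) with empty common intersection; it induces a cell decomposition of $\mathbb{P}^3$, and two arrangements are isomorphic if their cell decompositions are isomorphic. The 3-cells are chambers; each is bounded by at least $4$ hyperplanes (walls); $\mathcal{A}$ is simplicial if every chamber has exactly $4$ walls. $\mathcal{A}$ is reducible if, after a linear change of coordinates, $\mathbb{R}^4=V_1\oplus V_2$ with $V_1,V_2\neq 0$ and every linear hyperplane corresponding to $\mathcal{A}$ is of the form $H_1\oplus V_2$ with $H_1$ a hyperplane of $V_1$ or $V_1\oplus H_2$ with $H_2$ a hyperplane of $V_2$ (i.e. $\mathcal{A}$ is a product of two arrangements); otherwise it is irreducible. Vertices are the points of $\mathbb{P}^3$ that are intersections of hyperplanes of $\mathcal{A}$ (1-dimensional intersections in $\mathbb{R}^4$), lines the 2-dimensional intersections in $\mathbb{R}^4$; weights count the hyperplanes containing them; $h^\mathcal{A}_i$ is the number of lines of weight $i$, and $m(\mathcal{A})$ is the maximal weight of a vertex. $\mathcal{A}(A_4)$ is the reflection arrangement of the Coxeter group $A_4$ (the $10$ hyperplanes $x_i=x_j$,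 $1\le i<j\le5$, in $\{x\in\mathbb{R}^5:\sum x_i=0\}\cong\mathbb{R}^4$), and $\mathcal{A}(D_4)$ is the reflection arrangement of $D_4$ (the $12$ hyperplanes $x_i=\pm x_j$, $1\le i<j\le 4$, in $\mathbb{R}^4$), viewed projectively. $\mathcal{A}$ is simply laced if for every chamber $C$ and every pair of distinct walls $H,H'$ of $C$, at most three hyperplanes contain $H\cap H'$. $\mathcal{A}$ is a Grünbaum–Shephard arrangement if $h^\mathcal{A}_2>\sum_{i\ge3}h^\mathcal{A}_i$. The characteristic polynomial is $\chi(\mathcal{A},t)=\sum_{X\in L}\mu(\mathbb{R}^4,X)t^{\dim X}$ with $L$ the intersection lattice (reverse inclusion) and $\mu$ its Möbius function. -}

module Defs where

open import Level using (Level) renaming (suc to lsuc)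
open import Algebra.Bundles using (CommutativeRing)
open import Axiom.ExcludedMiddle using (ExcludedMiddle)
open import Data.Bool.Base using (if_then_else_)
open import Data.Empty using (⊥-elim)
open import Data.Fin.Base using (Fin)
open import Data.Fin.Patterns using (0F; 1F; 2F; 3F; 4F)
import Data.Fin.Properties as Fin
open import Data.Fin.Subset using (Subset; inside; outside; _∈_; ∣_∣; _⊂_) renaming (⊥ to ∅)
open import Data.Fin.Subset.Induction using (⊂-wellFounded)
open import Data.Fin.Subset.Properties using (_⊂?_)
import Data.Bool.Properties as Bool
open import Data.Integer.Base as ℤ using (ℤ; +_; -[1+_])
open import Data.List.Base as List using (List; []; _∷_; _++_; length; filter; foldr; drop; upTo; allFin; cartesianProduct)
open import Data.Nat.Base as ℕ using (ℕ; zero; suc)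
open import Data.Nat.ListAction using () renaming (sum to sumℕ)
open import Data.Product.Base using (Σ; ∃; ∃-syntax; ∃₂; _×_; _,_; proj₁; proj₂)
open import Data.Sum.Base using (_⊎_; inj₁; inj₂)
open import Data.Vec.Base as Vec using ([]; _∷_)
import Data.Vec.Properties as Vec
open import Data.Vec.Functional using (Vector; fromList)
open import Induction.WellFounded using (Acc; acc)
open import Relation.Binary.Core using (Rel)
open import Relation.Binary.Definitions using (tri<; tri≈; tri>)
open import Relation.Binary.Morphism.Structures using (IsOrderIsomorphism)
open import Relation.Binary.PropositionalEquality.Core using (_≡_; _≢_)
open import Relation.Binary.Structures using (IsStrictTotalOrder)
open import Relation.Nullary using (¬_; Dec; yes; no; does)
open import Relation.Unary using (Pred; _≐_; _⊆_; _∩_)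

-- The real numbers, axiomatised as a Dedekind-complete ordered field (which is
-- unique up to isomorphism).  `sup` uses the textbook description of the least
-- upper bound s of S: no element exceeds s, and every b below s is exceeded by
-- some element.  Stated for arbitrary predicates, it implies excluded middle
-- (see `em`), so the theory over ℝ below is classical.
record Reals (ℓ : Level) : Set (lsuc ℓ) where
  infix 4 _<ᵣ_
  field
    commutativeRing : CommutativeRing ℓ ℓ

  open CommutativeRing commutativeRing public
    hiding (zero)

  field
    _<ᵣ_               : Rel Carrier ℓ
    isStrictTotalOrder : IsStrictTotalOrder _≈_ _<ᵣ_
    0≉1                : ¬ (0# ≈ 1#)
    inverse            : ∀ {x} → ¬ (x ≈ 0#) → ∃[ y ] (x * y ≈ 1#)
    +-mono-<           : ∀ {x y} z → x <ᵣ y → (x + z) <ᵣ (y + z)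
    *-pos              : ∀ {x y} → 0# <ᵣ x → 0# <ᵣ y → 0# <ᵣ (x * y)
    sup                : (S : Pred Carrier ℓ) →
                         ∃ S →
                         ∃[ u ] (∀ {x} → S x → ¬ (u <ᵣ x)) →
                         ∃[ s ] ((∀ {x} → S x → ¬ (s <ᵣ x)) ×
                                 (∀ {b} → b <ᵣ s → ∃[ x ] (S x × b <ᵣ x)))

  open IsStrictTotalOrder isStrictTotalOrder public
    using (compare) renaming (irrefl to <-irrefl; trans to <-trans; <-respʳ-≈ to <-respʳ; <-respˡ-≈ to <-respˡ)

  private
    distinct : ∃₂ λ a b → a <ᵣ b
    distinct with compare 0# 1#
    ... | tri< 0<1 _ _ = 0# , 1# , 0<1
    ... | tri≈ _ 0≈1 _ = ⊥-elim (0≉1 0≈1)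
    ... | tri> _ _ 1<0 = 1# , 0# , 1<0

  em : ExcludedMiddle ℓ
  em {P} = decide
    where
    a = proj₁ distinct
    b = proj₁ (proj₂ distinct)
    a<b : a <ᵣ b
    a<b = proj₂ (proj₂ distinct)

    S : Pred Carrier ℓ
    S x = x ≈ a ⊎ (x ≈ b × P)

    bounded : ∀ {x} → S x → ¬ (b <ᵣ x)
    bounded (inj₁ x≈a)       b<x = <-irrefl refl (<-trans a<b (<-respʳ x≈a b<x))
    bounded (inj₂ (x≈b , _)) b<x = <-irrefl (sym x≈b) b<x

    S-sup = sup S (a , inj₁ refl) (b , bounded)
    s     = proj₁ S-sup

    above : ∀ {x} → S x × a <ᵣ x → P
    above (inj₁ x≈a , a<x)     = ⊥-elim (<-irrefl (sym x≈a) a<x)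
    above (inj₂ (_ , p) , _)   = p

    s≯b : P → ¬ (s <ᵣ b)
    s≯b p = proj₁ (proj₂ S-sup) (inj₂ (refl , p))

    decide : Dec P
    decide with compare a s
    ... | tri< a<s _ _ = yes (above (proj₂ (proj₂ (proj₂ S-sup) a<s)))
    ... | tri≈ _ a≈s _ = no λ p → s≯b p (<-respˡ a≈s a<b)
    ... | tri> _ _ s<a = no λ p → s≯b p (<-trans s<a a<b)

allSubsets : ∀ n → List (Subset n)
allSubsets zero    = [] ∷ []
allSubsets (suc n) = List.map (outside ∷_) (allSubsets n) ++ List.map (inside ∷_) (allSubsets n)

pairs : ∀ n → List (Fin n × Fin n)
pairs n = filter (λ (i , j) → i Fin.<? j) (cartesianProduct (allFin n) (allFin n))

module OverReals {ℓ} (R : Reals ℓ) where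

  open Reals R
  open import Algebra.Definitions.RawMonoid +-rawMonoid using (sum) renaming (_×_ to _·1#_)

  count : ∀ {a} {A : Set a} → List A → Pred A ℓ → ℕ
  count xs P = length (filter (λ x → em {P x}) xs)

  ----------------------------------------------------------------------
  -- Linear algebra in ℝ⁴

  V : Set ℓ
  V = Vector Carrier 4

  infix  4 _≈ᵥ_
  infixl 6 _+ᵥ_ _-ᵥ_
  infixr 7 _*ᵥ_

  _≈ᵥ_ : Rel V ℓ
  x ≈ᵥ y = ∀ k → x k ≈ y k

  0ᵥ : V
  0ᵥ _ = 0#

  _+ᵥ_ _-ᵥ_ : V → V → V
  (x +ᵥ y) k = x k + y k
  (x -ᵥ y) k = x k - y k

  -ᵥ_ : V → V
  (-ᵥ x) k = - x k

  _*ᵥ_ : Carrier → V → V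
  (c *ᵥ x) k = c * x k

  ⟨_,_⟩ : V → V → Carrier
  ⟨ x , y ⟩ = sum (λ k → x k * y k)

  combination : ∀ {d} → Vector Carrier d → Vector V d → V
  combination c b k = sum (λ i → c i * b i k)

  Span : ∀ {d} → Vector V d → Pred V ℓ
  Span b x = ∃[ c ] (x ≈ᵥ combination c b)

  LinearlyIndependent : ∀ {d} → Vector V d → Set ℓ
  LinearlyIndependent b = ∀ c → combination c b ≈ᵥ 0ᵥ → ∀ i → c i ≈ 0#

  -- U is a linear subspace with a basis of d vectors.
  HasDim : Pred V ℓ → ℕ → Set ℓ
  HasDim U d = ∃[ b ] (LinearlyIndependent {d} b × U ≐ Span b)

  record IsSubspace (U : Pred V ℓ) : Set ℓ where
    field
      resp     : ∀ {x y} → x ≈ᵥ y → U x → U y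
      0-closed : U 0ᵥ
      +-closed : ∀ {x y} → U x → U y → U (x +ᵥ y)
      *-closed : ∀ c {x} → U x → U (c *ᵥ x)

  NonTrivial : Pred V ℓ → Set ℓ
  NonTrivial U = ∃[ x ] (U x × ¬ (x ≈ᵥ 0ᵥ))

  _⊕_ : Pred V ℓ → Pred V ℓ → Pred V ℓ
  (U ⊕ W) x = ∃₂ λ u w → U u × W w × x ≈ᵥ u +ᵥ w

  -- K is a linear hyperplane of the subspace U (K = 0 if U is a line).
  HyperplaneOf : Pred V ℓ → Pred V ℓ → Set ℓ
  HyperplaneOf U K = K ⊆ U × ∃[ d ] (HasDim U (suc d) × HasDim K d)

  ----------------------------------------------------------------------
  -- Arrangements in ℙ³

  -- Homogeneous coordinates of points of ℙ³.
  Point : Set ℓ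
  Point = Σ V λ x → ¬ (x ≈ᵥ 0ᵥ)

  -- A finite family of hyperplanes is given by normal vectors α i.
  module _ {n : ℕ} (α : Vector V n) where

    H : Fin n → Pred V ℓ
    H i x = ⟨ α i , x ⟩ ≈ 0#

    record IsArrangement : Set ℓ where
      field
        nonzero      : ∀ i → ¬ (α i ≈ᵥ 0ᵥ)
        distinct     : ∀ {i j} → H i ≐ H j → i ≡ j
        empty-common : ∀ (p : Point) → ¬ (∀ i → H i (proj₁ p))

    -- The cells of ℙ³ are the images of the cones of ℝ⁴ on which every linear
    -- form α i has constant sign.  x ≼ y: the cone containing x lies in the
    -- closure of the cone containing y.
    _≼_ : Rel V ℓ
    x ≼ y = ∀ i → (0# <ᵣ ⟨ α i , x ⟩ → 0# <ᵣ ⟨ α i , y ⟩)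
                × (⟨ α i , x ⟩ <ᵣ 0# → ⟨ α i , y ⟩ <ᵣ 0#)

    SameCone : Rel V ℓ
    SameCone x y = x ≼ y × y ≼ x

    -- Cells are represented by their points, cones C and -C having the same
    -- image in ℙ³.  p ⊑ q: the cell of p lies in the closure of the cell of q.
    SameCell _⊑_ : Rel Point ℓ
    SameCell (x , _) (y , _) = SameCone x y ⊎ SameCone (-ᵥ x) y
    (x , _) ⊑ (y , _)        = x ≼ y ⊎ (-ᵥ x) ≼ y

    IsChamber : Pred Point ℓ
    IsChamber (x , _) = ∀ i → ¬ H i x

    -- H i is a wall of the chamber of p: some 2-cell in its closure (a cell
    -- contained in exactly one hyperplane) lies on H i.
    IsWall : Point → Pred (Fin n) ℓ
    IsWall p i = ∃[ q ] (q ⊑ p × H i (proj₁ q) × (∀ j → H j (proj₁ q) → j ≡ i))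

    Simplicial : Set ℓ
    Simplicial = ∀ p → IsChamber p → count (allFin n) (IsWall p) ≡ 4

    Reducible : Set (lsuc ℓ)
    Reducible = ∃₂ λ (V₁ V₂ : Pred V ℓ) →
      IsSubspace V₁ × IsSubspace V₂ ×
      NonTrivial V₁ × NonTrivial V₂ ×
      (∀ x → (V₁ ⊕ V₂) x) × (∀ {x} → V₁ x → V₂ x → x ≈ᵥ 0ᵥ) ×
      (∀ i → (∃[ K ] (HyperplaneOf V₁ K × H i ≐ (K ⊕ V₂)))
           ⊎ (∃[ K ] (HyperplaneOf V₂ K × H i ≐ (V₁ ⊕ K))))

    Irreducible : Set (lsuc ℓ)
    Irreducible = ¬ Reducible

    SimplyLaced : Set ℓ
    SimplyLaced = ∀ p → IsChamber p → ∀ i j → i ≢ j → IsWall p i → IsWall p j →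
      count (allFin n) (λ k → (H i ∩ H j) ⊆ H k) ℕ.≤ 3

    --------------------------------------------------------------------
    -- The intersection lattice

    ⋂ : Subset n → Pred V ℓ
    ⋂ S x = ∀ i → i ∈ S → H i x

    -- An element X of the lattice is encoded by the set S of all hyperplanes
    -- containing it, so X = ⋂ S, the weight of X is ∣ S ∣, and reverse
    -- inclusion of intersections is inclusion of these sets.
    IsFlat : Pred (Subset n) ℓ
    IsFlat S = ∀ i → ⋂ S ⊆ H i → i ∈ S

    IsFlatOfDim : ℕ → Pred (Subset n) ℓ
    IsFlatOfDim d S = IsFlat S × HasDim (⋂ S) d

    IsVertex IsLine : Pred (Subset n) ℓ
    IsVertex = IsFlatOfDim 1
    IsLine   = IsFlatOfDim 2

    IsMaxVertexWeight : ℕ → Set ℓ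
    IsMaxVertexWeight m = (∃[ S ] (IsVertex S × ∣ S ∣ ≡ m))
                        × (∀ S → IsVertex S → ∣ S ∣ ℕ.≤ m)

    h : ℕ → ℕ
    h w = count (allSubsets n) (λ S → IsLine S × ∣ S ∣ ≡ w)

    -- No weight exceeds n, so i ranges over 3, …, n.
    GrünbaumShephard : Set
    GrünbaumShephard = sumℕ (List.map h (drop 3 (upTo (suc n)))) ℕ.< h 2

    sumℤ : List ℤ → ℤ
    sumℤ = foldr ℤ._+_ (+ 0)

    flats : List (Subset n)
    flats = filter (λ S → em {IsFlat S}) (allSubsets n)

    -- μ S is the Möbius value μ(ℝ⁴, ⋂ S); the flat encoding ℝ⁴ itself is ∅.
    -- The inner sum runs over the flats strictly below S.
    μ-acc : (S : Subset n) → Acc _⊂_ S → ℤ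
    μ-acc S (acc rec) with Vec.≡-dec Bool._≟_ S ∅
    ... | yes _ = + 1
    ... | no  _ = ℤ.- sumℤ (List.map below flats)
      where
      below : Subset n → ℤ
      below T with T ⊂? S
      ... | yes T⊂S = μ-acc T (rec T⊂S)
      ... | no  _   = + 0

    μ : Subset n → ℤ
    μ S = μ-acc S (⊂-wellFounded S)

    -- The coefficient of tᵏ in the characteristic polynomial.
    χ : ℕ → ℤ
    χ k = sumℤ (List.map μ (filter (λ S → em {HasDim (⋂ S) k}) flats))

  -- Isomorphism of the posets of cells, ordered by inclusion in the closure.
  Isomorphic : ∀ {m n} → Vector V m → Vector V n → Set ℓ
  Isomorphic α β = ∃[ f ] IsOrderIsomorphism (SameCell α) (SameCell β) (_⊑_ α) (_⊑_ β) f

  ----------------------------------------------------------------------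
  -- Splitting of polynomials over ℝ; a polynomial is its sequence of
  -- coefficients.

  fromℤ : ℤ → Carrier
  fromℤ (+ n)    = n ·1# 1#
  fromℤ -[1+ n ] = - (suc n ·1# 1#)

  constant : Carrier → ℕ → Carrier
  constant c zero    = c
  constant c (suc _) = 0#

  -- Multiplication by t - r.
  linearFactor : Carrier → (ℕ → Carrier) → (ℕ → Carrier)
  linearFactor r p zero    = - (r * p zero)
  linearFactor r p (suc k) = p k - r * p (suc k)

  SplitsOverℝ : (ℕ → Carrier) → Set ℓ
  SplitsOverℝ p = ∃₂ λ c (roots : List Carrier) →
    ∀ k → p k ≈ foldr linearFactor (constant c) roots k

  ----------------------------------------------------------------------
  -- The reflection arrangements of A₄ and D₄

  e : Fin 4 → V
  e i k = if does (i Fin.≟ k) then 1# else 0#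

  -- The hyperplane Σ xᵢ = 0 of ℝ⁵ is identified with ℝ⁴ through its first four
  -- coordinates; the fifth coordinate is then -(x₀ + x₁ + x₂ + x₃).
  coordinate : Fin 5 → V
  coordinate 0F = e 0F
  coordinate 1F = e 1F
  coordinate 2F = e 2F
  coordinate 3F = e 3F
  coordinate 4F = λ _ → - 1#

  A₄-normals : List V
  A₄-normals = List.map (λ (i , j) → coordinate i -ᵥ coordinate j) (pairs 5)

  D₄-normals : List V
  D₄-normals = List.concatMap (λ (i , j) → (e i -ᵥ e j) ∷ (e i +ᵥ e j) ∷ []) (pairs 4)

  𝒜A₄ : Vector V (length A₄-normals)
  𝒜A₄ = fromList A₄-normals

  𝒜D₄ : Vector V (length D₄-normals)
  𝒜D₄ = fromList D₄-normals

{-# OPTIONS --safe #-}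
-- A chamber is a simplicial cone, given by four rays and the four dual wall
-- forms; the coordinates of a hyperplane are the values of its form on the
-- rays, and they all have the same sign.  Crossing a wall changes a single
-- ray, and every hyperplane is a wall of some chamber of a gallery from a
-- chamber to its opposite.
--
-- Join two walls by an edge if more than two hyperplanes contain their
-- intersection.  If the diagram of one chamber is disconnected, then so are
-- all diagrams, along the same decomposition of the space, and the arrangement
-- is reducible.  Two adjacent edges i - j - k always produce a hyperplane whose
-- coordinates i, j and k are all nonzero.  With the three walls and one further
-- hyperplane for each of the two edges this makes six hyperplanes through a
-- common vertex, so m(𝒜) = 6 leaves room for no other: every edge belongs to
-- exactly three hyperplanes and the diagram contains no triangle.  It is
-- therefore a path, a star or a 4-cycle.  Rescaled so that the extra hyperplane
-- of an edge is the sum of the two wall forms, the chambers are related by the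
-- simple reflections of the diagram.  A 4-cycle is impossible, since a suitable
-- positive combination of the wall forms never decreases along a gallery.  For
-- the path and the star the hyperplanes are the roots of A₄ and D₄, and the
-- flats are the images of the faces of one chamber under the Weyl group, which
-- leaves finite computations with integer vectors.
module Submission where

open import Defs
open import Data.Nat using (ℕ)
open import Data.Product using (_×_)
open import Data.Sum using (_⊎_)
open import Data.Vec.Functional using (Vector)

open import Data.Fin.Base using (Fin)
open import Data.Fin.Subset using (Subset; ∣_∣)
open import Data.Nat.Base as ℕ using ()
open import Level using (Level)

-- No symmetry of the arrangement is known in advance, so crossing a wall need not be a reflection:
-- the new ray is minus the old one plus multiples of the other three, and these multiples may
-- depend on the chamber. Each multiple is the slope of a hyperplane in the pencil of two walls,
-- namely of the steepest one. Once the weight bound leaves a single such hyperplane on each edge,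
-- the slope belongs to the edge, but it could still change from chamber to chamber. It does not:
-- the hyperplane in general position to two adjacent edges keeps one sign on each neighbouring
-- chamber, the inequalities obtained there from different sides meet and express its coordinates
-- through the slopes, and it is this hyperplane that takes over an edge after a crossing. The
-- slopes thus form a constant matrix. Along a tree they can all be scaled to 1; on a cycle the
-- product of the slopes around it survives as a positive parameter, and the height argument has to
-- work for each of its values.

-- Finite sets, lists without repetition and cardinalities

module FiniteSets where

  open import Data.Fin.Base using (Fin; zero; suc; punchOut)
  import Data.Fin.Properties as Fin
  open import Data.Fin.Subset using (Subset; _∈_; ∣_∣; inside; outside) renaming (_-_ to _∖_)
  open import Data.Fin.Subset.Properties using (x∈p∧x≢y⇒x∈p-y; x∈p⇒∣p-x∣<∣p∣)
  open import Data.Integer.Base as ℤ using (ℤ; +_)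
  import Data.Integer.Properties as ℤ
  open import Data.List.Base using (List; []; _∷_; length; map; foldr; lookup)
  import Data.List.Properties as List
  import Data.List.Membership.Propositional as List
  open import Data.List.Membership.Propositional.Properties using (∈-map⁺; ∈-map⁻; ∈-++⁺ˡ; ∈-++⁺ʳ; ∈-lookup)
  open import Data.List.Membership.Propositional.Properties.WithK using (unique∧set⇒bag)
  open import Data.List.Relation.Binary.BagAndSetEquality using (∼bag⇒↭)
  open import Data.List.Relation.Binary.Permutation.Propositional as Perm using (_↭_)
  open import Data.List.Relation.Unary.All as All using (All; []; _∷_)
  import Data.List.Relation.Unary.All.Properties as All
  open import Data.List.Relation.Unary.AllPairs using ([]; _∷_)
  open import Data.List.Relation.Unary.Any as Any using (here)
  open import Data.List.Relation.Unary.Any.Properties using (lookup-index)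
  open import Data.List.Relation.Unary.Unique.Propositional using (Unique)
  import Data.List.Relation.Unary.Unique.Propositional.Properties as Unique
  open import Data.Nat.Base as ℕ using (ℕ)
  import Data.Nat.Properties as ℕ
  open import Data.Product.Base using (∃-syntax; _×_; _,_)
  open import Data.Vec.Base using ([]; _∷_; here; there)
  open import Data.Vec.Properties using (∷-injectiveʳ)
  open import Function.Bundles using (mk⇔)
  open import Function.Definitions using (Injective)
  open import Relation.Nullary using (¬_; yes; no; contradiction)
  import Relation.Binary.PropositionalEquality as ≡
  open ≡ using (_≡_; _≢_; ≢-sym)

  abstract
    -- A missed value could be punched out of the target, leaving an injection into a smaller set.
    injective⇒surjective : ∀ {m} (μ : Fin m → Fin m) → Injective _≡_ _≡_ μ → ∀ j → ∃[ i ] μ i ≡ j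
    injective⇒surjective {ℕ.suc m} μ inj j with Fin.any? (λ i → μ i Fin.≟ j)
    ... | yes p = p
    ... | no none = contradiction (Fin.injective⇒≤ {f = λ i → punchOut (miss i)} (λ {i} {i′} e → inj (Fin.punchOut-injective (miss i) (miss i′) e))) (ℕ.<⇒≱ (ℕ.n<1+n m))
      where
      miss : ∀ i → j ≢ μ i
      miss i e = none (i , ≡.sym e)

    lookup-injective : ∀ {A : Set} {xs : List A} → Unique xs → Injective _≡_ _≡_ (lookup xs)
    lookup-injective {xs = x ∷ xs} (p ∷ u) {zero}  {zero}  e = ≡.refl
    lookup-injective {xs = x ∷ xs} (p ∷ u) {zero}  {suc j} e = contradiction e (All.lookup p (∈-lookup {xs = xs} j))
    lookup-injective {xs = x ∷ xs} (p ∷ u) {suc i} {zero}  e = contradiction (≡.sym e) (All.lookup p (∈-lookup {xs = xs} i))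
    lookup-injective {xs = x ∷ xs} (p ∷ u) {suc i} {suc j} e = ≡.cong suc (lookup-injective u e)

    length-mono-unique : ∀ {A : Set} {xs ys : List A} → Unique xs → (∀ {x} → x List.∈ xs → x List.∈ ys) → length xs ℕ.≤ length ys
    length-mono-unique {xs = xs} {ys} u sub = Fin.injective⇒≤ {f = position} inj
      where
      position : Fin (length xs) → Fin (length ys)
      position i = Any.index (sub (∈-lookup {xs = xs} i))
      inj : Injective _≡_ _≡_ position
      inj {i} {j} e = lookup-injective u (≡.trans (lookup-index (sub (∈-lookup {xs = xs} i)))
        (≡.trans (≡.cong (lookup ys) e) (≡.sym (lookup-index (sub (∈-lookup {xs = xs} j))))))

    -- Used to exhibit hyperplanes through a vertex one by one: a list of distinct members bounds
    -- the weight of the flat from below.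
    unique-length-≤ : ∀ {m} (S : Subset m) (xs : List (Fin m)) → Unique xs → All (_∈ S) xs → length xs ℕ.≤ ∣ S ∣
    unique-length-≤ S [] _ _ = ℕ.z≤n
    unique-length-≤ S (x ∷ xs) (x∉ ∷ u) (x∈ ∷ mem) = ℕ.≤-<-trans
      (unique-length-≤ (S ∖ x) xs u (All.zipWith (λ (x≢y , y∈) → x∈p∧x≢y⇒x∈p-y y∈ (≢-sym x≢y)) (x∉ , mem)))
      (x∈p⇒∣p-x∣<∣p∣ x∈)

    -- Counts and sums over the flats of the arrangement are compared with those over the faces of
    -- the root system through this lemma.
    unique-↭ : ∀ {A : Set} {xs ys : List A} → Unique xs → Unique ys → (∀ {x} → x List.∈ xs → x List.∈ ys) → (∀ {x} → x List.∈ ys → x List.∈ xs) → xs ↭ ys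
    unique-↭ u v f g = ∼bag⇒↭ (unique∧set⇒bag u v (mk⇔ f g))

    elements : ∀ {m} → Subset m → List (Fin m)
    elements [] = []
    elements (inside  ∷ p) = zero ∷ map suc (elements p)
    elements (outside ∷ p) = map suc (elements p)

    length-elements : ∀ {m} (p : Subset m) → length (elements p) ≡ ∣ p ∣
    length-elements [] = ≡.refl
    length-elements (inside  ∷ p) = ≡.cong ℕ.suc (≡.trans (List.length-map suc (elements p)) (length-elements p))
    length-elements (outside ∷ p) = ≡.trans (List.length-map suc (elements p)) (length-elements p)

    elements-∈ : ∀ {m} (p : Subset m) → All (_∈ p) (elements p)
    elements-∈ [] = []
    elements-∈ (inside  ∷ p) = here ∷ All.map⁺ (All.map there (elements-∈ p))
    elements-∈ (outside ∷ p) = All.map⁺ (All.map there (elements-∈ p))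

    elements-unique : ∀ {m} (p : Subset m) → Unique (elements p)
    elements-unique [] = []
    elements-unique (inside  ∷ p) = All.map⁺ (All.universal (λ _ ()) (elements p)) ∷ Unique.map⁺ Fin.suc-injective (elements-unique p)
    elements-unique (outside ∷ p) = Unique.map⁺ Fin.suc-injective (elements-unique p)

    injection-≤ : ∀ {m m′} (f : Fin m → Fin m′) → Injective _≡_ _≡_ f → (p : Subset m) (q : Subset m′) → (∀ i → i ∈ p → f i ∈ q) → ∣ p ∣ ℕ.≤ ∣ q ∣
    injection-≤ f inj p q h = ≡.subst (ℕ._≤ ∣ q ∣) (≡.trans (List.length-map f (elements p)) (length-elements p))
      (unique-length-≤ q (map f (elements p)) (Unique.map⁺ inj (elements-unique p)) (All.map⁺ (All.map (h _) (elements-∈ p))))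

    allSubsets-complete : ∀ {m} (S : Subset m) → S List.∈ allSubsets m
    allSubsets-complete [] = here ≡.refl
    allSubsets-complete {ℕ.suc m} (outside ∷ S) = ∈-++⁺ˡ (∈-map⁺ (outside ∷_) (allSubsets-complete S))
    allSubsets-complete {ℕ.suc m} (inside ∷ S) = ∈-++⁺ʳ (map (outside ∷_) (allSubsets m)) (∈-map⁺ (inside ∷_) (allSubsets-complete S))

    allSubsets-unique : ∀ m → Unique (allSubsets m)
    allSubsets-unique ℕ.zero = [] ∷ []
    allSubsets-unique (ℕ.suc m) = Unique.++⁺ (Unique.map⁺ ∷-injectiveʳ (allSubsets-unique m)) (Unique.map⁺ ∷-injectiveʳ (allSubsets-unique m)) disjoint
      where
      disjoint : ∀ {S} → ¬ (S List.∈ map (outside ∷_) (allSubsets m) × S List.∈ map (inside ∷_) (allSubsets m))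
      disjoint (p , q) with ∈-map⁻ (outside ∷_) p | ∈-map⁻ (inside ∷_) q
      ... | _ , _ , ≡.refl | _ , _ , ()

    sumℤ-↭ : ∀ {xs ys} → xs ↭ ys → foldr ℤ._+_ (+ 0) xs ≡ foldr ℤ._+_ (+ 0) ys
    sumℤ-↭ Perm.refl = ≡.refl
    sumℤ-↭ (Perm.prep x p) = ≡.cong (λ s → x ℤ.+ s) (sumℤ-↭ p)
    sumℤ-↭ (Perm.swap {xs} {ys} x y p) = ≡.trans (≡.sym (ℤ.+-assoc x y (foldr ℤ._+_ (+ 0) xs))) (≡.trans (≡.cong₂ ℤ._+_ (ℤ.+-comm x y) (sumℤ-↭ p)) (ℤ.+-assoc y x (foldr ℤ._+_ (+ 0) ys)))
    sumℤ-↭ (Perm.trans p q) = ≡.trans (sumℤ-↭ p) (sumℤ-↭ q)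

-- Ordered field arithmetic and the integers inside the reals

module OrderedField {ℓ : Level} (R : Reals ℓ) where

  open Reals R public renaming (Carrier to ℝ; _<ᵣ_ to _<_)
  open OverReals R public hiding (e; h; μ; χ)
  open import Algebra.Properties.Ring ring public
    using (-‿distribˡ-*; -‿distribʳ-*; -0#≈0#; -‿involutive; -‿+-comm)
  open import Algebra.Properties.Monoid.Mult +-monoid using (×-homo-+)
  open import Algebra.Properties.Semiring.Mult semiring using (×1-homo-*)
  open import Algebra.Properties.CommutativeMonoid.Sum +-commutativeMonoid public
    using (sum-remove; ∑-distrib-+; ∑-comm; sum-cong-≋; sum-replicate-zero)
  open import Algebra.Properties.Semiring.Sum semiring public
    using (*-distribˡ-sum; *-distribʳ-sum)
  open import Algebra.Definitions.RawMonoid +-rawMonoid public using (sum) renaming (_×_ to _·1_)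
  open import Algebra.Solver.Ring.AlmostCommutativeRing using (fromCommutativeRing; _-Raw-AlmostCommutative⟶_)
  open import Data.Fin.Base using (Fin; zero; suc)
  open import Data.Integer.Base as ℤ using (ℤ; +_; -[1+_]; +[1+_])
  import Data.Integer.Properties as ℤ
  open import Data.Maybe.Base using (Maybe; just; nothing)
  open import Data.Nat.Base as ℕ using (ℕ)
  open import Data.Product.Base
  open import Data.Sum.Base
  open import Data.Empty
  open import Relation.Nullary hiding (¬_)
  open import Relation.Nullary public using (¬_)
  open import Relation.Binary.Definitions using (tri<; tri≈; tri>)
  import Relation.Binary.PropositionalEquality as ≡
  open ≡ using (_≡_; _≢_)
  open import Relation.Binary.Reasoning.Setoid setoid

  infix 4 _≤_
  _≤_ : ℝ → ℝ → Set ℓ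
  x ≤ y = ¬ (y < x)

  abstract
    fromℤ-⊖ : ∀ m n → fromℤ (m ℤ.⊖ n) ≈ (m ·1 1#) - (n ·1 1#)
    fromℤ-⊖ ℕ.zero ℕ.zero = sym (-‿inverseʳ 0#)
    fromℤ-⊖ ℕ.zero (ℕ.suc n) = sym (+-identityˡ _)
    fromℤ-⊖ (ℕ.suc m) ℕ.zero = sym (trans (+-congˡ -0#≈0#) (+-identityʳ _))
    fromℤ-⊖ (ℕ.suc m) (ℕ.suc n) = begin
      fromℤ (ℕ.suc m ℤ.⊖ ℕ.suc n)      ≡⟨ ≡.cong fromℤ (ℤ.[1+m]⊖[1+n]≡m⊖n m n) ⟩
      fromℤ (m ℤ.⊖ n)                  ≈⟨ fromℤ-⊖ m n ⟩
      a - b                        ≈⟨ +-congʳ (sym (+-identityʳ a)) ⟩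
      a + 0# - b                   ≈⟨ +-congʳ (+-congˡ (sym (-‿inverseʳ 1#))) ⟩
      a + (1# - 1#) - b            ≈⟨ +-congʳ (sym (+-assoc a 1# (- 1#))) ⟩
      a + 1# - 1# - b              ≈⟨ +-assoc (a + 1#) (- 1#) (- b) ⟩
      a + 1# + (- 1# - b)          ≈⟨ +-cong (+-comm a 1#) (-‿+-comm 1# b) ⟩
      1# + a - (1# + b)            ∎
      where a b : ℝ
            a = m ·1 1#
            b = n ·1 1#

    fromℤ-neg : ∀ x → fromℤ (ℤ.- x) ≈ - fromℤ x
    fromℤ-neg (+ ℕ.zero) = sym -0#≈0#
    fromℤ-neg +[1+ n ] = refl
    fromℤ-neg -[1+ n ] = sym (-‿involutive _)

    fromℤ-+ : ∀ x y → fromℤ (x ℤ.+ y) ≈ fromℤ x + fromℤ y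
    fromℤ-+ (+ m) (+ n) = ×-homo-+ 1# m n
    fromℤ-+ (+ m) -[1+ n ] = fromℤ-⊖ m (ℕ.suc n)
    fromℤ-+ -[1+ m ] (+ n) = trans (fromℤ-⊖ n (ℕ.suc m)) (+-comm _ _)
    fromℤ-+ -[1+ m ] -[1+ n ] = trans (-‿cong (trans (reflexive (≡.cong (λ k → ℕ.suc k ·1 1#) (≡.sym (ℕ-+-suc m n)))) (×-homo-+ 1# (ℕ.suc m) (ℕ.suc n)))) (sym (-‿+-comm _ _))
      where open import Data.Nat.Properties using () renaming (+-suc to ℕ-+-suc)

    fromℤ-*⁺ : ∀ m y → fromℤ ((+ m) ℤ.* y) ≈ (m ·1 1#) * fromℤ y
    fromℤ-*⁺ ℕ.zero y = trans (reflexive (≡.cong fromℤ (ℤ.*-zeroˡ y))) (sym (zeroˡ _))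
    fromℤ-*⁺ (ℕ.suc m) y = begin
      fromℤ (+ ℕ.suc m ℤ.* y)         ≡⟨ ≡.cong fromℤ (ℤ.suc-* (+ m) y) ⟩
      fromℤ (y ℤ.+ + m ℤ.* y)         ≈⟨ fromℤ-+ y (+ m ℤ.* y) ⟩
      fromℤ y + fromℤ (+ m ℤ.* y)         ≈⟨ +-cong (sym (*-identityˡ (fromℤ y))) (fromℤ-*⁺ m y) ⟩
      1# * fromℤ y + (m ·1 1#) * fromℤ y  ≈⟨ sym (distribʳ (fromℤ y) 1# _) ⟩
      (ℕ.suc m ·1 1#) * fromℤ y       ∎

    fromℤ-* : ∀ x y → fromℤ (x ℤ.* y) ≈ fromℤ x * fromℤ y
    fromℤ-* (+ m) y = fromℤ-*⁺ m y
    fromℤ-* -[1+ m ] y = begin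
      fromℤ (-[1+ m ] ℤ.* y)         ≡⟨ ≡.cong fromℤ (≡.sym (ℤ.neg-distribˡ-* (+ ℕ.suc m) y)) ⟩
      fromℤ (ℤ.- (+ ℕ.suc m ℤ.* y))  ≈⟨ fromℤ-neg (+ ℕ.suc m ℤ.* y) ⟩
      - fromℤ (+ ℕ.suc m ℤ.* y)      ≈⟨ -‿cong (fromℤ-*⁺ (ℕ.suc m) y) ⟩
      - ((ℕ.suc m ·1 1#) * fromℤ y)  ≈⟨ -‿distribˡ-* _ _ ⟩
      fromℤ -[1+ m ] * fromℤ y           ∎

  -- Unlike fromℤ, this embedding sends the literal 1 to 1# by computation, so
  -- that the ring solver recognises 1#.
  ιℕ : ℕ → ℝ
  ιℕ 0 = 0#
  ιℕ 1 = 1#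
  ιℕ (ℕ.suc (ℕ.suc n)) = 1# + ιℕ (ℕ.suc n)

  ι : ℤ → ℝ
  ι (+ n) = ιℕ n
  ι -[1+ n ] = - ιℕ (ℕ.suc n)

  abstract
    ιℕ≈ : ∀ n → ιℕ n ≈ n ·1 1#
    ιℕ≈ 0 = refl
    ιℕ≈ 1 = sym (+-identityʳ 1#)
    ιℕ≈ (ℕ.suc (ℕ.suc n)) = +-congˡ (ιℕ≈ (ℕ.suc n))

    ι≈fromℤ : ∀ x → ι x ≈ fromℤ x
    ι≈fromℤ (+ n) = ιℕ≈ n
    ι≈fromℤ -[1+ n ] = -‿cong (ιℕ≈ (ℕ.suc n))

    ι-+ : ∀ x y → ι (x ℤ.+ y) ≈ ι x + ι y
    ι-+ x y = trans (ι≈fromℤ (x ℤ.+ y)) (trans (fromℤ-+ x y) (sym (+-cong (ι≈fromℤ x) (ι≈fromℤ y))))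

    ι-* : ∀ x y → ι (x ℤ.* y) ≈ ι x * ι y
    ι-* x y = trans (ι≈fromℤ (x ℤ.* y)) (trans (fromℤ-* x y) (sym (*-cong (ι≈fromℤ x) (ι≈fromℤ y))))

    ι-neg : ∀ x → ι (ℤ.- x) ≈ - ι x
    ι-neg x = trans (ι≈fromℤ (ℤ.- x)) (trans (fromℤ-neg x) (sym (-‿cong (ι≈fromℤ x))))

  private
    weak : ∀ x y → Maybe (ι x ≈ ι y)
    weak x y with x ℤ.≟ y
    ... | yes e = just (reflexive (≡.cong ι e))
    ... | no _ = nothing

    ι-morphism : ℤ.+-*-rawRing -Raw-AlmostCommutative⟶ fromCommutativeRing commutativeRing
    ι-morphism = record { ⟦_⟧ = ι ; +-homo = ι-+ ; *-homo = ι-* ; -‿homo = ι-neg ; 0-homo = refl ; 1-homo = refl }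

  open import Algebra.Solver.Ring ℤ.+-*-rawRing (fromCommutativeRing commutativeRing) ι-morphism weak public
    using (solve; _:=_; _:+_; _:*_; :-_; _:-_; con)

  abstract
    *-swapˡ : ∀ a c x → a * (c * x) ≈ c * (a * x)
    *-swapˡ = solve 3 (λ a c x → a :* (c :* x) := c :* (a :* x)) refl

    -1*x≈-x : ∀ x → - 1# * x ≈ - x
    -1*x≈-x = solve 1 (λ x → con -[1+ 0 ] :* x := :- x) refl

    <-asym : ∀ {x y} → x < y → ¬ (y < x)
    <-asym p q = <-irrefl refl (<-trans p q)

    <⇒≤ : ∀ {x y} → x < y → x ≤ y
    <⇒≤ = <-asym

    <⇒≉ : ∀ {x y} → x < y → x ≉ y
    <⇒≉ p e = <-irrefl e p

    ≤-refl : ∀ {x} → x ≤ x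
    ≤-refl = <-irrefl refl

    ≤-reflexive : ∀ {x y} → x ≈ y → x ≤ y
    ≤-reflexive e = <-irrefl (sym e)

    <-≤-trans : ∀ {x y z} → x < y → y ≤ z → x < z
    <-≤-trans {x} {y} {z} p q with compare x z
    ... | tri< a _ _ = a
    ... | tri≈ _ e _ = ⊥-elim (q (<-respˡ e p))
    ... | tri> _ _ c = ⊥-elim (q (<-trans c p))

    ≤-<-trans : ∀ {x y z} → x ≤ y → y < z → x < z
    ≤-<-trans {x} {y} {z} p q with compare x z
    ... | tri< a _ _ = a
    ... | tri≈ _ e _ = ⊥-elim (p (<-respʳ (sym e) q))
    ... | tri> _ _ c = ⊥-elim (p (<-trans q c))

    ≤-trans : ∀ {x y z} → x ≤ y → y ≤ z → x ≤ z
    ≤-trans p q r = q (<-≤-trans r p)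

    ≤-resp : ∀ {x y z w} → x ≈ y → z ≈ w → x ≤ z → y ≤ w
    ≤-resp e f p q = p (<-respˡ (sym f) (<-respʳ (sym e) q))

    <-resp : ∀ {x y z w} → x ≈ y → z ≈ w → x < z → y < w
    <-resp e f p = <-respʳ f (<-respˡ e p)

    ≤∧≉⇒< : ∀ {x y} → x ≤ y → x ≉ y → x < y
    ≤∧≉⇒< {x} {y} p q with compare x y
    ... | tri< a _ _ = a
    ... | tri≈ _ e _ = ⊥-elim (q e)
    ... | tri> _ _ c = ⊥-elim (p c)

    ≤-antisym : ∀ {x y} → x ≤ y → y ≤ x → x ≈ y
    ≤-antisym {x} {y} p q with compare x y
    ... | tri< a _ _ = ⊥-elim (q a)
    ... | tri≈ _ e _ = e
    ... | tri> _ _ c = ⊥-elim (p c)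

    ≉⇒<> : ∀ {x} → x ≉ 0# → 0# < x ⊎ x < 0#
    ≉⇒<> {x} n with compare 0# x
    ... | tri< a _ _ = inj₁ a
    ... | tri≈ _ e _ = ⊥-elim (n (sym e))
    ... | tri> _ _ c = inj₂ c

    ≤⇒<⊎≈ : ∀ {x} → 0# ≤ x → 0# < x ⊎ x ≈ 0#
    ≤⇒<⊎≈ {x} p with compare 0# x
    ... | tri< a _ _ = inj₁ a
    ... | tri≈ _ e _ = inj₂ (sym e)
    ... | tri> _ _ c = ⊥-elim (p c)

    x<y⇒0<y-x : ∀ {x y} → x < y → 0# < y - x
    x<y⇒0<y-x {x} p = <-respˡ (-‿inverseʳ x) (+-mono-< (- x) p)

    0<y-x⇒x<y : ∀ {x y} → 0# < y - x → x < y
    0<y-x⇒x<y {x} {y} p = <-resp (+-identityˡ x) (solve 2 (λ x y → y :- x :+ x := y) refl x y) (+-mono-< x p)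

    x≤y⇒0≤y-x : ∀ {x y} → x ≤ y → 0# ≤ y - x
    x≤y⇒0≤y-x {x} {y} p q = p (<-resp (solve 2 (λ x y → y :- x :+ x := y) refl x y) (+-identityˡ x) (+-mono-< x q))

    0≤y-x⇒x≤y : ∀ {x y} → 0# ≤ y - x → x ≤ y
    0≤y-x⇒x≤y {x} {y} p q = p (<-respʳ (-‿inverseʳ x) (+-mono-< (- x) q))

    neg-pos : ∀ {x} → x < 0# → 0# < - x
    neg-pos p = <-respʳ (+-identityˡ _) (x<y⇒0<y-x p)

    pos-neg : ∀ {x} → 0# < x → - x < 0#
    pos-neg {x} p = 0<y-x⇒x<y (<-respʳ (solve 1 (λ x → x := con (+ 0) :- (:- x)) refl x) p)

    +-pos-≤ : ∀ {x y} → 0# < x → 0# ≤ y → 0# < x + y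
    +-pos-≤ {x} {y} p q = ≤-<-trans q (<-respˡ (+-identityˡ y) (+-mono-< y p))

    +-≤-pos : ∀ {x y} → 0# ≤ x → 0# < y → 0# < x + y
    +-≤-pos p q = <-respʳ (+-comm _ _) (+-pos-≤ q p)

    +-pos : ∀ {x y} → 0# < x → 0# < y → 0# < x + y
    +-pos p q = +-pos-≤ p (<⇒≤ q)

    +-nonneg : ∀ {x y} → 0# ≤ x → 0# ≤ y → 0# ≤ x + y
    +-nonneg {x} {y} p q with ≤⇒<⊎≈ p
    ... | inj₁ p′ = <⇒≤ (+-pos-≤ p′ q)
    ... | inj₂ e = ≤-resp refl (trans (sym (+-identityˡ y)) (+-congʳ (sym e))) q

    *-nonneg : ∀ {x y} → 0# ≤ x → 0# ≤ y → 0# ≤ x * y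
    *-nonneg {x} {y} p q with ≤⇒<⊎≈ p | ≤⇒<⊎≈ q
    ... | inj₁ a | inj₁ b = <⇒≤ (*-pos a b)
    ... | inj₂ e | _ = ≤-reflexive (sym (trans (*-congʳ e) (zeroˡ y)))
    ... | _ | inj₂ e = ≤-reflexive (sym (trans (*-congˡ e) (zeroʳ x)))

    *-pos-neg : ∀ {x y} → 0# < x → y < 0# → x * y < 0#
    *-pos-neg {x} {y} p q = <-respˡ (solve 2 (λ x y → :- (x :* (:- y)) := x :* y) refl x y) (pos-neg (*-pos p (neg-pos q)))

    *-neg-neg : ∀ {x y} → x < 0# → y < 0# → 0# < x * y
    *-neg-neg {x} {y} p q = <-respʳ (solve 2 (λ x y → (:- x) :* (:- y) := x :* y) refl x y) (*-pos (neg-pos p) (neg-pos q))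

    *-neg-pos : ∀ {x y} → x < 0# → 0# < y → x * y < 0#
    *-neg-pos p q = <-respˡ (*-comm _ _) (*-pos-neg q p)

    square-pos : ∀ {x} → x ≉ 0# → 0# < x * x
    square-pos n with ≉⇒<> n
    ... | inj₁ p = *-pos p p
    ... | inj₂ p = *-neg-neg p p

    0<1 : 0# < 1#
    0<1 = <-respʳ (*-identityˡ 1#) (square-pos (λ e → 0≉1 (sym e)))

    1≉0 : 1# ≉ 0#
    1≉0 e = 0≉1 (sym e)

    *-cancel-pos : ∀ {x y} → 0# < x → 0# < x * y → 0# < y
    *-cancel-pos {x} {y} p q with compare 0# y
    ... | tri< a _ _ = a
    ... | tri≈ _ e _ = ⊥-elim (<-irrefl (sym (trans (*-congˡ (sym e)) (zeroʳ x))) q)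
    ... | tri> _ _ c = ⊥-elim (<-asym q (*-pos-neg p c))

    *-cancel-neg : ∀ {x y} → 0# < x → x * y < 0# → y < 0#
    *-cancel-neg {x} {y} p q with compare 0# y
    ... | tri> _ _ a = a
    ... | tri≈ _ e _ = ⊥-elim (<-irrefl (trans (*-congˡ (sym e)) (zeroʳ x)) q)
    ... | tri< c _ _ = ⊥-elim (<-asym q (*-pos p c))

  opaque
    dec : ∀ {P : Set ℓ} → Dec P
    dec = em

  infix 9 _⁻¹
  opaque
    _⁻¹ : ℝ → ℝ
    x ⁻¹ with dec {x ≈ 0#}
    -- Default value that makes inversion total; the laws below assume `x ≉ 0#`.
    ... | yes _ = 0#
    ... | no n = proj₁ (inverse n)

    *-inv : ∀ {x} → x ≉ 0# → x * x ⁻¹ ≈ 1#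
    *-inv {x} n with dec {x ≈ 0#}
    ... | yes e = ⊥-elim (n e)
    ... | no n′ = proj₂ (inverse n′)

  abstract
    inv-*′ : ∀ {x} → x ≉ 0# → x ⁻¹ * x ≈ 1#
    inv-*′ n = trans (*-comm _ _) (*-inv n)

    ≉-pos : ∀ {x} → 0# < x → x ≉ 0#
    ≉-pos p e = <⇒≉ p (sym e)

    ≉-neg : ∀ {x} → x < 0# → x ≉ 0#
    ≉-neg p e = <⇒≉ p e

    inv-pos : ∀ {x} → 0# < x → 0# < x ⁻¹
    inv-pos p = *-cancel-pos p (<-respʳ (sym (*-inv (≉-pos p))) 0<1)

    inv-≉ : ∀ {x} → x ≉ 0# → x ⁻¹ ≉ 0#
    inv-≉ n e = 1≉0 (trans (sym (*-inv n)) (trans (*-congˡ e) (zeroʳ _)))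

    *-cancelˡ : ∀ {x y z} → x ≉ 0# → x * y ≈ x * z → y ≈ z
    *-cancelˡ {x} {y} {z} n e = begin
      y                ≈⟨ sym (*-identityˡ y) ⟩
      1# * y           ≈⟨ *-congʳ (sym (inv-*′ n)) ⟩
      x ⁻¹ * x * y     ≈⟨ *-assoc _ _ _ ⟩
      x ⁻¹ * (x * y)   ≈⟨ *-congˡ e ⟩
      x ⁻¹ * (x * z)   ≈⟨ sym (*-assoc _ _ _) ⟩
      x ⁻¹ * x * z     ≈⟨ *-congʳ (inv-*′ n) ⟩
      1# * z           ≈⟨ *-identityˡ z ⟩
      z                ∎

    *-≈0 : ∀ {x y} → x ≉ 0# → x * y ≈ 0# → y ≈ 0#
    *-≈0 {x} n e = *-cancelˡ n (trans e (sym (zeroʳ x)))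

    *-≉0 : ∀ {x y} → x ≉ 0# → y ≉ 0# → x * y ≉ 0#
    *-≉0 n m e = m (*-≈0 n e)

    x-y≈0⇒x≈y : ∀ {x y} → x - y ≈ 0# → x ≈ y
    x-y≈0⇒x≈y {x} {y} e = trans (solve 2 (λ x y → x := x :- y :+ y) refl x y) (trans (+-congʳ e) (+-identityˡ y))

    sum-nonneg : ∀ {n} (f : Fin n → ℝ) → (∀ i → 0# ≤ f i) → 0# ≤ sum f
    sum-nonneg {ℕ.zero} _ _ = ≤-refl
    sum-nonneg {ℕ.suc n} f p = +-nonneg (p zero) (sum-nonneg (λ i → f (suc i)) (λ i → p (suc i)))

    sum-pos : ∀ {n} (f : Fin n → ℝ) → (∀ i → 0# ≤ f i) → ∀ i → 0# < f i → 0# < sum f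
    sum-pos f p zero q = +-pos-≤ q (sum-nonneg (λ i → f (suc i)) (λ i → p (suc i)))
    sum-pos f p (suc i) q = +-≤-pos (p zero) (sum-pos (λ i → f (suc i)) (λ i → p (suc i)) i q)

    sum-zero⁻¹ : ∀ {n} (f : Fin n → ℝ) → (∀ i → 0# ≤ f i) → sum f ≈ 0# → ∀ i → f i ≈ 0#
    sum-zero⁻¹ f p e i with ≤⇒<⊎≈ (p i)
    ... | inj₁ q = ⊥-elim (<⇒≉ (sum-pos f p i q) (sym e))
    ... | inj₂ z = z

    Σ-cong : ∀ {n} (f g : Fin n → ℝ) → (∀ i → f i ≈ g i) → sum f ≈ sum g
    Σ-cong f g = sum-cong-≋

    sum-zero : ∀ {n} (f : Fin n → ℝ) → (∀ i → f i ≈ 0#) → sum f ≈ 0#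
    sum-zero {n} f z = trans (Σ-cong f (λ _ → 0#) z) (sum-replicate-zero n)

    *-distribˡ-Σ : ∀ {n} c (f : Fin n → ℝ) → c * sum f ≈ sum (λ i → c * f i)
    *-distribˡ-Σ c f = *-distribˡ-sum c f

    sum-single : ∀ {n} (f : Fin n → ℝ) i → (∀ j → j ≢ i → f j ≈ 0#) → sum f ≈ f i
    sum-single f zero z = trans (+-congˡ (sum-zero (λ j → f (suc j)) (λ j → z (suc j) (λ ())))) (+-identityʳ _)
    sum-single f (suc i) z = trans (+-congʳ (z zero (λ ()))) (trans (+-identityˡ _)
      (sum-single (λ j → f (suc j)) i (λ j ne → z (suc j) (λ { ≡.refl → ne ≡.refl }))))

-- Linear forms, dependence and dual bases

module LinearAlgebra {ℓ : Level} (R : Reals ℓ) where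

  open OrderedField R
  open import Data.Fin.Base using (Fin; zero; suc; punchIn)
  open import Data.List.Base using (List; []; _∷_)
  open import Data.List.Relation.Unary.All as All using (All; []; _∷_)
  open import Data.Nat.Base as ℕ using (ℕ)
  import Data.Nat.Properties as ℕ
  open import Data.Product.Base
  open import Data.Sum.Base
  open import Data.Empty
  open import Data.Vec.Functional using (insertAt)
  open import Data.Vec.Functional.Properties using (insertAt-lookup; insertAt-punchIn)
  open import Data.Integer.Base using (+_)
  open import Relation.Nullary using (yes; no; contradiction)
  open import Relation.Binary.Definitions using (tri<; tri≈; tri>)
  import Relation.Binary.PropositionalEquality as ≡
  open ≡ using (_≡_; _≢_)
  open import Relation.Binary.Reasoning.Setoid setoid

  private
    eliminate : ∀ c x r y → c * x ≈ c * (x - r * y) + (c * r) * y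
    eliminate = solve 4 (λ c x r y → c :* x := c :* (x :- r :* y) :+ (c :* r) :* y) refl

    cancel-product : ∀ s y → (- s) * y + (0# + s * y) ≈ 0#
    cancel-product = solve 2 (λ s y → (:- s) :* y :+ (con (+ 0) :+ s :* y) := con (+ 0)) refl

    halve : ∀ h x → h * x ≈ (1# + 1#) * h * x - h * x
    halve = solve 2 (λ h x → h :* x := (con (+ 1) :+ con (+ 1)) :* h :* x :- h :* x) refl

    affine-pos : ∀ a b i t → (a * i - t) * (- b) ≈ a * (i * (- b)) + t * b
    affine-pos = solve 4 (λ a b i t → (a :* i :- t) :* (:- b) := a :* (i :* (:- b)) :+ t :* b) refl

    affine-neg : ∀ a b t → - (- a + t * (- b)) ≈ a + t * b
    affine-neg = solve 3 (λ a b t → :- (:- a :+ t :* (:- b)) := a :+ t :* b) refl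

    solve-pivot : ∀ i c d y → - i * (0# + y) ≈ i * c * d - i * (c * d + y)
    solve-pivot = solve 4 (λ i c d y → (:- i) :* (con (+ 0) :+ y) := i :* c :* d :- i :* (c :* d :+ y)) refl

  abstract
    ⟨⟩-cong : ∀ a a′ x y → a ≈ᵥ a′ → x ≈ᵥ y → ⟨ a , x ⟩ ≈ ⟨ a′ , y ⟩
    ⟨⟩-cong a a′ x y p q = Σ-cong (λ k → a k * x k) (λ k → a′ k * y k) (λ k → *-cong (p k) (q k))

    ⟨⟩-congʳ : ∀ a x y → x ≈ᵥ y → ⟨ a , x ⟩ ≈ ⟨ a , y ⟩
    ⟨⟩-congʳ a x y = ⟨⟩-cong a a x y (λ _ → refl)

    ⟨⟩-comm : ∀ a x → ⟨ a , x ⟩ ≈ ⟨ x , a ⟩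
    ⟨⟩-comm a x = Σ-cong (λ k → a k * x k) (λ k → x k * a k) (λ k → *-comm (a k) (x k))

    ⟨⟩-+ : ∀ a x y → ⟨ a , x +ᵥ y ⟩ ≈ ⟨ a , x ⟩ + ⟨ a , y ⟩
    ⟨⟩-+ a x y = trans (Σ-cong (λ k → a k * (x k + y k)) (λ k → a k * x k + a k * y k) (λ k → distribˡ (a k) (x k) (y k)))
      (∑-distrib-+ (λ k → a k * x k) (λ k → a k * y k))

    ⟨⟩-* : ∀ a c x → ⟨ a , c *ᵥ x ⟩ ≈ c * ⟨ a , x ⟩
    ⟨⟩-* a c x = trans (Σ-cong (λ k → a k * (c * x k)) (λ k → c * (a k * x k)) (λ k → *-swapˡ (a k) c (x k)))
      (sym (*-distribˡ-Σ c (λ k → a k * x k)))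

    ⟨⟩-*ˡ : ∀ c a x → ⟨ c *ᵥ a , x ⟩ ≈ c * ⟨ a , x ⟩
    ⟨⟩-*ˡ c a x = trans (⟨⟩-comm (c *ᵥ a) x) (trans (⟨⟩-* x c a) (*-congˡ (⟨⟩-comm x a)))

    ⟨⟩-neg : ∀ a x → ⟨ a , -ᵥ x ⟩ ≈ - ⟨ a , x ⟩
    ⟨⟩-neg a x = trans (⟨⟩-congʳ a (-ᵥ x) ((- 1#) *ᵥ x) (λ k → sym (-1*x≈-x (x k)))) (trans (⟨⟩-* a (- 1#) x) (-1*x≈-x ⟨ a , x ⟩))

    ⟨⟩-0 : ∀ a → ⟨ a , 0ᵥ ⟩ ≈ 0#
    ⟨⟩-0 a = sum-zero (λ k → a k * 0#) (λ k → zeroʳ (a k))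

    ⟨⟩-combination : ∀ {d} a (c : Fin d → ℝ) b → ⟨ a , combination c b ⟩ ≈ sum (λ i → c i * ⟨ a , b i ⟩)
    ⟨⟩-combination a c b = begin
      sum (λ k → a k * sum (λ i → c i * b i k))    ≈⟨ Σ-cong (λ k → a k * sum (λ i → c i * b i k)) (λ k → sum (λ i → a k * (c i * b i k))) (λ k → *-distribˡ-Σ (a k) (λ i → c i * b i k)) ⟩
      sum (λ k → sum (λ i → a k * (c i * b i k)))  ≈⟨ ∑-comm (λ k i → a k * (c i * b i k)) ⟩
      sum (λ i → sum (λ k → a k * (c i * b i k)))  ≈⟨ Σ-cong (λ i → sum (λ k → a k * (c i * b i k))) (λ i → c i * ⟨ a , b i ⟩) (λ i → ⟨⟩-* a (c i) (b i)) ⟩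
      sum (λ i → c i * ⟨ a , b i ⟩)                ∎

  δ : ∀ {d} → Fin d → Fin d → ℝ
  δ zero    zero    = 1#
  δ zero    (suc _) = 0#
  δ (suc _) zero    = 0#
  δ (suc i) (suc j) = δ i j

  δ-refl : ∀ {d} (i : Fin d) → δ i i ≈ 1#
  δ-refl zero = refl
  δ-refl (suc i) = δ-refl i

  δ-≢ : ∀ {d} {i j : Fin d} → i ≢ j → δ i j ≈ 0#
  δ-≢ {i = zero} {zero} n = contradiction ≡.refl n
  δ-≢ {i = zero} {suc j} n = refl
  δ-≢ {i = suc i} {zero} n = refl
  δ-≢ {i = suc i} {suc j} n = δ-≢ (λ e → n (≡.cong suc e))

  δ-sym : ∀ {d} (i j : Fin d) → δ i j ≈ δ j i
  δ-sym zero    zero    = refl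
  δ-sym zero    (suc _) = refl
  δ-sym (suc _) zero    = refl
  δ-sym (suc i) (suc j) = δ-sym i j

  δ-nonneg : ∀ {d} (i j : Fin d) → 0# ≤ δ i j
  δ-nonneg zero    zero    = <⇒≤ 0<1
  δ-nonneg zero    (suc _) = ≤-refl
  δ-nonneg (suc _) zero    = ≤-refl
  δ-nonneg (suc i) (suc j) = δ-nonneg i j

  sum-δ : ∀ {d} (i : Fin d) (f : Fin d → ℝ) → sum (λ j → δ i j * f j) ≈ f i
  sum-δ i f = trans (sum-single (λ j → δ i j * f j) i (λ j ne → trans (*-congʳ (δ-≢ (λ e → ne (≡.sym e)))) (zeroˡ _)))
    (trans (*-congʳ (δ-refl i)) (*-identityˡ _))

  sum-δʳ : ∀ {d} (i : Fin d) (f : Fin d → ℝ) → sum (λ j → f j * δ j i) ≈ f i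
  sum-δʳ i f = trans (Σ-cong (λ j → f j * δ j i) (λ j → δ i j * f j) (λ j → trans (*-comm (f j) (δ j i)) (*-congʳ (δ-sym j i)))) (sum-δ i f)

  -- Gaussian elimination. If some vector has a nonzero first coordinate, multiples of it clear that
  -- coordinate from the others, and the coefficient of this pivot is solved for at the end. If no
  -- vector has one, the first coordinate imposes no condition.
  relation : ∀ {d m} (v : Fin (ℕ.suc m) → Fin d → ℝ) → d ℕ.≤ m →
             Σ[ c ∈ (Fin (ℕ.suc m) → ℝ) ] (∃[ i ] c i ≉ 0#) × (∀ k → sum (λ i → c i * v i k) ≈ 0#)
  relation {ℕ.zero} v _ = (λ _ → 1#) , (zero , 1≉0) , λ ()
  relation {ℕ.suc d} {ℕ.suc m} v (ℕ.s≤s d≤m) with dec {∃[ j ] v j zero ≉ 0#}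
  ... | no none = c , nz , λ { zero → sum-zero (λ i → c i * v i zero) (λ i → trans (*-congˡ (vz i)) (zeroʳ _)) ; (suc k) → eq k }
    where
    vz : ∀ i → v i zero ≈ 0#
    vz i with dec {v i zero ≈ 0#}
    ... | yes e = e
    ... | no n = contradiction (i , n) none
    ih = relation (λ i k → v i (suc k)) (ℕ.m≤n⇒m≤1+n d≤m)
    c = proj₁ ih
    nz = proj₁ (proj₂ ih)
    eq = proj₂ (proj₂ ih)
  ... | yes (j , vj≉0) = c′ , (punchIn j (proj₁ nz) , λ e → proj₂ nz (trans (sym (reflexive (insertAt-punchIn c j c₀ (proj₁ nz)))) e)) , total
    where
    r : Fin (ℕ.suc m) → ℝ
    r i = v (punchIn j i) zero * v j zero ⁻¹
    u : Fin (ℕ.suc m) → Fin (ℕ.suc d) → ℝ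
    u i k = v (punchIn j i) k - r i * v j k
    ih = relation (λ i k → u i (suc k)) d≤m
    c = proj₁ ih
    nz = proj₁ (proj₂ ih)
    u0 : ∀ i → u i zero ≈ 0#
    u0 i = trans (+-congˡ (-‿cong (trans (*-assoc _ _ _) (trans (*-congˡ (inv-*′ vj≉0)) (*-identityʳ _))))) (-‿inverseʳ _)
    eq : ∀ k → sum (λ i → c i * u i k) ≈ 0#
    eq zero = sum-zero (λ i → c i * u i zero) (λ i → trans (*-congˡ (u0 i)) (zeroʳ _))
    eq (suc k) = proj₂ (proj₂ ih) k
    c₀ = - sum (λ i → c i * r i)
    c′ = insertAt c j c₀
    total : ∀ k → sum (λ i → c′ i * v i k) ≈ 0#
    total k = begin
      sum (λ i → c′ i * v i k)
        ≈⟨ sum-remove {i = j} (λ i → c′ i * v i k) ⟩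
      c′ j * v j k + sum (λ i → c′ (punchIn j i) * v (punchIn j i) k)
        ≈⟨ +-cong (*-congʳ (reflexive (insertAt-lookup c j c₀)))
                  (Σ-cong (λ i → c′ (punchIn j i) * v (punchIn j i) k) (λ i → c i * v (punchIn j i) k) (λ i → *-congʳ (reflexive (insertAt-punchIn c j c₀ i)))) ⟩
      c₀ * v j k + sum (λ i → c i * v (punchIn j i) k)
        ≈⟨ +-congˡ (Σ-cong (λ i → c i * v (punchIn j i) k) (λ i → c i * u i k + (c i * r i) * v j k) (λ i → eliminate (c i) (v (punchIn j i) k) (r i) (v j k))) ⟩
      c₀ * v j k + sum (λ i → c i * u i k + (c i * r i) * v j k)
        ≈⟨ +-congˡ (∑-distrib-+ (λ i → c i * u i k) (λ i → (c i * r i) * v j k)) ⟩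
      c₀ * v j k + (sum (λ i → c i * u i k) + sum (λ i → (c i * r i) * v j k))
        ≈⟨ +-congˡ (+-cong (eq k) (sym (*-distribʳ-sum (v j k) (λ i → c i * r i)))) ⟩
      c₀ * v j k + (0# + sum (λ i → c i * r i) * v j k)
        ≈⟨ cancel-product (sum (λ i → c i * r i)) (v j k) ⟩
      0# ∎

  abstract
    combination-assoc : ∀ {d k} (c : Fin k → ℝ) (m : Fin k → Fin d → ℝ) b x →
      sum (λ i → c i * combination (m i) b x) ≈ combination (λ j → sum (λ i → c i * m i j)) b x
    combination-assoc {d} {k} c m b x = begin
      sum (λ i → c i * sum (λ j → m i j * b j x))    ≈⟨ Σ-cong (λ i → c i * sum (λ j → m i j * b j x)) (λ i → sum (λ j → c i * (m i j * b j x))) (λ i → *-distribˡ-Σ (c i) (λ j → m i j * b j x)) ⟩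
      sum (λ i → sum (λ j → c i * (m i j * b j x)))  ≈⟨ ∑-comm (λ i j → c i * (m i j * b j x)) ⟩
      sum (λ j → sum (λ i → c i * (m i j * b j x)))  ≈⟨ Σ-cong (λ j → sum (λ i → c i * (m i j * b j x))) (λ j → sum (λ i → c i * m i j) * b j x) (λ j → begin
          sum (λ i → c i * (m i j * b j x))  ≈⟨ Σ-cong (λ i → c i * (m i j * b j x)) (λ i → c i * m i j * b j x) (λ i → sym (*-assoc (c i) (m i j) (b j x))) ⟩
          sum (λ i → c i * m i j * b j x)    ≈⟨ sym (*-distribʳ-sum (b j x) (λ i → c i * m i j)) ⟩
          sum (λ i → c i * m i j) * b j x    ∎) ⟩
      sum (λ j → sum (λ i → c i * m i j) * b j x)    ∎

    span-gen : ∀ {d} (b : Fin d → V) i → Span b (b i)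
    span-gen b i = δ i , λ k → sym (sum-δ i (λ j → b j k))

    independent-≤ : ∀ {k d} {b : Fin k → V} {b′ : Fin d → V} → LinearlyIndependent b → (∀ i → Span b′ (b i)) → k ℕ.≤ d
    independent-≤ {ℕ.zero} _ _ = ℕ.z≤n
    independent-≤ {ℕ.suc m} {d} {b} {b′} ind sp with d ℕ.≤? m
    ... | no d≰m = ℕ.≰⇒> d≰m
    ... | yes d≤m with relation (λ i → proj₁ (sp i)) d≤m
    ... | c , (i , ci) , eq = contradiction (ind c zero-comb i) ci
      where
      zero-comb : combination c b ≈ᵥ 0ᵥ
      zero-comb x = begin
        sum (λ i → c i * b i x)                             ≈⟨ Σ-cong (λ i → c i * b i x) (λ i → c i * combination (proj₁ (sp i)) b′ x) (λ i → *-congˡ (proj₂ (sp i) x)) ⟩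
        sum (λ i → c i * combination (proj₁ (sp i)) b′ x)   ≈⟨ combination-assoc c (λ i → proj₁ (sp i)) b′ x ⟩
        sum (λ j → sum (λ i → c i * proj₁ (sp i) j) * b′ j x)
          ≈⟨ sum-zero (λ j → sum (λ i → c i * proj₁ (sp i) j) * b′ j x) (λ j → trans (*-congʳ (eq j)) (zeroˡ (b′ j x))) ⟩
        0#                                                  ∎

    HasDim-unique : ∀ {U d k} → HasDim U d → HasDim U k → d ≡ k
    HasDim-unique (b , ib , (to , from)) (b′ , ib′ , (to′ , from′)) = ℕ.≤-antisym
      (independent-≤ ib (λ i → to′ (from (span-gen b i))))
      (independent-≤ ib′ (λ i → to (from′ (span-gen b′ i))))

    -- The m-th unit vector and the four columns of the matrix `a` are five vectors in dimension 4,
    -- hence dependent. The trivial kernel forces the coefficient of the unit vector to be nonzero,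
    -- and dividing by it gives the m-th column of the inverse matrix.
    dual-basis : (a : Fin 4 → V) → (∀ x → (∀ l → ⟨ a l , x ⟩ ≈ 0#) → x ≈ᵥ 0ᵥ) →
                 Σ[ b ∈ (Fin 4 → V) ] (∀ l m → ⟨ a l , b m ⟩ ≈ δ l m)
    dual-basis a ker = (λ m → proj₁ (col m)) , λ l m → proj₂ (col m) l
      where
      col : ∀ m → Σ[ b ∈ V ] (∀ l → ⟨ a l , b ⟩ ≈ δ l m)
      col m with relation v ℕ.≤-refl
        where
        v : Fin 5 → Fin 4 → ℝ
        v zero l = δ l m
        v (suc j) l = a l j
      ... | c , (i , ci) , eq = (- c zero ⁻¹) *ᵥ x , λ l → begin
        ⟨ a l , (- c zero ⁻¹) *ᵥ x ⟩     ≈⟨ ⟨⟩-* (a l) (- c zero ⁻¹) x ⟩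
        - c zero ⁻¹ * ⟨ a l , x ⟩        ≈⟨ *-congˡ (sym (+-identityˡ _)) ⟩
        - c zero ⁻¹ * (0# + ⟨ a l , x ⟩) ≈⟨ solve-pivot (c zero ⁻¹) (c zero) (δ l m) ⟨ a l , x ⟩ ⟩
        c zero ⁻¹ * c zero * δ l m - c zero ⁻¹ * (c zero * δ l m + ⟨ a l , x ⟩)
          ≈⟨ +-cong (trans (*-congʳ (inv-*′ c₀)) (*-identityˡ _)) (-‿cong (trans (*-congˡ (eq′ l)) (zeroʳ _))) ⟩
        δ l m - 0#                      ≈⟨ trans (+-congˡ -0#≈0#) (+-identityʳ _) ⟩
        δ l m                           ∎
        where
        x : V
        x j = c (suc j)
        eq′ : ∀ l → c zero * δ l m + ⟨ a l , x ⟩ ≈ 0#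
        eq′ l = trans (+-congˡ (⟨⟩-comm (a l) x)) (eq l)
        c₀ : c zero ≉ 0#
        c₀ z = ci (all i)
          where
          all : ∀ i → c i ≈ 0#
          all zero = z
          all (suc j) = ker x (λ l → trans (sym (trans (+-congʳ (trans (*-congʳ z) (zeroˡ _))) (+-identityˡ _))) (eq′ l)) j

  -- Small perturbations and generic points

  abstract
    -- Germs of properties at 0 from the right: strict inequalities survive a small move, and
    -- finitely many of them survive a common one.
    Eventually : (ℝ → Set ℓ) → Set ℓ
    Eventually P = ∃[ δ ] (0# < δ × ∀ t → 0# < t → t < δ → P t)

    ev-map : ∀ {P Q} → (∀ {t} → 0# < t → P t → Q t) → Eventually P → Eventually Q
    ev-map f (d , p , g) = d , p , λ t a b → f a (g t a b)

    ev-true : ∀ {P : ℝ → Set ℓ} → (∀ t → 0# < t → P t) → Eventually P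
    ev-true f = 1# , 0<1 , λ t p _ → f t p

    ev-∧ : ∀ {P Q} → Eventually P → Eventually Q → Eventually (λ t → P t × Q t)
    ev-∧ (d , p , f) (d′ , p′ , f′) with compare d d′
    ... | tri< a _ _ = d , p , λ t x y → f t x y , f′ t x (<-trans y a)
    ... | tri≈ _ e _ = d , p , λ t x y → f t x y , f′ t x (<-respʳ e y)
    ... | tri> _ _ c = d′ , p′ , λ t x y → f t x (<-trans y c) , f′ t x y

    ev-∀ : ∀ {n} {P : Fin n → ℝ → Set ℓ} → (∀ i → Eventually (P i)) → Eventually (λ t → ∀ i → P i t)
    ev-∀ {ℕ.zero} _ = ev-true λ _ _ ()
    ev-∀ {ℕ.suc n} f = ev-map (λ { _ (p , q) zero → p ; _ (p , q) (suc i) → q i }) (ev-∧ (f zero) (ev-∀ (λ i → f (suc i))))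

    ev-All : ∀ {A : Set ℓ} {P : A → ℝ → Set ℓ} (xs : List A) → All (λ x → Eventually (P x)) xs → Eventually (λ t → All (λ x → P x t) xs)
    ev-All [] [] = 1# , 0<1 , λ _ _ _ → []
    ev-All (x ∷ xs) (p ∷ ps) with ev-All xs ps
    ... | d′ , p′ , f′ with p
    ... | d , p , f with compare d d′
    ... | tri< a _ _ = d , p , λ t x y → f t x y ∷ f′ t x (<-trans y a)
    ... | tri≈ _ e _ = d , p , λ t x y → f t x y ∷ f′ t x (<-respʳ e y)
    ... | tri> _ _ c = d′ , p′ , λ t x y → f t x (<-trans y c) ∷ f′ t x y

    half : ∀ {x} → 0# < x → ∃[ y ] (0# < y × y < x)
    half {x} p = ½ * x , ½p , 0<y-x⇒x<y (<-respʳ half-eq ½p)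
      where
      ½ : ℝ
      ½ = (1# + 1#) ⁻¹
      2≉0 : 1# + 1# ≉ 0#
      2≉0 = ≉-pos (+-pos 0<1 0<1)
      ½p : 0# < ½ * x
      ½p = *-pos (inv-pos (+-pos 0<1 0<1)) p
      half-eq : ½ * x ≈ x - ½ * x
      half-eq = trans (halve ½ x) (+-congʳ (trans (*-congʳ (*-inv 2≉0)) (*-identityˡ x)))

    ev-witness : ∀ {P} → Eventually P → ∃[ t ] (0# < t × P t)
    ev-witness (d , p , f) with half p
    ... | t , a , b = t , a , f t a b

    ev-affine-pos : ∀ {a} b → 0# < a → Eventually (λ t → 0# < a + t * b)
    ev-affine-pos {a} b p with compare 0# b
    ... | tri< q _ _ = ev-true λ t r → +-pos p (*-pos r q)
    ... | tri≈ _ e _ = ev-true λ t r → +-pos-≤ p (≤-reflexive (sym (trans (*-congˡ (sym e)) (zeroʳ t))))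
    ... | tri> _ _ q = a * (- b) ⁻¹ , *-pos p (inv-pos q′) , λ t r s →
        <-respʳ (trans (affine-pos a b ((- b) ⁻¹) t)
                       (+-congʳ (trans (*-congˡ (inv-*′ (≉-pos q′))) (*-identityʳ a))))
                (*-pos (x<y⇒0<y-x s) q′)
      where q′ : 0# < - b
            q′ = neg-pos q

    ev-affine-neg : ∀ {a} b → a < 0# → Eventually (λ t → a + t * b < 0#)
    ev-affine-neg {a} b p = ev-map (λ {t} _ q → <-respˡ (affine-neg a b t) (pos-neg q)) (ev-affine-pos (- b) (neg-pos p))

    ⟨⟩-move : ∀ a x t u → ⟨ a , x +ᵥ t *ᵥ u ⟩ ≈ ⟨ a , x ⟩ + t * ⟨ a , u ⟩
    ⟨⟩-move a x t u = trans (⟨⟩-+ a x (t *ᵥ u)) (+-congˡ (⟨⟩-* a t u))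

    -- Nonzero signs at `q` are stable under small moves while zeros may take any sign, which is
    -- exactly what the closure order permits.
    ev-≼ : ∀ {n} (α : Fin n → V) q u → Eventually (λ t → _≼_ α q (q +ᵥ t *ᵥ u))
    ev-≼ α q u = ev-∀ λ i → lem i
      where
      lem : ∀ i → Eventually (λ t → (0# < ⟨ α i , q ⟩ → 0# < ⟨ α i , q +ᵥ t *ᵥ u ⟩) × (⟨ α i , q ⟩ < 0# → ⟨ α i , q +ᵥ t *ᵥ u ⟩ < 0#))
      lem i with compare 0# ⟨ α i , q ⟩
      ... | tri< p _ n = ev-map (λ {t} _ r → (λ _ → <-respʳ (sym (⟨⟩-move (α i) q t u)) r) , λ c → ⊥-elim (n c)) (ev-affine-pos ⟨ α i , u ⟩ p)
      ... | tri≈ n _ n′ = ev-true λ t _ → (λ c → ⊥-elim (n c)) , (λ c → ⊥-elim (n′ c))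
      ... | tri> n _ p = ev-map (λ {t} _ r → (λ c → ⊥-elim (n c)) , λ _ → <-respˡ (sym (⟨⟩-move (α i) q t u)) r) (ev-affine-neg ⟨ α i , u ⟩ p)

    ev-≉ : ∀ a q u → ⟨ a , q ⟩ ≉ 0# → Eventually (λ t → ⟨ a , q +ᵥ t *ᵥ u ⟩ ≉ 0#)
    ev-≉ a q u n with ≉⇒<> n
    ... | inj₁ p = ev-map (λ {t} _ r e → ≉-pos r (trans (sym (⟨⟩-move a q t u)) e)) (ev-affine-pos ⟨ a , u ⟩ p)
    ... | inj₂ p = ev-map (λ {t} _ r e → ≉-neg r (trans (sym (⟨⟩-move a q t u)) e)) (ev-affine-neg ⟨ a , u ⟩ p)

    ⟨⟩-δ : ∀ a k → ⟨ a , δ k ⟩ ≈ a k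
    ⟨⟩-δ a k = trans (⟨⟩-comm a (δ k)) (sum-δ k a)

    nonzero-coordinate : ∀ {x} → ¬ (x ≈ᵥ 0ᵥ) → ∃[ k ] x k ≉ 0#
    nonzero-coordinate {x} n with dec {∃[ k ] x k ≉ 0#}
    ... | yes p = p
    ... | no none = contradiction (λ k → case k) n
      where
      case : ∀ k → x k ≈ 0#
      case k with dec {x k ≈ 0#}
      ... | yes e = e
      ... | no ne = contradiction (k , ne) none

    -- A nonzero form that vanishes at the point is made nonzero by a small move along a coordinate
    -- axis on which it does not vanish; everything achieved before is an open condition and
    -- persists.
    generic : ∀ {n} (γ : Fin n → V) (p : V) (λs : List V) →
      Σ[ p′ ∈ V ] ((∀ i → 0# < ⟨ γ i , p ⟩ → 0# < ⟨ γ i , p′ ⟩) × All (λ a → ¬ (a ≈ᵥ 0ᵥ) → ⟨ a , p′ ⟩ ≉ 0#) λs)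
    generic γ p [] = p , (λ _ q → q) , []
    generic γ p (a ∷ as) = extend (generic γ p as)
      where
      Good : V → List V → Set ℓ
      Good p′ λs = (∀ i → 0# < ⟨ γ i , p ⟩ → 0# < ⟨ γ i , p′ ⟩) × All (λ a → ¬ (a ≈ᵥ 0ᵥ) → ⟨ a , p′ ⟩ ≉ 0#) λs

      keep : ∀ p₁ k {b} → (¬ (b ≈ᵥ 0ᵥ) → ⟨ b , p₁ ⟩ ≉ 0#) → Eventually (λ t → ¬ (b ≈ᵥ 0ᵥ) → ⟨ b , p₁ +ᵥ t *ᵥ δ k ⟩ ≉ 0#)
      keep p₁ k {b} f with dec {b ≈ᵥ 0ᵥ}
      ... | yes e = ev-true λ _ _ n → contradiction e n
      ... | no n = ev-map (λ {t} _ r _ → r) (ev-≉ b p₁ (δ k) (f n))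

      move : ∀ p₁ → Good p₁ as → ⟨ a , p₁ ⟩ ≈ 0# → ∃[ k ] a k ≉ 0# → Σ[ p′ ∈ V ] Good p′ (a ∷ as)
      move p₁ (pos , nz) z (k , ak) = p₁ +ᵥ t *ᵥ δ k , (λ i q → proj₁ (proj₁ good i) (pos i q)) , (λ _ e → *-≉0 (≉-pos tp) ak (trans (sym val) e)) ∷ proj₂ good
        where
        w : ∃[ t ] (0# < t × _≼_ γ p₁ (p₁ +ᵥ t *ᵥ δ k) × All (λ b → ¬ (b ≈ᵥ 0ᵥ) → ⟨ b , p₁ +ᵥ t *ᵥ δ k ⟩ ≉ 0#) as)
        w = ev-witness (ev-∧ (ev-≼ γ p₁ (δ k)) (ev-All as (All.map (λ {b} → keep p₁ k {b}) nz)))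
        t : ℝ
        t = proj₁ w
        tp : 0# < t
        tp = proj₁ (proj₂ w)
        good : _≼_ γ p₁ (p₁ +ᵥ t *ᵥ δ k) × All (λ b → ¬ (b ≈ᵥ 0ᵥ) → ⟨ b , p₁ +ᵥ t *ᵥ δ k ⟩ ≉ 0#) as
        good = proj₂ (proj₂ w)
        val : ⟨ a , p₁ +ᵥ t *ᵥ δ k ⟩ ≈ t * a k
        val = trans (⟨⟩-move a p₁ t (δ k)) (trans (+-congʳ z) (trans (+-identityˡ _) (*-congˡ (⟨⟩-δ a k))))

      extend : Σ[ p₁ ∈ V ] Good p₁ as → Σ[ p′ ∈ V ] Good p′ (a ∷ as)
      extend (p₁ , pos , nz) with dec {a ≈ᵥ 0ᵥ} | dec {⟨ a , p₁ ⟩ ≈ 0#}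
      ... | yes e | _ = p₁ , pos , (λ n → contradiction e n) ∷ nz
      ... | no n | no m = p₁ , pos , (λ _ → m) ∷ nz
      ... | no n | yes z = move p₁ (pos , nz) z (nonzero-coordinate n)

    argmin : ∀ {n} (P : Fin n → Set ℓ) (r : Fin n → ℝ) → ∃ P → ∃[ j ] (P j × ∀ i → P i → r j ≤ r i)
    argmin {ℕ.suc n} P r (i₀ , p₀) with dec {∃[ i ] P (suc i)}
    argmin {ℕ.suc n} P r (zero , p₀) | no none = zero , p₀ , λ { zero _ → ≤-refl ; (suc i) q → contradiction (i , q) none }
    argmin {ℕ.suc n} P r (suc i , p₀) | no none = contradiction (i , p₀) none
    ... | yes ex with argmin (λ i → P (suc i)) (λ i → r (suc i)) ex
    ... | j , pj , min with dec {P zero} | compare (r zero) (r (suc j))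
    ... | no n | _ = suc j , pj , λ { zero q → contradiction q n ; (suc i) q → min i q }
    ... | yes p | tri< a _ _ = zero , p , λ { zero _ → ≤-refl ; (suc i) q → ≤-trans (<⇒≤ a) (min i q) }
    ... | yes p | tri≈ a _ _ = suc j , pj , λ { zero _ → a ; (suc i) q → min i q }
    ... | yes p | tri> a _ _ = suc j , pj , λ { zero _ → a ; (suc i) q → min i q }

-- Linear forms of the hyperplanes and simplicial cones

module SimplicialCones {ℓ : Level} (R : Reals ℓ) {n : ℕ} (α : Fin n → OverReals.V R) (arr : OverReals.IsArrangement R α) where

  open OrderedField R
  open LinearAlgebra R
  open IsArrangement arr
  import Data.Fin.Properties as Fin
  open import Data.Product.Base
  open import Data.Sum.Base
  open import Relation.Nullary using (yes; no; contradiction)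
  import Relation.Binary.PropositionalEquality as ≡
  open ≡ using (_≡_; _≢_)
  open import Relation.Binary.Reasoning.Setoid setoid

  -- A defining form of a hyperplane, free up to a nonzero scalar. Keeping the index makes it
  -- possible to pass from proportional forms to equal hyperplanes.
  record Form : Set ℓ where
    constructor form
    field
      idx     : Fin n
      scale   : ℝ
      scale≉0 : scale ≉ 0#
  open Form public

  infix 8 _·_
  abstract
    _·_ : Form → V → ℝ
    f · x = scale f * ⟨ α (idx f) , x ⟩

    ·-def : ∀ f x → f · x ≈ scale f * ⟨ α (idx f) , x ⟩
    ·-def f x = refl

    ·-cong : ∀ f x y → x ≈ᵥ y → f · x ≈ f · y
    ·-cong f x y p = *-congˡ (⟨⟩-congʳ (α (idx f)) x y p)

    ·-+ : ∀ f x y → f · (x +ᵥ y) ≈ f · x + f · y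
    ·-+ f x y = trans (*-congˡ (⟨⟩-+ (α (idx f)) x y)) (distribˡ _ _ _)

    ·-* : ∀ f c x → f · (c *ᵥ x) ≈ c * f · x
    ·-* f c x = trans (*-congˡ (⟨⟩-* (α (idx f)) c x)) (*-swapˡ (scale f) c _)

    ·-combination : ∀ f {d} (c : Fin d → ℝ) b → f · combination c b ≈ sum (λ i → c i * f · b i)
    ·-combination f c b = begin
      scale f * ⟨ α (idx f) , combination c b ⟩               ≈⟨ *-congˡ (⟨⟩-combination (α (idx f)) c b) ⟩
      scale f * sum (λ i → c i * ⟨ α (idx f) , b i ⟩)         ≈⟨ *-distribˡ-Σ (scale f) (λ i → c i * ⟨ α (idx f) , b i ⟩) ⟩
      sum (λ i → scale f * (c i * ⟨ α (idx f) , b i ⟩))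
        ≈⟨ Σ-cong (λ i → scale f * (c i * ⟨ α (idx f) , b i ⟩)) (λ i → c i * f · b i) (λ i → *-swapˡ (scale f) (c i) ⟨ α (idx f) , b i ⟩) ⟩
      sum (λ i → c i * f · b i)                               ∎

  abstract
    ·-move : ∀ f x t y → f · (x +ᵥ t *ᵥ y) ≈ f · x + t * f · y
    ·-move f x t y = trans (·-+ f x (t *ᵥ y)) (+-congˡ (·-* f t y))

    H⇒·≈0 : ∀ f x → H α (idx f) x → f · x ≈ 0#
    H⇒·≈0 f x hx = trans (·-def f x) (trans (*-congˡ hx) (zeroʳ _))

    ·≈0⇒H : ∀ f x → f · x ≈ 0# → H α (idx f) x
    ·≈0⇒H f x z = *-≈0 (scale≉0 f) (trans (sym (·-def f x)) z)

    same-idx : ∀ f g → idx f ≡ idx g → ∃[ c ] (c ≉ 0# × ∀ x → f · x ≈ c * g · x)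
    same-idx f@(form i s s≉0) g@(form .i t t≉0) ≡.refl = s * t ⁻¹ , *-≉0 s≉0 (inv-≉ t≉0) , λ x → begin
      f · x                                     ≈⟨ ·-def f x ⟩
      s * ⟨ α i , x ⟩                            ≈⟨ *-congʳ (sym (*-identityʳ s)) ⟩
      s * 1# * ⟨ α i , x ⟩                       ≈⟨ *-congʳ (*-congˡ (sym (inv-*′ t≉0))) ⟩
      s * (t ⁻¹ * t) * ⟨ α i , x ⟩               ≈⟨ regroup s (t ⁻¹) t ⟨ α i , x ⟩ ⟩
      s * t ⁻¹ * (t * ⟨ α i , x ⟩)               ≈⟨ *-congˡ (sym (·-def g x)) ⟩
      s * t ⁻¹ * g · x                          ∎
      where
      regroup : ∀ s i t a → s * (i * t) * a ≈ s * i * (t * a)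
      regroup = solve 4 (λ s i t a → s :* (i :* t) :* a := s :* i :* (t :* a)) refl

    idx-≡-zero : ∀ f g → idx f ≡ idx g → ∀ x → f · x ≈ 0# → g · x ≈ 0#
    idx-≡-zero f g e x z = H⇒·≈0 g x (≡.subst (λ i → H α i x) e (·≈0⇒H f x z))

    proportional⇒≡ : ∀ f g {c} → c ≉ 0# → (∀ x → f · x ≈ c * g · x) → idx f ≡ idx g
    proportional⇒≡ f g {c} n p = distinct
      ( (λ {x} hx → ·≈0⇒H g x (*-≈0 n (trans (sym (p x)) (H⇒·≈0 f x hx))))
      , (λ {x} hx → ·≈0⇒H f x (trans (p x) (trans (*-congˡ (H⇒·≈0 g x hx)) (zeroʳ c)))))

  infixr 7 _⊙_
  _⊙_ : Σ ℝ (_≉ 0#) → Form → Form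
  (c , c≉0) ⊙ f = form (idx f) (c * scale f) (*-≉0 c≉0 (scale≉0 f))

  abstract
    ⊙-· : ∀ c f x → (c ⊙ f) · x ≈ proj₁ c * f · x
    ⊙-· (c , c≉0) f x = trans (·-def ((c , c≉0) ⊙ f) x) (trans (*-assoc c _ _) (*-congˡ (sym (·-def f x))))

  -1≉0 : - 1# ≉ 0#
  -1≉0 = ≉-neg (pos-neg 0<1)

  negate : Form → Form
  negate f = (- 1# , -1≉0) ⊙ f

  abstract
    negate-· : ∀ f x → negate f · x ≈ - (f · x)
    negate-· f x = trans (⊙-· (- 1# , -1≉0) f x) (-1*x≈-x (f · x))

  -- A simplicial cone spanned by four rays whose walls are hyperplanes of the
  -- arrangement and which no hyperplane of the arrangement cuts.
  record Base : Set ℓ where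
    field
      ray      : Fin 4 → V
      wall     : Fin 4 → Form
      dual     : ∀ l m → wall l · ray m ≈ δ l m
      kernel   : ∀ x → (∀ l → wall l · x ≈ 0#) → x ≈ᵥ 0ᵥ
      coherent : ∀ f l m → 0# < f · ray l → ¬ (f · ray m < 0#)

    wall-refl : ∀ l → wall l · ray l ≈ 1#
    wall-refl l = trans (dual l l) (δ-refl l)

    wall-≢ : ∀ {l m} → l ≢ m → wall l · ray m ≈ 0#
    wall-≢ {l} {m} ne = trans (dual l m) (δ-≢ ne)

    abstract
      expand : ∀ x → x ≈ᵥ combination (λ l → wall l · x) ray
      expand x k = x-y≈0⇒x≈y (trans (+-congˡ (sym (-1*x≈-x (y k)))) (kernel (x +ᵥ (- 1#) *ᵥ y) zeros k))
        where
        y : V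
        y = combination (λ l → wall l · x) ray
        zeros : ∀ l → wall l · (x +ᵥ (- 1#) *ᵥ y) ≈ 0#
        zeros l = begin
          wall l · (x +ᵥ (- 1#) *ᵥ y)           ≈⟨ ·-move (wall l) x (- 1#) y ⟩
          wall l · x + - 1# * wall l · y        ≈⟨ +-congˡ (-1*x≈-x _) ⟩
          wall l · x - wall l · y               ≈⟨ +-congˡ (-‿cong (·-combination (wall l) (λ l → wall l · x) ray)) ⟩
          wall l · x - sum (λ m → wall m · x * wall l · ray m)
            ≈⟨ +-congˡ (-‿cong (Σ-cong (λ m → wall m · x * wall l · ray m) (λ m → wall m · x * δ m l)
                                  (λ m → *-congˡ (trans (dual l m) (δ-sym l m))))) ⟩
          wall l · x - sum (λ m → wall m · x * δ m l) ≈⟨ +-congˡ (-‿cong (sum-δʳ l (λ m → wall m · x))) ⟩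
          wall l · x - wall l · x               ≈⟨ -‿inverseʳ _ ⟩
          0#                                    ∎

      expand-· : ∀ f x → f · x ≈ sum (λ l → wall l · x * f · ray l)
      expand-· f x = trans (·-cong f x (combination (λ l → wall l · x) ray) (expand x)) (·-combination f (λ l → wall l · x) ray)

    Nonneg : Form → Set ℓ
    Nonneg f = ∀ l → 0# ≤ f · ray l

    abstract
      proportional-rays : ∀ f g {c} → c ≉ 0# → (∀ l → f · ray l ≈ c * g · ray l) → idx f ≡ idx g
      proportional-rays f g {c} n p = proportional⇒≡ f g n λ x → begin
        f · x                                       ≈⟨ expand-· f x ⟩
        sum (λ l → wall l · x * f · ray l)
          ≈⟨ Σ-cong (λ l → wall l · x * f · ray l) (λ l → c * (wall l · x * g · ray l)) (λ l → trans (*-congˡ (p l)) (*-swapˡ _ c _)) ⟩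
        sum (λ l → c * (wall l · x * g · ray l))    ≈⟨ sym (*-distribˡ-Σ c (λ l → wall l · x * g · ray l)) ⟩
        c * sum (λ l → wall l · x * g · ray l)      ≈⟨ *-congˡ (sym (expand-· g x)) ⟩
        c * g · x                                   ∎

      nonzero-ray : ∀ f → ∃[ l ] f · ray l ≉ 0#
      nonzero-ray f with dec {∃[ l ] f · ray l ≉ 0#}
      ... | yes p = p
      ... | no none = contradiction vanish (nonzero (idx f))
        where
        z : ∀ l → f · ray l ≈ 0#
        z l with dec {f · ray l ≈ 0#}
        ... | yes e = e
        ... | no ne = contradiction (l , ne) none
        zx : ∀ x → f · x ≈ 0#
        zx x = trans (expand-· f x) (sum-zero (λ l → wall l · x * f · ray l) (λ l → trans (*-congˡ (z l)) (zeroʳ _)))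
        vanish : α (idx f) ≈ᵥ 0ᵥ
        vanish k = trans (sym (⟨⟩-δ (α (idx f)) k)) (·≈0⇒H f (δ k) (zx (δ k)))

      -- A hyperplane that contains three of the four rays is their span, and so is the wall.
      only-ray : ∀ f k → (∀ l → l ≢ k → f · ray l ≈ 0#) → idx f ≡ idx (wall k)
      only-ray f k z = proportional-rays f (wall k) {f · ray k} nz eq
        where
        nz : f · ray k ≉ 0#
        nz e with nonzero-ray f
        ... | l , ne with l Fin.≟ k
        ... | yes ≡.refl = ne e
        ... | no l≢k = ne (z l l≢k)
        eq : ∀ l → f · ray l ≈ f · ray k * wall k · ray l
        eq l with l Fin.≟ k
        ... | yes ≡.refl = sym (trans (*-congˡ (wall-refl k)) (*-identityʳ _))
        ... | no l≢k = trans (z l l≢k) (sym (trans (*-congˡ (wall-≢ (λ e → l≢k (≡.sym e)))) (zeroʳ _)))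

      other-ray : ∀ f k → idx f ≢ idx (wall k) → ∃[ l ] (l ≢ k × f · ray l ≉ 0#)
      other-ray f k ne with dec {∃[ l ] (l ≢ k × f · ray l ≉ 0#)}
      ... | yes p = p
      ... | no none = contradiction (only-ray f k (λ l l≢k → zero? l l≢k)) ne
        where
        zero? : ∀ l → l ≢ k → f · ray l ≈ 0#
        zero? l l≢k with dec {f · ray l ≈ 0#}
        ... | yes e = e
        ... | no n = contradiction (l , l≢k , n) none

      nonneg-from : ∀ f {l} → 0# < f · ray l → Nonneg f
      nonneg-from f p m = coherent f _ m p

      -- A negative value on one ray would, by coherence, make the form nonpositive on all rays and
      -- hence on the whole closed cone.
      closed-positive : ∀ f x → (∀ l → 0# ≤ wall l · x) → 0# < f · x → Nonneg f
      closed-positive f x p q m neg = sum-nonneg (λ l → wall l · x * - (f · ray l)) (λ l → *-nonneg (p l) (λ c → coherent f l m (flip (f · ray l) c) neg))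
        (<-respˡ (trans (-‿cong (expand-· f x)) (trans (trans (sym (-1*x≈-x _)) (*-distribˡ-Σ (- 1#) (λ l → wall l · x * f · ray l)))
           (Σ-cong (λ l → - 1# * (wall l · x * f · ray l)) (λ l → wall l · x * - (f · ray l)) (λ l → move (wall l · x) (f · ray l))))) (pos-neg q))
        where
        flip : ∀ a → - a < 0# → 0# < a
        flip a c = <-respʳ (-‿involutive a) (neg-pos c)
        move : ∀ a b → - 1# * (a * b) ≈ a * - b
        move = solve 2 (λ a b → :- con (ℤ.+ 1) :* (a :* b) := a :* (:- b)) refl
          where import Data.Integer.Base as ℤ

      positive-form : ∀ i → ∃[ f ] (idx f ≡ i × Nonneg f)
      positive-form i with nonzero-ray (form i 1# 1≉0)
      ... | l , ne with ≉⇒<> ne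
      ... | inj₁ p = form i 1# 1≉0 , ≡.refl , nonneg-from (form i 1# 1≉0) p
      ... | inj₂ p = negate (form i 1# 1≉0) , ≡.refl , nonneg-from (negate (form i 1# 1≉0)) (<-respʳ (sym (negate-· (form i 1# 1≉0) (ray l))) (neg-pos p))

      wall-nonneg : ∀ k → Nonneg (wall k)
      wall-nonneg k l = ≤-resp refl (sym (dual k l)) (δ-nonneg k l)

      nonneg-at : ∀ f x → (∀ l → 0# ≤ wall l · x) → Nonneg f → 0# ≤ f · x
      nonneg-at f x p q = ≤-resp refl (sym (expand-· f x)) (sum-nonneg (λ l → wall l · x * f · ray l) (λ l → *-nonneg (p l) (q l)))

  open Base public

  abstract
    -- The closure order is stated for the given normals; a multiple of a normal obeys it too, a
    -- negative factor exchanging the two clauses.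
    ≼-form : ∀ {q p} → _≼_ α q p → ∀ f → (0# < f · q → 0# < f · p) × (f · q < 0# → f · p < 0#)
    ≼-form {q} {p} le f with ≉⇒<> (scale≉0 f)
    ... | inj₁ s = (λ a → <-respʳ (sym (·-def f p)) (*-pos s (proj₁ (le (idx f)) (*-cancel-pos s (<-respʳ (·-def f q) a)))))
                 , (λ a → <-respˡ (sym (·-def f p)) (*-pos-neg s (proj₂ (le (idx f)) (*-cancel-neg s (<-respˡ (·-def f q) a)))))
    ... | inj₂ s = (λ a → <-respʳ (sym (·-def f p)) (*-neg-neg s (proj₂ (le (idx f)) (*-cancel-neg s′ (<-respˡ (flip q) (pos-neg a))))))
                 , (λ a → <-respˡ (sym (·-def f p)) (*-neg-pos s (proj₁ (le (idx f)) (*-cancel-pos s′ (<-respʳ (flip q) (neg-pos a))))))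
      where
      s′ : 0# < - scale f
      s′ = neg-pos s
      flip : ∀ x → - (f · x) ≈ - scale f * ⟨ α (idx f) , x ⟩
      flip x = trans (-‿cong (·-def f x)) (-‿distribˡ-* _ _)

-- Every chamber is a simplicial cone

module ChamberCones {ℓ : Level} (R : Reals ℓ) {n : ℕ} (α : Fin n → OverReals.V R) (arr : OverReals.IsArrangement R α) where

  open OrderedField R
  open LinearAlgebra R
  open SimplicialCones R α arr
  open IsArrangement arr
  open import Data.Fin.Base using (cast)
  import Data.Fin.Properties as Fin
  open import Data.Fin.Patterns
  open import Data.List.Base using (List; allFin; filter; length; cartesianProductWith; lookup)
  open import Data.List.Membership.Propositional using (_∈_)
  open import Data.List.Membership.Propositional.Properties using (∈-allFin; ∈-filter⁺; ∈-filter⁻; ∈-cartesianProductWith⁺; ∈-lookup)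
  open import Data.List.Relation.Unary.Any using (index)
  open import Data.List.Relation.Unary.Any.Properties using (lookup-index)
  open import Data.List.Relation.Unary.All as All using (All)
  open import Data.Product.Base
  open import Data.Sum.Base
  open import Data.Empty
  open import Relation.Nullary using (yes; no; contradiction)
  open import Relation.Binary.Definitions using (tri<; tri≈; tri>)
  import Relation.Binary.PropositionalEquality as ≡
  open ≡ using (_≡_; _≢_)
  open import Relation.Binary.Reasoning.Setoid setoid

  -- Scaled by its own value at p, the form of each hyperplane is positive at p.
  module _ (p : V) (p∉H : ∀ i → ¬ H α i p) where

    toward : Fin n → Form
    toward i = form i ⟨ α i , p ⟩ (p∉H i)

    abstract
      toward-pos : ∀ i → 0# < toward i · p
      toward-pos i = <-respʳ (sym (·-def (toward i) p)) (square-pos (p∉H i))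

      toward-nonneg : ∀ {q} → (∀ i → 0# ≤ toward i · q) → _≼_ α q p
      toward-nonneg {q} nn i = (λ a → side a) , (λ a → side′ a)
        where
        side : 0# < ⟨ α i , q ⟩ → 0# < ⟨ α i , p ⟩
        side a with ≉⇒<> (p∉H i)
        ... | inj₁ b = b
        ... | inj₂ b = contradiction (<-respˡ (sym (·-def (toward i) q)) (*-neg-pos b a)) (nn i)
        side′ : ⟨ α i , q ⟩ < 0# → ⟨ α i , p ⟩ < 0#
        side′ a with ≉⇒<> (p∉H i)
        ... | inj₂ b = b
        ... | inj₁ b = contradiction (<-respˡ (sym (·-def (toward i) q)) (*-pos-neg b a)) (nn i)

    p≉0 : Fin n → ¬ (p ≈ᵥ 0ᵥ)
    p≉0 i z = p∉H i (trans (⟨⟩-congʳ (α i) p 0ᵥ z) (⟨⟩-0 (α i)))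

    point : Fin n → Point
    point i = p , p≉0 i

    -- Moving from a generic point of the chamber towards x, the first
    -- hyperplane that is crossed is a wall.
    module _ (i₀ : Fin n) (wall₀ : IsWall α (point i₀) i₀) (x : V)
             (positive : ∀ i → IsWall α (point i₀) i → 0# < toward i · x) where

      private
        γ : Fin n → V
        γ i = ⟨ α i , p ⟩ *ᵥ α i

        γ-· : ∀ i y → ⟨ γ i , y ⟩ ≈ toward i · y
        γ-· i y = trans (⟨⟩-*ˡ ⟨ α i , p ⟩ (α i) y) (sym (·-def (toward i) y))

        -- If both forms are negative at `x`, this form vanishes at `y` exactly when the line from
        -- `y` in direction `x` meets the hyperplanes `i` and `j` at the same time. Avoiding its
        -- zeros separates the crossing times.
        cross : Fin n → Fin n → V
        cross i j = (toward i · x) *ᵥ γ j +ᵥ (- (toward j · x)) *ᵥ γ i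

        cross-· : ∀ i j y → ⟨ cross i j , y ⟩ ≈ toward i · x * toward j · y - toward j · x * toward i · y
        cross-· i j y = begin
          ⟨ cross i j , y ⟩                                 ≈⟨ ⟨⟩-comm (cross i j) y ⟩
          ⟨ y , cross i j ⟩                                 ≈⟨ ⟨⟩-move y ((toward i · x) *ᵥ γ j) (- (toward j · x)) (γ i) ⟩
          ⟨ y , (toward i · x) *ᵥ γ j ⟩ + - (toward j · x) * ⟨ y , γ i ⟩
            ≈⟨ +-cong (trans (⟨⟩-* y (toward i · x) (γ j)) (*-congˡ (trans (⟨⟩-comm y (γ j)) (γ-· j y))))
                      (trans (*-congˡ (trans (⟨⟩-comm y (γ i)) (γ-· i y))) (sym (-‿distribˡ-* _ _))) ⟩
          toward i · x * toward j · y - toward j · x * toward i · y ∎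

        crosses : List V
        crosses = cartesianProductWith cross (allFin n) (allFin n)

        gen = generic γ p crosses

        p′ : V
        p′ = proj₁ gen

        p′-pos : ∀ i → 0# < toward i · p′
        p′-pos i = <-respʳ (γ-· i p′) (proj₁ (proj₂ gen) i (<-respʳ (sym (γ-· i p)) (toward-pos i)))

        p′-generic : ∀ i j → ¬ (cross i j ≈ᵥ 0ᵥ) → ⟨ cross i j , p′ ⟩ ≉ 0#
        p′-generic i j = All.lookup (proj₂ (proj₂ gen)) (∈-cartesianProductWith⁺ cross (∈-allFin i) (∈-allFin j))

        Neg : Fin n → Set ℓ
        Neg i = toward i · x < 0#

        cross≉0 : ∀ {i j} → Neg i → Neg j → i ≢ j → ¬ (cross i j ≈ᵥ 0ᵥ)
        cross≉0 {i} {j} ni nj i≢j z = i≢j (≡.sym (proportional⇒≡ (toward j) (toward i)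
          {toward j · x * (toward i · x) ⁻¹} (*-≉0 (≉-neg nj) (inv-≉ (≉-neg ni))) λ y → *-cancelˡ (≉-neg ni) (begin
            toward i · x * toward j · y
              ≈⟨ x-y≈0⇒x≈y (trans (sym (cross-· i j y)) (trans (⟨⟩-comm (cross i j) y) (trans (⟨⟩-congʳ y (cross i j) 0ᵥ z) (⟨⟩-0 y)))) ⟩
            toward j · x * toward i · y
              ≈⟨ sym (*-identityˡ _) ⟩
            1# * (toward j · x * toward i · y)
              ≈⟨ *-congʳ (sym (*-inv (≉-neg ni))) ⟩
            toward i · x * (toward i · x) ⁻¹ * (toward j · x * toward i · y)
              ≈⟨ regroup (toward i · x) ((toward i · x) ⁻¹) (toward j · x) (toward i · y) ⟩
            toward i · x * (toward j · x * (toward i · x) ⁻¹ * toward i · y) ∎)))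
          where
          regroup : ∀ a b c d → a * b * (c * d) ≈ a * (c * b * d)
          regroup = solve 4 (λ a b c d → a :* b :* (c :* d) := a :* (c :* b :* d)) refl

        time : Fin n → ℝ
        time i = toward i · p′ * (- (toward i · x)) ⁻¹

        time-eq : ∀ {i} → Neg i → toward i · p′ + time i * toward i · x ≈ 0#
        time-eq {i} ni = trans (regroup (toward i · p′) (toward i · x) ((- (toward i · x)) ⁻¹))
          (trans (+-congˡ (-‿cong (trans (*-congˡ (*-inv (≉-pos (neg-pos ni)))) (*-identityʳ _)))) (-‿inverseʳ _))
          where
          regroup : ∀ a x i → a + a * i * x ≈ a - a * (- x * i)
          regroup = solve 3 (λ a x i → a :+ a :* i :* x := a :- a :* ((:- x) :* i)) refl

        time≉ : ∀ {i j} → Neg i → Neg j → i ≢ j → time i ≉ time j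
        time≉ {i} {j} ni nj i≢j e = p′-generic i j (cross≉0 ni nj i≢j) (begin
          ⟨ cross i j , p′ ⟩ ≈⟨ cross-· i j p′ ⟩
          toward i · x * toward j · p′ - toward j · x * toward i · p′
            ≈⟨ regroup (toward i · x) (toward j · p′) (toward j · x) (toward i · p′) (time i) ⟩
          toward i · x * (toward j · p′ + time i * toward j · x) - toward j · x * (toward i · p′ + time i * toward i · x)
            ≈⟨ +-cong (trans (*-congˡ (trans (+-congˡ (*-congʳ e)) (time-eq nj))) (zeroʳ _))
                      (-‿cong (trans (*-congˡ (time-eq ni)) (zeroʳ _))) ⟩
          0# - 0# ≈⟨ -‿inverseʳ _ ⟩
          0# ∎)
          where
          regroup : ∀ a b c d t → a * b - c * d ≈ a * (b + t * c) - c * (d + t * a)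
          regroup = solve 5 (λ a b c d t → a :* b :- c :* d := a :* (b :+ t :* c) :- c :* (d :+ t :* a)) refl

      abstract
        chamber-closed : ∀ j → ¬ (toward j · x < 0#)
        chamber-closed j₀ neg₀ = <-asym (positive j wall-j) nj
          where
          am : ∃[ j ] (Neg j × ∀ i → Neg i → time j ≤ time i)
          am = argmin Neg time (j₀ , neg₀)
          j : Fin n
          j = proj₁ am
          nj : Neg j
          nj = proj₁ (proj₂ am)
          -- The first crossing point. Crossing times are pairwise distinct, so it lies on
          -- hyperplane `j` alone and represents a 2-cell in the closure of the chamber.
          q : V
          q = p′ +ᵥ time j *ᵥ x
          time-pos : 0# < time j
          time-pos = *-pos (p′-pos j) (inv-pos (neg-pos nj))
          q-eq : ∀ i → toward i · q ≈ toward i · p′ + time j * toward i · x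
          q-eq i = ·-move (toward i) p′ (time j) x
          q-zero : toward j · q ≈ 0#
          q-zero = trans (q-eq j) (time-eq nj)
          q-pos : ∀ i → i ≢ j → 0# < toward i · q
          q-pos i i≢j with compare 0# (toward i · x)
          ... | tri< a _ _ = <-respʳ (sym (q-eq i)) (+-pos (p′-pos i) (*-pos time-pos a))
          ... | tri≈ _ e _ = <-respʳ (sym (q-eq i)) (+-pos-≤ (p′-pos i) (≤-reflexive (sym (trans (*-congˡ (sym e)) (zeroʳ _)))))
          ... | tri> _ _ ni = <-respʳ (trans (trans (sym (+-identityˡ _)) (trans (+-congʳ (sym (time-eq ni))) (regroup (toward i · p′) (time i) (time j) (toward i · x)))) (sym (q-eq i)))
                (*-neg-neg (<-respˡ (neg-diff (time i) (time j)) (pos-neg (x<y⇒0<y-x (≤∧≉⇒< (proj₂ (proj₂ am) i ni) (time≉ nj ni (λ e → i≢j (≡.sym e))))))) ni)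
            where
            regroup : ∀ a s t x → a + s * x + (t - s) * x ≈ a + t * x
            regroup = solve 4 (λ a s t x → a :+ s :* x :+ (t :- s) :* x := a :+ t :* x) refl
            neg-diff : ∀ s t → - (s - t) ≈ t - s
            neg-diff = solve 2 (λ s t → :- (s :- t) := t :- s) refl
          i₀≢j : i₀ ≢ j
          i₀≢j e = <-asym (positive i₀ wall₀) (≡.subst Neg (≡.sym e) nj)
          q≉0 : ¬ (q ≈ᵥ 0ᵥ)
          q≉0 z = <⇒≉ (q-pos i₀ i₀≢j) (sym (H⇒·≈0 (toward i₀) q (trans (⟨⟩-congʳ (α i₀) q 0ᵥ z) (⟨⟩-0 (α i₀)))))
          q-nonneg : ∀ i → 0# ≤ toward i · q
          q-nonneg i with i Fin.≟ j
          ... | yes ≡.refl = ≤-reflexive (sym q-zero)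
          ... | no ne = <⇒≤ (q-pos i ne)
          only-j : ∀ i → H α i q → i ≡ j
          only-j i h with i Fin.≟ j
          ... | yes e = e
          ... | no ne = contradiction (sym (H⇒·≈0 (toward i) q h)) (<⇒≉ (q-pos i ne))
          wall-j : IsWall α (point i₀) j
          wall-j = (q , q≉0) , inj₁ (toward-nonneg {q} q-nonneg) , ·≈0⇒H (toward j) q q-zero , only-j

    module _ (w : Fin 4 → Fin n) (closed : ∀ x → (∀ l → 0# < toward (w l) · x) → ∀ j → ¬ (toward j · x < 0#)) where

      abstract
        a : Fin 4 → V
        a l = ⟨ α (w l) , p ⟩ *ᵥ α (w l)
        a-· : ∀ l x → ⟨ a l , x ⟩ ≈ toward (w l) · x
        a-· l x = trans (⟨⟩-*ˡ ⟨ α (w l) , p ⟩ (α (w l)) x) (sym (·-def (toward (w l)) x))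
        -- From `p` one could move along such an `x` without changing the four wall forms. A
        -- hyperplane that does not contain `x` would be crossed on the way, against `closed`.
        kernel′ : ∀ x → (∀ l → toward (w l) · x ≈ 0#) → x ≈ᵥ 0ᵥ
        kernel′ x z with dec {x ≈ᵥ 0ᵥ}
        ... | yes e = e
        ... | no ne = ⊥-elim (empty-common (x , ne) λ i → ·≈0⇒H (toward i) x (vanish i))
          where
          vanish : ∀ i → toward i · x ≈ 0#
          vanish i with dec {toward i · x ≈ 0#}
          ... | yes e = e
          ... | no nz = ⊥-elim (closed (p +ᵥ s *ᵥ x) pos i neg)
            where
            s : ℝ
            -- The factor 2 carries the point beyond the hyperplane, to the value
            -- `- (toward i · p)`.
            s = - (1# + 1#) * toward i · p * (toward i · x) ⁻¹
            pos : ∀ l → 0# < toward (w l) · (p +ᵥ s *ᵥ x)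
            pos l = <-respʳ (sym (trans (·-move (toward (w l)) p s x) (trans (+-congˡ (trans (*-congˡ (z l)) (zeroʳ _))) (+-identityʳ _)))) (toward-pos (w l))
            double : ∀ a i b → a + - (1# + 1#) * a * i * b ≈ a - (1# + 1#) * a * (i * b)
            double = solve 3 (λ a i b → a :+ (:- (con (ℤ.+ 1) :+ con (ℤ.+ 1))) :* a :* i :* b := a :- (con (ℤ.+ 1) :+ con (ℤ.+ 1)) :* a :* (i :* b)) refl
              where import Data.Integer.Base as ℤ
            double′ : ∀ a → a - (1# + 1#) * a * 1# ≈ - a
            double′ = solve 1 (λ a → a :- (con (ℤ.+ 1) :+ con (ℤ.+ 1)) :* a :* con (ℤ.+ 1) := :- a) refl
              where import Data.Integer.Base as ℤ
            neg : toward i · (p +ᵥ s *ᵥ x) < 0#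
            neg = <-respˡ (sym (trans (·-move (toward i) p s x) (trans (double (toward i · p) ((toward i · x) ⁻¹) (toward i · x)) (trans (+-congˡ (-‿cong (*-congˡ (inv-*′ nz)))) (double′ (toward i · p)))))) (pos-neg (toward-pos i))
        db : Σ[ b ∈ (Fin 4 → V) ] (∀ l m → ⟨ a l , b m ⟩ ≈ δ l m)
        db = dual-basis a (λ x z → kernel′ x (λ l → trans (sym (a-· l x)) (z l)))
        b : Fin 4 → V
        b = proj₁ db
        dual′ : ∀ l m → toward (w l) · b m ≈ δ l m
        dual′ l m = trans (sym (a-· l (b m))) (proj₂ db l m)
        -- A dual ray lies on the boundary of the region to which `closed` applies, so it is first
        -- pushed inwards by a small multiple of the sum of all rays.
        nonneg : ∀ i l → ¬ (toward i · b l < 0#)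
        nonneg i l neg = closed (b l +ᵥ t *ᵥ s) pos i neg′
          where
          s : V
          s = combination (λ _ → 1#) b
          ev : ∃[ t ] (0# < t × toward i · b l + t * toward i · s < 0#)
          ev = ev-witness (ev-affine-neg (toward i · s) neg)
          t : ℝ
          t = proj₁ ev
          neg′ : toward i · (b l +ᵥ t *ᵥ s) < 0#
          neg′ = <-respˡ (sym (·-move (toward i) (b l) t s)) (proj₂ (proj₂ ev))
          pos : ∀ m → 0# < toward (w m) · (b l +ᵥ t *ᵥ s)
          pos m = <-respʳ (sym (trans (·-move (toward (w m)) (b l) t s) (+-cong (dual′ m l) (*-congˡ sum1))))
                          (+-≤-pos (δ-nonneg m l) (<-respʳ (sym (*-identityʳ t)) (proj₁ (proj₂ ev))))
            where
            sum1 : toward (w m) · s ≈ 1#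
            sum1 = trans (·-combination (toward (w m)) (λ _ → 1#) b)
              (trans (Σ-cong (λ k → 1# * toward (w m) · b k) (λ k → 1# * δ k m) (λ k → *-congˡ (trans (dual′ m k) (δ-sym m k)))) (sum-δʳ m (λ _ → 1#)))
        coherent′ : ∀ f l m → 0# < f · b l → ¬ (f · b m < 0#)
        coherent′ f l m pos neg with same-idx f (toward (idx f)) ≡.refl
        ... | c , c≉0 , eq with ≉⇒<> c≉0
        ... | inj₁ cp = nonneg (idx f) m (*-cancel-neg cp (<-respˡ (eq (b m)) neg))
        ... | inj₂ cn = nonneg (idx f) l (*-cancel-neg (neg-pos cn) (<-respˡ (trans (-‿cong (eq (b l))) (-‿distribˡ-* _ _)) (pos-neg pos)))

        closed-base : Base
        closed-base = record { ray = b ; wall = λ l → toward (w l) ; dual = dual′ ; kernel = kernel′ ; coherent = coherent′ }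

        closed-base-pos : ∀ l → 0# < wall closed-base l · p
        closed-base-pos l = toward-pos (w l)

        closed-base-idx : ∀ l → idx (wall closed-base l) ≡ w l
        closed-base-idx l = ≡.refl

    module _ (simplicial : Simplicial α) (i₀ : Fin n) where

      private
        walls : List (Fin n)
        walls = filter (λ j → em {IsWall α (point i₀) j}) (allFin n)

      abstract
        w : Fin 4 → Fin n
        w l = lookup walls (cast (≡.sym (simplicial (point i₀) p∉H)) l)
        sound : ∀ l → IsWall α (point i₀) (w l)
        sound l = proj₂ (∈-filter⁻ (λ j → em {IsWall α (point i₀) j}) {xs = allFin n} (∈-lookup {xs = walls} (cast (≡.sym (simplicial (point i₀) p∉H)) l)))
        complete : ∀ i → IsWall α (point i₀) i → ∃[ l ] w l ≡ i
        complete i wi = cast eq4 (index mem) , ≡.trans (≡.cong (lookup walls) (≡.trans (Fin.cast-trans eq4 (≡.sym eq4) (index mem)) (Fin.cast-is-id ≡.refl (index mem)))) (≡.sym (lookup-index mem))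
          where
          eq4 : length walls ≡ 4
          eq4 = simplicial (point i₀) p∉H
          mem : i ∈ walls
          mem = ∈-filter⁺ (λ j → em {IsWall α (point i₀) j}) (∈-allFin i) wi
        closed : ∀ x → (∀ l → 0# < toward (w l) · x) → ∀ j → ¬ (toward j · x < 0#)
        closed x pos = chamber-closed (w 0F) wall₀ x (λ i wi → ≡.subst (λ i → 0# < toward i · x) (proj₂ (complete i wi)) (pos (proj₁ (complete i wi))))
          where
          wall₀ : IsWall α (point (w 0F)) (w 0F)
          wall₀ = sound 0F

        chamber-base : ∃[ B ] ((∀ l → 0# < wall B l · p) × (∀ i → IsWall α (point i₀) i → ∃[ l ] idx (wall B l) ≡ i))
        chamber-base = closed-base w closed , closed-base-pos w closed
                     , λ i wi → proj₁ (complete i wi) , ≡.trans (closed-base-idx w closed _) (proj₂ (complete i wi))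

-- Crossing a wall, and galleries

module Crossings {ℓ : Level} (R : Reals ℓ) {n : ℕ} (α : Fin n → OverReals.V R) (arr : OverReals.IsArrangement R α)
  (simplicial : OverReals.Simplicial R α) where

  open FiniteSets
  open OrderedField R
  open LinearAlgebra R
  open SimplicialCones R α arr
  open ChamberCones R α arr using (chamber-base; point; p≉0)
  open import Data.Fin.Base using (zero; suc)
  import Data.Fin.Properties as Fin
  open import Data.Fin.Patterns
  open import Data.Fin.Subset using (Subset; _∈_; ∣_∣; ⊤) renaming (_-_ to _∖_)
  open import Data.Fin.Subset.Properties using (x∈p∧x≢y⇒x∈p-y; x∈p⇒∣p-x∣<∣p∣; ∈⊤)
  import Data.Nat.Properties as ℕ
  open import Data.Product.Base
  open import Data.Sum.Base
  open import Data.Empty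
  open import Function.Definitions using (Injective)
  open import Relation.Nullary using (yes; no; contradiction)
  import Relation.Binary.PropositionalEquality as ≡
  open ≡ using (_≡_; _≢_; ≢-sym)

  module _ (B : Base) (μ : Fin 4 → Fin 4) (μ-inj : Injective _≡_ _≡_ μ) (z : Fin 4 → ℝ) (z-pos : ∀ l → 0# < z l) where

    private
      κ : Fin 4 → Σ ℝ (_≉ 0#)
      κ l = z l ⁻¹ , inv-≉ (≉-pos (z-pos l))

      w : Fin 4 → Form
      w l = κ l ⊙ wall B (μ l)

    abstract
      relabel-dual : ∀ l m → w l · (z m *ᵥ ray B (μ m)) ≈ δ l m
      relabel-dual l m = trans (trans (⊙-· (κ l) (wall B (μ l)) (z m *ᵥ ray B (μ m))) (*-congˡ (·-* (wall B (μ l)) (z m) (ray B (μ m))))) (go l m)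
        where
        go : ∀ l m → z l ⁻¹ * (z m * wall B (μ l) · ray B (μ m)) ≈ δ l m
        go l m with l Fin.≟ m
        ... | yes ≡.refl = trans (*-congˡ (trans (*-congˡ (wall-refl B (μ l))) (*-identityʳ _))) (trans (inv-*′ (≉-pos (z-pos l))) (sym (δ-refl l)))
        ... | no ne = trans (*-congˡ (trans (*-congˡ (wall-≢ B (λ e → ne (μ-inj e)))) (zeroʳ _))) (trans (zeroʳ _) (sym (δ-≢ ne)))

      relabel-kernel : ∀ x → (∀ l → w l · x ≈ 0#) → x ≈ᵥ 0ᵥ
      relabel-kernel x v = kernel B x λ m → ≡.subst (λ m → wall B m · x ≈ 0#) (proj₂ (surj m))
        (*-≈0 (inv-≉ (≉-pos (z-pos (proj₁ (surj m))))) (trans (sym (⊙-· (κ (proj₁ (surj m))) (wall B (μ (proj₁ (surj m)))) x)) (v (proj₁ (surj m)))))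
        where
        surj : ∀ j → ∃[ i ] μ i ≡ j
        surj = injective⇒surjective μ μ-inj

      relabel-coherent : ∀ f l m → 0# < f · (z l *ᵥ ray B (μ l)) → ¬ (f · (z m *ᵥ ray B (μ m)) < 0#)
      relabel-coherent f l m p q = coherent B f (μ l) (μ m)
        (*-cancel-pos (z-pos l) (<-respʳ (·-* f (z l) (ray B (μ l))) p))
        (*-cancel-neg (z-pos m) (<-respˡ (·-* f (z m) (ray B (μ m))) q))

    relabel : Base
    relabel = record { ray = λ l → z l *ᵥ ray B (μ l) ; wall = w ; dual = relabel-dual ; kernel = relabel-kernel ; coherent = relabel-coherent }

  -- The chamber on the other side of the k-th wall.
  record Crossing (B : Base) (k : Fin 4) : Set ℓ where
    field
      next    : Base
      coeff   : Fin 4 → ℝ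
      same    : ∀ j → j ≢ k → ray next j ≈ᵥ ray B j
      new     : ray next k ≈ᵥ combination coeff (ray B)
      coeff-k : coeff k ≈ - 1#
      idx-k   : idx (wall next k) ≡ idx (wall B k)

  open Crossing public

  module _ (B : Base) (k : Fin 4) where

    private
      -- An interior point of the facet opposite to ray `k`. A small step from it against this ray
      -- leads into the adjacent chamber.
      facet : V
      facet = combination (λ j → 1# - δ k j) (ray B)

      beyond : V
      beyond = (- 1#) *ᵥ ray B k

    abstract
      private
        facet-coeff-≥ : ∀ j → 0# ≤ 1# - δ k j
        facet-coeff-≥ j with k Fin.≟ j
        ... | yes ≡.refl = ≤-reflexive (sym (trans (+-congˡ (-‿cong (δ-refl k))) (-‿inverseʳ 1#)))
        ... | no ne = <⇒≤ (<-respʳ (sym (trans (+-congˡ (trans (-‿cong (δ-≢ ne)) -0#≈0#)) (+-identityʳ 1#))) 0<1)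

        facet-coeff-1 : ∀ j → j ≢ k → 1# - δ k j ≈ 1#
        facet-coeff-1 j ne = trans (+-congˡ (trans (-‿cong (δ-≢ (≢-sym ne))) -0#≈0#)) (+-identityʳ 1#)

        wall-facet : ∀ l → wall B l · facet ≈ 1# - δ k l
        wall-facet l = trans (·-combination (wall B l) (λ j → 1# - δ k j) (ray B))
          (trans (Σ-cong (λ j → (1# - δ k j) * wall B l · ray B j) (λ j → (1# - δ k j) * δ j l) (λ j → *-congˡ (trans (dual B l j) (δ-sym l j)))) (sum-δʳ l (λ j → 1# - δ k j)))

        facet-closed : ∀ l → 0# ≤ wall B l · facet
        facet-closed l = ≤-resp refl (sym (wall-facet l)) (facet-coeff-≥ l)

        facet-pos : ∀ f → idx f ≢ idx (wall B k) → Nonneg B f → 0# < f · facet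
        facet-pos f ne nn with other-ray B f k ne
        ... | l , l≢k , nz = <-respʳ (sym (·-combination f (λ j → 1# - δ k j) (ray B)))
          (sum-pos (λ j → (1# - δ k j) * f · ray B j) (λ j → *-nonneg (facet-coeff-≥ j) (nn j)) l
            (*-pos (<-respʳ (sym (facet-coeff-1 l l≢k)) 0<1) (≤∧≉⇒< (nn l) (λ e → nz (sym e)))))

        facet-≉ : ∀ f → idx f ≢ idx (wall B k) → f · facet ≉ 0#
        facet-≉ f ne z with positive-form B (idx f)
        ... | g , e , nn = ≉-pos (facet-pos g (λ e′ → ne (≡.trans (≡.sym e) e′)) nn) (idx-≡-zero f g (≡.sym e) facet z)

        small : ∃[ s ] (0# < s × _≼_ α facet (facet +ᵥ s *ᵥ beyond))
        small = ev-witness (ev-≼ α facet beyond)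

        s : ℝ
        s = proj₁ small

        p′ : V
        p′ = facet +ᵥ s *ᵥ beyond

        facet≼p′ : _≼_ α facet p′
        facet≼p′ = proj₂ (proj₂ small)

        wall-p′ : ∀ l → wall B l · p′ ≈ 1# - δ k l - s * δ k l
        wall-p′ l = trans (·-move (wall B l) facet s beyond) (+-cong (wall-facet l)
          (trans (*-congˡ (trans (·-* (wall B l) (- 1#) (ray B k)) (trans (-1*x≈-x _) (-‿cong (trans (dual B l k) (δ-sym l k)))))) (sym (-‿distribʳ-* s (δ k l)))))

        wall-k-p′ : wall B k · p′ < 0#
        wall-k-p′ = <-respˡ (sym (trans (wall-p′ k) (trans (+-cong (trans (+-congˡ (-‿cong (δ-refl k))) (-‿inverseʳ 1#)) (-‿cong (trans (*-congˡ (δ-refl k)) (*-identityʳ s)))) (+-identityˡ _))))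
          (pos-neg (proj₁ (proj₂ small)))

        wall-j-p′ : ∀ j → j ≢ k → 0# < wall B j · p′
        wall-j-p′ j ne = <-respʳ (sym (trans (wall-p′ j) (trans (+-cong (facet-coeff-1 j ne) (trans (-‿cong (trans (*-congˡ (δ-≢ (≢-sym ne))) (zeroʳ s))) -0#≈0#)) (+-identityʳ 1#)))) 0<1

        p′-chamber : ∀ i → ¬ H α i p′
        p′-chamber i hi with positive-form B i
        ... | f , ≡.refl , nn with idx f Fin.≟ idx (wall B k)
        ... | yes e = ≉-neg wall-k-p′ (idx-≡-zero f (wall B k) e p′ (H⇒·≈0 f p′ hi))
        ... | no ne = ≉-pos (proj₁ (≼-form {facet} {p′} facet≼p′ f) (facet-pos f ne nn)) (H⇒·≈0 f p′ hi)

        facet≉0 : ¬ (facet ≈ᵥ 0ᵥ)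
        facet≉0 z = 1≉0 (trans (sym (facet-coeff-1 j j≢k)) (trans (sym (wall-facet j)) (H⇒·≈0 (wall B j) facet (trans (⟨⟩-congʳ (α (idx (wall B j))) facet 0ᵥ z) (⟨⟩-0 (α (idx (wall B j))))))))
          where
          other : ∀ (k : Fin 4) → Σ[ j ∈ Fin 4 ] j ≢ k
          other zero = 1F , λ ()
          other (suc _) = 0F , λ ()
          j : Fin 4
          j = proj₁ (other k)
          j≢k : j ≢ k
          j≢k = proj₂ (other k)

        wall-of-p′ : ∀ p′≉0 → IsWall α (p′ , p′≉0) (idx (wall B k))
        wall-of-p′ _ = (facet , facet≉0) , inj₁ facet≼p′ , ·≈0⇒H (wall B k) facet (trans (wall-facet k) (trans (+-congˡ (-‿cong (δ-refl k))) (-‿inverseʳ 1#))) , only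
          where
          only : ∀ j → H α j facet → j ≡ idx (wall B k)
          only j hj with j Fin.≟ idx (wall B k)
          ... | yes e = e
          ... | no ne = contradiction (H⇒·≈0 (form j 1# 1≉0) facet hj) (facet-≉ (form j 1# 1≉0) ne)

        Dbase : ∃[ D ] ((∀ l → 0# < wall D l · p′) × (∀ i → IsWall α (point p′ p′-chamber (idx (wall B k))) i → ∃[ l ] idx (wall D l) ≡ i))
        Dbase = chamber-base p′ p′-chamber simplicial (idx (wall B k))

        D : Base
        D = proj₁ Dbase

        D-pos : ∀ l → 0# < wall D l · p′
        D-pos = proj₁ (proj₂ Dbase)

        D-k : ∃[ l ] idx (wall D l) ≡ idx (wall B k)
        D-k = proj₂ (proj₂ Dbase) (idx (wall B k)) (wall-of-p′ (p≉0 p′ p′-chamber (idx (wall B k))))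

        m₀ : Fin 4
        m₀ = proj₁ D-k

        -- The facet point lies in the closures of both chambers, so a wall form of `D` is not
        -- negative there. Unless it defines the common wall, it is positive there, and coherence on
        -- `B` spreads the sign to the rays.
        wallD-ray : ∀ m j → j ≢ k → 0# ≤ wall D m · ray B j
        wallD-ray m j j≢k with idx (wall D m) Fin.≟ idx (wall B k)
        ... | yes e = ≤-reflexive (sym (idx-≡-zero (wall B k) (wall D m) (≡.sym e) (ray B j) (wall-≢ B (≢-sym j≢k))))
        ... | no ne with ≉⇒<> (facet-≉ (wall D m) ne)
        ... | inj₁ p = closed-positive B (wall D m) facet facet-closed p j
        ... | inj₂ p = ⊥-elim (<-asym (D-pos m) (proj₂ (≼-form {facet} {p′} facet≼p′ (wall D m)) p))

        wallB-ray : ∀ j → j ≢ k → ∀ m → 0# ≤ wall B j · ray D m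
        wallB-ray j j≢k = closed-positive D (wall B j) p′ (λ l → <⇒≤ (D-pos l)) (wall-j-p′ j j≢k)

        wall-k-ray : ∀ m → m ≢ m₀ → wall B k · ray D m ≈ 0#
        wall-k-ray m ne = idx-≡-zero (wall D m₀) (wall B k) (proj₂ D-k) (ray D m) (wall-≢ D (≢-sym ne))

        wall-k-m₀ : wall B k · ray D m₀ < 0#
        wall-k-m₀ = *-cancel-neg (D-pos m₀) (<-respˡ (trans (expand-· D (wall B k) p′)
          (sum-single (λ l → wall D l · p′ * wall B k · ray D l) m₀ (λ m ne → trans (*-congˡ (wall-k-ray m ne)) (zeroʳ _)))) wall-k-p′)

        ray≉0 : ∀ (A A′ : Base) j → ∃[ m ] wall A m · ray A′ j ≉ 0#
        ray≉0 A A′ j with dec {∃[ m ] wall A m · ray A′ j ≉ 0#}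
        ... | yes p = p
        ... | no none = contradiction (trans (sym (wall-refl A′ j)) (H⇒·≈0 (wall A′ j) (ray A′ j) (trans (⟨⟩-congʳ (α (idx (wall A′ j))) (ray A′ j) 0ᵥ zv) (⟨⟩-0 (α (idx (wall A′ j))))))) 1≉0
          where
          z : ∀ m → wall A m · ray A′ j ≈ 0#
          z m with dec {wall A m · ray A′ j ≈ 0#}
          ... | yes e = e
          ... | no ne = contradiction (m , ne) none
          zv : ray A′ j ≈ᵥ 0ᵥ
          zv = kernel A (ray A′ j) z

        partner : ∀ j → j ≢ k → ∃[ m ] 0# < wall D m · ray B j
        partner j j≢k = proj₁ (ray≉0 D B j) , ≤∧≉⇒< (wallD-ray _ j j≢k) (λ e → proj₂ (ray≉0 D B j) (sym e))

        partner≢m₀ : ∀ j (j≢k : j ≢ k) → proj₁ (partner j j≢k) ≢ m₀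
        partner≢m₀ j j≢k e = ≉-pos (proj₂ (partner j j≢k)) (idx-≡-zero (wall B k) (wall D (proj₁ (partner j j≢k))) (≡.trans (≡.sym (proj₂ D-k)) (≡.cong (λ m → idx (wall D m)) (≡.sym e))) (ray B j) (wall-≢ B (≢-sym j≢k)))

        -- Expand ray `j` of `B` in the rays of `D` and apply a wall form `l` of `B` with `l`
        -- different from `j` and `k`: a sum of nonnegative terms vanishes, so each term does. The
        -- partner is therefore proportional to ray `j`.
        partner-zero : ∀ j (j≢k : j ≢ k) l → l ≢ j → wall B l · ray D (proj₁ (partner j j≢k)) ≈ 0#
        partner-zero j j≢k l l≢j with l Fin.≟ k
        ... | yes ≡.refl = wall-k-ray _ (partner≢m₀ j j≢k)
        ... | no l≢k = *-≈0 (≉-pos (proj₂ (partner j j≢k))) (sum-zero⁻¹ (λ m → wall D m · ray B j * wall B l · ray D m)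
                (λ m → *-nonneg (wallD-ray m j j≢k) (wallB-ray l l≢k m)) (trans (sym (expand-· D (wall B l) (ray B j))) (wall-≢ B l≢j)) (proj₁ (partner j j≢k)))

        partner-pos : ∀ j (j≢k : j ≢ k) → 0# < wall B j · ray D (proj₁ (partner j j≢k))
        partner-pos j j≢k = ≤∧≉⇒< (wallB-ray j j≢k _) (λ e → proj₂ (ray≉0 B D (proj₁ (partner j j≢k))) (all (sym e) (proj₁ (ray≉0 B D (proj₁ (partner j j≢k))))))
          where
          all : wall B j · ray D (proj₁ (partner j j≢k)) ≈ 0# → ∀ l → wall B l · ray D (proj₁ (partner j j≢k)) ≈ 0#
          all z l with l Fin.≟ j
          ... | yes ≡.refl = z
          ... | no ne = partner-zero j j≢k l ne

        μ : Fin 4 → Fin 4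
        μ j with j Fin.≟ k
        ... | yes _ = m₀
        ... | no ne = proj₁ (partner j ne)

        μ-inj : Injective _≡_ _≡_ μ
        μ-inj {i} {j} e with i Fin.≟ k | j Fin.≟ k
        ... | yes p | yes q = ≡.trans p (≡.sym q)
        ... | yes p | no q = contradiction (≡.sym e) (partner≢m₀ j q)
        ... | no p | yes q = contradiction e (partner≢m₀ i p)
        ... | no p | no q with i Fin.≟ j
        ... | yes r = r
        ... | no r = contradiction (≡.subst (λ m → wall B i · ray D m ≈ 0#) (≡.sym e) (partner-zero j q i r)) (≉-pos (partner-pos i p))

        -- Rays are determined only up to positive factors. This choice makes the three common rays
        -- equal to the old ones and the k-th coordinate of the new ray equal to -1.
        z : Fin 4 → ℝ
        z j with j Fin.≟ k
        ... | yes _ = (- (wall B k · ray D m₀)) ⁻¹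
        ... | no ne = (wall B j · ray D (proj₁ (partner j ne))) ⁻¹

        z-pos : ∀ j → 0# < z j
        z-pos j with j Fin.≟ k
        ... | yes _ = inv-pos (neg-pos wall-k-m₀)
        ... | no ne = inv-pos (partner-pos j ne)

        next-k : wall B k · (z k *ᵥ ray D (μ k)) ≈ - 1#
        next-k = trans (·-* (wall B k) (z k) (ray D (μ k))) go
          where
          go : z k * wall B k · ray D (μ k) ≈ - 1#
          go with k Fin.≟ k
          ... | no ne = contradiction ≡.refl ne
          ... | yes _ = trans (neg-neg ((- (wall B k · ray D m₀)) ⁻¹) (wall B k · ray D m₀)) (-‿cong (inv-*′ (≉-pos (neg-pos wall-k-m₀))))
            where
            neg-neg : ∀ a b → a * b ≈ - (a * - b)
            neg-neg = solve 2 (λ a b → a :* b := :- (a :* (:- b))) refl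

        next-j : ∀ j → j ≢ k → ∀ l → wall B l · (z j *ᵥ ray D (μ j)) ≈ δ l j
        next-j j j≢k l = trans (·-* (wall B l) (z j) (ray D (μ j))) (go l)
          where
          go : ∀ l → z j * wall B l · ray D (μ j) ≈ δ l j
          go l with j Fin.≟ k
          ... | yes e = contradiction e j≢k
          ... | no ne with l Fin.≟ j
          ... | yes ≡.refl = trans (inv-*′ (≉-pos (partner-pos j ne))) (sym (δ-refl j))
          ... | no l≢j = trans (*-congˡ (partner-zero j ne l l≢j)) (trans (zeroʳ _) (sym (δ-≢ l≢j)))

        μ-k : μ k ≡ m₀
        μ-k with k Fin.≟ k
        ... | yes _ = ≡.refl
        ... | no ne = contradiction ≡.refl ne

      cross : Crossing B k
      cross = record
        { next    = relabel D μ μ-inj z z-pos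
        ; coeff   = λ l → wall B l · (z k *ᵥ ray D (μ k))
        ; same    = λ j j≢k x → trans (expand B (z j *ᵥ ray D (μ j)) x)
                      (trans (Σ-cong (λ l → wall B l · (z j *ᵥ ray D (μ j)) * ray B l x) (λ l → δ j l * ray B l x) (λ l → *-congʳ (trans (next-j j j≢k l) (δ-sym l j))))
                             (sum-δ j (λ l → ray B l x)))
        ; new     = expand B (z k *ᵥ ray D (μ k))
        ; coeff-k = next-k
        ; idx-k   = ≡.trans (≡.cong (λ m → idx (wall D m)) μ-k) (proj₂ D-k)
        }

  module _ {B : Base} {k : Fin 4} (X : Crossing B k) where

    abstract
      same-· : ∀ f j → j ≢ k → f · ray (next X) j ≈ f · ray B j
      same-· f j ne = ·-cong f (ray (next X) j) (ray B j) (same X j ne)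

      new-· : ∀ f → f · ray (next X) k ≈ sum (λ l → coeff X l * f · ray B l)
      new-· f = trans (·-cong f (ray (next X) k) (combination (coeff X) (ray B)) (new X)) (·-combination f (coeff X) (ray B))

      nonneg-next : ∀ f → idx f ≢ idx (wall B k) → Nonneg B f → Nonneg (next X) f
      nonneg-next f ne nn with other-ray B f k ne
      ... | l , l≢k , nz = nonneg-from (next X) f (<-respʳ (sym (same-· f l l≢k)) (≤∧≉⇒< (nn l) (λ e → nz (sym e))))

      nonneg-prev : ∀ f → idx f ≢ idx (wall B k) → Nonneg (next X) f → Nonneg B f
      nonneg-prev f ne nn with other-ray B f k ne
      ... | l , l≢k , nz = nonneg-from B f (≤∧≉⇒< (≤-resp refl (same-· f l l≢k) (nn l)) (λ e → nz (sym e)))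

  Separates : Base → V → Fin n → Set ℓ
  Separates B x i = ∃[ f ] (idx f ≡ i × Nonneg B f × f · x < 0#)

  module Walk (x : V) (Inv : Base → Set ℓ)
              (step : ∀ {B} k (X : Crossing B k) → wall B k · x < 0# → Inv B → Inv (next X)) where

    abstract
      private
        -- Crossing a wall that has `x` on its far side removes this hyperplane from the separating
        -- set and adds none, so the walk terminates.
        separates-prev : ∀ {B} k (X : Crossing B k) → wall B k · x < 0# → ∀ i → Separates (next X) x i → i ≢ idx (wall B k) × Separates B x i
        separates-prev {B} k X neg i (f , ≡.refl , nn , fx) with idx f Fin.≟ idx (wall B k)
        ... | no ne = ne , f , ≡.refl , nonneg-prev X f ne nn , fx
        ... | yes e with same-idx f (wall B k) e
        ... | c , c≉0 , eq with ≉⇒<> c≉0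
        ... | inj₂ cn = ⊥-elim (<-asym fx (<-respʳ (sym (eq x)) (*-neg-neg cn neg)))
        ... | inj₁ cp = ⊥-elim (nn k (<-respˡ (sym (trans (eq (ray (next X) k)) (*-congˡ val))) (*-pos-neg cp (pos-neg 0<1))))
          where
          val : wall B k · ray (next X) k ≈ - 1#
          val = trans (new-· X (wall B k)) (trans (sum-single (λ l → coeff X l * wall B k · ray B l) k (λ l ne → trans (*-congˡ (wall-≢ B (λ e → ne (≡.sym e)))) (zeroʳ _)))
            (trans (*-cong (coeff-k X) (wall-refl B k)) (*-identityʳ _)))

        go : ∀ m (s : Subset n) → ∣ s ∣ ℕ.≤ m → ∀ {B} → Inv B → (∀ i → Separates B x i → i ∈ s) → ∃[ B′ ] (Inv B′ × ∀ l → 0# ≤ wall B′ l · x)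
        go m s le {B} inv sep with dec {∃[ k ] wall B k · x < 0#}
        ... | no none = B , inv , λ l neg → none (l , neg)
        ... | yes (k , neg) with sep (idx (wall B k)) (wall B k , ≡.refl , wall-nonneg B k , neg)
        ... | k∈s with m | ℕ.<-≤-trans (x∈p⇒∣p-x∣<∣p∣ k∈s) le
        ... | ℕ.suc m′ | ℕ.s≤s le′ = go m′ (s ∖ idx (wall B k)) le′ (step k (cross B k) neg inv)
              (λ i si → x∈p∧x≢y⇒x∈p-y (sep i (proj₂ (separates-prev k (cross B k) neg i si))) (proj₁ (separates-prev k (cross B k) neg i si)))

      walk : ∀ {B} → Inv B → ∃[ B′ ] (Inv B′ × ∀ l → 0# ≤ wall B′ l · x)
      walk inv = go _ ⊤ ℕ.≤-refl inv (λ _ _ → ∈⊤)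

  -- Every hyperplane separates a chamber from its opposite, hence is crossed.
  module _ (Inv : Base → Set ℓ) {B₀ : Base} where

    private
      centre : V
      centre = combination (λ _ → 1#) (ray B₀)

      opposite : V
      opposite = (- 1#) *ᵥ centre

    module _ (step : ∀ {B} k (X : Crossing B k) → wall B k · opposite < 0# → Inv B → Inv (next X)) (inv₀ : Inv B₀) (i : Fin n) where

      private
        Found : Set ℓ
        Found = ∃[ B ] (Inv B × ∃[ l ] idx (wall B l) ≡ i)

        -- Either the hyperplane has already occurred as a wall, or it still separates the current
        -- chamber from the target. At the end of the gallery only the first is possible.
        Inv′ : Base → Set ℓ
        Inv′ B = Found ⊎ (Inv B × Separates B opposite i)

        step′ : ∀ {B} k (X : Crossing B k) → wall B k · opposite < 0# → Inv′ B → Inv′ (next X)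
        step′ k X neg (inj₁ found) = inj₁ found
        step′ {B} k X neg (inj₂ (inv , f , e , nn , fx)) with idx (wall B k) Fin.≟ i
        ... | yes p = inj₁ (B , inv , k , p)
        ... | no p = inj₂ (step k X neg inv , f , e , nonneg-next X f (λ q → p (≡.trans (≡.sym q) e)) nn , fx)

      abstract
        reach-wall : Found
        reach-wall with Walk.walk opposite Inv′ step′ {B₀} (inj₂ (inv₀ , separated))
          where
          separated : Separates B₀ opposite i
          separated with positive-form B₀ i
          ... | f , e , nn with nonzero-ray B₀ f
          ... | l , nz = f , e , nn , <-respˡ (sym (trans (·-* f (- 1#) centre) (-1*x≈-x _)))
                (pos-neg (<-respʳ (sym (·-combination f (λ _ → 1#) (ray B₀))) (sum-pos (λ j → 1# * f · ray B₀ j) (λ j → *-nonneg (<⇒≤ 0<1) (nn j)) l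
                   (*-pos 0<1 (≤∧≉⇒< (nn l) (λ e → nz (sym e)))))))
        ... | _ , inj₁ found , _ = found
        ... | B , inj₂ (_ , f , _ , nn , fx) , closed = ⊥-elim (nonneg-at B f opposite closed nn fx)

-- Hyperplanes supported on two or three rays

module LocalStructure {ℓ : Level} (R : Reals ℓ) {n : ℕ} (α : Fin n → OverReals.V R) (arr : OverReals.IsArrangement R α)
  (simplicial : OverReals.Simplicial R α) where

  open OrderedField R
  open LinearAlgebra R
  open SimplicialCones R α arr
  open Crossings R α arr simplicial
  import Data.Fin.Properties as Fin
  open import Data.Product.Base
  open import Data.Empty
  open import Relation.Nullary using (Dec; yes; no; contradiction)
  import Relation.Binary.PropositionalEquality as ≡
  open ≡ using (_≡_; _≢_; ≢-sym)
  open import Relation.Binary.Reasoning.Setoid setoid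

  abstract
    sum-two : ∀ {m} (f : Fin m → ℝ) {i j} → i ≢ j → (∀ l → l ≢ i → l ≢ j → f l ≈ 0#) → sum f ≈ f i + f j
    sum-two f {i} {j} i≢j z = begin
      sum f                                                   ≈⟨ Σ-cong f (λ l → δ i l * f l + δ j l * f l) split ⟩
      sum (λ l → δ i l * f l + δ j l * f l)                   ≈⟨ ∑-distrib-+ (λ l → δ i l * f l) (λ l → δ j l * f l) ⟩
      sum (λ l → δ i l * f l) + sum (λ l → δ j l * f l)       ≈⟨ +-cong (sum-δ i f) (sum-δ j f) ⟩
      f i + f j                                               ∎
      where
      split : ∀ l → f l ≈ δ i l * f l + δ j l * f l
      split l with i Fin.≟ l | j Fin.≟ l
      ... | yes ≡.refl | yes ≡.refl = contradiction ≡.refl i≢j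
      ... | yes ≡.refl | no p = sym (trans (+-cong (trans (*-congʳ (δ-refl i)) (*-identityˡ _)) (trans (*-congʳ (δ-≢ p)) (zeroˡ _))) (+-identityʳ _))
      ... | no p | yes ≡.refl = sym (trans (+-cong (trans (*-congʳ (δ-≢ p)) (zeroˡ _)) (trans (*-congʳ (δ-refl j)) (*-identityˡ _))) (+-identityˡ _))
      ... | no p | no q = trans (z l (λ e → p (≡.sym e)) (λ e → q (≡.sym e))) (sym (trans (+-cong (trans (*-congʳ (δ-≢ p)) (zeroˡ _)) (trans (*-congʳ (δ-≢ q)) (zeroˡ _))) (+-identityˡ 0#)))

    sum-three : ∀ {m} (f : Fin m → ℝ) {i j k} → i ≢ j → i ≢ k → j ≢ k → (∀ l → l ≢ i → l ≢ j → l ≢ k → f l ≈ 0#) → sum f ≈ f i + f j + f k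
    sum-three {m} f {i} {j} {k} i≢j i≢k j≢k z = begin
      sum f                                               ≈⟨ Σ-cong f (λ l → δ k l * f l + g l) split ⟩
      sum (λ l → δ k l * f l + g l)                       ≈⟨ ∑-distrib-+ (λ l → δ k l * f l) g ⟩
      sum (λ l → δ k l * f l) + sum g                     ≈⟨ +-cong (sum-δ k f) (sum-two g i≢j gz) ⟩
      f k + (g i + g j)                                   ≈⟨ +-comm _ _ ⟩
      g i + g j + f k                                     ≈⟨ +-congʳ (+-cong (g≢ i (≢-sym i≢k)) (g≢ j (≢-sym j≢k))) ⟩
      f i + f j + f k                                     ∎
      where
      g : Fin m → ℝ
      g l = (1# - δ k l) * f l
      split : ∀ l → f l ≈ δ k l * f l + g l
      split l = solve 2 (λ d f → f := d :* f :+ (con (ℤ.+ 1) :- d) :* f) refl (δ k l) (f l)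
        where import Data.Integer.Base as ℤ
      g≢ : ∀ l → k ≢ l → g l ≈ f l
      g≢ l p = trans (*-congʳ (trans (+-congˡ (trans (-‿cong (δ-≢ p)) -0#≈0#)) (+-identityʳ 1#))) (*-identityˡ _)
      gz : ∀ l → l ≢ i → l ≢ j → g l ≈ 0#
      gz l p q with l Fin.≟ k
      ... | yes ≡.refl = trans (*-congʳ (trans (+-congˡ (-‿cong (δ-refl l))) (-‿inverseʳ 1#))) (zeroˡ _)
      ... | no r = trans (*-congˡ (z l p q r)) (zeroʳ _)

  Supp₂ : Base → Fin 4 → Fin 4 → Form → Set ℓ
  Supp₂ B i j f = ∀ l → l ≢ i → l ≢ j → f · ray B l ≈ 0#

  Supp₃ : Base → Fin 4 → Fin 4 → Fin 4 → Form → Set ℓ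
  Supp₃ B i j k f = ∀ l → l ≢ i → l ≢ j → l ≢ k → f · ray B l ≈ 0#

  -- A hyperplane of the pencil of the walls `i` and `j` other than these two; its existence is an
  -- edge of the diagram.
  Mid : Base → Fin 4 → Fin 4 → Form → Set ℓ
  Mid B i j f = f · ray B i ≉ 0# × f · ray B j ≉ 0# × Supp₂ B i j f

  -- A hyperplane through the fourth ray that belongs to none of the three pencils formed by the
  -- walls `i`, `j` and `k`.
  Full : Base → Fin 4 → Fin 4 → Fin 4 → Form → Set ℓ
  Full B i j k f = f · ray B i ≉ 0# × f · ray B j ≉ 0# × f · ray B k ≉ 0# × Supp₃ B i j k f

  Mid-sym : ∀ {B i j f} → Mid B i j f → Mid B j i f
  Mid-sym (p , q , s) = q , p , λ l a b → s l b a

  abstract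
    positivize : ∀ B f → ∃[ g ] (Nonneg B g × (∀ x → f · x ≉ 0# → g · x ≉ 0#) × (∀ x → f · x ≈ 0# → g · x ≈ 0#))
    positivize B f with positive-form B (idx f)
    ... | g , e , nn = g , nn , (λ x n z → n (idx-≡-zero g f e x z)) , λ x z → idx-≡-zero f g (≡.sym e) x z

    nonneg-≉ : ∀ B f {l} → Nonneg B f → f · ray B l ≉ 0# → 0# < f · ray B l
    nonneg-≉ B f nn n = ≤∧≉⇒< (nn _) (λ e → n (sym e))

  module _ {B : Base} {k : Fin 4} (X : Crossing B k) where

    abstract
      new-two : ∀ f {j} → j ≢ k → Supp₂ B j k f → f · ray (next X) k ≈ coeff X j * f · ray B j - f · ray B k
      new-two f {j} j≢k s = trans (new-· X f) (trans (sum-two (λ l → coeff X l * f · ray B l) j≢k (λ l p q → trans (*-congˡ (s l p q)) (zeroʳ _)))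
        (+-congˡ (trans (*-congʳ (coeff-k X)) (-1*x≈-x _))))

      new-three : ∀ f {i j} → i ≢ j → i ≢ k → j ≢ k → Supp₃ B i j k f →
                  f · ray (next X) k ≈ coeff X i * f · ray B i + coeff X j * f · ray B j - f · ray B k
      new-three f {i} {j} i≢j i≢k j≢k s = trans (new-· X f) (trans (sum-three (λ l → coeff X l * f · ray B l) i≢j i≢k j≢k (λ l p q r → trans (*-congˡ (s l p q r)) (zeroʳ _)))
        (+-congˡ (trans (*-congʳ (coeff-k X)) (-1*x≈-x _))))

      wall-next-j : ∀ {j} → j ≢ k → wall (next X) j · ray B j ≈ 1#
      wall-next-j {j} ne = trans (sym (same-· X (wall (next X) j) j ne)) (wall-refl (next X) j)

      wall-next-supp : ∀ {j} → j ≢ k → Supp₂ B j k (wall (next X) j)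
      wall-next-supp {j} ne l l≢j l≢k = trans (sym (same-· X (wall (next X) j) l l≢k)) (wall-≢ (next X) (≢-sym l≢j))

      -- The coefficients of the new ray are slopes of hyperplanes: the new wall `j` belongs to the
      -- pencil of the old walls `j` and `k` and vanishes on the new ray.
      wall-next-k : ∀ {j} → j ≢ k → wall (next X) j · ray B k ≈ coeff X j
      wall-next-k {j} ne = sym (trans (sym (trans (*-congˡ (wall-next-j ne)) (*-identityʳ _)))
        (x-y≈0⇒x≈y (trans (sym (new-two (wall (next X) j) ne (wall-next-supp ne))) (wall-≢ (next X) ne))))

      coeff-mid : ∀ {j} → j ≢ k → coeff X j ≉ 0# → Mid B j k (wall (next X) j)
      coeff-mid ne n = (λ e → 1≉0 (trans (sym (wall-next-j ne)) e)) , (λ e → n (trans (sym (wall-next-k ne)) e)) , wall-next-supp ne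

      no-mid⇒coeff≈0 : ∀ {j} → j ≢ k → ¬ (∃[ f ] Mid B j k f) → coeff X j ≈ 0#
      no-mid⇒coeff≈0 {j} ne none with dec {coeff X j ≈ 0#}
      ... | yes e = e
      ... | no n = contradiction (_ , coeff-mid ne n) none

      new-nonneg : ∀ f {j} → j ≢ k → 0# < f · ray B j → 0# ≤ f · ray (next X) k
      new-nonneg f {j} ne p = coherent (next X) f j k (<-respʳ (sym (same-· X f j ne)) p)

      -- No hyperplane of the pencil may be negative on the new ray once it is positive on ray `j`,
      -- so the new wall `j` has the steepest slope among them.
      coeff-bound : ∀ f {j} → j ≢ k → 0# < f · ray B j → Supp₂ B j k f → f · ray B k ≤ coeff X j * f · ray B j
      coeff-bound f ne p s = 0≤y-x⇒x≤y (≤-resp refl (new-two f ne s) (new-nonneg f ne p))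

      mid⇒coeff-pos : ∀ {f j} → j ≢ k → Mid B j k f → 0# < coeff X j
      mid⇒coeff-pos {f} {j} ne (fj , fk , s) with positivize B f
      ... | g , nn , nz , z = *-cancel-pos gj (<-≤-trans gk (≤-resp refl (*-comm _ _) (coeff-bound g ne gj (λ l p q → z (ray B l) (s l p q)))))
        where
        gj : 0# < g · ray B j
        gj = nonneg-≉ B g nn (nz (ray B j) fj)
        gk : 0# < g · ray B k
        gk = nonneg-≉ B g nn (nz (ray B k) fk)

  -- If no edge of the diagram joins k to i or j, crossing wall k negates one
  -- coordinate of a form supported on {i, j, k} and fixes the others.
  abstract
    isolated : ∀ B {i j k} → i ≢ j → i ≢ k → j ≢ k → ¬ (∃[ f ] Mid B i k f) → ¬ (∃[ f ] Mid B j k f) →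
               ∀ f → Supp₃ B i j k f → f · ray B j ≉ 0# → f · ray B k ≉ 0# → ⊥
    isolated B {i} {j} {k} i≢j i≢k j≢k ik jk f s fj fk with positivize B f
    ... | g , nn , nz , z = new-nonneg X g j≢k (nonneg-≉ B g nn (nz (ray B j) fj))
            (<-respˡ (sym value) (pos-neg (nonneg-≉ B g nn (nz (ray B k) fk))))
      where
      X : Crossing B k
      X = cross B k
      value : g · ray (next X) k ≈ - (g · ray B k)
      value = trans (new-three X g i≢j i≢k j≢k (λ l p q r → z (ray B l) (s l p q r)))
        (trans (+-congʳ (trans (+-cong (trans (*-congʳ (no-mid⇒coeff≈0 X i≢k ik)) (zeroˡ _)) (trans (*-congʳ (no-mid⇒coeff≈0 X j≢k jk)) (zeroˡ _))) (+-identityˡ 0#))) (+-identityˡ _))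

    x≈y+z-w : ∀ {x y w} → y - w ≈ x → w ≈ y - x
    x≈y+z-w {x} {y} {w} e = trans (regroup y w) (+-congˡ (-‿cong e))
      where
      regroup : ∀ y w → w ≈ y - (y - w)
      regroup = solve 2 (λ y w → w := y :- (y :- w)) refl

    -- Two adjacent edges of the diagram produce a hyperplane in general
    -- position with respect to the three walls: it is found in one of the two
    -- chambers obtained by crossing wall j and then wall i.
    full-exists : ∀ B {i j k} → i ≢ j → i ≢ k → j ≢ k → ∃[ f ] Mid B i j f → ∃[ f ] Mid B j k f → ∃[ f ] Full B i j k f
    full-exists B {i} {j} {k} i≢j i≢k j≢k (g , midg) (h , midh) with dec {∃[ f ] Mid (next (cross B j)) i k f}
    ... | yes (f , fi , fk , s) = f′ , ≉-pos pi , ≉-pos pj , ≉-pos pk , λ l p q r → trans (sym (same-· X f′ l q)) (z (ray D l) (s l p r))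
      where
      X : Crossing B j
      X = cross B j
      D : Base
      D = next X
      pz : ∃[ g ] (Nonneg D g × (∀ x → f · x ≉ 0# → g · x ≉ 0#) × (∀ x → f · x ≈ 0# → g · x ≈ 0#))
      pz = positivize D f
      f′ : Form
      f′ = proj₁ pz
      z : ∀ x → f · x ≈ 0# → f′ · x ≈ 0#
      z = proj₂ (proj₂ (proj₂ pz))
      pi : 0# < f′ · ray B i
      pi = <-respʳ (same-· X f′ i i≢j) (nonneg-≉ D f′ (proj₁ (proj₂ pz)) (proj₁ (proj₂ (proj₂ pz)) (ray D i) fi))
      pk : 0# < f′ · ray B k
      pk = <-respʳ (same-· X f′ k (≢-sym j≢k)) (nonneg-≉ D f′ (proj₁ (proj₂ pz)) (proj₁ (proj₂ (proj₂ pz)) (ray D k) fk))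
      -- The j-coordinate in `D` is zero. Solving the crossing relation for the old one gives a
      -- combination of the coordinates `i` and `k` with positive coefficients.
      pj : 0# < f′ · ray B j
      pj = <-respʳ (sym (trans (x≈y+z-w (trans (sym (new-three X f′ i≢k i≢j (≢-sym j≢k) (λ l p q r → trans (sym (same-· X f′ l r)) (z (ray D l) (s l p q))))) (z (ray D j) (s j (≢-sym i≢j) j≢k)))) (trans (+-congˡ -0#≈0#) (+-identityʳ _))))
        (+-pos (*-pos (mid⇒coeff-pos X i≢j midg) pi) (*-pos (mid⇒coeff-pos X (≢-sym j≢k) (Mid-sym {B} {j} {k} {h} midh)) pk))
    ... | no no-ik = case dec
      where
      X : Crossing B j
      X = cross B j
      D : Base
      D = next X
      Y : Crossing D i
      Y = cross D i
      E : Base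
      E = next Y
      ti : 0# < coeff X i
      ti = mid⇒coeff-pos X i≢j midg
      tk : 0# < coeff X k
      tk = mid⇒coeff-pos X (≢-sym j≢k) (Mid-sym {B} {j} {k} {h} midh)
      sk : coeff Y k ≈ 0#
      sk = no-mid⇒coeff≈0 Y (≢-sym i≢k) (λ { (f , m) → no-ik (f , Mid-sym {D} {k} {i} {f} m) })
      D≈ : ∀ f l → l ≢ j → f · ray D l ≈ f · ray B l
      D≈ f l ne = same-· X f l ne
      E≈ : ∀ f l → l ≢ i → f · ray E l ≈ f · ray D l
      E≈ f l ne = same-· Y f l ne
      D-j : ∀ f → Supp₃ B i k j f → f · ray D j ≈ coeff X i * f · ray B i + coeff X k * f · ray B k - f · ray B j
      D-j f s = new-three X f i≢k i≢j (≢-sym j≢k) s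
      E-i : ∀ f → Supp₃ D j k i f → f · ray E i ≈ coeff Y j * f · ray D j - f · ray D i
      E-i f s = trans (new-three Y f j≢k (≢-sym i≢j) (≢-sym i≢k) s) (+-congʳ (trans (+-congˡ (trans (*-congʳ sk) (zeroˡ _))) (+-identityʳ _)))
      wall-supp : ∀ m → m ≢ j → Supp₂ D m j (wall B m)
      wall-supp m m≢j l p q = trans (D≈ (wall B m) l q) (wall-≢ B (≢-sym p))
      wall-D-j : ∀ m → m ≢ j → wall B m · ray D j ≈ coeff X m
      wall-D-j m m≢j = trans (new-two X (wall B m) m≢j (λ l p q → wall-≢ B (≢-sym p)))
        (trans (+-cong (trans (*-congˡ (wall-refl B m)) (*-identityʳ _)) (trans (-‿cong (wall-≢ B m≢j)) -0#≈0#)) (+-identityʳ _))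
      -- The old wall `i` lies in the pencil of the walls `i` and `j` of `D`, so its slope there
      -- bounds `coeff Y j` from below. The bound makes the first term of `fBj` nonnegative.
      sj-bound : 1# ≤ coeff Y j * coeff X i
      sj-bound = ≤-resp (trans (D≈ (wall B i) i i≢j) (wall-refl B i)) (*-congˡ (wall-D-j i i≢j))
        (coeff-bound Y (wall B i) (≢-sym i≢j) (<-respʳ (sym (wall-D-j i i≢j)) ti) (λ l p q → wall-supp i i≢j l q p))
      sj : 0# < coeff Y j
      sj = *-cancel-pos ti (<-≤-trans 0<1 (≤-resp refl (*-comm _ _) sj-bound))
      case : Dec (∃[ f ] Mid E j k f) → ∃[ f ] Full B i j k f
      case (yes (f , fj , fk , s)) = f′ , ≉-pos fi>0 , ≉-pos fj>0 , ≉-pos (<-respʳ (D≈ f′ k (≢-sym j≢k)) fDk)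
                                   , λ l p q r → trans (sym (D≈ f′ l q)) (suppD l q r p)
        where
        pz : ∃[ g ] (Nonneg E g × (∀ x → f · x ≉ 0# → g · x ≉ 0#) × (∀ x → f · x ≈ 0# → g · x ≈ 0#))
        pz = positivize E f
        f′ : Form
        f′ = proj₁ pz
        suppE : Supp₂ E j k f′
        suppE l p q = proj₂ (proj₂ (proj₂ pz)) (ray E l) (s l p q)
        suppD : Supp₃ D j k i f′
        suppD l p q r = trans (sym (E≈ f′ l r)) (suppE l p q)
        fDj : 0# < f′ · ray D j
        fDj = <-respʳ (E≈ f′ j (≢-sym i≢j)) (nonneg-≉ E f′ (proj₁ (proj₂ pz)) (proj₁ (proj₂ (proj₂ pz)) (ray E j) fj))
        fDk : 0# < f′ · ray D k
        fDk = <-respʳ (E≈ f′ k (≢-sym i≢k)) (nonneg-≉ E f′ (proj₁ (proj₂ pz)) (proj₁ (proj₂ (proj₂ pz)) (ray E k) fk))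
        fBk : 0# < f′ · ray B k
        fBk = <-respʳ (D≈ f′ k (≢-sym j≢k)) fDk
        fBi : f′ · ray B i ≈ coeff Y j * f′ · ray D j
        fBi = trans (sym (D≈ f′ i i≢j)) (sym (x-y≈0⇒x≈y (trans (sym (E-i f′ suppD)) (suppE i i≢j i≢k))))
        fi>0 : 0# < f′ · ray B i
        fi>0 = <-respʳ (sym fBi) (*-pos sj fDj)
        fBj : f′ · ray B j ≈ (coeff Y j * coeff X i - 1#) * f′ · ray D j + coeff X k * f′ · ray B k
        fBj = trans (x≈y+z-w (sym (D-j f′ (λ l p q r → trans (sym (D≈ f′ l r)) (suppD l r q p)))))
          (trans (+-congʳ (+-congʳ (*-congˡ fBi))) (regroup (coeff X i) (coeff Y j) (f′ · ray D j) (coeff X k * f′ · ray B k)))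
          where
          regroup : ∀ t s d x → t * (s * d) + x - d ≈ (s * t - 1#) * d + x
          regroup = solve 4 (λ t s d x → t :* (s :* d) :+ x :- d := (s :* t :- con (ℤ.+ 1)) :* d :+ x) refl
            where import Data.Integer.Base as ℤ
        fj>0 : 0# < f′ · ray B j
        fj>0 = <-respʳ (sym fBj) (+-≤-pos (*-nonneg (x≤y⇒0≤y-x sj-bound) (<⇒≤ fDj)) (*-pos tk fBk))
      -- In this case `k` is joined neither to `i` nor to `j` in `E`. But the old wall `k` is
      -- supported on these three rays, with nonzero coordinates `j` and `k`, which `isolated`
      -- excludes.
      case (no no-jk) = ⊥-elim (isolated E i≢j i≢k j≢k no-ik′ no-jk (wall B k) supp
          (≉-pos (<-respʳ (sym (trans (E≈ (wall B k) j (≢-sym i≢j)) (wall-D-j k (≢-sym j≢k)))) tk))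
          (λ e → 1≉0 (trans (sym (trans (E≈ (wall B k) k (≢-sym i≢k)) (trans (D≈ (wall B k) k (≢-sym j≢k)) (wall-refl B k)))) e)))
        where
        supp : Supp₃ E i j k (wall B k)
        supp l p q r = trans (E≈ (wall B k) l p) (wall-supp k (≢-sym j≢k) l r q)
        no-ik′ : ¬ (∃[ f ] Mid E i k f)
        no-ik′ (f , fi , fk , s) = no-ik (f , (λ e → fi (trans value (trans (-‿cong e) -0#≈0#))) , (λ e → fk (trans (E≈ f k (≢-sym i≢k)) e)) , suppD)
          where
          suppD : Supp₂ D i k f
          suppD l p q = trans (sym (E≈ f l p)) (s l p q)
          value : f · ray E i ≈ - (f · ray D i)
          value = trans (E-i f (λ l p q r → suppD l r q)) (trans (+-congʳ (trans (*-congˡ (suppD j (≢-sym i≢j) j≢k)) (zeroʳ _))) (+-identityˡ _))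

-- Spans of faces and dimensions of flats

module FaceSpans {ℓ : Level} (R : Reals ℓ) {n : ℕ} (α : Fin n → OverReals.V R) (arr : OverReals.IsArrangement R α) where

  open FiniteSets
  open OrderedField R
  open LinearAlgebra R
  open SimplicialCones R α arr
  open import Data.Bool.Base using (true)
  open import Data.Fin.Base using (suc; punchIn)
  import Data.Fin.Properties as Fin
  open import Data.Fin.Subset using (Subset; _∈_)
  open import Data.Product.Base
  open import Data.Sum.Base
  open import Data.Vec.Base as Vec using ()
  open import Data.Vec.Properties using (lookup∘tabulate; []=⇒lookup; lookup⇒[]=)
  open import Data.Vec.Functional using (insertAt)
  open import Data.Vec.Functional.Properties using (insertAt-lookup; insertAt-punchIn)
  open import Function.Definitions using (Injective)
  open import Function.Bundles using (_⇔_; Equivalence; mk⇔)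
  open import Relation.Nullary using (Dec; does; yes; no; contradiction)
  open import Relation.Unary using (Pred; _≐_)
  import Relation.Binary.PropositionalEquality as ≡
  open ≡ using (_≡_; _≢_; ≢-sym)
  open import Relation.Binary.Reasoning.Setoid setoid

  abstract
    subsetOf : ∀ {m} → (Fin m → Set ℓ) → Subset m
    subsetOf P = Vec.tabulate (λ i → does (dec {P i}))

    ∈-subsetOf : ∀ {m} (P : Fin m → Set ℓ) i → i ∈ subsetOf P ⇔ P i
    ∈-subsetOf P i = mk⇔ (λ m → to (≡.trans (≡.sym (lookup∘tabulate (λ i → does (dec {P i})) i)) ([]=⇒lookup m)))
                         (λ p → lookup⇒[]= i (subsetOf P) (≡.trans (lookup∘tabulate (λ i → does (dec {P i})) i) (from p)))
      where
      to : does (dec {P i}) ≡ true → P i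
      to with dec {P i}
      ... | yes p = λ _ → p
      ... | no _ = λ ()
      from : P i → does (dec {P i}) ≡ true
      from p with dec {P i}
      ... | yes _ = ≡.refl
      ... | no n = contradiction p n

  -- The subspace spanned by a set of rays, given by the vanishing of the
  -- remaining wall forms.
  module _ (B : Base) {d : ℕ} (φ : Fin d → Fin 4) (φ-inj : Injective _≡_ _≡_ φ) where

    FaceSpan : Pred V ℓ
    FaceSpan x = ∀ l → (∀ k → φ k ≢ l) → wall B l · x ≈ 0#

    abstract
      private
        rays : Fin d → V
        rays k = ray B (φ k)

        wall-comb : ∀ c k → wall B (φ k) · combination c rays ≈ c k
        wall-comb c k = trans (·-combination (wall B (φ k)) c rays) (trans (sum-single (λ j → c j * wall B (φ k) · rays j) k
          (λ j ne → trans (*-congˡ (wall-≢ B (λ e → ne (≡.sym (φ-inj e))))) (zeroʳ _))) (trans (*-congˡ (wall-refl B (φ k))) (*-identityʳ _)))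

        wall-comb-0 : ∀ c l → (∀ k → φ k ≢ l) → wall B l · combination c rays ≈ 0#
        wall-comb-0 c l ne = trans (·-combination (wall B l) c rays) (sum-zero (λ j → c j * wall B l · rays j) (λ j → trans (*-congˡ (wall-≢ B (≢-sym (ne j)))) (zeroʳ _)))

      faceSpan-independent : LinearlyIndependent (λ k → ray B (φ k))
      faceSpan-independent c z k = trans (sym (wall-comb c k)) (H⇒·≈0 (wall B (φ k)) (combination c rays) (trans (⟨⟩-congʳ (α (idx (wall B (φ k)))) (combination c rays) 0ᵥ z) (⟨⟩-0 (α (idx (wall B (φ k)))))))

      faceSpan-≐ : FaceSpan ≐ Span (λ k → ray B (φ k))
      faceSpan-≐ = to , λ {x} → from x
        where
        from : ∀ x → Span rays x → FaceSpan x
        from x (c , e) l ne = trans (·-cong (wall B l) x (combination c rays) e) (wall-comb-0 c l ne)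
        to : ∀ {x} → FaceSpan x → Span rays x
        to {x} fs = c , λ k → x-y≈0⇒x≈y (trans (+-congˡ (sym (-1*x≈-x (combination c rays k)))) (kernel B (x +ᵥ (- 1#) *ᵥ combination c rays) zeros k))
          where
          c : Fin d → ℝ
          c k = wall B (φ k) · x
          zeros : ∀ l → wall B l · (x +ᵥ (- 1#) *ᵥ combination c rays) ≈ 0#
          zeros l = trans (·-move (wall B l) x (- 1#) (combination c rays)) (trans (+-congˡ (-1*x≈-x _)) (go (Fin.any? (λ k → φ k Fin.≟ l))))
            where
            go : Dec (∃[ k ] φ k ≡ l) → wall B l · x - wall B l · combination c rays ≈ 0#
            go (yes (k , ≡.refl)) = trans (+-congˡ (-‿cong (wall-comb c k))) (-‿inverseʳ _)
            go (no none) = trans (+-cong (fs l (λ k e → none (k , e))) (-‿cong (wall-comb-0 c l (λ k e → none (k , e))))) (-‿inverseʳ _)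

      -- The walls opposite to the omitted rays belong to `S` and already cut out the span of the
      -- chosen rays; every other member of `S` contains this span.
      face-flat : ∀ S → (∀ i → i ∈ S ⇔ (∀ k → H α i (ray B (φ k)))) → IsFlatOfDim α d S
      face-flat S mem = flat , (λ k → ray B (φ k)) , faceSpan-independent
                      , (λ {x} x∈ → proj₁ faceSpan-≐ (to x x∈)) , λ {x} sp → from x (proj₂ faceSpan-≐ sp)
        where
        to : ∀ x → ⋂ α S x → FaceSpan x
        to x x∈ l ne = H⇒·≈0 (wall B l) x (x∈ (idx (wall B l)) (Equivalence.from (mem _) (λ k → ·≈0⇒H (wall B l) (ray B (φ k)) (wall-≢ B (≢-sym (ne k))))))
        from : ∀ x → FaceSpan x → ⋂ α S x
        from x fs i i∈ = ·≈0⇒H f x (trans (expand-· B f x) (sum-zero (λ l → wall B l · x * f · ray B l) term))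
          where
          f : Form
          f = form i 1# 1≉0
          term : ∀ l → wall B l · x * f · ray B l ≈ 0#
          term l with Fin.any? (λ k → φ k Fin.≟ l)
          ... | yes (k , ≡.refl) = trans (*-congˡ (H⇒·≈0 f (ray B (φ k)) (Equivalence.to (mem i) i∈ k))) (zeroʳ _)
          ... | no none = trans (*-congʳ (fs l (λ k e → none (k , e)))) (zeroˡ _)
        flat : IsFlat α S
        flat i sub = Equivalence.from (mem i) λ k → sub {ray B (φ k)} (λ j j∈ → Equivalence.to (mem j) j∈ k)

  module _ {U : Pred V ℓ} {d : ℕ} (b : Fin (ℕ.suc d) → V) (ind : LinearlyIndependent b) (U≐ : U ≐ Span b)
           (f : Form) (j : Fin (ℕ.suc d)) (fj : f · b j ≉ 0#) where

    private
      r : Fin d → ℝ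
      r i = f · b (punchIn j i) * (f · b j) ⁻¹

      u : Fin d → V
      u i = b (punchIn j i) +ᵥ (- r i) *ᵥ b j

      lift : (Fin d → ℝ) → Fin (ℕ.suc d) → ℝ
      lift c = insertAt c j (- sum (λ i → c i * r i))

    abstract
      private
        combination-lift : ∀ c k → combination c u k ≈ combination (lift c) b k
        combination-lift c k = sym (begin
          sum (λ i → lift c i * b i k)
            ≈⟨ sum-remove {i = j} (λ i → lift c i * b i k) ⟩
          lift c j * b j k + sum (λ i → lift c (punchIn j i) * b (punchIn j i) k)
            ≈⟨ +-cong (*-congʳ (reflexive (insertAt-lookup c j (- sum (λ i → c i * r i)))))
                      (Σ-cong (λ i → lift c (punchIn j i) * b (punchIn j i) k) (λ i → c i * u i k + (c i * r i) * b j k)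
                        (λ i → trans (*-congʳ (reflexive (insertAt-punchIn c j (- sum (λ i → c i * r i)) i))) (eliminate (c i) (b (punchIn j i) k) (r i) (b j k)))) ⟩
          - sum (λ i → c i * r i) * b j k + sum (λ i → c i * u i k + (c i * r i) * b j k)
            ≈⟨ +-congˡ (trans (∑-distrib-+ (λ i → c i * u i k) (λ i → (c i * r i) * b j k)) (+-congˡ (sym (*-distribʳ-sum (b j k) (λ i → c i * r i))))) ⟩
          - sum (λ i → c i * r i) * b j k + (sum (λ i → c i * u i k) + sum (λ i → c i * r i) * b j k)
            ≈⟨ cancel (sum (λ i → c i * r i)) (b j k) (combination c u k) ⟩
          combination c u k ∎)
          where
          eliminate : ∀ c x r y → c * x ≈ c * (x + - r * y) + (c * r) * y
          eliminate = solve 4 (λ c x r y → c :* x := c :* (x :+ (:- r) :* y) :+ (c :* r) :* y) refl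
          cancel : ∀ s y x → - s * y + (x + s * y) ≈ x
          cancel = solve 3 (λ s y x → (:- s) :* y :+ (x :+ s :* y) := x) refl

        f-u : ∀ i → f · u i ≈ 0#
        f-u i = trans (·-move f (b (punchIn j i)) (- r i) (b j)) (trans (regroup (f · b (punchIn j i)) ((f · b j) ⁻¹) (f · b j))
          (trans (+-congˡ (-‿cong (trans (*-congˡ (inv-*′ fj)) (*-identityʳ _)))) (-‿inverseʳ _)))
          where
          regroup : ∀ a i y → a + - (a * i) * y ≈ a - a * (i * y)
          regroup = solve 3 (λ a i y → a :+ (:- (a :* i)) :* y := a :- a :* (i :* y)) refl

      -- Subtracting multiples of one basis vector off the hyperplane moves the remaining ones into
      -- it; `lift` is the same change on coefficients.
      kernel-dim : HasDim (λ x → U x × f · x ≈ 0#) d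
      kernel-dim = u , independent , (λ {x} p → to x p) , (λ {x} p → from x p)
        where
        independent : LinearlyIndependent u
        independent c z i = trans (sym (reflexive (insertAt-punchIn c j (- sum (λ i → c i * r i)) i))) (ind (lift c) (λ k → trans (sym (combination-lift c k)) (z k)) (punchIn j i))
        from : ∀ x → Span u x → U x × f · x ≈ 0#
        from x (c , e) = proj₂ U≐ (lift c , λ k → trans (e k) (combination-lift c k))
          , trans (·-cong f x (combination c u) e) (trans (·-combination f c u) (sum-zero (λ i → c i * f · u i) (λ i → trans (*-congˡ (f-u i)) (zeroʳ _))))
        to : ∀ x → U x × f · x ≈ 0# → Span u x
        to x (ux , fx) = c , λ k → trans (e k) (trans (same-comb k) (sym (combination-lift c k)))
          where
          sp : Span b x
          sp = proj₁ U≐ ux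
          a : Fin (ℕ.suc d) → ℝ
          a = proj₁ sp
          e : x ≈ᵥ combination a b
          e = proj₂ sp
          c : Fin d → ℝ
          c i = a (punchIn j i)
          fx-sum : a j * f · b j + sum (λ i → c i * f · b (punchIn j i)) ≈ 0#
          fx-sum = trans (sym (sum-remove {i = j} (λ i → a i * f · b i))) (trans (sym (·-combination f a b)) (trans (sym (·-cong f x (combination a b) e)) fx))
          aj : a j ≈ - sum (λ i → c i * r i)
          aj = *-cancelˡ fj (x-y≈0⇒x≈y (trans (+-cong (*-comm _ _) (trans (cancel-neg (f · b j) (sum (λ i → c i * r i))) (trans (*-distribˡ-Σ (f · b j) (λ i → c i * r i))
            (Σ-cong (λ i → f · b j * (c i * r i)) (λ i → c i * f · b (punchIn j i)) (λ i → trans (regroup (f · b j) (c i) (f · b (punchIn j i)) ((f · b j) ⁻¹)) (trans (*-congˡ (*-inv fj)) (*-identityʳ _))))))) fx-sum))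
            where
            cancel-neg : ∀ y s → - (y * - s) ≈ y * s
            cancel-neg = solve 2 (λ y s → :- (y :* (:- s)) := y :* s) refl
            regroup : ∀ y c x i → y * (c * (x * i)) ≈ c * x * (y * i)
            regroup = solve 4 (λ y c x i → y :* (c :* (x :* i)) := c :* x :* (y :* i)) refl
          same-comb : ∀ k → combination a b k ≈ combination (lift c) b k
          same-comb k = trans (sum-remove {i = j} (λ i → a i * b i k)) (trans (+-cong (*-congʳ (trans aj (reflexive (≡.sym (insertAt-lookup c j (- sum (λ i → c i * r i)))))))
            (Σ-cong (λ i → c i * b (punchIn j i) k) (λ i → lift c (punchIn j i) * b (punchIn j i) k) (λ i → *-congʳ (reflexive (≡.sym (insertAt-punchIn c j (- sum (λ i → c i * r i)) i))))))
            (sym (sum-remove {i = j} (λ i → lift c i * b i k))))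

-- Diagrams: consequences of the weight bound and of irreducibility

module Diagrams {ℓ : Level} (R : Reals ℓ) {n : ℕ} (α : Fin n → OverReals.V R) (arr : OverReals.IsArrangement R α)
  (simplicial : OverReals.Simplicial R α) (irreducible : OverReals.Irreducible R α)
  (weight≤6 : ∀ S → OverReals.IsVertex R α S → ∣ S ∣ ℕ.≤ 6) where

  open FiniteSets
  open OrderedField R
  open LinearAlgebra R
  open SimplicialCones R α arr
  open Crossings R α arr simplicial
  open LocalStructure R α arr simplicial
  open FaceSpans R α arr
  open import Data.Bool.Base using (Bool; true; false; not)
  import Data.Bool.Properties as Bool
  open import Data.Fin.Base using (zero; suc)
  import Data.Fin.Properties as Fin
  open import Data.List.Base using (List; []; _∷_; length; map; filter; allFin; lookup)
  open import Data.List.Membership.Propositional using (_∈_)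
  open import Data.List.Membership.Propositional.Properties using (∈-allFin; ∈-filter⁺; ∈-filter⁻; ∈-lookup)
  open import Data.List.Relation.Unary.Any using (index)
  open import Data.List.Relation.Unary.Any.Properties using (lookup-index)
  open import Data.List.Relation.Unary.All as All using (All; []; _∷_)
  import Data.List.Relation.Unary.All.Properties as All
  open import Data.List.Relation.Unary.AllPairs as AllPairs using (AllPairs; []; _∷_)
  import Data.List.Relation.Unary.AllPairs.Properties as AllPairs
  open import Data.List.Relation.Unary.Unique.Propositional using (Unique)
  import Data.List.Relation.Unary.Unique.Propositional.Properties as Unique
  import Data.Nat.Properties as ℕ
  open import Data.Product.Base hiding (map)
  import Data.Product.Properties as Product
  open import Data.Sum.Base using (_⊎_; inj₁; inj₂)
  open import Data.Empty
  open import Function.Bundles using (Equivalence)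
  open import Function.Definitions using (Injective)
  open import Relation.Nullary.Decidable using (toWitness)
  open import Relation.Nullary using (Dec; yes; no; contradiction; ¬?; from-yes; _×-dec_)
  open import Relation.Unary using (Pred; _≐_)
  import Relation.Binary.PropositionalEquality as ≡
  open ≡ using (_≡_; _≢_; ≢-sym)

  abstract
    -- The one place where the bound on the weight enters: the hyperplanes through a ray of a
    -- chamber form a vertex.
    vertex-weight : ∀ B l (xs : List (Fin n)) → Unique xs → All (λ i → H α i (ray B l)) xs → length xs ℕ.≤ 6
    vertex-weight B l xs u h = ℕ.≤-trans (unique-length-≤ S xs u (All.map (λ {i} hi → Equivalence.from (∈-subsetOf _ i) (λ _ → hi)) h))
        (weight≤6 S (face-flat B φ φ-inj S (∈-subsetOf (λ i → ∀ k → H α i (ray B (φ k))))))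
      where
      φ : Fin 1 → Fin 4
      φ _ = l
      φ-inj : Injective _≡_ _≡_ φ
      φ-inj {zero} {zero} _ = ≡.refl
      S : Subset n
      S = subsetOf (λ i → ∀ k → H α i (ray B (φ k)))

    fourth : ∀ (i j k : Fin 4) → ∃[ l ] (l ≢ i × l ≢ j × l ≢ k)
    fourth = toWitness {a? = decide} _
      where
      decide : Dec (∀ (i j k : Fin 4) → ∃[ l ] (l ≢ i × l ≢ j × l ≢ k))
      decide = Fin.all? λ i → Fin.all? λ j → Fin.all? λ k → Fin.any? λ l → ¬? (l Fin.≟ i) ×-dec ¬? (l Fin.≟ j) ×-dec ¬? (l Fin.≟ k)

  private
    Pattern : Set
    Pattern = Bool × Bool × Bool

    _≟ᵖ_ : (p q : Pattern) → Dec (p ≡ q)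
    _≟ᵖ_ = Product.≡-dec Bool._≟_ (Product.≡-dec Bool._≟_ Bool._≟_)

    Vanishing : Bool → ℝ → Set ℓ
    Vanishing true  x = x ≈ 0#
    Vanishing false x = x ≉ 0#

  -- Hyperplanes through a common vertex are told apart by their zero patterns
  -- on three rays; seven of them contradict the bound on the weight.
  module _ (B : Base) (i j k : Fin 4) where

    private
      HasPattern : Form → Pattern → Set ℓ
      HasPattern f (a , b , c) = Vanishing a (f · ray B i) × Vanishing b (f · ray B j) × Vanishing c (f · ray B k)

      Tagged : Set ℓ
      Tagged = Σ[ f ∈ Form ] Σ[ p ∈ Pattern ] HasPattern f p

      tag : Tagged → Pattern
      tag t = proj₁ (proj₂ t)

      vanishing-≡ : ∀ f g x a b → idx f ≡ idx g → Vanishing a (f · x) → Vanishing b (g · x) → a ≡ b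
      vanishing-≡ f g x true true e p q = ≡.refl
      vanishing-≡ f g x false false e p q = ≡.refl
      vanishing-≡ f g x true false e p q = contradiction (idx-≡-zero f g e x p) q
      vanishing-≡ f g x false true e p q = contradiction (idx-≡-zero g f (≡.sym e) x q) p

      tag-≡ : ∀ s t → idx (proj₁ s) ≡ idx (proj₁ t) → tag s ≡ tag t
      tag-≡ (f , (a , b , c) , (p , q , r)) (g , (a′ , b′ , c′) , (p′ , q′ , r′)) e = ≡.cong₂ _,_
        (vanishing-≡ f g (ray B i) a a′ e p p′) (≡.cong₂ _,_ (vanishing-≡ f g (ray B j) b b′ e q q′) (vanishing-≡ f g (ray B k) c c′ e r r′))

      tagged-unique : ∀ ts → AllPairs (λ s t → tag s ≢ tag t) ts → Unique (map (λ t → idx (proj₁ t)) ts)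
      tagged-unique ts ps = AllPairs.map⁺ (AllPairs.map (λ {s} {t} ne e → ne (tag-≡ s t e)) ps)

    module _ (i≢j : i ≢ j) (i≢k : i ≢ k) (j≢k : j ≢ k)
             (g : Form) (mid-g : Mid B i j g) (h : Form) (mid-h : Mid B j k h) where

      private
        full : ∃[ f ] Full B i j k f
        full = full-exists B i≢j i≢k j≢k (g , mid-g) (h , mid-h)

        w≉ : ∀ l → wall B l · ray B l ≉ 0#
        w≉ l e = 1≉0 (trans (sym (wall-refl B l)) e)

        ti tj tk tg th tf : Tagged
        ti = wall B i , (false , true , true) , w≉ i , wall-≢ B i≢j , wall-≢ B i≢k
        tj = wall B j , (true , false , true) , wall-≢ B (≢-sym i≢j) , w≉ j , wall-≢ B j≢k
        tk = wall B k , (true , true , false) , wall-≢ B (≢-sym i≢k) , wall-≢ B (≢-sym j≢k) , w≉ k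
        tg = g , (false , false , true) , proj₁ mid-g , proj₁ (proj₂ mid-g) , proj₂ (proj₂ mid-g) k (≢-sym i≢k) (≢-sym j≢k)
        th = h , (true , false , false) , proj₂ (proj₂ mid-h) i i≢j i≢k , proj₁ mid-h , proj₁ (proj₂ mid-h)
        tf = proj₁ full , (false , false , false) , proj₁ (proj₂ full) , proj₁ (proj₂ (proj₂ full)) , proj₁ (proj₂ (proj₂ (proj₂ full)))

        vertex : ∃[ l ] (l ≢ i × l ≢ j × l ≢ k)
        vertex = fourth i j k

        l : Fin 4
        l = proj₁ vertex

        vanish : All (λ m → H α m (ray B l)) (idx (wall B i) ∷ idx (wall B j) ∷ idx (wall B k) ∷ idx g ∷ idx h ∷ idx (proj₁ full) ∷ [])
        vanish = ·≈0⇒H (wall B i) (ray B l) (wall-≢ B (≢-sym (proj₁ (proj₂ vertex))))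
               ∷ ·≈0⇒H (wall B j) (ray B l) (wall-≢ B (≢-sym (proj₁ (proj₂ (proj₂ vertex)))))
               ∷ ·≈0⇒H (wall B k) (ray B l) (wall-≢ B (≢-sym (proj₂ (proj₂ (proj₂ vertex)))))
               ∷ ·≈0⇒H g (ray B l) (proj₂ (proj₂ mid-g) l (proj₁ (proj₂ vertex)) (proj₁ (proj₂ (proj₂ vertex))))
               ∷ ·≈0⇒H h (ray B l) (proj₂ (proj₂ mid-h) l (proj₁ (proj₂ (proj₂ vertex))) (proj₂ (proj₂ (proj₂ vertex))))
               ∷ ·≈0⇒H (proj₁ full) (ray B l) (proj₂ (proj₂ (proj₂ (proj₂ full))) l (proj₁ (proj₂ vertex)) (proj₁ (proj₂ (proj₂ vertex))) (proj₂ (proj₂ (proj₂ vertex))))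
               ∷ []

        six : List Tagged
        six = ti ∷ tj ∷ tk ∷ tg ∷ th ∷ tf ∷ []

      abstract
        no-triangle : ¬ (∃[ f ] Mid B i k f)
        no-triangle (f , fi , fk , s) = contradiction (vertex-weight B l _ (tagged-unique (tm ∷ six) (from-yes (AllPairs.allPairs? (λ s t → ¬? (tag s ≟ᵖ tag t)) (tm ∷ six))))
            (·≈0⇒H f (ray B l) (s l (proj₁ (proj₂ vertex)) (proj₂ (proj₂ (proj₂ vertex)))) ∷ vanish)) (ℕ.<⇒≱ (ℕ.n<1+n 6))
          where
          tm : Tagged
          tm = f , (false , true , false) , fi , s j (≢-sym i≢j) j≢k , fk

        mid-unique : ∀ f → Mid B i j f → idx f ≡ idx g
        mid-unique f (fi , fj , s) with idx f Fin.≟ idx g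
        ... | yes e = e
        ... | no ne = contradiction (vertex-weight B l _ (new-f ∷ tagged-unique six (from-yes (AllPairs.allPairs? (λ s t → ¬? (tag s ≟ᵖ tag t)) six)))
            (·≈0⇒H f (ray B l) (s l (proj₁ (proj₂ vertex)) (proj₁ (proj₂ (proj₂ vertex)))) ∷ vanish)) (ℕ.<⇒≱ (ℕ.n<1+n 6))
          where
          tm : Tagged
          tm = f , (false , false , true) , fi , fj , s k (≢-sym i≢k) (≢-sym j≢k)
          differ : ∀ t → tag tm ≢ tag t → idx f ≢ idx (proj₁ t)
          differ t ne e = ne (tag-≡ tm t e)
          new-f : All (idx f ≢_) (idx (wall B i) ∷ idx (wall B j) ∷ idx (wall B k) ∷ idx g ∷ idx h ∷ idx (proj₁ full) ∷ [])
          -- The zero patterns tell `f` apart from all six hyperplanes except `g`, whose pattern is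
          -- the same.
          new-f = differ ti (λ ()) ∷ differ tj (λ ()) ∷ differ tk (λ ()) ∷ ne ∷ differ th (λ ()) ∷ differ tf (λ ()) ∷ []

  -- If no edge of the diagram joins I to its complement, this remains true in
  -- all chambers and the arrangement is a product.
  module _ (I : Fin 4 → Bool) where

    private
      NoEdge : Base → Set ℓ
      NoEdge B = ∀ a b → I a ≢ I b → ¬ (∃[ f ] Mid B a b f)

      Vanish : Base → Bool → Form → Set ℓ
      Vanish B c f = ∀ l → I l ≡ c → f · ray B l ≈ 0#

      ≢⇒ : ∀ {a b : Fin 4} → I a ≢ I b → a ≢ b
      ≢⇒ ne e = ne (≡.cong I e)

      bool-third : ∀ {a b c : Bool} → a ≢ b → c ≢ a → c ≡ b
      bool-third {a} {b} {c} p q = ≡.trans (Bool.¬-not q) (≡.sym (Bool.¬-not (≢-sym p)))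

    abstract
      private
        across-0 : ∀ {B k} (X : Crossing B k) → NoEdge B → ∀ j → I j ≢ I k → coeff X j ≈ 0#
        across-0 X ne j p = no-mid⇒coeff≈0 X (≢⇒ p) (ne j _ p)

        -- Without edges across the partition, the coefficients of the new ray on the other side are
        -- zero, so its coordinate is minus the old one plus coordinates from its own side. The
        -- vanishing can thus be carried back to the first chamber.
        vanish-prev : ∀ {B k} (X : Crossing B k) → NoEdge B → ∀ c f → Vanish (next X) c f → Vanish B c f
        vanish-prev {B} {k} X ne c f v l Il with l Fin.≟ k
        ... | no l≢k = trans (sym (same-· X f l l≢k)) (v l Il)
        ... | yes ≡.refl = trans (sym (-‿involutive _)) (trans (-‿cong (trans (sym value) (v l Il))) -0#≈0#)
          where
          term : ∀ m → m ≢ k → coeff X m * f · ray B m ≈ 0#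
          term m m≢k with I m Bool.≟ c
          ... | yes e = trans (*-congˡ (trans (sym (same-· X f m m≢k)) (v m e))) (zeroʳ _)
          ... | no e = trans (*-congʳ (across-0 X ne m (λ q → e (≡.trans q Il)))) (zeroˡ _)
          value : f · ray (next X) k ≈ - (f · ray B k)
          value = trans (new-· X f) (trans (sum-single (λ m → coeff X m * f · ray B m) k term) (trans (*-congʳ (coeff-k X)) (-1*x≈-x _)))

        -- If `a` is `k`, the crossing merely negates the a-coordinate of the hyperplane. Otherwise
        -- a hyperplane joining `a` and `b` in the new chamber is supported on `a`, `b` and `k` in
        -- the old one, where `b` is joined to neither of the others: `isolated` applies.
        noEdge-half : ∀ {B k} (X : Crossing B k) → NoEdge B → ∀ a b → I a ≢ I b → I k ≡ I a → ¬ (∃[ f ] Mid (next X) a b f)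
        noEdge-half {B} {k} X ne a b a≢b k≡a (f , fa , fb , s) with a Fin.≟ k
        ... | yes ≡.refl = ne a b a≢b (f , (λ e → fa (trans value (trans (-‿cong e) -0#≈0#))) , (λ e → fb (trans (same-· X f b b≢k) e)) , suppB)
          where
          b≢k : b ≢ k
          b≢k e = a≢b (≡.cong I (≡.sym e))
          suppB : Supp₂ B a b f
          suppB l p q = trans (sym (same-· X f l p)) (s l p q)
          value : f · ray (next X) a ≈ - (f · ray B a)
          value = trans (new-two X f b≢k (λ l p q → suppB l q p)) (trans (+-congʳ (trans (*-congʳ (across-0 X ne b (λ e → a≢b (≡.sym e)))) (zeroˡ _))) (+-identityˡ _))
        ... | no a≢k = isolated B (≢-sym a≢k) (≢-sym b≢k) (≢⇒ a≢b) (ne k b (λ e → a≢b (≡.trans (≡.sym k≡a) e))) (ne a b a≢b) f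
                         (λ l p q r → trans (sym (same-· X f l p)) (s l q r)) (λ e → fa (trans (same-· X f a a≢k) e)) (λ e → fb (trans (same-· X f b b≢k) e))
          where
          b≢k : b ≢ k
          b≢k e = a≢b (≡.trans (≡.sym k≡a) (≡.cong I (≡.sym e)))

        noEdge-next : ∀ {B k} (X : Crossing B k) → NoEdge B → NoEdge (next X)
        noEdge-next {B} {k} X ne a b a≢b with I k Bool.≟ I a
        ... | yes p = noEdge-half X ne a b a≢b p
        ... | no p = λ { (f , m) → noEdge-half X ne b a (≢-sym a≢b) (bool-third a≢b p) (f , Mid-sym {next X} {a} {b} {f} m) }

      module _ (B₀ : Base) (noEdge : NoEdge B₀) where

        private
          Inv : Base → Set ℓ
          Inv B = NoEdge B × (∀ c f → Vanish B c f → Vanish B₀ c f)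

        -- The hyperplane is a wall of some chamber, and a wall contains all rays but one. It
        -- therefore contains all rays on the side opposite to that one, in this chamber and hence
        -- in the first.
        side : ∀ i f → idx f ≡ i → ∃[ c ] Vanish B₀ c f
        side i f e with reach-wall Inv {B₀} (λ k X _ (ne , v) → noEdge-next X ne , λ c g p → v c g (vanish-prev X ne c g p)) (noEdge , λ _ _ p → p) i
        ... | B , (_ , v) , l , e′ = not (I l) , v (not (I l)) f λ m Im → idx-≡-zero (wall B l) f (≡.trans e′ (≡.sym e)) (ray B m)
                (wall-≢ B (λ { ≡.refl → Bool.not-¬ {I m} ≡.refl Im }))

    module _ (B : Base) where

      Part : Bool → Pred V ℓ
      Part c x = ∀ l → I l ≢ c → wall B l · x ≈ 0#

      private
        members : Bool → List (Fin 4)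
        members c = filter (λ l → I l Bool.≟ c) (allFin 4)

        abstract
          unique-members : ∀ c → Unique (members c)
          unique-members c = Unique.filter⁺ (λ l → I l Bool.≟ c) (Unique.allFin⁺ 4)

        module _ (c : Bool) where

          φ : Fin (length (members c)) → Fin 4
          φ = lookup (members c)

          abstract
            φ-I : ∀ k → I (φ k) ≡ c
            φ-I k = proj₂ (∈-filter⁻ (λ l → I l Bool.≟ c) {xs = allFin 4} (∈-lookup {xs = members c} k))

            φ-onto : ∀ l → I l ≡ c → ∃[ k ] φ k ≡ l
            φ-onto l e = index mem , ≡.sym (lookup-index mem)
              where
              mem : l ∈ members c
              mem = ∈-filter⁺ (λ l → I l Bool.≟ c) (∈-allFin l) e

            part≐ : Part c ≐ Span (λ k → ray B (φ k))
            part≐ = (λ p → proj₁ fs (λ l ne → p l (λ e → ne (proj₁ (φ-onto l e)) (proj₂ (φ-onto l e)))))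
                  , (λ sp l ne → proj₂ fs sp l (λ k e → ne (≡.trans (≡.cong I (≡.sym e)) (φ-I k))))
              where
              fs : FaceSpan B φ (lookup-injective (unique-members c)) ≐ Span (λ k → ray B (φ k))
              fs = faceSpan-≐ B φ (lookup-injective (unique-members c))

            part-independent : LinearlyIndependent (λ k → ray B (φ k))
            part-independent = faceSpan-independent B φ (lookup-injective (unique-members c))

            hyperplane-dims : ∀ {d} (φ : Fin d → Fin 4) → LinearlyIndependent (λ k → ray B (φ k)) → Part c ≐ Span (λ k → ray B (φ k)) →
                              ∀ f j → f · ray B (φ j) ≉ 0# → ∃[ d ] (HasDim (Part c) (ℕ.suc d) × HasDim (λ x → Part c x × f · x ≈ 0#) d)
            hyperplane-dims {ℕ.suc d} φ ind eq f j fj = d , ((λ k → ray B (φ k)) , ind , eq) , kernel-dim (λ k → ray B (φ k)) ind eq f j fj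

      abstract
        private
          part-subspace : ∀ c → IsSubspace (Part c)
          part-subspace c = record
            { resp     = λ {x} {y} e p l ne → trans (sym (·-cong (wall B l) x y e)) (p l ne)
            ; 0-closed = λ l ne → H⇒·≈0 (wall B l) 0ᵥ (⟨⟩-0 (α (idx (wall B l))))
            ; +-closed = λ {x} {y} p q l ne → trans (·-+ (wall B l) x y) (trans (+-cong (p l ne) (q l ne)) (+-identityˡ 0#))
            ; *-closed = λ a {x} p l ne → trans (·-* (wall B l) a x) (trans (*-congˡ (p l ne)) (zeroʳ a)) }

          part-nontrivial : ∀ c a → I a ≡ c → NonTrivial (Part c)
          part-nontrivial c a Ia = ray B a , (λ l ne → wall-≢ B (λ e → ne (≡.trans (≡.cong I e) Ia)))
            , λ z → 1≉0 (trans (sym (wall-refl B a)) (H⇒·≈0 (wall B a) (ray B a) (trans (⟨⟩-congʳ (α (idx (wall B a))) (ray B a) 0ᵥ z) (⟨⟩-0 (α (idx (wall B a)))))))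

          indicator : Bool → Bool → ℝ
          indicator true  true  = 1#
          indicator false false = 1#
          indicator true  false = 0#
          indicator false true  = 0#

          weight : Bool → Fin 4 → ℝ
          weight c l = indicator c (I l)

          weight-no : ∀ c l → I l ≢ c → weight c l ≈ 0#
          weight-no c l ne = go c (I l) ne
            where
            go : ∀ c b → b ≢ c → indicator c b ≈ 0#
            go true  true  ne = contradiction ≡.refl ne
            go false false ne = contradiction ≡.refl ne
            go true  false _  = refl
            go false true  _  = refl

          weight-sum : ∀ l → weight true l + weight false l ≈ 1#
          weight-sum l = go (I l)
            where
            go : ∀ b → indicator true b + indicator false b ≈ 1#
            go true  = +-identityʳ 1#
            go false = +-identityˡ 1#

          project : Bool → V → V
          project c x = combination (λ l → weight c l * wall B l · x) (ray B)

          project-part : ∀ c x → Part c (project c x)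
          project-part c x l ne = trans (·-combination (wall B l) (λ m → weight c m * wall B m · x) (ray B))
            (sum-zero (λ m → weight c m * wall B m · x * wall B l · ray B m) term)
            where
            term : ∀ m → weight c m * wall B m · x * wall B l · ray B m ≈ 0#
            term m with l Fin.≟ m
            ... | yes ≡.refl = trans (*-congʳ (trans (*-congʳ (weight-no c l ne)) (zeroˡ _))) (zeroˡ _)
            ... | no l≢m = trans (*-congˡ (wall-≢ B l≢m)) (zeroʳ _)

          decompose : ∀ x → x ≈ᵥ project true x +ᵥ project false x
          decompose x k = trans (expand B x k) (trans (Σ-cong (λ l → wall B l · x * ray B l k)
              (λ l → weight true l * wall B l · x * ray B l k + weight false l * wall B l · x * ray B l k) split)
              (∑-distrib-+ (λ l → weight true l * wall B l · x * ray B l k) (λ l → weight false l * wall B l · x * ray B l k)))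
            where
            regroup : ∀ a b w r → (a + b) * w * r ≈ a * w * r + b * w * r
            regroup = solve 4 (λ a b w r → (a :+ b) :* w :* r := a :* w :* r :+ b :* w :* r) refl
            split : ∀ l → wall B l · x * ray B l k ≈ weight true l * wall B l · x * ray B l k + weight false l * wall B l · x * ray B l k
            split l = trans (*-congʳ (trans (sym (*-identityˡ _)) (*-congʳ (sym (weight-sum l))))) (regroup (weight true l) (weight false l) (wall B l · x) (ray B l k))

          kills : ∀ c f → Vanish B c f → ∀ x → Part c x → f · x ≈ 0#
          kills c f v x p = trans (expand-· B f x) (sum-zero (λ l → wall B l · x * f · ray B l) term)
            where
            term : ∀ l → wall B l · x * f · ray B l ≈ 0#
            term l with I l Bool.≟ c
            ... | yes e = trans (*-congˡ (v l e)) (zeroʳ _)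
            ... | no ne = trans (*-congʳ (p l ne)) (zeroˡ _)

          hyperplane-of : ∀ c f → Vanish B (not c) f → HyperplaneOf (Part c) (λ x → Part c x × f · x ≈ 0#)
          hyperplane-of c f v with nonzero-ray B f
          ... | l , nz with I l Bool.≟ c
          ... | no ne = contradiction (v l (Bool.¬-not ne)) nz
          ... | yes e with φ-onto c l e
          ... | k , ≡.refl = (λ p → proj₁ p) , hyperplane-dims c (φ c) (part-independent c) (part≐ c) f k nz

        reducible : NoEdge B → (∃[ a ] I a ≡ true) → (∃[ b ] I b ≡ false) → Reducible α
        reducible ne (a , Ia) (b , Ib) = Part true , Part false , part-subspace true , part-subspace false
          , part-nontrivial true a Ia , part-nontrivial false b Ib
          , (λ x → project true x , project false x , project-part true x , project-part false x , decompose x)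
          , (λ {x} p q → kernel B x (λ l → both x p q l))
          , hyperplanes
          where
          both : ∀ x → Part true x → Part false x → ∀ l → wall B l · x ≈ 0#
          both x p q l with I l in eq
          ... | true = q l (λ e → contradiction (≡.trans (≡.sym eq) e) (λ ()))
          ... | false = p l (λ e → contradiction (≡.trans (≡.sym eq) e) (λ ()))
          hyperplanes : ∀ i → (∃[ K ] (HyperplaneOf (Part true) K × H α i ≐ (K ⊕ Part false))) ⊎ (∃[ K ] (HyperplaneOf (Part false) K × H α i ≐ (Part true ⊕ K)))
          hyperplanes i with side B ne i (form i 1# 1≉0) ≡.refl
          ... | false , v = inj₁ ((λ x → Part true x × f · x ≈ 0#) , hyperplane-of true f v
                , (λ {x} hx → project true x , project false x , (project-part true x , trans (sym (trans (trans (·-cong f x (project true x +ᵥ project false x) (decompose x)) (·-+ f (project true x) (project false x)))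
                      (trans (+-congˡ (kills false f v (project false x) (project-part false x))) (+-identityʳ _)))) (H⇒·≈0 f x hx)) , project-part false x , decompose x)
                , λ {x} (u , w , (pu , fu) , pw , e) → ·≈0⇒H f x (trans (·-cong f x (u +ᵥ w) e) (trans (·-+ f u w) (trans (+-cong fu (kills false f v w pw)) (+-identityˡ 0#)))))
            where f : Form
                  f = form i 1# 1≉0
          ... | true , v = inj₂ ((λ x → Part false x × f · x ≈ 0#) , hyperplane-of false f v
                , (λ {x} hx → project true x , project false x , project-part true x , (project-part false x , trans (sym (trans (trans (·-cong f x (project true x +ᵥ project false x) (decompose x)) (·-+ f (project true x) (project false x)))
                      (trans (+-congʳ (kills true f v (project true x) (project-part true x))) (+-identityˡ _)))) (H⇒·≈0 f x hx)) , decompose x)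
                , λ {x} (u , w , pu , (pw , fw) , e) → ·≈0⇒H f x (trans (·-cong f x (u +ᵥ w) e) (trans (·-+ f u w) (trans (+-cong (kills true f v u pu) fw) (+-identityˡ 0#)))))
            where f : Form
                  f = form i 1# 1≉0

  abstract
    connected : ∀ B (I : Fin 4 → Bool) → (∃[ a ] I a ≡ true) → (∃[ b ] I b ≡ false) → ∃[ a ] ∃[ b ] (I a ≢ I b × ∃[ f ] Mid B a b f)
    connected B I a b with dec {∃[ a ] ∃[ b ] (I a ≢ I b × ∃[ f ] Mid B a b f)}
    ... | yes p = p
    ... | no none = ⊥-elim (irreducible (reducible I B (λ a b ne m → none (a , b , ne , m)) a b))

-- Slopes of the edges as weights of the diagram

module EdgeWeights {ℓ : Level} (R : Reals ℓ) {n : ℕ} (α : Fin n → OverReals.V R) (arr : OverReals.IsArrangement R α)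
  (simplicial : OverReals.Simplicial R α) (irreducible : OverReals.Irreducible R α)
  (weight≤6 : ∀ S → OverReals.IsVertex R α S → ∣ S ∣ ℕ.≤ 6) where

  open FiniteSets
  open OrderedField R
  open LinearAlgebra R
  open SimplicialCones R α arr
  open Crossings R α arr simplicial
  open LocalStructure R α arr simplicial
  open Diagrams R α arr simplicial irreducible weight≤6
  open import Data.Bool.Base using (Bool; true; false; _∨_)
  import Data.Fin.Properties as Fin
  open import Data.Product.Base
  open import Data.Sum.Base
  open import Data.Empty
  open import Function.Definitions using (Injective)
  open import Relation.Nullary using (Dec; does; yes; no; contradiction)
  open import Relation.Nullary.Decidable using (dec-true; dec-false)
  import Relation.Binary.PropositionalEquality as ≡
  open ≡ using (_≡_; _≢_; ≢-sym)
  open import Relation.Binary.Reasoning.Setoid setoid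

  -- t k j is the ratio of the k-th to the j-th coordinate of the hyperplane
  -- through the edge common to the walls j and k, and 0 if there is none.
  record Weighted (B : Base) (t : Fin 4 → Fin 4 → ℝ) : Set ℓ where
    field
      nonneg : ∀ {j k} → j ≢ k → 0# ≤ t k j
      mid    : ∀ {j k} → j ≢ k → 0# < t k j → ∃[ f ] (f · ray B j ≈ 1# × f · ray B k ≈ t k j × Supp₂ B j k f)
      ratio  : ∀ {j k} → j ≢ k → ∀ f → Mid B j k f → f · ray B k ≈ t k j * f · ray B j

    abstract
      zero? : ∀ {j k} → j ≢ k → 0# < t k j ⊎ t k j ≈ 0#
      zero? ne = ≤⇒<⊎≈ (nonneg ne)

      mid′ : ∀ {j k} → j ≢ k → 0# < t k j → ∃[ f ] Mid B j k f
      mid′ ne p with mid ne p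
      ... | f , fj , fk , s = f , (λ e → 1≉0 (trans (sym fj) e)) , (λ e → ≉-pos p (trans (sym fk) e)) , s

      recip : ∀ {j k} → j ≢ k → 0# < t k j → t j k * t k j ≈ 1#
      recip {j} {k} ne p with mid ne p
      ... | f , fj , fk , s = sym (trans (sym fj) (trans (ratio (≢-sym ne) f
              ((λ e → ≉-pos p (trans (sym fk) e)) , (λ e → 1≉0 (trans (sym fj) e)) , λ l a b → s l b a)) (*-congˡ fk)))

      edge-sym : ∀ {j k} → j ≢ k → 0# < t k j → 0# < t j k
      edge-sym ne p = *-cancel-pos p (<-respʳ (sym (trans (*-comm _ _) (recip ne p))) 0<1)

      zero⇒no-mid : ∀ {j k} → j ≢ k → t k j ≈ 0# → ¬ (∃[ f ] Mid B j k f)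
      zero⇒no-mid ne z (f , m) = proj₁ (proj₂ m) (trans (ratio ne f m) (trans (*-congʳ z) (zeroˡ _)))

      zero⇒no-mid′ : ∀ {j k} → j ≢ k → t k j ≈ 0# → ¬ (∃[ f ] Mid B k j f)
      zero⇒no-mid′ {j} {k} ne z (f , m) = zero⇒no-mid ne z (f , Mid-sym {B} {k} {j} {f} m)

      invert : ∀ {j k x y} → j ≢ k → 0# < t j k → x ≈ t j k * y → y ≈ t k j * x
      invert {j} {k} {x} {y} ne p e = sym (trans (*-congˡ e) (trans (sym (*-assoc _ _ _)) (trans (*-congʳ (recip (≢-sym ne) p)) (*-identityˡ y))))

      -- A nonzero coefficient is the slope of a hyperplane on the edge, and on an edge the
      -- coefficient cannot vanish. The weights therefore determine every crossing.
      coeff≈ : ∀ {k} (X : Crossing B k) j → j ≢ k → coeff X j ≈ t k j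
      coeff≈ {k} X j ne with dec {coeff X j ≈ 0#}
      ... | no nz = trans (sym (wall-next-k X ne)) (trans (ratio ne (wall (next X) j) (coeff-mid X ne nz)) (trans (*-congˡ (wall-next-j X ne)) (*-identityʳ _)))
      ... | yes z with zero? ne
      ... | inj₂ e = trans z (sym e)
      ... | inj₁ p = contradiction z (≉-pos (mid⇒coeff-pos X ne (proj₂ (mid′ ne p))))

      triangle-free : ∀ {i j k} → i ≢ j → i ≢ k → j ≢ k → 0# < t j i → 0# < t k j → ¬ (∃[ f ] Mid B i k f)
      triangle-free i≢j i≢k j≢k p q = no-triangle B _ _ _ i≢j i≢k j≢k _ (proj₂ (mid′ i≢j p)) _ (proj₂ (mid′ j≢k q))

      triangle-free′ : ∀ {i j k} → i ≢ j → i ≢ k → j ≢ k → 0# < t j i → 0# < t k j → t k i ≈ 0#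
      triangle-free′ i≢j i≢k j≢k p q with zero? i≢k
      ... | inj₂ z = z
      ... | inj₁ r = contradiction (mid′ i≢k r) (triangle-free i≢j i≢k j≢k p q)

      -- The bounds come from the chambers obtained by crossing wall k,
      -- respectively wall j and then wall i.
      full-ratio : ∀ {i j k} → i ≢ j → i ≢ k → j ≢ k → 0# < t j i → 0# < t k j → ∀ f → Full B i j k f → f · ray B j ≈ t j k * f · ray B k
      full-ratio {i} {j} {k} i≢j i≢k j≢k p q f (fi , fj , fk , s) with positive-form B (idx f)
      ... | g , e , nn with same-idx f g (≡.sym e)
      ... | c , c≉0 , f≈ = trans (f≈ _) (trans (*-congˡ (≤-antisym upper lower)) (trans (*-swapˡ c (t j k) _) (*-congˡ (sym (f≈ _)))))
        where
        X : Crossing B j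
        X = cross B j
        D : Base
        D = next X
        Y : Crossing D i
        Y = cross D i
        Z : Crossing B k
        Z = cross B k
        g≉ : ∀ {x} → f · x ≉ 0# → g · x ≉ 0#
        g≉ {x} n z = n (trans (f≈ x) (trans (*-congˡ z) (zeroʳ c)))
        gs : Supp₃ B i j k g
        gs l a b d = idx-≡-zero f g (≡.sym e) (ray B l) (s l a b d)
        gk : 0# < g · ray B k
        gk = nonneg-≉ B g nn (g≉ fk)
        gj : 0# < g · ray B j
        gj = nonneg-≉ B g nn (g≉ fj)
        wall-D : ∀ m → m ≢ j → 0# < t j m → Mid D m j (wall B m)
        wall-D m m≢j tm = (λ e → 1≉0 (trans (sym (trans (same-· X (wall B m) m m≢j) (wall-refl B m))) e))
          , (λ e → ≉-pos tm (trans (sym (trans (new-two X (wall B m) m≢j (λ l a b → wall-≢ B (≢-sym a)))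
               (trans (+-cong (trans (*-cong (coeff≈ X m m≢j) (wall-refl B m)) (*-identityʳ _)) (trans (-‿cong (wall-≢ B m≢j)) -0#≈0#)) (+-identityʳ _)))) e))
          , λ l a b → trans (same-· X (wall B m) l b) (wall-≢ B (≢-sym a))
        -- The invariance of the weights rests on this lemma, so the coefficients of `Y` have to be
        -- computed directly in `D`. The old walls `i` and `k` provide the two edges at `j` there,
        -- and a triangle is excluded.
        Yk : coeff Y k ≈ 0#
        Yk = no-mid⇒coeff≈0 Y (≢-sym i≢k) (λ { (h , m) → no-triangle D i j k i≢j i≢k j≢k _ (wall-D i i≢j p) _
               (Mid-sym {D} {k} {j} (wall-D k (≢-sym j≢k) (edge-sym j≢k q))) (h , Mid-sym {D} {k} {i} {h} m) })
        Yj : coeff Y j ≈ t i j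
        Yj = trans (sym (wall-next-k Y (≢-sym i≢j))) (trans (ratioD (wall (next Y) j) (coeff-mid Y (≢-sym i≢j) Yj≉0)) (trans (*-congˡ (wall-next-j Y (≢-sym i≢j))) (*-identityʳ _)))
          where
          Yj≉0 : coeff Y j ≉ 0#
          Yj≉0 = ≉-pos (mid⇒coeff-pos Y (≢-sym i≢j) (Mid-sym {D} {i} {j} (wall-D i i≢j p)))
          -- A hyperplane on the edge of `i` and `j` in `D` is the old wall `i`: any other would be
          -- on that edge in `B` already, and its ratio there would make the new j-coordinate
          -- vanish.
          ratioD : ∀ h → Mid D j i h → h · ray D i ≈ t i j * h · ray D j
          ratioD h (hj , hi , hs) with dec {h · ray B j ≈ 0#}
          ... | yes z = trans (same-· X h i i≢j) (invert (≢-sym i≢j) p (trans value (trans (+-congˡ (trans (-‿cong z) -0#≈0#)) (+-identityʳ _))))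
            where
            value : h · ray D j ≈ t j i * h · ray B i - h · ray B j
            value = trans (new-two X h i≢j (λ l a b → trans (sym (same-· X h l b)) (hs l b a))) (+-congʳ (*-congʳ (coeff≈ X i i≢j)))
          ... | no nz = contradiction (trans value (trans (+-congˡ (-‿cong (ratio i≢j h ((λ e → hi (trans (same-· X h i i≢j) e)) , nz , supp)))) (-‿inverseʳ _))) hj
            where
            supp : Supp₂ B i j h
            supp l a b = trans (sym (same-· X h l b)) (hs l b a)
            value : h · ray D j ≈ t j i * h · ray B i - h · ray B j
            value = trans (new-two X h i≢j supp) (+-congʳ (*-congʳ (coeff≈ X i i≢j)))
        lower : t j k * g · ray B k ≤ g · ray B j
        lower = ≤-resp refl (sym (invert (≢-sym j≢k) q refl)) (*-mono (edge-sym j≢k q) (0≤y-x⇒x≤y (≤-resp refl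
            (trans (new-three Z g i≢j i≢k j≢k gs) (+-congʳ (trans (+-cong (trans (*-congʳ (trans (coeff≈ Z i i≢k) (triangle-free′ i≢j i≢k j≢k p q))) (zeroˡ _)) (*-congʳ (coeff≈ Z j j≢k))) (+-identityˡ _))))
            (new-nonneg Z g j≢k gj))))
          where
          *-mono : ∀ {a x y} → 0# < a → x ≤ y → a * x ≤ a * y
          *-mono {a} {x} {y} p q = 0≤y-x⇒x≤y (≤-resp refl (dist a x y) (*-nonneg (<⇒≤ p) (x≤y⇒0≤y-x q)))
            where
            dist : ∀ a x y → a * (y - x) ≈ a * y - a * x
            dist = solve 3 (λ a x y → a :* (y :- x) := a :* y :- a :* x) refl
        -- Otherwise the hyperplane would be negative on ray `i` of the chamber beyond both walls,
        -- although it is positive on ray `k` of that chamber.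
        upper : g · ray B j ≤ t j k * g · ray B k
        upper neg = new-nonneg Y g (≢-sym i≢k) (<-respʳ (sym (same-· X g k (≢-sym j≢k))) gk)
          (<-respˡ (sym value) (*-pos-neg (edge-sym i≢j p) (<-respˡ (flip _ _) (pos-neg (x<y⇒0<y-x neg)))))
          where
          flip : ∀ a b → - (a - b) ≈ b - a
          flip = solve 2 (λ a b → :- (a :- b) := b :- a) refl
          gDj : g · ray D j ≈ t j i * g · ray B i + t j k * g · ray B k - g · ray B j
          gDj = trans (new-three X g i≢k i≢j (≢-sym j≢k) (λ l a b d → gs l a d b)) (+-congʳ (+-cong (*-congʳ (coeff≈ X i i≢j)) (*-congʳ (coeff≈ X k (≢-sym j≢k)))))
          value : g · ray (next Y) i ≈ t i j * (t j k * g · ray B k - g · ray B j)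
          value = begin
            g · ray (next Y) i
              ≈⟨ new-three Y g j≢k (≢-sym i≢j) (≢-sym i≢k) (λ l a b d → trans (same-· X g l a) (gs l d a b)) ⟩
            coeff Y j * g · ray D j + coeff Y k * g · ray D k - g · ray D i
              ≈⟨ +-cong (trans (+-cong (*-cong Yj gDj) (trans (*-congʳ Yk) (zeroˡ _))) (+-identityʳ _)) (-‿cong (same-· X g i i≢j)) ⟩
            t i j * (t j i * g · ray B i + t j k * g · ray B k - g · ray B j) - g · ray B i
              ≈⟨ regroup (t i j) (t j i) (g · ray B i) (t j k * g · ray B k) (g · ray B j) ⟩
            (t i j * t j i) * g · ray B i - g · ray B i + t i j * (t j k * g · ray B k - g · ray B j)
              ≈⟨ +-congʳ (trans (+-congʳ (trans (*-congʳ (recip i≢j p)) (*-identityˡ _))) (-‿inverseʳ _)) ⟩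
            0# + t i j * (t j k * g · ray B k - g · ray B j)
              ≈⟨ +-identityˡ _ ⟩
            t i j * (t j k * g · ray B k - g · ray B j) ∎
            where
            regroup : ∀ s r a c b → s * (r * a + c - b) - a ≈ (s * r) * a - a + s * (c - b)
            regroup = solve 5 (λ s r a c b → s :* (r :* a :+ c :- b) :- a := (s :* r) :* a :- a :+ s :* (c :- b)) refl

      full-ratio′ : ∀ {i j k} → i ≢ j → i ≢ k → j ≢ k → 0# < t j i → 0# < t k j → ∀ f → Full B i j k f → f · ray B j ≈ t j i * f · ray B i
      full-ratio′ i≢j i≢k j≢k p q f (fi , fj , fk , s) = full-ratio (≢-sym j≢k) (≢-sym i≢k) (≢-sym i≢j) (edge-sym j≢k q) (edge-sym i≢j p) f
        (fk , fj , fi , λ l a b d → s l d b a)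

  open Weighted

  -- Invariance of the weights under crossings

  module _ {B : Base} {t : Fin 4 → Fin 4 → ℝ} (W : Weighted B t) {k : Fin 4} (X : Crossing B k) where

    private
      C : Base
      C = next X

      Goal-mid : Fin 4 → Fin 4 → Set ℓ
      Goal-mid j m = ∃[ f ] (f · ray C j ≈ 1# × f · ray C m ≈ t m j × Supp₂ C j m f)

    abstract
      private
        C-three : ∀ f {i j} → i ≢ j → i ≢ k → j ≢ k → Supp₃ B i j k f → f · ray C k ≈ t k i * f · ray B i + t k j * f · ray B j - f · ray B k
        C-three f i≢j i≢k j≢k s = trans (new-three X f i≢j i≢k j≢k s) (+-congʳ (+-cong (*-congʳ (coeff≈ W X _ i≢k)) (*-congʳ (coeff≈ W X _ j≢k))))

        C-two : ∀ f {j} → j ≢ k → Supp₂ B j k f → f · ray C k ≈ t k j * f · ray B j - f · ray B k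
        C-two f ne s = trans (new-two X f ne s) (+-congʳ (*-congʳ (coeff≈ W X _ ne)))

        wall-k-value : ∀ {j} → j ≢ k → wall B j · ray C k ≈ t k j
        wall-k-value {j} ne = trans (C-two (wall B j) ne (λ l a b → wall-≢ B (≢-sym a)))
          (trans (+-cong (trans (*-congˡ (wall-refl B j)) (*-identityʳ _)) (trans (-‿cong (wall-≢ B ne)) -0#≈0#)) (+-identityʳ _))

        mid-k : ∀ {j} → j ≢ k → Goal-mid j k
        mid-k {j} ne = wall B j , trans (same-· X (wall B j) j ne) (wall-refl B j) , wall-k-value ne
                     , λ l a b → trans (same-· X (wall B j) l b) (wall-≢ B (≢-sym a))

        k-mid : ∀ {m} → m ≢ k → 0# < t m k → Goal-mid k m
        k-mid {m} ne p = c ⊙ wall B m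
          , trans (⊙-· c (wall B m) (ray C k)) (trans (*-congˡ (wall-k-value ne)) (trans (*-comm _ _) (recip W (≢-sym ne) p)))
          , trans (⊙-· c (wall B m) (ray C m)) (trans (*-congˡ (trans (same-· X (wall B m) m ne) (wall-refl B m))) (*-identityʳ _))
          , λ l a b → trans (⊙-· c (wall B m) (ray C l)) (trans (*-congˡ (trans (same-· X (wall B m) l a) (wall-≢ B (≢-sym b)))) (zeroʳ _))
          where
          c : Σ ℝ (_≉ 0#)
          c = t m k , ≉-pos p

        supported : ∀ {j m} → j ≢ m → j ≢ k → m ≢ k → ∀ f → f · ray B j ≉ 0# → Supp₃ B j m k f →
                    f · ray B m ≈ t m j * f · ray B j → t k j * f · ray B j + t k m * f · ray B m - f · ray B k ≈ 0# → Goal-mid j m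
        supported {j} {m} j≢m j≢k m≢k f fj s rm rk = c ⊙ f
          , trans (⊙-· c f (ray C j)) (trans (*-congˡ (same-· X f j j≢k)) (inv-*′ fj))
          , trans (⊙-· c f (ray C m)) (trans (*-congˡ (trans (same-· X f m m≢k) rm)) (trans (*-swapˡ _ _ _) (trans (*-congˡ (inv-*′ fj)) (*-identityʳ _))))
          , λ l a b → trans (⊙-· c f (ray C l)) (trans (*-congˡ (vanish l a b)) (zeroʳ _))
          where
          c : Σ ℝ (_≉ 0#)
          c = (f · ray B j) ⁻¹ , inv-≉ fj
          vanish : Supp₂ C j m f
          vanish l a b with l Fin.≟ k
          ... | yes ≡.refl = trans (C-three f j≢m j≢k m≢k s) rk
          ... | no ne = trans (same-· X f l ne) (s l a b ne)

        cancel₁ : ∀ {a b x y z} → z ≈ a * x → b ≈ 0# → a * x + b * y - z ≈ 0#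
        cancel₁ {a} {b} {x} {y} {z} e e′ = trans (+-cong (trans (+-congˡ (trans (*-congʳ e′) (zeroˡ y))) (+-identityʳ _)) (-‿cong e)) (-‿inverseʳ _)

        cancel₂ : ∀ {a b x y z} → z ≈ b * y → a ≈ 0# → a * x + b * y - z ≈ 0#
        cancel₂ {a} {b} {x} {y} {z} e e′ = trans (+-cong (trans (+-congʳ (trans (*-congʳ e′) (zeroˡ x))) (+-identityˡ _)) (-‿cong e)) (-‿inverseʳ _)

        -- There are no triangles, so `k` is joined to at most one of `j` and `m`. If to neither,
        -- the old hyperplane of the edge keeps its support. Otherwise the full hyperplane of the
        -- two adjacent edges loses its k-coordinate in the crossing and becomes the hyperplane of
        -- the edge.
        other-mid : ∀ {j m} → j ≢ m → j ≢ k → m ≢ k → 0# < t m j → Goal-mid j m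
        other-mid {j} {m} j≢m j≢k m≢k p with zero? W j≢k | zero? W m≢k
        ... | inj₁ a | inj₁ b = contradiction (mid′ W j≢m p) (triangle-free W j≢k j≢m (≢-sym m≢k) a (edge-sym W m≢k b))
        ... | inj₂ a | inj₂ b with mid W j≢m p
        ... | f , fj , fm , s = f , trans (same-· X f j j≢k) fj , trans (same-· X f m m≢k) fm , vanish
          where
          vanish : Supp₂ C j m f
          vanish l q r with l Fin.≟ k
          ... | yes ≡.refl = trans (C-three f j≢m j≢k m≢k (λ l a b _ → s l a b)) (cancel₁ (trans (s l q r) (sym (trans (*-congʳ a) (zeroˡ _)))) b)
          ... | no ne = trans (same-· X f l ne) (s l q r)
        other-mid {j} {m} j≢m j≢k m≢k p | inj₁ a | inj₂ b
          with full-exists B (≢-sym j≢k) (≢-sym m≢k) j≢m (mid′ W (≢-sym j≢k) (edge-sym W j≢k a)) (mid′ W j≢m p)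
        ... | f , full@(fk , fj , fm , s) = supported j≢m j≢k m≢k f fj (λ l x y z → s l z x y)
              (invert W j≢m (edge-sym W j≢m p) (full-ratio W (≢-sym j≢k) (≢-sym m≢k) j≢m (edge-sym W j≢k a) p f full))
              (cancel₁ (invert W j≢k (edge-sym W j≢k a) (full-ratio′ W (≢-sym j≢k) (≢-sym m≢k) j≢m (edge-sym W j≢k a) p f full)) b)
        other-mid {j} {m} j≢m j≢k m≢k p | inj₂ a | inj₁ b
          with full-exists B (≢-sym m≢k) (≢-sym j≢k) (≢-sym j≢m) (mid′ W (≢-sym m≢k) (edge-sym W m≢k b)) (mid′ W (≢-sym j≢m) (edge-sym W j≢m p))
        ... | f , full@(fk , fm , fj , s) = supported j≢m j≢k m≢k f fj (λ l x y z → s l z y x)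
              (full-ratio W (≢-sym m≢k) (≢-sym j≢k) (≢-sym j≢m) (edge-sym W m≢k b) (edge-sym W j≢m p) f full)
              (cancel₂ (invert W m≢k (edge-sym W m≢k b) (full-ratio′ W (≢-sym m≢k) (≢-sym j≢k) (≢-sym j≢m) (edge-sym W m≢k b) (edge-sym W j≢m p) f full)) a)

        -- Two hyperplanes of the pencil exchange their roles: the one on the edge vanishes on the
        -- new ray and becomes a wall, and the old wall `j` becomes the one on the edge.
        k-zero : ∀ {j} → j ≢ k → ∀ f → f · ray B j ≉ 0# → Supp₂ B j k f → f · ray C k ≉ 0# → f · ray C k ≈ t k j * f · ray B j
        k-zero {j} ne f fj s fk with dec {f · ray B k ≈ 0#}
        ... | yes z = trans (C-two f ne s) (trans (+-congˡ (trans (-‿cong z) -0#≈0#)) (+-identityʳ _))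
        ... | no nz = contradiction (trans (C-two f ne s) (trans (+-congˡ (-‿cong (ratio W ne f (fj , nz , s)))) (-‿inverseʳ _))) fk

        ratio-k : ∀ {j} → j ≢ k → ∀ f → Mid C j k f → f · ray C k ≈ t k j * f · ray C j
        ratio-k {j} ne f (fj , fk , s) = trans (k-zero ne f (λ e → fj (trans (same-· X f j ne) e)) (λ l a b → trans (sym (same-· X f l b)) (s l a b)) fk)
          (*-congˡ (sym (same-· X f j ne)))

        k-ratio : ∀ {m} → m ≢ k → ∀ f → Mid C k m f → f · ray C m ≈ t m k * f · ray C k
        k-ratio {m} ne f (fk , fm , s) with zero? W ne
        ... | inj₁ p = trans (same-· X f m ne) (invert W (≢-sym ne) p value)
          where
          value : f · ray C k ≈ t k m * f · ray B m
          value = k-zero ne f (λ e → fm (trans (same-· X f m ne) e)) (λ l a b → trans (sym (same-· X f l b)) (s l b a)) fk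
        ... | inj₂ z = contradiction (trans (k-zero ne f (λ e → fm (trans (same-· X f m ne) e)) (λ l a b → trans (sym (same-· X f l b)) (s l b a)) fk) (trans (*-congʳ z) (zeroˡ _))) fk

        -- Vanishing on the new ray determines the old k-coordinate. In the old chamber the
        -- hyperplane is therefore either on the edge itself or full for two adjacent edges, and in
        -- both cases its ratios are known.
        other-ratio : ∀ {j m} → j ≢ m → j ≢ k → m ≢ k → ∀ f → Mid C j m f → f · ray C m ≈ t m j * f · ray C j
        other-ratio {j} {m} j≢m j≢k m≢k f (fj′ , fm′ , s) = trans (same-· X f m m≢k) (trans go (*-congˡ (sym (same-· X f j j≢k))))
          where
          fj : f · ray B j ≉ 0#
          fj e = fj′ (trans (same-· X f j j≢k) e)
          fm : f · ray B m ≉ 0#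
          fm e = fm′ (trans (same-· X f m m≢k) e)
          supp : Supp₃ B j m k f
          supp l a b c = trans (sym (same-· X f l c)) (s l a b)
          fk : f · ray B k ≈ t k j * f · ray B j + t k m * f · ray B m
          fk = sym (x-y≈0⇒x≈y (trans (sym (C-three f j≢m j≢k m≢k supp)) (s k (≢-sym j≢k) (≢-sym m≢k))))
          supp₂ : f · ray B k ≈ 0# → Supp₂ B j m f
          supp₂ z l a b with l Fin.≟ k
          ... | yes ≡.refl = z
          ... | no ne = supp l a b ne
          go : f · ray B m ≈ t m j * f · ray B j
          go with zero? W j≢k | zero? W m≢k
          ... | inj₂ a | inj₂ b = ratio W j≢m f (fj , fm , supp₂ (trans fk (trans (+-cong (trans (*-congʳ a) (zeroˡ _)) (trans (*-congʳ b) (zeroˡ _))) (+-identityˡ 0#))))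
          ... | inj₁ a | inj₁ b with dec {f · ray B k ≈ 0#}
          ... | yes z = contradiction (f , fj , fm , supp₂ z) (triangle-free W j≢k j≢m (≢-sym m≢k) a (edge-sym W m≢k b))
          ... | no nz = contradiction fk≈0 nz
            where
            full : Full B j k m f
            full = fj , nz , fm , λ l a b c → supp l a c b
            double : ∀ {x} → x ≈ x + x → x ≈ 0#
            double {x} e = sym (trans (sym (-‿inverseʳ x)) (trans (+-congʳ e) (cancel x)))
              where
              cancel : ∀ x → x + x - x ≈ x
              cancel = solve 1 (λ x → x :+ x :- x := x) refl
            -- By `fk` the k-coordinate is a sum of two terms, and the ratios of a full hyperplane
            -- make each of them equal to the k-coordinate itself.
            fk≈0 : f · ray B k ≈ 0#
            fk≈0 = double (trans fk (+-cong (sym (full-ratio′ W j≢k j≢m (≢-sym m≢k) a (edge-sym W m≢k b) f full))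
                                            (sym (full-ratio W j≢k j≢m (≢-sym m≢k) a (edge-sym W m≢k b) f full))))
          go | inj₁ a | inj₂ b with zero? W j≢m
          ... | inj₂ z = ⊥-elim (isolated B (≢-sym j≢k) (≢-sym m≢k) j≢m (zero⇒no-mid′ W m≢k b) (zero⇒no-mid W j≢m z) f (λ l x y z → supp l y z x) fj fm)
          ... | inj₁ p = invert W j≢m (edge-sym W j≢m p) (full-ratio W (≢-sym j≢k) (≢-sym m≢k) j≢m (edge-sym W j≢k a) p f
                           ((λ e → *-≉0 (≉-pos a) fj (trans (sym (trans fk (trans (+-congˡ (trans (*-congʳ b) (zeroˡ _))) (+-identityʳ _)))) e)) , fj , fm , λ l x y z → supp l y z x))
          go | inj₂ a | inj₁ b with zero? W j≢m
          ... | inj₂ z = ⊥-elim (isolated B (≢-sym m≢k) (≢-sym j≢k) (≢-sym j≢m) (zero⇒no-mid′ W j≢k a) (zero⇒no-mid′ W j≢m z) f (λ l x y z → supp l z y x) fm fj)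
          ... | inj₁ p = full-ratio W (≢-sym m≢k) (≢-sym j≢k) (≢-sym j≢m) (edge-sym W m≢k b) (edge-sym W j≢m p) f
                           ((λ e → *-≉0 (≉-pos b) fm (trans (sym (trans fk (trans (+-congʳ (trans (*-congʳ a) (zeroˡ _))) (+-identityˡ _)))) e)) , fm , fj , λ l x y z → supp l z y x)

        next-mid : ∀ {j m} → j ≢ m → 0# < t m j → Goal-mid j m
        next-mid {j} {m} ne p with j Fin.≟ k | m Fin.≟ k
        ... | yes ≡.refl | yes ≡.refl = contradiction ≡.refl ne
        ... | no q | yes ≡.refl = mid-k q
        ... | yes ≡.refl | no q = k-mid q p
        ... | no q | no r = other-mid ne q r p

        next-ratio : ∀ {j m} → j ≢ m → ∀ f → Mid C j m f → f · ray C m ≈ t m j * f · ray C j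
        next-ratio {j} {m} ne with j Fin.≟ k | m Fin.≟ k
        ... | yes ≡.refl | yes ≡.refl = contradiction ≡.refl ne
        ... | no q | yes ≡.refl = ratio-k q
        ... | yes ≡.refl | no q = k-ratio q
        ... | no q | no r = other-ratio ne q r

      weighted-next : Weighted (next X) t
      weighted-next = record { nonneg = nonneg W ; mid = next-mid ; ratio = next-ratio }

  -- The diagram is connected, so every edge is adjacent to another one and the
  -- vertex bound applies.
  module _ (B : Base) where

    abstract
      mid-idx : ∀ {j k} → j ≢ k → ∀ f g → Mid B j k f → Mid B j k g → idx f ≡ idx g
      mid-idx {j} {k} j≢k f g mf mg = go (connected B I (j , I-j) (out , I-out))
        where
        -- The cut between the two ends of the edge and the two other walls.
        I : Fin 4 → Bool
        I l = does (l Fin.≟ j) ∨ does (l Fin.≟ k)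
        I-j : I j ≡ true
        I-j rewrite dec-true (j Fin.≟ j) ≡.refl = ≡.refl
        out : Fin 4
        out = proj₁ (fourth j k k)
        I-out : I out ≡ false
        I-out rewrite dec-false (out Fin.≟ j) (proj₁ (proj₂ (fourth j k k))) | dec-false (out Fin.≟ k) (proj₁ (proj₂ (proj₂ (fourth j k k)))) = ≡.refl
        inside : ∀ a → I a ≡ true → a ≡ j ⊎ a ≡ k
        inside a e with a Fin.≟ j | a Fin.≟ k
        ... | yes p | _ = inj₁ p
        ... | no _ | yes p = inj₂ p
        inside a () | no _ | no _
        outside : ∀ b → I b ≡ false → b ≢ j × b ≢ k
        outside b e with b Fin.≟ j | b Fin.≟ k
        ... | no p | no q = p , q
        outside b () | yes _ | _
        outside b () | no _ | yes _
        use : ∀ a b → I a ≡ true → I b ≡ false → ∀ h → Mid B a b h → idx f ≡ idx g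
        use a b Ia Ib h mh with inside a Ia | outside b Ib
        ... | inj₁ ≡.refl | b≢j , b≢k = mid-unique B k j b (≢-sym j≢k) (≢-sym b≢k) (≢-sym b≢j) g (Mid-sym {B} {j} {k} {g} mg) h mh f (Mid-sym {B} {j} {k} {f} mf)
        ... | inj₂ ≡.refl | b≢j , b≢k = mid-unique B j k b j≢k (≢-sym b≢j) (≢-sym b≢k) g mg h mh f mf
        go : ∃[ a ] ∃[ b ] (I a ≢ I b × ∃[ h ] Mid B a b h) → idx f ≡ idx g
        go (a , b , ne , h , mh) with I a in ea | I b in eb
        ... | true | true = contradiction ≡.refl ne
        ... | false | false = contradiction ≡.refl ne
        ... | true | false = use a b ea eb h mh
        ... | false | true = use b a eb ea h (Mid-sym {B} {a} {b} {h} mh)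

    private
      choose : ∀ j k → Dec (∃[ f ] Mid B j k f) → ℝ
      choose j k (yes (f , _)) = f · ray B k * (f · ray B j) ⁻¹
      choose j k (no _) = 0#

    weights : Fin 4 → Fin 4 → ℝ
    weights k j = choose j k dec

    abstract
      weighted : Weighted B weights
      weighted = record
        { nonneg = λ {j} {k} ne → nonneg₀ j k dec
        ; mid    = λ {j} {k} ne p → mid₀ j k dec p
        ; ratio  = λ {j} {k} ne f m → ratio₀ j k ne f m dec }
        where
        nonneg₀ : ∀ j k d → 0# ≤ choose j k d
        nonneg₀ j k (no _) = ≤-refl
        nonneg₀ j k (yes (f , fj , fk , s)) neg with ≉⇒<> fj
        ... | inj₁ p = coherent B f j k p (*-cancel-neg (inv-pos p) (<-respˡ (*-comm _ _) neg))
        ... | inj₂ p with ≉⇒<> fk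
        ... | inj₁ q = coherent B f k j q p
        ... | inj₂ q = <-asym neg (*-neg-neg q inv-neg)
          where
          inv-neg : (f · ray B j) ⁻¹ < 0#
          inv-neg with ≉⇒<> (inv-≉ fj)
          ... | inj₂ r = r
          ... | inj₁ r = ⊥-elim (<-asym 0<1 (<-respˡ (*-inv fj) (*-neg-pos p r)))
        mid₀ : ∀ j k d → 0# < choose j k d → ∃[ f ] (f · ray B j ≈ 1# × f · ray B k ≈ choose j k d × Supp₂ B j k f)
        mid₀ j k (no _) p = ⊥-elim (<-irrefl refl p)
        mid₀ j k (yes (f , fj , fk , s)) p = c ⊙ f , trans (⊙-· c f (ray B j)) (inv-*′ fj) , trans (⊙-· c f (ray B k)) (*-comm _ _)
                                           , λ l a b → trans (⊙-· c f (ray B l)) (trans (*-congˡ (s l a b)) (zeroʳ _))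
          where
          c : Σ ℝ (_≉ 0#)
          c = (f · ray B j) ⁻¹ , inv-≉ fj
        ratio₀ : ∀ j k → j ≢ k → ∀ f → Mid B j k f → ∀ d → f · ray B k ≈ choose j k d * f · ray B j
        ratio₀ j k ne f m (no none) = contradiction (f , m) none
        ratio₀ j k ne f m (yes (g , mg)) with same-idx f g (mid-idx ne f g m mg)
        ... | c , _ , eq = trans (eq _) (trans (trans (*-congˡ (sym (trans (*-congˡ (inv-*′ (proj₁ mg))) (*-identityʳ _)))) (regroup c (g · ray B k) ((g · ray B j) ⁻¹) (g · ray B j))) (*-congˡ (sym (eq _))))
          where
          regroup : ∀ c k i j → c * (k * (i * j)) ≈ k * i * (c * j)
          regroup = solve 4 (λ c k i j → c :* (k :* (i :* j)) := k :* i :* (c :* j)) refl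

  abstract
    weighted-cong : ∀ {B t t′} → (∀ {j k} → j ≢ k → t k j ≈ t′ k j) → Weighted B t → Weighted B t′
    weighted-cong e W = record
      { nonneg = λ ne → ≤-resp refl (e ne) (nonneg W ne)
      ; mid    = λ ne p → let (f , a , b , s) = mid W ne (<-respʳ (sym (e ne)) p) in f , a , trans b (e ne) , s
      ; ratio  = λ ne f m → trans (ratio W ne f m) (*-congʳ (e ne)) }

    weighted-relabel : ∀ {B t} → Weighted B t → ∀ μ (μ-inj : Injective _≡_ _≡_ μ) z (z-pos : ∀ l → 0# < z l) →
                       Weighted (relabel B μ μ-inj z z-pos) (λ k j → t (μ k) (μ j) * (z k * z j ⁻¹))
    weighted-relabel {B} {t} W μ μ-inj z z-pos = record
      { nonneg = λ {j} {k} ne → *-nonneg (nonneg W (λ e → ne (μ-inj e))) (<⇒≤ (*-pos (z-pos k) (inv-pos (z-pos j))))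
      ; mid    = mid₀
      ; ratio  = ratio₀ }
      where
      C : Base
      C = relabel B μ μ-inj z z-pos
      C-· : ∀ f l → f · ray C l ≈ z l * f · ray B (μ l)
      C-· f l = ·-* f (z l) (ray B (μ l))
      surj : ∀ j → ∃[ i ] μ i ≡ j
      surj = injective⇒surjective μ μ-inj
      mid₀ : ∀ {j k} → j ≢ k → 0# < t (μ k) (μ j) * (z k * z j ⁻¹) → ∃[ f ] (f · ray C j ≈ 1# × f · ray C k ≈ t (μ k) (μ j) * (z k * z j ⁻¹) × Supp₂ C j k f)
      mid₀ {j} {k} ne p with mid W {μ j} {μ k} (λ e → ne (μ-inj e)) (*-cancel-pos (*-pos (z-pos k) (inv-pos (z-pos j))) (<-respʳ (*-comm _ _) p))
      ... | f , fj , fk , s = c ⊙ f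
        , trans (⊙-· c f (ray C j)) (trans (*-congˡ (trans (C-· f j) (trans (*-congˡ fj) (*-identityʳ _)))) (inv-*′ (≉-pos (z-pos j))))
        , trans (⊙-· c f (ray C k)) (trans (*-congˡ (trans (C-· f k) (*-congˡ fk))) (regroup (z j ⁻¹) (z k) (t (μ k) (μ j))))
        , λ l a b → trans (⊙-· c f (ray C l)) (trans (*-congˡ (trans (C-· f l) (trans (*-congˡ (s (μ l) (λ e → a (μ-inj e)) (λ e → b (μ-inj e)))) (zeroʳ _)))) (zeroʳ _))
        where
        c : Σ ℝ (_≉ 0#)
        c = z j ⁻¹ , inv-≉ (≉-pos (z-pos j))
        regroup : ∀ i z t → i * (z * t) ≈ t * (z * i)
        regroup = solve 3 (λ i z t → i :* (z :* t) := t :* (z :* i)) refl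
      ratio₀ : ∀ {j k} → j ≢ k → ∀ f → Mid C j k f → f · ray C k ≈ t (μ k) (μ j) * (z k * z j ⁻¹) * f · ray C j
      ratio₀ {j} {k} ne f (fj , fk , s) = begin
        f · ray C k                                                ≈⟨ C-· f k ⟩
        z k * f · ray B (μ k)                                      ≈⟨ *-congˡ (ratio W (λ e → ne (μ-inj e)) f (nz j fj , nz k fk , supp)) ⟩
        z k * (t (μ k) (μ j) * f · ray B (μ j))                    ≈⟨ *-congˡ (*-congˡ (trans (sym (*-identityˡ _)) (*-congʳ (sym (inv-*′ (≉-pos (z-pos j))))))) ⟩
        z k * (t (μ k) (μ j) * (z j ⁻¹ * z j * f · ray B (μ j)))   ≈⟨ regroup (z k) (t (μ k) (μ j)) (z j ⁻¹) (z j) (f · ray B (μ j)) ⟩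
        t (μ k) (μ j) * (z k * z j ⁻¹) * (z j * f · ray B (μ j))   ≈⟨ *-congˡ (sym (C-· f j)) ⟩
        t (μ k) (μ j) * (z k * z j ⁻¹) * f · ray C j               ∎
        where
        regroup : ∀ a t i z x → a * (t * (i * z * x)) ≈ t * (a * i) * (z * x)
        regroup = solve 5 (λ a t i z x → a :* (t :* (i :* z :* x)) := t :* (a :* i) :* (z :* x)) refl
        nz : ∀ l → f · ray C l ≉ 0# → f · ray B (μ l) ≉ 0#
        nz l n e = n (trans (C-· f l) (trans (*-congˡ e) (zeroʳ _)))
        supp : Supp₂ B (μ j) (μ k) f
        supp l a b with surj l
        ... | i , ≡.refl = *-≈0 (≉-pos (z-pos i)) (trans (sym (C-· f i)) (s i (λ e → a (≡.cong μ e)) (λ e → b (≡.cong μ e))))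

-- Integer data of a root system and the conditions to be verified

module RootData where

  open import Data.Bool.Base using (Bool; true; false; _∧_)
  import Data.Bool.Properties as Bool
  open import Data.Fin.Base using (Fin; zero; suc)
  open import Data.Fin.Patterns
  import Data.Fin.Properties as Fin
  open import Data.Fin.Subset using (Subset; _∩_; ⊤; ∣_∣) renaming (⊥ to ∅)
  open import Data.Fin.Subset.Properties using (_⊂?_)
  open import Data.Integer.Base as ℤ using (ℤ; +_; +[1+_])
  import Data.Integer.Properties as ℤ
  open import Data.List.Base as List using (List; []; _∷_; _++_; map; concatMap; filter; foldr; length; drop; upTo)
  open import Data.List.Relation.Unary.All as All using (All; all?)
  open import Data.List.Relation.Unary.Any as Any using (Any; any?)
  open import Data.List.Relation.Unary.AllPairs using (AllPairs)
  open import Data.Nat.Base as ℕ using (ℕ; zero; suc)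
  import Data.Nat.Properties as ℕ
  open import Data.Nat.ListAction using (sum)
  open import Data.Product.Base using (∃-syntax; _×_; _,_; proj₁; proj₂)
  open import Data.Sum.Base using (_⊎_)
  open import Data.Vec.Base as Vec using (Vec; []; _∷_; lookup; tabulate)
  import Data.Vec.Properties as Vec
  open import Relation.Nullary using (Dec; yes; no; does; _×-dec_; _→-dec_; _because_)
  open import Relation.Nullary.Decidable using (True)
  open import Relation.Nullary.Reflects using (Reflects; ofʸ; ofⁿ)
  open import Relation.Binary.PropositionalEquality using (_≡_; _≢_; refl; cong)

  pattern 10F = suc 9F
  pattern 11F = suc 10F

  -- The coordinates of a form are its values on the four rays of a chamber,
  -- and the coordinates of a point are the values of the four wall forms.
  Coord : Set
  Coord = Vec ℤ 4

  _≟ᶜ_ : (u v : Coord) → Dec (u ≡ v)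
  _≟ᶜ_ = Vec.≡-dec ℤ._≟_

  neg : Coord → Coord
  neg = Vec.map (λ x → ℤ.- x)

  unit : Fin 4 → Coord
  unit l = tabulate (λ m → if′ (l Fin.≟ m))
    where
    if′ : ∀ {P : Set} → Dec P → ℤ
    if′ d with does d
    ... | true  = + 1
    ... | false = + 0

  -- Much faster to evaluate than the decision procedure for vectors.
  _==_ : ∀ {m} → Subset m → Subset m → Bool
  []          == []          = true
  (true  ∷ F) == (true  ∷ G) = F == G
  (false ∷ F) == (false ∷ G) = F == G
  (true  ∷ F) == (false ∷ G) = false
  (false ∷ F) == (true  ∷ G) = false

  ==-reflects : ∀ {m} (F G : Subset m) → Reflects (F ≡ G) (F == G)
  ==-reflects []          []          = ofʸ refl
  ==-reflects (true  ∷ F) (false ∷ G) = ofⁿ λ ()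
  ==-reflects (false ∷ F) (true  ∷ G) = ofⁿ λ ()
  ==-reflects (true  ∷ F) (true  ∷ G) with F == G | ==-reflects F G
  ... | true  | ofʸ e = ofʸ (cong (true ∷_) e)
  ... | false | ofⁿ n = ofⁿ λ e → n (Vec.∷-injectiveʳ e)
  ==-reflects (false ∷ F) (false ∷ G) with F == G | ==-reflects F G
  ... | true  | ofʸ e = ofʸ (cong (false ∷_) e)
  ... | false | ofⁿ n = ofⁿ λ e → n (Vec.∷-injectiveʳ e)

  _≟ˢ_ : ∀ {m} (F G : Subset m) → Dec (F ≡ G)
  F ≟ˢ G = (F == G) because ==-reflects F G

  sum₄ : (Fin 4 → ℤ) → ℤ
  sum₄ f = f 0F ℤ.+ (f 1F ℤ.+ (f 2F ℤ.+ (f 3F ℤ.+ + 0)))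

  dot : Coord → Coord → ℤ
  dot u v = sum₄ (λ l → lookup u l ℤ.* lookup v l)

  sumℤ : List ℤ → ℤ
  sumℤ = foldr ℤ._+_ (+ 0)

  linearFactorℤ : ℤ → (ℕ → ℤ) → ℕ → ℤ
  linearFactorℤ r p zero    = ℤ.- (r ℤ.* p zero)
  linearFactorℤ r p (suc k) = p k ℤ.- r ℤ.* p (suc k)

  constantℤ : ℤ → ℕ → ℤ
  constantℤ c zero    = c
  constantℤ c (suc _) = + 0

  path star : Fin 4 → Fin 4 → ℤ
  path 0F 1F = + 1
  path 1F 0F = + 1
  path 1F 2F = + 1
  path 2F 1F = + 1
  path 2F 3F = + 1
  path 3F 2F = + 1
  path _  _  = + 0
  star 0F 1F = + 1
  star 1F 0F = + 1
  star 1F 2F = + 1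
  star 2F 1F = + 1
  star 1F 3F = + 1
  star 3F 1F = + 1
  star _  _  = + 0

  -- The roots are the positive ones in simple coordinates, `swap` gives the permutation of their
  -- hyperplanes under each simple reflection, and `vertex` lists the vertices up to sign. Each
  -- entry of `types` is a face of the fundamental chamber representing an orbit of flats, which
  -- `rounds` rounds of reflections generate. The proposed Möbius value depends on the dimension and
  -- the weight of the flat only.
  record Datum : Set where
    field
      N M      : ℕ
      g        : Fin 4 → Fin 4 → ℤ
      root     : Vec Coord N
      swap     : Vec (Vec (Fin N) N) 4
      simple   : Vec (Fin N) 4
      vertex   : Vec Coord M
      types    : List (∃[ d ] Vec (Fin 4) d)
      rounds   : ℕ
      exponents : List ℤ
      möbius   : ℕ → ℕ → ℤ
      -- A realisation: the normals of the hyperplanes, and vectors dual to the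
      -- simple roots up to the common factor suc factor.
      normal   : Vec Coord N
      codual   : Vec Coord 4
      factor   : ℕ

  module Derived (D : Datum) where
    open Datum D public

    ρ : Fin N → Coord
    ρ = lookup root

    π : Fin 4 → Fin N → Fin N
    π k = lookup (lookup swap k)

    -- Crossing the k-th wall changes the coordinates of forms and of points by
    -- these reflections.
    reflect-at coreflect-at : ∀ {k} → Coord → ∀ l → Dec (l ≡ k) → ℤ
    reflect-at {k} v l (yes _) = sum₄ (λ m → g k m ℤ.* lookup v m) ℤ.- lookup v k
    reflect-at v l (no _)  = lookup v l
    coreflect-at {k} v l (yes _) = ℤ.- lookup v k
    coreflect-at {k} v l (no _)  = lookup v l ℤ.+ g k l ℤ.* lookup v k

    reflect coreflect : Fin 4 → Coord → Coord
    reflect k v = tabulate (λ l → reflect-at v l (l Fin.≟ k))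
    coreflect k v = tabulate (λ l → coreflect-at v l (l Fin.≟ k))

    height : Coord → ℕ
    height v = ℤ.∣ sum₄ (lookup v) ∣

    zeros : Coord → Subset N
    zeros v = Vec.map (λ r → does (dot r v ℤ.≟ + 0)) root

    vertex-zeros : Vec (Subset N) M
    vertex-zeros = Vec.map zeros vertex

    image : Fin 4 → Subset N → Subset N
    image k F = tabulate (λ a → lookup F (π k a))

    standard-face : ∀ {d} → Vec (Fin 4) d → Subset N
    standard-face φ = Vec.map (λ r → Vec.foldr (λ _ → Bool) (λ l b → does (lookup r l ℤ.≟ + 0) ∧ b) true φ) root

    Injective : ∀ {d} → Vec (Fin 4) d → Set
    Injective {d} φ = ∀ (i j : Fin d) → lookup φ i ≡ lookup φ j → i ≡ j

    injective? : ∀ {d} (φ : Vec (Fin 4) d) → Dec (Injective φ)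
    injective? φ = Fin.all? λ i → Fin.all? λ j → (lookup φ i Fin.≟ lookup φ j) →-dec (i Fin.≟ j)

    -- The flats of dimension d are the images of the faces spanned by d rays
    -- of the fundamental chamber.
    data Face : ℕ → Subset N → Set where
      standard  : ∀ {d} (φ : Vec (Fin 4) d) → True (injective? φ) → Face d (standard-face φ)
      reflected : ∀ {d F} k → Face d F → Face d (image k F)

    Flat : Set
    Flat = ∃[ d ] ∃[ F ] Face d F

    dim : Flat → ℕ
    dim = proj₁

    set : Flat → Subset N
    set f = proj₁ (proj₂ f)

    insert : Flat → List Flat → List Flat
    insert f fs with does (any? (λ f′ → set f ≟ˢ set f′) fs)
    ... | true  = fs
    ... | false = fs ++ f ∷ []

    grow : List Flat → List Flat
    grow fs = foldr insert fs (concatMap (λ (d , F , f) → map (λ k → d , image k F , reflected k f) (0F ∷ 1F ∷ 2F ∷ 3F ∷ [])) fs)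

    iterate : ℕ → List Flat → List Flat
    iterate zero    fs = fs
    iterate (suc r) fs = iterate r (grow fs)

    orbit : (∃[ d ] Vec (Fin 4) d) → List Flat
    orbit (d , φ) with injective? φ
    ... | yes inj = iterate rounds ((d , standard-face φ , standard φ (fromWitness′ inj)) ∷ [])
      where
      open import Relation.Nullary.Decidable using (fromWitness)
      fromWitness′ : Injective φ → True (injective? φ)
      fromWitness′ = fromWitness
    ... | no _ = []

    flats : List Flat
    flats = concatMap orbit types

    μ : Flat → ℤ
    μ f = möbius (dim f) ∣ set f ∣

    below : Flat → Flat → ℤ
    below f f′ with does (set f′ ⊂? set f)
    ... | true  = μ f′
    ... | false = + 0

    lines : List Flat → ℕ → List Flat
    lines fs w = filter (λ f → (dim f ℕ.≟ 2) ×-dec (∣ set f ∣ ℕ.≟ w)) fs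

    χ : ℕ → ℤ
    χ k = sumℤ (map μ (filter (λ f → dim f ℕ.≟ k) flats))

  record Valid (D : Datum) : Set where
    open Derived D
    field
      symmetric     : ∀ k l → g k l ≡ g l k
      diagonal      : ∀ k → g k k ≡ + 0
      root-closed   : ∀ k a → reflect k (ρ a) ≡ ρ (π k a) ⊎ reflect k (ρ a) ≡ neg (ρ (π k a))
      involutive    : ∀ k a → π k (π k a) ≡ a
      simple-root   : ∀ l → ρ (lookup simple l) ≡ unit l
      -- A root that is not simple is lowered by some simple reflection; the induction that realises
      -- roots by hyperplanes follows this descent.
      descent       : ∀ a → (∃[ l ] ρ a ≡ unit l) ⊎ (∃[ k ] (ρ a ≡ reflect k (ρ (π k a)) × height (ρ (π k a)) ℕ.< height (ρ a)))
      independent   : ∀ a b → a ≢ b → ∃[ l ] ∃[ m ] (lookup (ρ a) l ℤ.* lookup (ρ b) m ≢ lookup (ρ a) m ℤ.* lookup (ρ b) l)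
      vertex-closed : ∀ k v → ∃[ v′ ] (coreflect k (lookup vertex v) ≡ lookup vertex v′ ⊎ coreflect k (lookup vertex v) ≡ neg (lookup vertex v′))
      simple-vertex : ∀ l → ∃[ v ] lookup vertex v ≡ unit l
      -- The zero subspace, contained in all hyperplanes. Every flat is an intersection of zero sets
      -- of vertices, so this field and `∩-closed` together make the list of flats complete.
      space-flat    : Any (λ f → ⊤ ≡ set f) flats
      ∩-closed      : All (λ f → ∀ v → Any (λ f′ → set f ∩ lookup vertex-zeros v ≡ set f′) flats) flats
      flats-unique  : AllPairs (λ f f′ → set f ≢ set f′) flats
      μ-empty       : All (λ f → set f ≡ ∅ → μ f ≡ + 1) flats
      -- The defining recursion of the Möbius function, checked for the proposed values.
      μ-nonempty    : All (λ f → set f ≢ ∅ → μ f ≡ ℤ.- sumℤ (map (below f) flats)) flats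
      few-triple    : sum (map (λ w → length (lines flats w)) (drop 3 (upTo (suc N)))) ℕ.< length (lines flats 2)
      χ-splits      : ∀ k → χ k ≡ foldr linearFactorℤ (constantℤ (+ 1)) exponents k
      realised      : ∀ a l → dot (lookup normal a) (lookup codual l) ≡ +[1+ factor ] ℤ.* lookup (ρ a) l
      dual-basis    : ∀ k k′ → sum₄ (λ l → lookup (lookup normal (lookup simple l)) k ℤ.* lookup (lookup codual l) k′) ≡ +[1+ factor ] ℤ.* lookup (unit k) k′

-- Change of the wall forms under a crossing

module Classification {ℓ : Level} (R : Reals ℓ) {n : ℕ} (α : Fin n → OverReals.V R) (arr : OverReals.IsArrangement R α)
  (simplicial : OverReals.Simplicial R α) (irreducible : OverReals.Irreducible R α)
  (weight≤6 : ∀ S → OverReals.IsVertex R α S → ∣ S ∣ ℕ.≤ 6) where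

  open OrderedField R
  open LinearAlgebra R
  open SimplicialCones R α arr
  open ChamberCones R α arr using (chamber-base)
  open Crossings R α arr simplicial
  open LocalStructure R α arr simplicial
  open Diagrams R α arr simplicial irreducible weight≤6
  open EdgeWeights R α arr simplicial irreducible weight≤6
  open Weighted
  open RootData using (path; star)
  open import Data.Bool.Base using (Bool; true; false)
  import Data.Bool.Properties as Bool
  open import Data.Fin.Base using (zero; suc; inject₁)
  import Data.Fin.Properties as Fin
  open import Data.Fin.Patterns
  open import Data.Integer.Base as ℤ using (+_; -[1+_])
  open import Data.List.Base using (List; []; _∷_; tabulate)
  open import Data.List.Membership.Propositional.Properties using (∈-tabulate⁺)
  open import Data.List.Relation.Unary.All as All using (All; []; _∷_; all?)
  open import Data.List.Relation.Unary.Any as Any using (Any; here; there; any?)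
  open import Data.Product.Base
  open import Data.Sum.Base using (_⊎_; inj₁; inj₂)
  open import Data.Empty
  open import Data.Vec.Base as Vec using (Vec; []; _∷_)
  open import Function.Definitions using (Injective)
  open import Relation.Nullary using (Dec; yes; no; contradiction; ¬?; _×-dec_; map′)
  open import Relation.Nullary.Decidable using (toWitness)
  import Relation.Binary.PropositionalEquality as ≡
  open ≡ using (_≡_; _≢_; ≢-sym)
  open import Relation.Binary.Reasoning.Setoid setoid

  module _ {B : Base} {k : Fin 4} (X : Crossing B k) where

    abstract
      wall-next : ∀ {j} → j ≢ k → ∀ x → wall (next X) j · x ≈ wall B j · x + coeff X j * wall B k · x
      wall-next {j} ne x = trans (expand-· B (wall (next X) j) x) (trans (sum-two (λ l → wall B l · x * wall (next X) j · ray B l) ne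
          (λ l p q → trans (*-congˡ (wall-next-supp X ne l p q)) (zeroʳ _)))
        (+-cong (trans (*-congˡ (wall-next-j X ne)) (*-identityʳ _)) (trans (*-congˡ (wall-next-k X ne)) (*-comm _ _))))

      wall-next-self : ∀ x → wall (next X) k · x ≈ - (wall B k · x)
      wall-next-self x with same-idx (wall (next X) k) (wall B k) (idx-k X)
      ... | c , _ , eq = trans (eq x) (trans (*-congʳ c≈-1) (-1*x≈-x _))
        where
        val : wall B k · ray (next X) k ≈ - 1#
        val = trans (new-· X (wall B k)) (trans (sum-single (λ l → coeff X l * wall B k · ray B l) k (λ l ne → trans (*-congˡ (wall-≢ B (≢-sym ne))) (zeroʳ _)))
          (trans (*-cong (coeff-k X) (wall-refl B k)) (*-identityʳ _)))
        negate-both : ∀ c → c ≈ - (c * - 1#)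
        negate-both = solve 1 (λ c → c := :- (c :* (:- con (+ 1)))) refl
        c≈-1 : c ≈ - 1#
        c≈-1 = trans (negate-both c) (-‿cong (trans (*-congˡ (sym val)) (trans (sym (eq (ray (next X) k))) (wall-refl (next X) k))))

  -- Exclusion of the 4-cycle

  module _ {B₀ : Base} {t : Fin 4 → Fin 4 → ℝ} (W₀ : Weighted B₀ t)
           (t10 : t 1F 0F ≈ 1#) (t21 : t 2F 1F ≈ 1#) (t32 : t 3F 2F ≈ 1#) (t30 : 0# < t 3F 0F)
           (t20 : t 2F 0F ≈ 0#) (t02 : t 0F 2F ≈ 0#) (t31 : t 3F 1F ≈ 0#) (t13 : t 1F 3F ≈ 0#) where

    private
      q : ℝ
      q = t 3F 0F

      num : ℕ → ℝ
      num k = ι (+ k)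

      -- The positive form Σ u_l w_l, evaluated on the first chamber, never
      -- decreases along a gallery from that chamber to its opposite: u is
      -- chosen so that Σ_j t k j u_j ≥ 2 u_k for all k.
      u : Fin 4 → ℝ
      u 0F = num 12
      u 1F = num 9 + num 3 * q
      u 2F = num 6 + num 6 * q
      u 3F = num 3 + num 9 * q

      centre : V
      centre = combination (λ _ → 1#) (ray B₀)

      opposite : V
      opposite = (- 1#) *ᵥ centre

      height : Base → ℝ
      height B = sum (λ l → u l * wall B l · centre)

      Inv : Base → Set ℓ
      Inv B = Weighted B t × 0# < height B

    abstract
      private
        num-pos : ∀ k → 0# < num (ℕ.suc k)
        num-pos ℕ.zero = 0<1
        num-pos (ℕ.suc k) = +-pos 0<1 (num-pos k)

        u-pos : ∀ l → 0# < u l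
        u-pos 0F = num-pos 11
        u-pos 1F = +-pos (num-pos 8) (*-pos (num-pos 2) t30)
        u-pos 2F = +-pos (num-pos 5) (*-pos (num-pos 5) t30)
        u-pos 3F = +-pos (num-pos 2) (*-pos (num-pos 8) t30)

        inverse-edge : ∀ {j k} → j ≢ k → t k j ≈ 1# → t j k ≈ 1#
        inverse-edge ne e = trans (sym (*-identityʳ _)) (trans (*-congˡ (sym e)) (recip W₀ ne (<-respʳ (sym e) 0<1)))

        t01 : t 0F 1F ≈ 1#
        t01 = inverse-edge (λ ()) t10
        t12 : t 1F 2F ≈ 1#
        t12 = inverse-edge (λ ()) t21
        t23 : t 2F 3F ≈ 1#
        t23 = inverse-edge (λ ()) t32

        q-inv : t 0F 3F * q ≈ 1#
        q-inv = recip W₀ (λ ()) t30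

        t03-pos : 0# < t 0F 3F
        t03-pos = edge-sym W₀ (λ ()) t30

        -- The l-th wall form gains `coeff X l` times the k-th one, whereas the k-th is negated, a
        -- change by -2. As `coeff X k` is only -1, the term `δ k l` supplies the rest.
        gain : ∀ {B k} → Crossing B k → ℝ
        gain {B} {k} X = sum (λ l → u l * (coeff X l - δ k l))

        height-next : ∀ {B k} (X : Crossing B k) → height (next X) ≈ height B + gain X * wall B k · centre
        height-next {B} {k} X = begin
          sum (λ l → u l * wall (next X) l · centre)
            ≈⟨ Σ-cong (λ l → u l * wall (next X) l · centre) (λ l → u l * wall B l · centre + u l * (coeff X l - δ k l) * wall B k · centre) (λ l → trans (*-congˡ (term l)) (regroup (u l) _ _ _)) ⟩
          sum (λ l → u l * wall B l · centre + u l * (coeff X l - δ k l) * wall B k · centre)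
            ≈⟨ ∑-distrib-+ (λ l → u l * wall B l · centre) (λ l → u l * (coeff X l - δ k l) * wall B k · centre) ⟩
          height B + sum (λ l → u l * (coeff X l - δ k l) * wall B k · centre)
            ≈⟨ +-congˡ (sym (*-distribʳ-sum (wall B k · centre) (λ l → u l * (coeff X l - δ k l)))) ⟩
          height B + gain X * wall B k · centre ∎
          where
          regroup : ∀ u w c y → u * (w + c * y) ≈ u * w + u * c * y
          regroup = solve 4 (λ u w c y → u :* (w :+ c :* y) := u :* w :+ u :* c :* y) refl
          flip : ∀ w → - w ≈ w + (- 1# - 1#) * w
          flip = solve 1 (λ w → :- w := w :+ (:- con (+ 1) :- con (+ 1)) :* w) refl
          term : ∀ l → wall (next X) l · centre ≈ wall B l · centre + (coeff X l - δ k l) * wall B k · centre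
          term l with l Fin.≟ k
          ... | yes ≡.refl = trans (wall-next-self X centre) (trans (flip _) (+-congˡ (*-congʳ (sym (+-cong (coeff-k X) (-‿cong (δ-refl k)))))))
          ... | no ne = trans (wall-next X ne centre) (+-congˡ (*-congʳ (sym (trans (+-congˡ (trans (-‿cong (δ-≢ (≢-sym ne))) -0#≈0#)) (+-identityʳ _)))))

        -- The numbers `u 0F`, `u 1F`, `u 2F`, `u 3F` and `q * u 0F` form an arithmetic progression
        -- with difference 3q - 3, which is why the gains at the walls 1, 2 and 3 vanish. Starting
        -- from 12, a multiple of 4, avoids fractions.
        gain₁ : ∀ q → num 12 * (1# - 0#) + ((num 9 + num 3 * q) * (- 1# - 1#) + ((num 6 + num 6 * q) * (1# - 0#) + ((num 3 + num 9 * q) * (0# - 0#) + 0#))) ≈ 0#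
        gain₁ = solve 1 (λ q → con (+ 12) :* (con (+ 1) :- con (+ 0)) :+ ((con (+ 9) :+ con (+ 3) :* q) :* (:- con (+ 1) :- con (+ 1)) :+ ((con (+ 6) :+ con (+ 6) :* q) :* (con (+ 1) :- con (+ 0)) :+ ((con (+ 3) :+ con (+ 9) :* q) :* (con (+ 0) :- con (+ 0)) :+ con (+ 0)))) := con (+ 0)) refl

        gain₂ : ∀ q → num 12 * (0# - 0#) + ((num 9 + num 3 * q) * (1# - 0#) + ((num 6 + num 6 * q) * (- 1# - 1#) + ((num 3 + num 9 * q) * (1# - 0#) + 0#))) ≈ 0#
        gain₂ = solve 1 (λ q → con (+ 12) :* (con (+ 0) :- con (+ 0)) :+ ((con (+ 9) :+ con (+ 3) :* q) :* (con (+ 1) :- con (+ 0)) :+ ((con (+ 6) :+ con (+ 6) :* q) :* (:- con (+ 1) :- con (+ 1)) :+ ((con (+ 3) :+ con (+ 9) :* q) :* (con (+ 1) :- con (+ 0)) :+ con (+ 0)))) := con (+ 0)) refl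

        gain₃ : ∀ q → num 12 * (q - 0#) + ((num 9 + num 3 * q) * (0# - 0#) + ((num 6 + num 6 * q) * (1# - 0#) + ((num 3 + num 9 * q) * (- 1# - 1#) + 0#))) ≈ 0#
        gain₃ = solve 1 (λ q → con (+ 12) :* (q :- con (+ 0)) :+ ((con (+ 9) :+ con (+ 3) :* q) :* (con (+ 0) :- con (+ 0)) :+ ((con (+ 6) :+ con (+ 6) :* q) :* (con (+ 1) :- con (+ 0)) :+ ((con (+ 3) :+ con (+ 9) :* q) :* (:- con (+ 1) :- con (+ 1)) :+ con (+ 0)))) := con (+ 0)) refl

        -- q⁻¹ (q - 1)² ≥ 0
        gain₀ : ∀ q i → num 12 * (- 1# - 1#) + ((num 9 + num 3 * q) * (1# - 0#) + ((num 6 + num 6 * q) * (0# - 0#) + ((num 3 + num 9 * q) * (i - 0#) + 0#)))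
                ≈ num 3 * (i * ((q - 1#) * (q - 1#))) + (num 15 - num 3 * q) * (i * q - 1#)
        gain₀ = solve 2 (λ q i → con (+ 12) :* (:- con (+ 1) :- con (+ 1)) :+ ((con (+ 9) :+ con (+ 3) :* q) :* (con (+ 1) :- con (+ 0)) :+ ((con (+ 6) :+ con (+ 6) :* q) :* (con (+ 0) :- con (+ 0)) :+ ((con (+ 3) :+ con (+ 9) :* q) :* (i :- con (+ 0)) :+ con (+ 0))))
                := con (+ 3) :* (i :* ((q :- con (+ 1)) :* (q :- con (+ 1)))) :+ (con (+ 15) :- con (+ 3) :* q) :* (i :* q :- con (+ 1))) refl

        square-nonneg : ∀ x → 0# ≤ x * x
        square-nonneg x with dec {x ≈ 0#}
        ... | yes e = ≤-reflexive (sym (trans (*-congʳ e) (zeroˡ _)))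
        ... | no n = <⇒≤ (square-pos n)

        sum4 : ∀ (k : Fin 4) {a b c d a′ b′ c′ d′} → a ≈ a′ → b ≈ b′ → c ≈ c′ → d ≈ d′ →
               u 0F * (a - δ k 0F) + (u 1F * (b - δ k 1F) + (u 2F * (c - δ k 2F) + (u 3F * (d - δ k 3F) + 0#)))
               ≈ u 0F * (a′ - δ k 0F) + (u 1F * (b′ - δ k 1F) + (u 2F * (c′ - δ k 2F) + (u 3F * (d′ - δ k 3F) + 0#)))
        sum4 k a b c d = +-cong (*-congˡ (+-congʳ a)) (+-cong (*-congˡ (+-congʳ b)) (+-cong (*-congˡ (+-congʳ c)) (+-congʳ (*-congˡ (+-congʳ d)))))

        gain-nonneg : ∀ {B} k → Weighted B t → (X : Crossing B k) → 0# ≤ gain X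
        gain-nonneg 0F W X = ≤-resp refl (sym (trans (sum4 0F (coeff-k X) (trans (coeff≈ W X 1F (λ ())) t01) (trans (coeff≈ W X 2F (λ ())) t02) (coeff≈ W X 3F (λ ()))) (gain₀ q (t 0F 3F))))
          (+-nonneg (*-nonneg (<⇒≤ (num-pos 2)) (*-nonneg (<⇒≤ t03-pos) (square-nonneg (q - 1#))))
                    (≤-reflexive (sym (trans (*-congˡ (trans (+-congʳ q-inv) (-‿inverseʳ 1#))) (zeroʳ _)))))
        gain-nonneg 1F W X = ≤-reflexive (sym (trans (sum4 1F (trans (coeff≈ W X 0F (λ ())) t10) (coeff-k X) (trans (coeff≈ W X 2F (λ ())) t12) (trans (coeff≈ W X 3F (λ ())) t13)) (gain₁ q)))
        gain-nonneg 2F W X = ≤-reflexive (sym (trans (sum4 2F (trans (coeff≈ W X 0F (λ ())) t20) (trans (coeff≈ W X 1F (λ ())) t21) (coeff-k X) (trans (coeff≈ W X 3F (λ ())) t23)) (gain₂ q)))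
        gain-nonneg 3F W X = ≤-reflexive (sym (trans (sum4 3F (coeff≈ W X 0F (λ ())) (trans (coeff≈ W X 1F (λ ())) t31) (trans (coeff≈ W X 2F (λ ())) t32) (coeff-k X)) (gain₃ q)))

        wall-centre : ∀ l → wall B₀ l · centre ≈ 1#
        wall-centre l = trans (·-combination (wall B₀ l) (λ _ → 1#) (ray B₀)) (trans (Σ-cong (λ j → 1# * wall B₀ l · ray B₀ j) (λ j → 1# * δ j l) (λ j → *-congˡ (trans (dual B₀ l j) (δ-sym l j)))) (sum-δʳ l (λ _ → 1#)))

        opposite-· : ∀ f → f · opposite ≈ - (f · centre)
        opposite-· f = trans (·-* f (- 1#) centre) (-1*x≈-x _)

        unflip : ∀ {x} → - x < 0# → 0# < x
        unflip {x} p = <-respʳ (-‿involutive x) (neg-pos p)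

        step : ∀ {B} k (X : Crossing B k) → wall B k · opposite < 0# → Inv B → Inv (next X)
        step {B} k X neg (W , h) = weighted-next W X , <-respʳ (sym (height-next X))
          (+-pos-≤ h (*-nonneg (gain-nonneg k W X) (<⇒≤ (unflip (<-respˡ (opposite-· (wall B k)) neg)))))

      no-cycle : ⊥
      no-cycle = conclude (Walk.walk opposite Inv step {B₀} (W₀ , sum-pos (λ l → u l * wall B₀ l · centre) (λ l → <⇒≤ (pos₀ l)) 0F (pos₀ 0F)))
        where
        pos₀ : ∀ l → 0# < u l * wall B₀ l · centre
        pos₀ l = *-pos (u-pos l) (<-respʳ (sym (wall-centre l)) 0<1)
        -- In the last chamber every wall form is nonnegative at `opposite`, so the height, taken at
        -- `centre`, cannot be positive.
        conclude : ∃[ B ] (Inv B × ∀ l → 0# ≤ wall B l · opposite) → ⊥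
        conclude (B , (_ , h) , closed) = sum-nonneg (λ l → u l * - (wall B l · centre)) (λ l → *-nonneg (<⇒≤ (u-pos l)) (≤-resp refl (opposite-· (wall B l)) (closed l)))
          (<-respˡ (trans (sym (-1*x≈-x _)) (trans (*-distribˡ-Σ (- 1#) (λ l → u l * wall B l · centre))
            (Σ-cong (λ l → - 1# * (u l * wall B l · centre)) (λ l → u l * - (wall B l · centre)) (λ l → move (u l) (wall B l · centre))))) (pos-neg h))
          where
          move : ∀ a b → - 1# * (a * b) ≈ a * - b
          move = solve 2 (λ a b → con -[1+ 0 ] :* (a :* b) := a :* (:- b)) refl

  -- Graphs on four vertices and the normalisation of trees

  Sign : Bool → ℝ → Set ℓ
  Sign true  x = 0# < x
  Sign false x = x ≈ 0#

  private
    symmetric : (a b c d e f : Bool) → Fin 4 → Fin 4 → Bool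
    symmetric a b c d e f 0F 1F = a
    symmetric a b c d e f 1F 0F = a
    symmetric a b c d e f 0F 2F = b
    symmetric a b c d e f 2F 0F = b
    symmetric a b c d e f 0F 3F = c
    symmetric a b c d e f 3F 0F = c
    symmetric a b c d e f 1F 2F = d
    symmetric a b c d e f 2F 1F = d
    symmetric a b c d e f 1F 3F = e
    symmetric a b c d e f 3F 1F = e
    symmetric a b c d e f 2F 3F = f
    symmetric a b c d e f 3F 2F = f
    symmetric a b c d e f _ _ = false

    -- Pairs that are not listed are left free, so that `triangle`, `isolated-vertex` and
    -- `two-pairs` each cover many graphs.
    Constraints : Set
    Constraints = List (Fin 4 × Fin 4 × Bool)

    triangle isolated-vertex two-pairs path-shape star-shape cycle-shape : Constraints
    triangle        = (0F , 1F , true) ∷ (1F , 2F , true) ∷ (0F , 2F , true) ∷ []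
    isolated-vertex = (0F , 1F , false) ∷ (0F , 2F , false) ∷ (0F , 3F , false) ∷ []
    two-pairs       = (0F , 2F , false) ∷ (0F , 3F , false) ∷ (1F , 2F , false) ∷ (1F , 3F , false) ∷ []
    path-shape      = (0F , 1F , true) ∷ (1F , 2F , true) ∷ (2F , 3F , true) ∷ (0F , 2F , false) ∷ (1F , 3F , false) ∷ (0F , 3F , false) ∷ []
    star-shape      = (0F , 1F , true) ∷ (1F , 2F , true) ∷ (1F , 3F , true) ∷ (0F , 2F , false) ∷ (0F , 3F , false) ∷ (2F , 3F , false) ∷ []
    cycle-shape     = (0F , 1F , true) ∷ (1F , 2F , true) ∷ (2F , 3F , true) ∷ (0F , 2F , false) ∷ (1F , 3F , false) ∷ (0F , 3F , true) ∷ []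

    shapes : List Constraints
    shapes = triangle ∷ isolated-vertex ∷ two-pairs ∷ path-shape ∷ star-shape ∷ cycle-shape ∷ []

    order : (i j k l : Fin 4) → Fin 4 → Fin 4
    order i j k l = Vec.lookup (i ∷ j ∷ k ∷ l ∷ [])

    Distinct : (i j k l : Fin 4) → Set
    Distinct i j k l = i ≢ j × i ≢ k × i ≢ l × j ≢ k × j ≢ l × k ≢ l

    order-injective : ∀ {i j k l} → Distinct i j k l → Injective _≡_ _≡_ (order i j k l)
    order-injective (a , b , c , d , e , f) {0F} {0F} p = ≡.refl
    order-injective (a , b , c , d , e , f) {0F} {1F} p = contradiction p a
    order-injective (a , b , c , d , e , f) {0F} {2F} p = contradiction p b
    order-injective (a , b , c , d , e , f) {0F} {3F} p = contradiction p c
    order-injective (a , b , c , d , e , f) {1F} {0F} p = contradiction (≡.sym p) a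
    order-injective (a , b , c , d , e , f) {1F} {1F} p = ≡.refl
    order-injective (a , b , c , d , e , f) {1F} {2F} p = contradiction p d
    order-injective (a , b , c , d , e , f) {1F} {3F} p = contradiction p e
    order-injective (a , b , c , d , e , f) {2F} {0F} p = contradiction (≡.sym p) b
    order-injective (a , b , c , d , e , f) {2F} {1F} p = contradiction (≡.sym p) d
    order-injective (a , b , c , d , e , f) {2F} {2F} p = ≡.refl
    order-injective (a , b , c , d , e , f) {2F} {3F} p = contradiction p f
    order-injective (a , b , c , d , e , f) {3F} {0F} p = contradiction (≡.sym p) c
    order-injective (a , b , c , d , e , f) {3F} {1F} p = contradiction (≡.sym p) e
    order-injective (a , b , c , d , e , f) {3F} {2F} p = contradiction (≡.sym p) f
    order-injective (a , b , c , d , e , f) {3F} {3F} p = ≡.refl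

    Satisfies : (Fin 4 → Fin 4 → Bool) → (Fin 4 → Fin 4) → Constraints → Set
    Satisfies g μ = All (λ (i , j , b) → g (μ i) (μ j) ≡ b)

    HasShape : (Fin 4 → Fin 4 → Bool) → Constraints → Set
    HasShape g c = ∃[ i ] ∃[ j ] ∃[ k ] ∃[ l ] (Distinct i j k l × Satisfies g (order i j k l) c)

    hasShape? : ∀ g c → Dec (HasShape g c)
    hasShape? g c = Fin.any? λ i → Fin.any? λ j → Fin.any? λ k → Fin.any? λ l →
      (¬? (i Fin.≟ j) ×-dec ¬? (i Fin.≟ k) ×-dec ¬? (i Fin.≟ l) ×-dec ¬? (j Fin.≟ k) ×-dec ¬? (j Fin.≟ l) ×-dec ¬? (k Fin.≟ l))
      ×-dec all? (λ (i′ , j′ , b) → g (order i j k l i′) (order i j k l j′) Bool.≟ b) c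

    ∀Bool? : ∀ {P : Bool → Set} → (∀ b → Dec (P b)) → Dec (∀ b → P b)
    ∀Bool? p = map′ (λ { (t , f) true → t ; (t , f) false → f }) (λ h → h true , h false) (p true ×-dec p false)

    abstract
      -- All 64 graphs are examined. A disconnected one has an isolated vertex or splits into two
      -- pairs; a connected one without triangles is a path, a star or a 4-cycle.
      every-shape : ∀ a b c d e f → Any (HasShape (symmetric a b c d e f)) shapes
      every-shape = toWitness {a? = decide} _
        where
        decide : Dec (∀ a b c d e f → Any (HasShape (symmetric a b c d e f)) shapes)
        decide = ∀Bool? λ a → ∀Bool? λ b → ∀Bool? λ c → ∀Bool? λ d → ∀Bool? λ e → ∀Bool? λ f → any? (hasShape? (symmetric a b c d e f)) shapes

  Tree : Base → Set ℓ
  Tree B = Weighted B (λ k j → ι (path k j)) ⊎ Weighted B (λ k j → ι (star k j))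

  module _ {B : Base} {t : Fin 4 → Fin 4 → ℝ} (W : Weighted B t) where

    abstract
      private
        sign : ∀ x → ∃[ b ] (0# ≤ x → Sign b x)
        sign x with dec {0# < x}
        ... | yes p = true , λ _ → p
        ... | no n = false , λ p → ≤-antisym n p

        signed : ∀ j k → j ≢ k → Sign (proj₁ (sign (t k j))) (t k j)
        signed j k ne = proj₂ (sign (t k j)) (nonneg W ne)

        sign-sym : ∀ b {j k} → j ≢ k → Sign b (t k j) → Sign b (t j k)
        sign-sym true ne p = edge-sym W ne p
        sign-sym false ne z with zero? W (≢-sym ne)
        ... | inj₂ e = e
        ... | inj₁ p = contradiction z (≉-pos (edge-sym W (≢-sym ne) p))

        b : Fin 4 → Fin 4 → Bool
        b k j = proj₁ (sign (t k j))

        g : Fin 4 → Fin 4 → Bool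
        g = symmetric (b 0F 1F) (b 0F 2F) (b 0F 3F) (b 1F 2F) (b 1F 3F) (b 2F 3F)

        g-sign : ∀ k j → k ≢ j → Sign (g k j) (t k j)
        g-sign 0F 0F n = contradiction ≡.refl n
        g-sign 0F 1F n = signed 1F 0F (λ ())
        g-sign 0F 2F n = signed 2F 0F (λ ())
        g-sign 0F 3F n = signed 3F 0F (λ ())
        g-sign 1F 0F n = sign-sym (b 0F 1F) (λ ()) (signed 1F 0F (λ ()))
        g-sign 1F 1F n = contradiction ≡.refl n
        g-sign 1F 2F n = signed 2F 1F (λ ())
        g-sign 1F 3F n = signed 3F 1F (λ ())
        g-sign 2F 0F n = sign-sym (b 0F 2F) (λ ()) (signed 2F 0F (λ ()))
        g-sign 2F 1F n = sign-sym (b 1F 2F) (λ ()) (signed 2F 1F (λ ()))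
        g-sign 2F 2F n = contradiction ≡.refl n
        g-sign 2F 3F n = signed 3F 2F (λ ())
        g-sign 3F 0F n = sign-sym (b 0F 3F) (λ ()) (signed 3F 0F (λ ()))
        g-sign 3F 1F n = sign-sym (b 1F 3F) (λ ()) (signed 3F 1F (λ ()))
        g-sign 3F 2F n = sign-sym (b 2F 3F) (λ ()) (signed 3F 2F (λ ()))
        g-sign 3F 3F n = contradiction ≡.refl n

      classify : Any (λ c → ∃[ μ ] (Injective _≡_ _≡_ μ × (∀ i j b → i ≢ j → Any ((i , j , b) ≡_) c → Sign b (t (μ i) (μ j))))) shapes
      classify = Any.map (λ {c} → use c) (every-shape (b 0F 1F) (b 0F 2F) (b 0F 3F) (b 1F 2F) (b 1F 3F) (b 2F 3F))
        where
        use : ∀ c → HasShape g c → ∃[ μ ] (Injective _≡_ _≡_ μ × (∀ i j b → i ≢ j → Any ((i , j , b) ≡_) c → Sign b (t (μ i) (μ j))))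
        use c (i , j , k , l , d , s) = order i j k l , (λ {x} {y} → inj {x} {y}) , λ i′ j′ b ne mem →
            ≡.subst (λ b → Sign b (t (order i j k l i′) (order i j k l j′))) (All.lookup s mem) (g-sign (order i j k l i′) (order i j k l j′) (λ e → ne (inj e)))
          where
          inj : Injective _≡_ _≡_ (order i j k l)
          inj {x} {y} = order-injective {i} {j} {k} {l} d {x} {y}

      zero-sym : ∀ {j k} → j ≢ k → t k j ≈ 0# → t j k ≈ 0#
      zero-sym ne = sign-sym false ne

      no-triangle-shape : 0# < t 0F 1F → 0# < t 1F 2F → 0# < t 0F 2F → ⊥
      no-triangle-shape p q r = triangle-free W {0F} {1F} {2F} (λ ()) (λ ()) (λ ()) (edge-sym W (λ ()) p) (edge-sym W (λ ()) q) (mid′ W (λ ()) (edge-sym W (λ ()) r))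

      no-isolated-vertex : t 0F 1F ≈ 0# → t 0F 2F ≈ 0# → t 0F 3F ≈ 0# → ⊥
      no-isolated-vertex z₁ z₂ z₃ = conclude (connected B I (0F , ≡.refl) (1F , ≡.refl))
        where
        I : Fin 4 → Bool
        I zero = true
        I (suc _) = false
        from-0 : ∀ a → ¬ (∃[ f ] Mid B 0F (suc a) f)
        from-0 0F = zero⇒no-mid′ W (λ ()) z₁
        from-0 1F = zero⇒no-mid′ W (λ ()) z₂
        from-0 2F = zero⇒no-mid′ W (λ ()) z₃
        conclude : ∃[ a ] ∃[ b ] (I a ≢ I b × ∃[ f ] Mid B a b f) → ⊥
        conclude (zero , zero , ne , _) = ne ≡.refl
        conclude (suc a , suc b , ne , _) = ne ≡.refl
        conclude (zero , suc b , _ , m) = from-0 b m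
        conclude (suc a , zero , _ , f , m) = from-0 a (f , Mid-sym {B} {suc a} {zero} {f} m)

      no-two-pairs : t 0F 2F ≈ 0# → t 0F 3F ≈ 0# → t 1F 2F ≈ 0# → t 1F 3F ≈ 0# → ⊥
      no-two-pairs z₀₂ z₀₃ z₁₂ z₁₃ = conclude (connected B I (0F , ≡.refl) (2F , ≡.refl))
        where
        I : Fin 4 → Bool
        I 0F = true
        I 1F = true
        I (suc (suc _)) = false
        first second : Fin 2 → Fin 4
        first 0F = 0F
        first 1F = 1F
        second 0F = 2F
        second 1F = 3F
        across : ∀ a b → ¬ (∃[ f ] Mid B (first a) (second b) f)
        across 0F 0F = zero⇒no-mid′ W (λ ()) z₀₂
        across 0F 1F = zero⇒no-mid′ W (λ ()) z₀₃
        across 1F 0F = zero⇒no-mid′ W (λ ()) z₁₂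
        across 1F 1F = zero⇒no-mid′ W (λ ()) z₁₃
        which : ∀ a → (∃[ i ] (first i ≡ a × I a ≡ true)) ⊎ (∃[ i ] (second i ≡ a × I a ≡ false))
        which 0F = inj₁ (0F , ≡.refl , ≡.refl)
        which 1F = inj₁ (1F , ≡.refl , ≡.refl)
        which 2F = inj₂ (0F , ≡.refl , ≡.refl)
        which 3F = inj₂ (1F , ≡.refl , ≡.refl)
        conclude : ∃[ a ] ∃[ b ] (I a ≢ I b × ∃[ f ] Mid B a b f) → ⊥
        conclude (a , b , ne , f , m) with which a | which b
        ... | inj₁ (_ , _ , p) | inj₁ (_ , _ , q) = ne (≡.trans p (≡.sym q))
        ... | inj₂ (_ , _ , p) | inj₂ (_ , _ , q) = ne (≡.trans p (≡.sym q))
        ... | inj₁ (i , ≡.refl , p) | inj₂ (j , ≡.refl , q) = across i j (f , m)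
        ... | inj₂ (i , ≡.refl , p) | inj₁ (j , ≡.refl , q) = across j i (f , Mid-sym {B} {second i} {first j} {f} m)

    -- Rescaling the rays so that the edges of a spanning tree get weight 1.
    module Rescale (p : Fin 3) (t01 : 0# < t 0F 1F) (t12 : 0# < t 1F 2F) (t3p : 0# < t 3F (inject₁ p)) where

      private
        -- In each remaining shape the vertices 0, 1, 2 form a path and 3 is attached to `p`, which
        -- is 2 for the path and the 4-cycle and 1 for the star. The scale of a vertex is that of
        -- its predecessor divided by the weight of the connecting edge.
        parent : Fin 3 → ℝ
        parent 0F = 1#
        parent 1F = 1# * t 1F 0F ⁻¹
        parent 2F = 1# * t 1F 0F ⁻¹ * t 2F 1F ⁻¹

        z : Fin 4 → ℝ
        z 0F = parent 0F
        z 1F = parent 1F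
        z 2F = parent 2F
        z 3F = parent p * t 3F (inject₁ p) ⁻¹

      abstract
        private
          t10 : 0# < t 1F 0F
          t10 = edge-sym W (λ ()) t01
          t21 : 0# < t 2F 1F
          t21 = edge-sym W (λ ()) t12

          parent-pos : ∀ p → 0# < parent p
          parent-pos 0F = 0<1
          parent-pos 1F = *-pos 0<1 (inv-pos t10)
          parent-pos 2F = *-pos (parent-pos 1F) (inv-pos t21)

          z-pos : ∀ l → 0# < z l
          z-pos 0F = parent-pos 0F
          z-pos 1F = parent-pos 1F
          z-pos 2F = parent-pos 2F
          z-pos 3F = *-pos (parent-pos p) (inv-pos t3p)

          edge-1 : ∀ {z x} → 0# < z → 0# < x → x * (z * x ⁻¹ * z ⁻¹) ≈ 1#
          edge-1 {z} {x} pz px = trans (regroup x z (x ⁻¹) (z ⁻¹)) (trans (*-cong (*-inv (≉-pos px)) (*-inv (≉-pos pz))) (*-identityˡ 1#))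
            where
            regroup : ∀ x z i j → x * (z * i * j) ≈ (x * i) * (z * j)
            regroup = solve 4 (λ x z i j → x :* (z :* i :* j) := (x :* i) :* (z :* j)) refl

          z-parent : ∀ p → z (inject₁ p) ≡ parent p
          z-parent 0F = ≡.refl
          z-parent 1F = ≡.refl
          z-parent 2F = ≡.refl

        base : Base
        base = relabel B (λ l → l) (λ e → e) z z-pos

        t′ : Fin 4 → Fin 4 → ℝ
        t′ k j = t k j * (z k * z j ⁻¹)

        rescaled : Weighted base t′
        rescaled = weighted-relabel W (λ l → l) (λ e → e) z z-pos

        edge₁ : t′ 1F 0F ≈ 1#
        edge₁ = edge-1 (parent-pos 0F) t10
        edge₂ : t′ 2F 1F ≈ 1#
        edge₂ = edge-1 (parent-pos 1F) t21
        edge₃ : t′ 3F (inject₁ p) ≈ 1#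
        edge₃ = ≡.subst (λ x → t 3F (inject₁ p) * (z 3F * x ⁻¹) ≈ 1#) (≡.sym (z-parent p)) (edge-1 (parent-pos p) t3p)

        zero′ : ∀ {j k} → t k j ≈ 0# → t′ k j ≈ 0#
        zero′ e = trans (*-congʳ e) (zeroˡ _)

        positive′ : ∀ {j k} → 0# < t k j → 0# < t′ k j
        positive′ {j} {k} q = *-pos q (*-pos (z-pos k) (inv-pos (z-pos j)))

    abstract
      inverse-edge : ∀ {j k} → j ≢ k → t k j ≈ 1# → t j k ≈ 1#
      inverse-edge ne e = trans (sym (*-identityʳ _)) (trans (*-congˡ (sym e)) (recip W ne (<-respʳ (sym e) 0<1)))

  abstract
    path-weighted : ∀ {B t} → Weighted B t → t 1F 0F ≈ 1# → t 2F 1F ≈ 1# → t 3F 2F ≈ 1# →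
                    t 0F 2F ≈ 0# → t 1F 3F ≈ 0# → t 0F 3F ≈ 0# → Weighted B (λ k j → ι (path k j))
    path-weighted {t = t} W e₁ e₂ e₃ z₁ z₂ z₃ = weighted-cong (λ {j} {k} → entry k j) W
      where
      entry : ∀ k j → j ≢ k → t k j ≈ ι (path k j)
      entry 0F 0F n = contradiction ≡.refl n
      entry 0F 1F n = inverse-edge W (λ ()) e₁
      entry 0F 2F n = z₁
      entry 0F 3F n = z₃
      entry 1F 0F n = e₁
      entry 1F 1F n = contradiction ≡.refl n
      entry 1F 2F n = inverse-edge W (λ ()) e₂
      entry 1F 3F n = z₂
      entry 2F 0F n = zero-sym W (λ ()) z₁
      entry 2F 1F n = e₂
      entry 2F 2F n = contradiction ≡.refl n
      entry 2F 3F n = inverse-edge W (λ ()) e₃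
      entry 3F 0F n = zero-sym W (λ ()) z₃
      entry 3F 1F n = zero-sym W (λ ()) z₂
      entry 3F 2F n = e₃
      entry 3F 3F n = contradiction ≡.refl n

    star-weighted : ∀ {B t} → Weighted B t → t 1F 0F ≈ 1# → t 2F 1F ≈ 1# → t 3F 1F ≈ 1# →
                    t 0F 2F ≈ 0# → t 0F 3F ≈ 0# → t 2F 3F ≈ 0# → Weighted B (λ k j → ι (star k j))
    star-weighted {t = t} W e₁ e₂ e₃ z₁ z₂ z₃ = weighted-cong (λ {j} {k} → entry k j) W
      where
      entry : ∀ k j → j ≢ k → t k j ≈ ι (star k j)
      entry 0F 0F n = contradiction ≡.refl n
      entry 0F 1F n = inverse-edge W (λ ()) e₁
      entry 0F 2F n = z₁
      entry 0F 3F n = z₂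
      entry 1F 0F n = e₁
      entry 1F 1F n = contradiction ≡.refl n
      entry 1F 2F n = inverse-edge W (λ ()) e₂
      entry 1F 3F n = inverse-edge W (λ ()) e₃
      entry 2F 0F n = zero-sym W (λ ()) z₁
      entry 2F 1F n = e₂
      entry 2F 2F n = contradiction ≡.refl n
      entry 2F 3F n = z₃
      entry 3F 0F n = zero-sym W (λ ()) z₂
      entry 3F 1F n = e₃
      entry 3F 2F n = zero-sym W (λ ()) z₃
      entry 3F 3F n = contradiction ≡.refl n

    nonempty : ∀ {m} → ¬ (Fin m → ⊥) → Fin m
    nonempty {ℕ.zero} f = ⊥-elim (f (λ ()))
    nonempty {ℕ.suc m} _ = zero

    some-base : Base
    some-base = proj₁ (chamber-base p (λ i → All.lookup (proj₂ (proj₂ g)) (∈-tabulate⁺ i) (nonzero i)) simplicial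
        -- Without any hyperplane, every point would lie in the common intersection.
        (nonempty (λ no → empty-common (δ 0F , λ z → 1≉0 (z 0F)) (λ i → ⊥-elim (no i)))))
      where
      open IsArrangement arr
      g : Σ[ p ∈ V ] ((∀ (i : Fin 0) → 0# < ⟨ 0ᵥ , 0ᵥ ⟩ → 0# < ⟨ 0ᵥ , p ⟩) × All (λ a → ¬ (a ≈ᵥ 0ᵥ) → ⟨ a , p ⟩ ≉ 0#) (tabulate α))
      g = generic (λ _ → 0ᵥ) 0ᵥ (tabulate α)
      p : V
      p = proj₁ g

    tree : ∃[ B ] Tree B
    tree = go (classify (weighted some-base))
      where
      t : Fin 4 → Fin 4 → ℝ
      t = weights some-base
      reorder : ∀ {μ : Fin 4 → Fin 4} (inj : Injective _≡_ _≡_ μ) → Weighted (relabel some-base μ inj (λ _ → 1#) (λ _ → 0<1)) (λ k j → t (μ k) (μ j))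
      reorder {μ} inj = weighted-cong (λ _ → trans (*-congˡ (*-inv 1≉0)) (*-identityʳ _)) (weighted-relabel (weighted some-base) μ inj (λ _ → 1#) (λ _ → 0<1))
      go : Any (λ c → ∃[ μ ] (Injective _≡_ _≡_ μ × (∀ i j b → i ≢ j → Any ((i , j , b) ≡_) c → Sign b (t (μ i) (μ j))))) shapes → ∃[ B ] Tree B
      go (here (μ , inj , s)) = ⊥-elim (no-triangle-shape (reorder inj)
        (s 0F 1F true (λ ()) (here ≡.refl)) (s 1F 2F true (λ ()) (there (here ≡.refl))) (s 0F 2F true (λ ()) (there (there (here ≡.refl)))))
      go (there (here (μ , inj , s))) = ⊥-elim (no-isolated-vertex (reorder inj)
        (s 0F 1F false (λ ()) (here ≡.refl)) (s 0F 2F false (λ ()) (there (here ≡.refl))) (s 0F 3F false (λ ()) (there (there (here ≡.refl)))))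
      go (there (there (here (μ , inj , s)))) = ⊥-elim (no-two-pairs (reorder inj)
        (s 0F 2F false (λ ()) (here ≡.refl)) (s 0F 3F false (λ ()) (there (here ≡.refl))) (s 1F 2F false (λ ()) (there (there (here ≡.refl)))) (s 1F 3F false (λ ()) (there (there (there (here ≡.refl))))))
      go (there (there (there (here (μ , inj , s))))) = Rs.base , inj₁ (path-weighted Rs.rescaled Rs.edge₁ Rs.edge₂ Rs.edge₃
          (Rs.zero′ (s 0F 2F false (λ ()) (there (there (there (here ≡.refl)))))) (Rs.zero′ (s 1F 3F false (λ ()) (there (there (there (there (here ≡.refl))))))) (Rs.zero′ (s 0F 3F false (λ ()) (there (there (there (there (there (here ≡.refl)))))))))
        where
        module Rs = Rescale (reorder inj) 2F (s 0F 1F true (λ ()) (here ≡.refl)) (s 1F 2F true (λ ()) (there (here ≡.refl)))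
          (edge-sym (reorder inj) (λ ()) (s 2F 3F true (λ ()) (there (there (here ≡.refl)))))
      go (there (there (there (there (here (μ , inj , s)))))) = Rs.base , inj₂ (star-weighted Rs.rescaled Rs.edge₁ Rs.edge₂ Rs.edge₃
          (Rs.zero′ (s 0F 2F false (λ ()) (there (there (there (here ≡.refl)))))) (Rs.zero′ (s 0F 3F false (λ ()) (there (there (there (there (here ≡.refl))))))) (Rs.zero′ (s 2F 3F false (λ ()) (there (there (there (there (there (here ≡.refl)))))))))
        where
        module Rs = Rescale (reorder inj) 1F (s 0F 1F true (λ ()) (here ≡.refl)) (s 1F 2F true (λ ()) (there (here ≡.refl)))
          (edge-sym (reorder inj) (λ ()) (s 1F 3F true (λ ()) (there (there (here ≡.refl)))))
      -- Three consecutive edges of the cycle are scaled to weight 1. The fourth keeps an arbitrary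
      -- positive weight, the parameter `q` of `no-cycle`.
      go (there (there (there (there (there (here (μ , inj , s))))))) = ⊥-elim (no-cycle Rs.rescaled Rs.edge₁ Rs.edge₂ Rs.edge₃
          (Rs.positive′ (edge-sym (reorder inj) (λ ()) (s 0F 3F true (λ ()) (there (there (there (there (there (here ≡.refl)))))))))
          (Rs.zero′ (zero-sym (reorder inj) (λ ()) z₀₂)) (Rs.zero′ z₀₂) (Rs.zero′ (zero-sym (reorder inj) (λ ()) z₁₃)) (Rs.zero′ z₁₃))
        where
        module Rs = Rescale (reorder inj) 2F (s 0F 1F true (λ ()) (here ≡.refl)) (s 1F 2F true (λ ()) (there (here ≡.refl)))
          (edge-sym (reorder inj) (λ ()) (s 2F 3F true (λ ()) (there (there (here ≡.refl)))))
        z₀₂ : t (μ 0F) (μ 2F) ≈ 0#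
        z₀₂ = s 0F 2F false (λ ()) (there (there (there (here ≡.refl))))
        z₁₃ : t (μ 1F) (μ 3F) ≈ 0#
        z₁₃ = s 1F 3F false (λ ()) (there (there (there (there (here ≡.refl)))))

-- The root systems A₄ and D₄ and the finite verifications

module A₄-and-D₄ where

  open RootData
  open import Data.Fin.Base using (Fin; suc)
  open import Data.Fin.Patterns
  import Data.Fin.Properties as Fin
  open import Data.Fin.Subset using (Subset; _∩_; ⊤) renaming (⊥ to ∅)
  open import Data.Integer.Base as ℤ using (ℤ; +_; -[1+_]; +[1+_])
  import Data.Integer.Properties as ℤ
  open import Data.List.Base as List using (List; []; _∷_; map; length; drop; upTo)
  open import Data.List.Relation.Unary.All as All using (all?)
  open import Data.List.Relation.Unary.Any as Any using (any?)
  open import Data.List.Relation.Unary.AllPairs using (allPairs?)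
  open import Data.Nat.Base as ℕ using (ℕ; suc)
  import Data.Nat.Properties as ℕ
  open import Data.Product.Base using (_,_)
  open import Data.Vec.Base as Vec using (Vec; []; _∷_; lookup)
  open import Relation.Nullary using (¬?; _×-dec_; _⊎-dec_; _→-dec_)
  open import Relation.Nullary.Decidable using (toWitness)
  open import Relation.Binary.PropositionalEquality using (_≡_; refl)

  -- Signed products of the exponents of the parabolic subgroup fixing the flat: -6 for A₃, -2 for
  -- A₁ × A₂, -1 for A₁³, 24 = 1·2·3·4 for A₄ and 45 = 1·3·3·5 for D₄. In dimension 2 the groups A₁
  -- × A₁ and A₂ have weights 2 and 3 and values 1 and 2.
  möbius-A₄ möbius-D₄ : ℕ → ℕ → ℤ
  möbius-A₄ 4 _ = + 1
  möbius-A₄ 3 _ = -[1+ 0 ]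
  möbius-A₄ 2 w = + (w ℕ.∸ 1)
  möbius-A₄ 1 6 = -[1+ 5 ]
  möbius-A₄ 1 _ = -[1+ 1 ]
  möbius-A₄ _ _ = + 24
  möbius-D₄ 4 _ = + 1
  möbius-D₄ 3 _ = -[1+ 0 ]
  möbius-D₄ 2 w = + (w ℕ.∸ 1)
  möbius-D₄ 1 6 = -[1+ 5 ]
  möbius-D₄ 1 _ = -[1+ 0 ]
  möbius-D₄ _ _ = + 45

  -- The roots follow the order of the pairs in `A₄-normals`. The seven types correspond to the
  -- partitions of 5, the flats being set partitions of the five coordinates; the 15 vertices are
  -- the partitions into two blocks, 5 of weight 6 and 10 of weight 4.
  A₄ : Datum
  A₄ = record
    { N = 10
    ; M = 15
    ; g = path
    ; root =
        (+ 1 ∷ + 0 ∷ + 0 ∷ + 0 ∷ [])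
        ∷ (+ 1 ∷ + 1 ∷ + 0 ∷ + 0 ∷ [])
        ∷ (+ 1 ∷ + 1 ∷ + 1 ∷ + 0 ∷ [])
        ∷ (+ 1 ∷ + 1 ∷ + 1 ∷ + 1 ∷ [])
        ∷ (+ 0 ∷ + 1 ∷ + 0 ∷ + 0 ∷ [])
        ∷ (+ 0 ∷ + 1 ∷ + 1 ∷ + 0 ∷ [])
        ∷ (+ 0 ∷ + 1 ∷ + 1 ∷ + 1 ∷ [])
        ∷ (+ 0 ∷ + 0 ∷ + 1 ∷ + 0 ∷ [])
        ∷ (+ 0 ∷ + 0 ∷ + 1 ∷ + 1 ∷ [])
        ∷ (+ 0 ∷ + 0 ∷ + 0 ∷ + 1 ∷ [])
        ∷ []
    ; swap =
        (0F ∷ 4F ∷ 5F ∷ 6F ∷ 1F ∷ 2F ∷ 3F ∷ 7F ∷ 8F ∷ 9F ∷ [])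
        ∷ (1F ∷ 0F ∷ 2F ∷ 3F ∷ 4F ∷ 7F ∷ 8F ∷ 5F ∷ 6F ∷ 9F ∷ [])
        ∷ (0F ∷ 2F ∷ 1F ∷ 3F ∷ 5F ∷ 4F ∷ 6F ∷ 7F ∷ 9F ∷ 8F ∷ [])
        ∷ (0F ∷ 1F ∷ 3F ∷ 2F ∷ 4F ∷ 6F ∷ 5F ∷ 8F ∷ 7F ∷ 9F ∷ [])
        ∷ []
    ; simple = 0F ∷ 4F ∷ 7F ∷ 9F ∷ []
    ; vertex =
        (+ 1 ∷ + 0 ∷ + 0 ∷ + 0 ∷ [])
        ∷ (+ 0 ∷ + 1 ∷ + 0 ∷ + 0 ∷ [])
        ∷ (+ 0 ∷ + 0 ∷ + 1 ∷ + 0 ∷ [])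
        ∷ (+ 0 ∷ + 0 ∷ + 0 ∷ + 1 ∷ [])
        ∷ (-[1+ 0 ] ∷ + 1 ∷ + 0 ∷ + 0 ∷ [])
        ∷ (+ 1 ∷ -[1+ 0 ] ∷ + 1 ∷ + 0 ∷ [])
        ∷ (+ 0 ∷ + 1 ∷ -[1+ 0 ] ∷ + 1 ∷ [])
        ∷ (+ 0 ∷ + 0 ∷ + 1 ∷ -[1+ 0 ] ∷ [])
        ∷ (+ 0 ∷ -[1+ 0 ] ∷ + 1 ∷ + 0 ∷ [])
        ∷ (-[1+ 0 ] ∷ + 0 ∷ + 1 ∷ + 0 ∷ [])
        ∷ (+ 1 ∷ + 0 ∷ -[1+ 0 ] ∷ + 1 ∷ [])
        ∷ (+ 1 ∷ -[1+ 0 ] ∷ + 0 ∷ + 1 ∷ [])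
        ∷ (+ 0 ∷ + 1 ∷ + 0 ∷ -[1+ 0 ] ∷ [])
        ∷ (-[1+ 0 ] ∷ + 1 ∷ -[1+ 0 ] ∷ + 1 ∷ [])
        ∷ (+ 1 ∷ + 0 ∷ + 0 ∷ -[1+ 0 ] ∷ [])
        ∷ []
    ; types =
        (0 , [])
        ∷ (1 , 0F ∷ [])
        ∷ (1 , 1F ∷ [])
        ∷ (2 , 0F ∷ 1F ∷ [])
        ∷ (2 , 0F ∷ 2F ∷ [])
        ∷ (3 , 0F ∷ 1F ∷ 2F ∷ [])
        ∷ (4 , 0F ∷ 1F ∷ 2F ∷ 3F ∷ [])
        ∷ []
    ; rounds = 6
    ; exponents = + 1 ∷ + 2 ∷ + 3 ∷ + 4 ∷ []
    ; möbius = möbius-A₄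
    ; normal =
        (+ 1 ∷ -[1+ 0 ] ∷ + 0 ∷ + 0 ∷ [])
        ∷ (+ 1 ∷ + 0 ∷ -[1+ 0 ] ∷ + 0 ∷ [])
        ∷ (+ 1 ∷ + 0 ∷ + 0 ∷ -[1+ 0 ] ∷ [])
        ∷ (+ 2 ∷ + 1 ∷ + 1 ∷ + 1 ∷ [])
        ∷ (+ 0 ∷ + 1 ∷ -[1+ 0 ] ∷ + 0 ∷ [])
        ∷ (+ 0 ∷ + 1 ∷ + 0 ∷ -[1+ 0 ] ∷ [])
        ∷ (+ 1 ∷ + 2 ∷ + 1 ∷ + 1 ∷ [])
        ∷ (+ 0 ∷ + 0 ∷ + 1 ∷ -[1+ 0 ] ∷ [])
        ∷ (+ 1 ∷ + 1 ∷ + 2 ∷ + 1 ∷ [])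
        ∷ (+ 1 ∷ + 1 ∷ + 1 ∷ + 2 ∷ [])
        ∷ []
    ; codual =
        (+ 4 ∷ -[1+ 0 ] ∷ -[1+ 0 ] ∷ -[1+ 0 ] ∷ [])
        ∷ (+ 3 ∷ + 3 ∷ -[1+ 1 ] ∷ -[1+ 1 ] ∷ [])
        ∷ (+ 2 ∷ + 2 ∷ + 2 ∷ -[1+ 2 ] ∷ [])
        ∷ (+ 1 ∷ + 1 ∷ + 1 ∷ + 1 ∷ [])
        ∷ []
    -- The common factor is 5, the determinant of the Cartan matrix, which clears the denominators
    -- of the fundamental coweights.
    ; factor = 4
    }

  -- The roots alternate between differences and sums of unit vectors, as in `D₄-normals`, and node
  -- 1 is the centre of the star. The subgroups A₁ × A₁ and A₃ occur in three classes each, permuted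
  -- by triality, hence eleven types. Of the 24 vertices, 12 have weight 6 and 12 have weight 3.
  D₄ : Datum
  D₄ = record
    { N = 12
    ; M = 24
    ; g = star
    ; root =
        (+ 1 ∷ + 0 ∷ + 0 ∷ + 0 ∷ [])
        ∷ (+ 1 ∷ + 2 ∷ + 1 ∷ + 1 ∷ [])
        ∷ (+ 1 ∷ + 1 ∷ + 0 ∷ + 0 ∷ [])
        ∷ (+ 1 ∷ + 1 ∷ + 1 ∷ + 1 ∷ [])
        ∷ (+ 1 ∷ + 1 ∷ + 1 ∷ + 0 ∷ [])
        ∷ (+ 1 ∷ + 1 ∷ + 0 ∷ + 1 ∷ [])
        ∷ (+ 0 ∷ + 1 ∷ + 0 ∷ + 0 ∷ [])
        ∷ (+ 0 ∷ + 1 ∷ + 1 ∷ + 1 ∷ [])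
        ∷ (+ 0 ∷ + 1 ∷ + 1 ∷ + 0 ∷ [])
        ∷ (+ 0 ∷ + 1 ∷ + 0 ∷ + 1 ∷ [])
        ∷ (+ 0 ∷ + 0 ∷ + 1 ∷ + 0 ∷ [])
        ∷ (+ 0 ∷ + 0 ∷ + 0 ∷ + 1 ∷ [])
        ∷ []
    ; swap =
        (0F ∷ 1F ∷ 6F ∷ 7F ∷ 8F ∷ 9F ∷ 2F ∷ 3F ∷ 4F ∷ 5F ∷ 10F ∷ 11F ∷ [])
        ∷ (2F ∷ 3F ∷ 0F ∷ 1F ∷ 4F ∷ 5F ∷ 6F ∷ 7F ∷ 10F ∷ 11F ∷ 8F ∷ 9F ∷ [])
        ∷ (0F ∷ 1F ∷ 4F ∷ 5F ∷ 2F ∷ 3F ∷ 8F ∷ 9F ∷ 6F ∷ 7F ∷ 10F ∷ 11F ∷ [])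
        ∷ (0F ∷ 1F ∷ 5F ∷ 4F ∷ 3F ∷ 2F ∷ 9F ∷ 8F ∷ 7F ∷ 6F ∷ 10F ∷ 11F ∷ [])
        ∷ []
    ; simple = 0F ∷ 6F ∷ 10F ∷ 11F ∷ []
    ; vertex =
        (+ 1 ∷ + 0 ∷ + 0 ∷ + 0 ∷ [])
        ∷ (+ 0 ∷ + 1 ∷ + 0 ∷ + 0 ∷ [])
        ∷ (+ 0 ∷ + 0 ∷ + 1 ∷ + 0 ∷ [])
        ∷ (+ 0 ∷ + 0 ∷ + 0 ∷ + 1 ∷ [])
        ∷ (-[1+ 0 ] ∷ + 1 ∷ + 0 ∷ + 0 ∷ [])
        ∷ (+ 1 ∷ -[1+ 0 ] ∷ + 1 ∷ + 1 ∷ [])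
        ∷ (+ 0 ∷ + 1 ∷ -[1+ 0 ] ∷ + 0 ∷ [])
        ∷ (+ 0 ∷ + 1 ∷ + 0 ∷ -[1+ 0 ] ∷ [])
        ∷ (+ 0 ∷ -[1+ 0 ] ∷ + 1 ∷ + 1 ∷ [])
        ∷ (-[1+ 0 ] ∷ + 0 ∷ + 1 ∷ + 1 ∷ [])
        ∷ (+ 1 ∷ + 0 ∷ -[1+ 0 ] ∷ + 1 ∷ [])
        ∷ (+ 1 ∷ + 0 ∷ + 1 ∷ -[1+ 0 ] ∷ [])
        ∷ (+ 1 ∷ -[1+ 0 ] ∷ + 0 ∷ + 1 ∷ [])
        ∷ (+ 1 ∷ -[1+ 0 ] ∷ + 1 ∷ + 0 ∷ [])
        ∷ (+ 0 ∷ + 0 ∷ -[1+ 0 ] ∷ + 1 ∷ [])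
        ∷ (-[1+ 0 ] ∷ + 1 ∷ -[1+ 0 ] ∷ + 1 ∷ [])
        ∷ (-[1+ 0 ] ∷ + 1 ∷ + 1 ∷ -[1+ 0 ] ∷ [])
        ∷ (+ 1 ∷ + 1 ∷ -[1+ 0 ] ∷ -[1+ 0 ] ∷ [])
        ∷ (-[1+ 0 ] ∷ + 0 ∷ + 0 ∷ + 1 ∷ [])
        ∷ (-[1+ 0 ] ∷ + 0 ∷ + 1 ∷ + 0 ∷ [])
        ∷ (+ 0 ∷ -[1+ 0 ] ∷ + 0 ∷ + 2 ∷ [])
        ∷ (-[1+ 0 ] ∷ + 2 ∷ -[1+ 0 ] ∷ -[1+ 0 ] ∷ [])
        ∷ (+ 0 ∷ -[1+ 0 ] ∷ + 2 ∷ + 0 ∷ [])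
        ∷ (+ 2 ∷ -[1+ 0 ] ∷ + 0 ∷ + 0 ∷ [])
        ∷ []
    ; types =
        (0 , [])
        ∷ (1 , 0F ∷ [])
        ∷ (1 , 1F ∷ [])
        ∷ (1 , 2F ∷ [])
        ∷ (1 , 3F ∷ [])
        ∷ (2 , 0F ∷ 1F ∷ [])
        ∷ (2 , 0F ∷ 2F ∷ [])
        ∷ (2 , 1F ∷ 2F ∷ [])
        ∷ (2 , 1F ∷ 3F ∷ [])
        ∷ (3 , 0F ∷ 1F ∷ 2F ∷ [])
        ∷ (4 , 0F ∷ 1F ∷ 2F ∷ 3F ∷ [])
        ∷ []
    ; rounds = 4
    ; exponents = + 1 ∷ + 3 ∷ + 3 ∷ + 5 ∷ []
    ; möbius = möbius-D₄
    ; normal =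
        (+ 1 ∷ -[1+ 0 ] ∷ + 0 ∷ + 0 ∷ [])
        ∷ (+ 1 ∷ + 1 ∷ + 0 ∷ + 0 ∷ [])
        ∷ (+ 1 ∷ + 0 ∷ -[1+ 0 ] ∷ + 0 ∷ [])
        ∷ (+ 1 ∷ + 0 ∷ + 1 ∷ + 0 ∷ [])
        ∷ (+ 1 ∷ + 0 ∷ + 0 ∷ -[1+ 0 ] ∷ [])
        ∷ (+ 1 ∷ + 0 ∷ + 0 ∷ + 1 ∷ [])
        ∷ (+ 0 ∷ + 1 ∷ -[1+ 0 ] ∷ + 0 ∷ [])
        ∷ (+ 0 ∷ + 1 ∷ + 1 ∷ + 0 ∷ [])
        ∷ (+ 0 ∷ + 1 ∷ + 0 ∷ -[1+ 0 ] ∷ [])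
        ∷ (+ 0 ∷ + 1 ∷ + 0 ∷ + 1 ∷ [])
        ∷ (+ 0 ∷ + 0 ∷ + 1 ∷ -[1+ 0 ] ∷ [])
        ∷ (+ 0 ∷ + 0 ∷ + 1 ∷ + 1 ∷ [])
        ∷ []
    ; codual =
        (+ 2 ∷ + 0 ∷ + 0 ∷ + 0 ∷ [])
        ∷ (+ 2 ∷ + 2 ∷ + 0 ∷ + 0 ∷ [])
        ∷ (+ 1 ∷ + 1 ∷ + 1 ∷ -[1+ 0 ] ∷ [])
        ∷ (+ 1 ∷ + 1 ∷ + 1 ∷ + 1 ∷ [])
        ∷ []
    -- The common factor is 2: the two coweights of spin type have half-integral coordinates.
    ; factor = 1
    }

  module Decide (D : Datum) where
    open Derived D

    symmetric? = Fin.all? λ k → Fin.all? λ l → g k l ℤ.≟ g l k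
    diagonal? = Fin.all? λ k → g k k ℤ.≟ + 0
    root-closed? = Fin.all? λ k → Fin.all? λ a → (reflect k (ρ a) ≟ᶜ ρ (π k a)) ⊎-dec (reflect k (ρ a) ≟ᶜ neg (ρ (π k a)))
    involutive? = Fin.all? λ k → Fin.all? λ a → π k (π k a) Fin.≟ a
    simple-root? = Fin.all? λ l → ρ (lookup simple l) ≟ᶜ unit l
    descent? = Fin.all? λ a → (Fin.any? λ l → ρ a ≟ᶜ unit l) ⊎-dec (Fin.any? λ k → (ρ a ≟ᶜ reflect k (ρ (π k a))) ×-dec (height (ρ (π k a)) ℕ.<? height (ρ a)))
    independent? = Fin.all? λ a → Fin.all? λ b → ¬? (a Fin.≟ b) →-dec (Fin.any? λ l → Fin.any? λ m → ¬? (lookup (ρ a) l ℤ.* lookup (ρ b) m ℤ.≟ lookup (ρ a) m ℤ.* lookup (ρ b) l))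
    vertex-closed? = Fin.all? λ k → Fin.all? λ v → Fin.any? λ v′ → (coreflect k (lookup vertex v) ≟ᶜ lookup vertex v′) ⊎-dec (coreflect k (lookup vertex v) ≟ᶜ neg (lookup vertex v′))
    simple-vertex? = Fin.all? λ l → Fin.any? λ v → lookup vertex v ≟ᶜ unit l
    space-flat? = any? (λ f → ⊤ ≟ˢ set f) flats
    ∩-closed? = λ (fs : List Flat) (zs : Vec (Subset N) M) → all? (λ f → Fin.all? λ v → any? (λ f′ → (set f ∩ lookup zs v) ≟ˢ set f′) fs) fs
    flats-unique? = allPairs? (λ f f′ → ¬? (set f ≟ˢ set f′)) flats
    μ-empty? = all? (λ f → (set f ≟ˢ ∅) →-dec (μ f ℤ.≟ + 1)) flats
    μ-nonempty? = λ (fs : List Flat) → all? (λ f → ¬? (set f ≟ˢ ∅) →-dec (μ f ℤ.≟ ℤ.- sumℤ (map (below f) fs))) fs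
    few-triple? = λ (fs : List Flat) → Data.Nat.ListAction.sum (map (λ w → length (lines fs w)) (drop 3 (upTo (suc N)))) ℕ.<? length (lines fs 2)
      where import Data.Nat.ListAction
    realised? = Fin.all? λ a → Fin.all? λ l → dot (lookup normal a) (lookup codual l) ℤ.≟ +[1+ factor ] ℤ.* lookup (ρ a) l
    dual-basis? = Fin.all? λ k → Fin.all? λ k′ → sum₄ (λ l → lookup (lookup normal (lookup simple l)) k ℤ.* lookup (lookup codual l) k′) ℤ.≟ +[1+ factor ] ℤ.* lookup (unit k) k′

  abstract
    A₄-valid : Valid A₄
    A₄-valid = record
      { symmetric     = toWitness {a? = symmetric?} _
      ; diagonal      = toWitness {a? = diagonal?} _
      ; root-closed   = toWitness {a? = root-closed?} _
      ; involutive    = toWitness {a? = involutive?} _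
      ; simple-root   = toWitness {a? = simple-root?} _
      ; descent       = toWitness {a? = descent?} _
      ; independent   = toWitness {a? = independent?} _
      ; vertex-closed = toWitness {a? = vertex-closed?} _
      ; simple-vertex = toWitness {a? = simple-vertex?} _
      ; space-flat    = toWitness {a? = space-flat?} _
      ; ∩-closed      = toWitness {a? = ∩-closed? flats vertex-zeros} _
      ; flats-unique  = toWitness {a? = flats-unique?} _
      ; μ-empty       = toWitness {a? = μ-empty?} _
      ; μ-nonempty    = toWitness {a? = μ-nonempty? flats} _
      ; few-triple    = toWitness {a? = few-triple? flats} _
      ; χ-splits      = splits
      ; realised      = toWitness {a? = realised?} _
      ; dual-basis    = toWitness {a? = dual-basis?} _
      }
      where
      open Decide A₄
      open Derived A₄
      splits : ∀ k → χ k ≡ List.foldr linearFactorℤ (constantℤ (+ 1)) exponents k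
      splits 0 = refl
      splits 1 = refl
      splits 2 = refl
      splits 3 = refl
      splits 4 = refl
      -- No face has dimension above 4, and the product of four linear factors has no coefficient
      -- there.
      splits (suc (suc (suc (suc (suc k))))) = refl

  abstract
    D₄-valid : Valid D₄
    D₄-valid = record
      { symmetric     = toWitness {a? = symmetric?} _
      ; diagonal      = toWitness {a? = diagonal?} _
      ; root-closed   = toWitness {a? = root-closed?} _
      ; involutive    = toWitness {a? = involutive?} _
      ; simple-root   = toWitness {a? = simple-root?} _
      ; descent       = toWitness {a? = descent?} _
      ; independent   = toWitness {a? = independent?} _
      ; vertex-closed = toWitness {a? = vertex-closed?} _
      ; simple-vertex = toWitness {a? = simple-vertex?} _
      ; space-flat    = toWitness {a? = space-flat?} _
      ; ∩-closed      = toWitness {a? = ∩-closed? flats vertex-zeros} _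
      ; flats-unique  = toWitness {a? = flats-unique?} _
      ; μ-empty       = toWitness {a? = μ-empty?} _
      ; μ-nonempty    = toWitness {a? = μ-nonempty? flats} _
      ; few-triple    = toWitness {a? = few-triple? flats} _
      ; χ-splits      = splits
      ; realised      = toWitness {a? = realised?} _
      ; dual-basis    = toWitness {a? = dual-basis?} _
      }
      where
      open Decide D₄
      open Derived D₄
      splits : ∀ k → χ k ≡ List.foldr linearFactorℤ (constantℤ (+ 1)) exponents k
      splits 0 = refl
      splits 1 = refl
      splits 2 = refl
      splits 3 = refl
      splits 4 = refl
      splits (suc (suc (suc (suc (suc k))))) = refl

-- The hyperplanes are the roots

module RootCoordinates {ℓ : Level} (R : Reals ℓ) {n : ℕ} (α : Fin n → OverReals.V R) (arr : OverReals.IsArrangement R α)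
  (simplicial : OverReals.Simplicial R α) (irreducible : OverReals.Irreducible R α)
  (weight≤6 : ∀ S → OverReals.IsVertex R α S → ∣ S ∣ ℕ.≤ 6) (D : RootData.Datum) (valid : RootData.Valid D) where

  open RootData
  open OrderedField R hiding (neg-pos)
  open LinearAlgebra R
  open SimplicialCones R α arr
  open Crossings R α arr simplicial
  open LocalStructure R α arr simplicial
  open Diagrams R α arr simplicial irreducible weight≤6
  open EdgeWeights R α arr simplicial irreducible weight≤6
  open Classification R α arr simplicial irreducible weight≤6
  open FaceSpans R α arr
  open Weighted
  open Derived D hiding (flats; χ; μ; below; Injective)
  open Valid valid
  open import Data.Fin.Base using (zero; suc)
  import Data.Fin.Properties as Fin
  open import Data.Fin.Patterns
  open import Data.Integer.Base as ℤ using (ℤ; +_; -[1+_]; +[1+_])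
  import Data.Integer.Properties as ℤ
  import Data.Nat.Properties as ℕ
  open import Data.Product.Base
  open import Data.Sum.Base using (inj₁; inj₂)
  open import Data.Vec.Base as Vec using (lookup)
  open import Data.Vec.Properties using (lookup∘tabulate; lookup-map)
  open import Relation.Nullary using (Dec; yes; no; contradiction)
  import Relation.Binary.PropositionalEquality as ≡
  open ≡ using (_≡_; _≢_; ≢-sym)
  open import Relation.Binary.Reasoning.Setoid setoid

  abstract
    ιℕ-pos : ∀ k → 0# < ιℕ (ℕ.suc k)
    ιℕ-pos ℕ.zero = 0<1
    ιℕ-pos (ℕ.suc k) = +-pos 0<1 (ιℕ-pos k)

    ι-zero⁻¹ : ∀ x → ι x ≈ 0# → x ≡ + 0
    ι-zero⁻¹ (+ ℕ.zero) _ = ≡.refl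
    ι-zero⁻¹ +[1+ k ] e = contradiction e (≉-pos (ιℕ-pos k))
    ι-zero⁻¹ -[1+ k ] e = contradiction e (≉-neg (pos-neg (ιℕ-pos k)))

    ι-injective : ∀ x y → ι x ≈ ι y → x ≡ y
    ι-injective x y e = ℤ.i-j≡0⇒i≡j x y (ι-zero⁻¹ (x ℤ.- y) (trans (ι-+ x (ℤ.- y)) (trans (+-cong e (ι-neg y)) (-‿inverseʳ (ι y)))))

    ι-sum₄ : ∀ f → ι (sum₄ f) ≈ sum (λ l → ι (f l))
    ι-sum₄ f = trans (ι-+ (f 0F) _) (+-congˡ (trans (ι-+ (f 1F) _) (+-congˡ (trans (ι-+ (f 2F) _) (+-congˡ (ι-+ (f 3F) (+ 0)))))))

    ι-dot : ∀ u v → ι (dot u v) ≈ sum (λ l → ι (lookup u l) * ι (lookup v l))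
    ι-dot u v = trans (ι-sum₄ (λ l → lookup u l ℤ.* lookup v l)) (Σ-cong (λ l → ι (lookup u l ℤ.* lookup v l)) (λ l → ι (lookup u l) * ι (lookup v l)) (λ l → ι-* (lookup u l) (lookup v l)))

    ι-unit : ∀ l m → ι (lookup (unit l) m) ≈ δ l m
    ι-unit 0F 0F = refl
    ι-unit 0F 1F = refl
    ι-unit 0F 2F = refl
    ι-unit 0F 3F = refl
    ι-unit 1F 0F = refl
    ι-unit 1F 1F = refl
    ι-unit 1F 2F = refl
    ι-unit 1F 3F = refl
    ι-unit 2F 0F = refl
    ι-unit 2F 1F = refl
    ι-unit 2F 2F = refl
    ι-unit 2F 3F = refl
    ι-unit 3F 0F = refl
    ι-unit 3F 1F = refl
    ι-unit 3F 2F = refl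
    ι-unit 3F 3F = refl

  t : Fin 4 → Fin 4 → ℝ
  t k j = ι (g k j)

  -- The linear form whose values on the four rays are the coordinates `v`; at this point it need
  -- not define a hyperplane of the arrangement.
  eval : Base → Coord → V → ℝ
  eval B v x = sum (λ l → ι (lookup v l) * wall B l · x)

  point : Base → Coord → V
  point B v = combination (λ l → ι (lookup v l)) (ray B)

  abstract
    wall-point : ∀ B l v → wall B l · point B v ≈ ι (lookup v l)
    wall-point B l v = trans (·-combination (wall B l) (λ m → ι (lookup v m)) (ray B))
      (trans (Σ-cong (λ m → ι (lookup v m) * wall B l · ray B m) (λ m → ι (lookup v m) * δ m l) (λ m → *-congˡ (trans (dual B l m) (δ-sym l m)))) (sum-δʳ l (λ m → ι (lookup v m))))

    eval-point : ∀ B r v → eval B r (point B v) ≈ ι (dot r v)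
    eval-point B r v = trans (Σ-cong (λ l → ι (lookup r l) * wall B l · point B v) (λ l → ι (lookup r l) * ι (lookup v l)) (λ l → *-congˡ (wall-point B l v))) (sym (ι-dot r v))

    eval-ray : ∀ B r m → eval B r (ray B m) ≈ ι (lookup r m)
    eval-ray B r m = trans (Σ-cong (λ l → ι (lookup r l) * wall B l · ray B m) (λ l → ι (lookup r l) * δ l m) (λ l → *-congˡ (dual B l m))) (sum-δʳ m (λ l → ι (lookup r l)))

    eval-unit : ∀ B l x → eval B (unit l) x ≈ wall B l · x
    eval-unit B l x = trans (Σ-cong (λ m → ι (lookup (unit l) m) * wall B m · x) (λ m → δ l m * wall B m · x) (λ m → *-congʳ (ι-unit l m))) (sum-δ l (λ m → wall B m · x))

    point-unit : ∀ B l f → f · point B (unit l) ≈ f · ray B l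
    point-unit B l f = trans (·-combination f (λ m → ι (lookup (unit l) m)) (ray B)) (trans (Σ-cong (λ m → ι (lookup (unit l) m) * f · ray B m) (λ m → δ l m * f · ray B m) (λ m → *-congʳ (ι-unit l m))) (sum-δ l (λ m → f · ray B m)))

    sum-neg : ∀ {m} (c h : Fin m → ℝ) (c′ : Fin m → ℝ) → (∀ l → c′ l ≈ - c l) → sum (λ l → c′ l * h l) ≈ - 1# * sum (λ l → c l * h l)
    sum-neg c h c′ e = trans (Σ-cong (λ l → c′ l * h l) (λ l → - 1# * (c l * h l)) (λ l → trans (*-congʳ (e l)) (regroup (c l) (h l)))) (sym (*-distribˡ-Σ (- 1#) (λ l → c l * h l)))
      where
      regroup : ∀ c h → - c * h ≈ - 1# * (c * h)
      regroup = solve 2 (λ c h → (:- c) :* h := con -[1+ 0 ] :* (c :* h)) refl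

    ι-neg-lookup : ∀ v l → ι (lookup (neg v) l) ≈ - ι (lookup v l)
    ι-neg-lookup v l = trans (reflexive (≡.cong ι (lookup-map l (λ x → ℤ.- x) v))) (ι-neg (lookup v l))

    eval-neg : ∀ B v x → eval B (neg v) x ≈ - 1# * eval B v x
    eval-neg B v x = sum-neg (λ l → ι (lookup v l)) (λ l → wall B l · x) (λ l → ι (lookup (neg v) l)) (ι-neg-lookup v)

    point-· : ∀ B v f → f · point B v ≈ sum (λ l → ι (lookup v l) * f · ray B l)
    point-· B v f = ·-combination f (λ l → ι (lookup v l)) (ray B)

    point-neg : ∀ B v f → f · point B (neg v) ≈ - 1# * f · point B v
    point-neg B v f = trans (point-· B (neg v) f) (trans (sum-neg (λ l → ι (lookup v l)) (λ l → f · ray B l) (λ l → ι (lookup (neg v) l)) (ι-neg-lookup v)) (*-congˡ (sym (point-· B v f))))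

  module _ {B : Base} (W : Weighted B t) {k : Fin 4} (X : Crossing B k) where

    abstract
      private
        gain : Fin 4 → ℝ
        gain l = coeff X l - δ k l

        gain-g : ∀ l → gain l ≈ ι (g k l) - (1# + 1#) * δ k l
        gain-g l with l Fin.≟ k
        ... | yes ≡.refl = trans (+-cong (coeff-k X) (-‿cong (δ-refl k))) (trans (two-1) (sym (+-cong (reflexive (≡.cong ι (diagonal k))) (-‿cong (*-congˡ (δ-refl k))))))
          where
          two-1 : - 1# - 1# ≈ 0# - (1# + 1#) * 1#
          two-1 = solve 0 (:- con (+ 1) :- con (+ 1) := con (+ 0) :- (con (+ 1) :+ con (+ 1)) :* con (+ 1)) refl
        ... | no ne = +-cong (coeff≈ W X l ne) (-‿cong (trans (δ-≢ (≢-sym ne)) (sym (trans (*-congˡ (δ-≢ (≢-sym ne))) (zeroʳ _)))))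

        wall-gain : ∀ l x → wall (next X) l · x ≈ wall B l · x + gain l * wall B k · x
        wall-gain l x with l Fin.≟ k
        ... | yes ≡.refl = trans (wall-next-self X x) (trans (flip (wall B k · x)) (+-congˡ (*-congʳ (sym (+-cong (coeff-k X) (-‿cong (δ-refl k)))))))
          where
          flip : ∀ w → - w ≈ w + (- 1# - 1#) * w
          flip = solve 1 (λ w → :- w := w :+ (:- con (+ 1) :- con (+ 1)) :* w) refl
        ... | no ne = trans (wall-next X ne x) (+-congˡ (*-congʳ (sym (trans (+-congˡ (trans (-‿cong (δ-≢ (≢-sym ne))) -0#≈0#)) (+-identityʳ _)))))

        change : Coord → ℝ
        change v = sum (λ l → ι (lookup v l) * gain l)

        change-eq : ∀ v → change v ≈ ι (sum₄ (λ m → g k m ℤ.* lookup v m)) - (1# + 1#) * ι (lookup v k)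
        change-eq v = begin
          sum (λ l → ι (lookup v l) * gain l)
            ≈⟨ Σ-cong (λ l → ι (lookup v l) * gain l) (λ l → ι (g k l ℤ.* lookup v l) + δ k l * (- (1# + 1#) * ι (lookup v l)))
                 (λ l → trans (*-congˡ (gain-g l)) (trans (regroup (ι (lookup v l)) (ι (g k l)) (δ k l)) (+-congʳ (sym (ι-* (g k l) (lookup v l)))))) ⟩
          sum (λ l → ι (g k l ℤ.* lookup v l) + δ k l * (- (1# + 1#) * ι (lookup v l)))
            ≈⟨ ∑-distrib-+ (λ l → ι (g k l ℤ.* lookup v l)) (λ l → δ k l * (- (1# + 1#) * ι (lookup v l))) ⟩
          sum (λ l → ι (g k l ℤ.* lookup v l)) + sum (λ l → δ k l * (- (1# + 1#) * ι (lookup v l)))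
            ≈⟨ +-cong (sym (ι-sum₄ (λ l → g k l ℤ.* lookup v l))) (sum-δ k (λ l → - (1# + 1#) * ι (lookup v l))) ⟩
          ι (sum₄ (λ m → g k m ℤ.* lookup v m)) + - (1# + 1#) * ι (lookup v k)
            ≈⟨ +-congˡ (sym (-‿distribˡ-* _ _)) ⟩
          ι (sum₄ (λ m → g k m ℤ.* lookup v m)) - (1# + 1#) * ι (lookup v k) ∎
          where
          regroup : ∀ v g d → v * (g - (1# + 1#) * d) ≈ g * v + d * (- (1# + 1#) * v)
          regroup = solve 3 (λ v g d → v :* (g :- (con (+ 1) :+ con (+ 1)) :* d) := g :* v :+ d :* ((:- (con (+ 1) :+ con (+ 1))) :* v)) refl

        reflect-eq : ∀ v l → ι (lookup (reflect k v) l) ≈ ι (lookup v l) + δ k l * change v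
        reflect-eq v l = trans (reflexive (≡.cong ι (lookup∘tabulate (λ l → reflect-at {k} v l (l Fin.≟ k)) l))) (go (l Fin.≟ k))
          where
          go : ∀ (d : Dec (l ≡ k)) → ι (reflect-at v l d) ≈ ι (lookup v l) + δ k l * change v
          go (no ne) = sym (trans (+-congˡ (trans (*-congʳ (δ-≢ (≢-sym ne))) (zeroˡ _))) (+-identityʳ _))
          go (yes ≡.refl) = trans (ι-+ (sum₄ (λ m → g k m ℤ.* lookup v m)) (ℤ.- lookup v l)) (trans (+-congˡ (ι-neg (lookup v l))) (sym (trans (+-congˡ (trans (*-congʳ (δ-refl l)) (trans (*-identityˡ _) (change-eq v)))) (regroup (ι (lookup v l)) (ι (sum₄ (λ m → g k m ℤ.* lookup v m)))))))
            where
            regroup : ∀ v s → v + (s - (1# + 1#) * v) ≈ s - v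
            regroup = solve 2 (λ v s → v :+ (s :- (con (+ 1) :+ con (+ 1)) :* v) := s :- v) refl

      -- Both sides differ from `eval B v x` by a multiple of the k-th wall form: only the k-th ray
      -- changes, with the entries of `g` as its coefficients, and this is what `reflect k` does to
      -- coordinates.
      eval-next : ∀ v x → eval (next X) v x ≈ eval B (reflect k v) x
      eval-next v x = trans (begin
        sum (λ l → ι (lookup v l) * wall (next X) l · x)
          ≈⟨ Σ-cong (λ l → ι (lookup v l) * wall (next X) l · x) (λ l → ι (lookup v l) * wall B l · x + ι (lookup v l) * gain l * wall B k · x)
               (λ l → trans (*-congˡ (wall-gain l x)) (expand′ (ι (lookup v l)) (wall B l · x) (gain l) (wall B k · x))) ⟩
        sum (λ l → ι (lookup v l) * wall B l · x + ι (lookup v l) * gain l * wall B k · x)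
          ≈⟨ ∑-distrib-+ (λ l → ι (lookup v l) * wall B l · x) (λ l → ι (lookup v l) * gain l * wall B k · x) ⟩
        eval B v x + sum (λ l → ι (lookup v l) * gain l * wall B k · x)
          ≈⟨ +-congˡ (sym (*-distribʳ-sum (wall B k · x) (λ l → ι (lookup v l) * gain l))) ⟩
        eval B v x + change v * wall B k · x ∎)
        (sym (begin
        sum (λ l → ι (lookup (reflect k v) l) * wall B l · x)
          ≈⟨ Σ-cong (λ l → ι (lookup (reflect k v) l) * wall B l · x) (λ l → ι (lookup v l) * wall B l · x + δ k l * (change v * wall B l · x))
               (λ l → trans (*-congʳ (reflect-eq v l)) (distrib′ (ι (lookup v l)) (δ k l) (change v) (wall B l · x))) ⟩
        sum (λ l → ι (lookup v l) * wall B l · x + δ k l * (change v * wall B l · x))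
          ≈⟨ ∑-distrib-+ (λ l → ι (lookup v l) * wall B l · x) (λ l → δ k l * (change v * wall B l · x)) ⟩
        eval B v x + sum (λ l → δ k l * (change v * wall B l · x))
          ≈⟨ +-congˡ (sum-δ k (λ l → change v * wall B l · x)) ⟩
        eval B v x + change v * wall B k · x ∎))
        where
        expand′ : ∀ v w c y → v * (w + c * y) ≈ v * w + v * c * y
        expand′ = solve 4 (λ v w c y → v :* (w :+ c :* y) := v :* w :+ v :* c :* y) refl
        distrib′ : ∀ v d c w → (v + d * c) * w ≈ v * w + d * (c * w)
        distrib′ = solve 4 (λ v d c w → (v :+ d :* c) :* w := v :* w :+ d :* (c :* w)) refl

      private
        coreflect-eq : ∀ v l → ι (lookup (coreflect k v) l) ≈ ι (lookup v l) + ι (lookup v k) * gain l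
        coreflect-eq v l = trans (reflexive (≡.cong ι (lookup∘tabulate (λ l → coreflect-at {k} v l (l Fin.≟ k)) l))) (go (l Fin.≟ k))
          where
          go : ∀ (d : Dec (l ≡ k)) → ι (coreflect-at v l d) ≈ ι (lookup v l) + ι (lookup v k) * gain l
          go (no ne) = trans (ι-+ (lookup v l) (g k l ℤ.* lookup v k)) (+-congˡ (trans (ι-* (g k l) (lookup v k)) (trans (*-comm _ _) (*-congˡ (sym
             (trans (gain-g l) (trans (+-congˡ (trans (-‿cong (trans (*-congˡ (δ-≢ (≢-sym ne))) (zeroʳ _))) -0#≈0#)) (+-identityʳ _))))))))
          go (yes ≡.refl) = trans (ι-neg (lookup v l)) (trans (flip (ι (lookup v l))) (+-congˡ (*-congˡ (sym (+-cong (coeff-k X) (-‿cong (δ-refl l)))))))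
            where
            flip : ∀ w → - w ≈ w + w * (- 1# - 1#)
            flip = solve 1 (λ w → :- w := w :+ w :* (:- con (+ 1) :- con (+ 1))) refl

      point-next : ∀ v f → f · point (next X) v ≈ f · point B (coreflect k v)
      point-next v f = trans (trans (point-· (next X) v f) (begin
        sum (λ l → ι (lookup v l) * f · ray (next X) l)
          ≈⟨ Σ-cong (λ l → ι (lookup v l) * f · ray (next X) l) (λ l → ι (lookup v l) * f · ray B l + δ k l * (ι (lookup v k) * jump)) term ⟩
        sum (λ l → ι (lookup v l) * f · ray B l + δ k l * (ι (lookup v k) * jump))
          ≈⟨ ∑-distrib-+ (λ l → ι (lookup v l) * f · ray B l) (λ l → δ k l * (ι (lookup v k) * jump)) ⟩
        old + sum (λ l → δ k l * (ι (lookup v k) * jump))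
          ≈⟨ +-congˡ (sum-δ k (λ _ → ι (lookup v k) * jump)) ⟩
        old + ι (lookup v k) * jump ∎))
        (sym (trans (point-· B (coreflect k v) f) (begin
        sum (λ l → ι (lookup (coreflect k v) l) * f · ray B l)
          ≈⟨ Σ-cong (λ l → ι (lookup (coreflect k v) l) * f · ray B l) (λ l → ι (lookup v l) * f · ray B l + ι (lookup v k) * (gain l * f · ray B l))
               (λ l → trans (*-congʳ (coreflect-eq v l)) (distrib′ (ι (lookup v l)) (ι (lookup v k)) (gain l) (f · ray B l))) ⟩
        sum (λ l → ι (lookup v l) * f · ray B l + ι (lookup v k) * (gain l * f · ray B l))
          ≈⟨ ∑-distrib-+ (λ l → ι (lookup v l) * f · ray B l) (λ l → ι (lookup v k) * (gain l * f · ray B l)) ⟩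
        old + sum (λ l → ι (lookup v k) * (gain l * f · ray B l))
          ≈⟨ +-congˡ (sym (*-distribˡ-Σ (ι (lookup v k)) (λ l → gain l * f · ray B l))) ⟩
        old + ι (lookup v k) * sum (λ l → gain l * f · ray B l)
          ≈⟨ +-congˡ (*-congˡ (sym jump-eq)) ⟩
        old + ι (lookup v k) * jump ∎)))
        where
        old jump : ℝ
        old = sum (λ l → ι (lookup v l) * f · ray B l)
        jump = f · ray (next X) k - f · ray B k
        distrib′ : ∀ v d c w → (v + d * c) * w ≈ v * w + d * (c * w)
        distrib′ = solve 4 (λ v d c w → (v :+ d :* c) :* w := v :* w :+ d :* (c :* w)) refl
        jump-eq : jump ≈ sum (λ l → gain l * f · ray B l)
        jump-eq = sym (trans (Σ-cong (λ l → gain l * f · ray B l) (λ l → coeff X l * f · ray B l + δ k l * - (f · ray B l)) (λ l → split (coeff X l) (δ k l) (f · ray B l)))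
          (trans (∑-distrib-+ (λ l → coeff X l * f · ray B l) (λ l → δ k l * - (f · ray B l))) (+-cong (sym (new-· X f)) (sum-δ k (λ l → - (f · ray B l))))))
          where
          split : ∀ c d x → (c - d) * x ≈ c * x + d * - x
          split = solve 3 (λ c d x → (c :- d) :* x := c :* x :+ d :* (:- x)) refl
        term : ∀ l → ι (lookup v l) * f · ray (next X) l ≈ ι (lookup v l) * f · ray B l + δ k l * (ι (lookup v k) * jump)
        term l with l Fin.≟ k
        ... | yes ≡.refl = trans (grow′ (ι (lookup v l)) (f · ray (next X) l) (f · ray B l)) (+-congˡ (trans (sym (*-identityˡ _)) (*-congʳ (sym (δ-refl l)))))
          where
          grow′ : ∀ v a b → v * a ≈ v * b + v * (a - b)
          grow′ = solve 3 (λ v a b → v :* a := v :* b :+ v :* (a :- b)) refl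
        ... | no ne = trans (*-congˡ (same-· X f l ne)) (sym (trans (+-congˡ (trans (*-congʳ (δ-≢ (≢-sym ne))) (zeroˡ _))) (+-identityʳ _)))

  abstract
    -- Induction on the height, with the chamber varying: the lower root is realised by a hyperplane
    -- in the chamber across wall `k`, and the same hyperplane has the reflected coordinates in the
    -- present chamber.
    root-form : ∀ {B} → Weighted B t → ∀ a → ∃[ f ] ∀ x → f · x ≈ eval B (ρ a) x
    root-form W a = go (height (ρ a)) W a ℕ.≤-refl
      where
      go : ∀ h {B} → Weighted B t → ∀ a → height (ρ a) ℕ.≤ h → ∃[ f ] ∀ x → f · x ≈ eval B (ρ a) x
      go h {B} W a le with descent a
      ... | inj₁ (l , e) = wall B l , λ x → trans (sym (eval-unit B l x)) (reflexive (≡.cong (λ v → eval B v x) (≡.sym e)))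
      go ℕ.zero W a le | inj₂ (k , e , lt) = contradiction (ℕ.<-≤-trans lt le) ℕ.n≮0
      go (ℕ.suc h) {B} W a le | inj₂ (k , e , lt) with go h (weighted-next W (cross B k)) (π k a) (ℕ.≤-pred (ℕ.<-≤-trans lt le))
      ... | f , eq = f , λ x → trans (eq x) (trans (eval-next W (cross B k) (ρ (π k a)) x) (reflexive (≡.cong (λ v → eval B v x) (≡.sym e))))

  module _ {B : Base} (W : Weighted B t) where

    τ : Fin N → Fin n
    τ a = idx (proj₁ (root-form W a))

    abstract
      τ-unique : ∀ f a {c} → c ≉ 0# → (∀ x → f · x ≈ c * eval B (ρ a) x) → idx f ≡ τ a
      τ-unique f a c≉0 eq = proportional⇒≡ f (proj₁ (root-form W a)) c≉0 (λ x → trans (eq x) (*-congˡ (sym (proj₂ (root-form W a) x))))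

      τ-eval : ∀ f a → idx f ≡ τ a → ∃[ c ] (c ≉ 0# × ∀ x → f · x ≈ c * eval B (ρ a) x)
      τ-eval f a e with same-idx f (proj₁ (root-form W a)) e
      ... | c , c≉0 , eq = c , c≉0 , λ x → trans (eq x) (*-congˡ (proj₂ (root-form W a) x))

      τ-injective : ∀ a b → τ a ≡ τ b → a ≡ b
      τ-injective a b e with a Fin.≟ b
      ... | yes p = p
      ... | no a≢b with independent a b a≢b | τ-eval (proj₁ (root-form W a)) b e
      ... | l , m , ne | c , _ , eq = contradiction (ι-injective _ _ (begin
          ι (lookup (ρ a) l ℤ.* lookup (ρ b) m)        ≈⟨ ι-* (lookup (ρ a) l) (lookup (ρ b) m) ⟩
          ι (lookup (ρ a) l) * ι (lookup (ρ b) m)      ≈⟨ *-congʳ (ratio′ l) ⟩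
          c * ι (lookup (ρ b) l) * ι (lookup (ρ b) m)  ≈⟨ regroup c (ι (lookup (ρ b) l)) (ι (lookup (ρ b) m)) ⟩
          c * ι (lookup (ρ b) m) * ι (lookup (ρ b) l)  ≈⟨ *-congʳ (sym (ratio′ m)) ⟩
          ι (lookup (ρ a) m) * ι (lookup (ρ b) l)      ≈⟨ sym (ι-* (lookup (ρ a) m) (lookup (ρ b) l)) ⟩
          ι (lookup (ρ a) m ℤ.* lookup (ρ b) l)        ∎)) ne
        where
        regroup : ∀ c x y → c * x * y ≈ c * y * x
        regroup = solve 3 (λ c x y → c :* x :* y := c :* y :* x) refl
        ratio′ : ∀ l → ι (lookup (ρ a) l) ≈ c * ι (lookup (ρ b) l)
        ratio′ l = trans (sym (eval-ray B (ρ a) l)) (trans (sym (proj₂ (root-form W a) (ray B l))) (trans (eq (ray B l)) (*-congˡ (eval-ray B (ρ b) l))))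

      eval-reflect : ∀ k a → ∃[ s ] (s ≉ 0# × ∀ x → eval B (reflect k (ρ a)) x ≈ s * eval B (ρ (π k a)) x)
      eval-reflect k a with root-closed k a
      ... | inj₁ e = 1# , 1≉0 , λ x → trans (reflexive (≡.cong (λ v → eval B v x) e)) (sym (*-identityˡ _))
      ... | inj₂ e = - 1# , -1≉0 , λ x → trans (reflexive (≡.cong (λ v → eval B v x) e)) (eval-neg B (ρ (π k a)) x)

  abstract
    τ-next : ∀ {B} (W : Weighted B t) {k} (X : Crossing B k) (W′ : Weighted (next X) t) a → τ W′ a ≡ τ W (π k a)
    τ-next W {k} X W′ a with eval-reflect W k a
    ... | s , s≉0 , eq = τ-unique W (proj₁ (root-form W′ a)) (π k a) s≉0 (λ x → trans (proj₂ (root-form W′ a) x) (trans (eval-next W X (ρ a) x) (eq x)))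

    -- Every hyperplane is a wall of some chamber of a gallery. There it is a simple root, and going
    -- back along the gallery permutes the roots up to sign.
    τ-surjective : ∀ {B} (W : Weighted B t) i → ∃[ a ] τ W a ≡ i
    τ-surjective {B} W i = conclude (reach-wall Inv {B} (λ k X p → step k X p) (W , λ a → a , 1# , 1≉0 , λ x → sym (*-identityˡ _)) i)
      where
      Inv : Base → Set ℓ
      Inv B′ = Weighted B′ t × ∀ a → ∃[ a′ ] ∃[ s ] (s ≉ 0# × ∀ x → eval B′ (ρ a) x ≈ s * eval B (ρ a′) x)
      step : ∀ {x B′} k (X : Crossing B′ k) → wall B′ k · x < 0# → Inv B′ → Inv (next X)
      step k X _ (W′ , inv) = weighted-next W′ X , λ a → let (s , s≉0 , eq) = eval-reflect W′ k a
                                                             (a′ , s′ , s′≉0 , eq′) = inv (π k a)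
        in a′ , s * s′ , *-≉0 s≉0 s′≉0 , λ x → trans (eval-next W′ X (ρ a) x) (trans (eq x) (trans (*-congˡ (eq′ x)) (sym (*-assoc s s′ _))))
      conclude : ∃[ B′ ] (Inv B′ × ∃[ l ] idx (wall B′ l) ≡ i) → ∃[ a ] τ W a ≡ i
      conclude (B′ , (W′ , inv) , l , e) = let (a′ , s , s≉0 , eq) = inv (lookup simple l)
        in a′ , ≡.trans (≡.sym (τ-unique W (wall B′ l) a′ s≉0 (λ x → trans (sym (eval-unit B′ l x)) (trans (reflexive (≡.cong (λ v → eval B′ v x) (≡.sym (simple-root l)))) (eq x))))) e

-- The intersection lattice and its invariants

module IntersectionLattice {ℓ : Level} (R : Reals ℓ) {n : ℕ} (α : Fin n → OverReals.V R) (arr : OverReals.IsArrangement R α)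
  (simplicial : OverReals.Simplicial R α) (irreducible : OverReals.Irreducible R α)
  (weight≤6 : ∀ S → OverReals.IsVertex R α S → ∣ S ∣ ℕ.≤ 6) (D : RootData.Datum) (valid : RootData.Valid D) where

  open RootData
  open FiniteSets
  open OrderedField R hiding (sumℤ)
  open LinearAlgebra R
  open SimplicialCones R α arr
  open Crossings R α arr simplicial
  open LocalStructure R α arr simplicial
  open EdgeWeights R α arr simplicial irreducible weight≤6
  open FaceSpans R α arr
  open RootCoordinates R α arr simplicial irreducible weight≤6 D valid
  open Derived D hiding (below; Injective) renaming (flats to faces; χ to χᴰ; μ to μᴰ)
  private module Below = Derived D
  open Valid valid
  open import Data.Bool.Base using (Bool; true; _∧_)
  open import Data.Fin.Base using (zero; suc)
  import Data.Fin.Properties as Fin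
  open import Data.Fin.Subset using (_∈_; _⊂_) renaming (⊥ to ∅)
  open import Data.Fin.Subset.Properties using (∈⊤; ∉⊥; x∈p∩q⁺; x∈p∩q⁻; ⊆-antisym; _⊂?_; _∈?_)
  open import Data.Integer.Base as ℤ using (ℤ; +_)
  import Data.Integer.Properties as ℤ
  open import Data.List.Base using (List; []; _∷_; map; filter; length; allFin; drop; upTo; foldr)
  import Data.List.Properties as List
  import Data.List.Membership.Propositional as List
  open import Data.List.Membership.Propositional.Properties using (∈-allFin; ∈-filter⁺; ∈-filter⁻; ∈-map⁺; ∈-map⁻)
  open import Data.List.Relation.Binary.Permutation.Propositional as Perm using (_↭_)
  open import Data.List.Relation.Binary.Permutation.Propositional.Properties using (↭-length; map⁺)
  open import Data.List.Relation.Unary.Any as Any using (Any)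
  open import Data.List.Relation.Unary.All as All using (All; []; _∷_)
  import Data.List.Relation.Unary.All.Properties as All
  open import Data.List.Relation.Unary.AllPairs as AllPairs using (AllPairs; []; _∷_)
  import Data.List.Relation.Unary.AllPairs.Properties as AllPairs
  open import Data.List.Relation.Unary.Unique.Propositional using (Unique)
  import Data.List.Relation.Unary.Unique.Propositional.Properties as Unique
  open import Data.Nat.ListAction using () renaming (sum to sumℕ)
  import Data.Nat.Properties as ℕ
  open import Data.Product.Base hiding (map; swap)
  open import Data.Sum.Base using (inj₁; inj₂)
  open import Data.Empty
  open import Data.Vec.Base as Vec using (Vec; []; _∷_; lookup; tabulate)
  open import Data.Vec.Properties using (lookup∘tabulate; lookup-map; []=⇒lookup; lookup⇒[]=; ≡-dec)
  import Data.Bool.Properties as Bool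
  open import Function.Bundles using (_⇔_; Equivalence; mk⇔)
  open import Function.Definitions using (Injective)
  open import Induction.WellFounded using (Acc; acc)
  open import Data.Fin.Subset.Induction using (⊂-wellFounded)
  open import Relation.Nullary using (Dec; does; yes; no; contradiction; _×-dec_)
  open import Relation.Nullary.Decidable using (toWitness; dec-true; dec-false)
  import Relation.Binary.PropositionalEquality as ≡
  open ≡ using (_≡_; _≢_; ≢-sym)

  open Equivalence using (to; from)
  module Arr = OverReals R

  Rep : ∀ {B} → Weighted B t → Subset N → Subset n → Set
  Rep W F S = ∀ a → a ∈ F ⇔ τ W a ∈ S

  private
    ∈⇒lookup : ∀ {m} {p : Subset m} {i} → i ∈ p → lookup p i ≡ true
    ∈⇒lookup = []=⇒lookup

    lookup⇒∈ : ∀ {m} (p : Subset m) {i} → lookup p i ≡ true → i ∈ p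
    lookup⇒∈ p = lookup⇒[]= _ p

    does-true : ∀ {P : Set} (d : Dec P) → does d ≡ true → P
    does-true (yes p) _ = p

    root-zero : ∀ {B} (W : Weighted B t) a x → H α (τ W a) x ⇔ (eval B (ρ a) x ≈ 0#)
    root-zero W a x = mk⇔ (λ h → trans (sym (proj₂ (root-form W a) x)) (H⇒·≈0 (proj₁ (root-form W a)) x h))
                          (λ z → ·≈0⇒H (proj₁ (root-form W a)) x (trans (proj₂ (root-form W a) x) z))

  abstract
    ∈-zeros : ∀ v a → a ∈ zeros v ⇔ dot (ρ a) v ≡ + 0
    ∈-zeros v a = mk⇔ (λ m → does-true (dot (ρ a) v ℤ.≟ + 0) (≡.trans (≡.sym (lookup-map a (λ r → does (dot r v ℤ.≟ + 0)) root)) (∈⇒lookup m)))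
                      (λ e → lookup⇒∈ (zeros v) (≡.trans (lookup-map a (λ r → does (dot r v ℤ.≟ + 0)) root) (dec-true (dot (ρ a) v ℤ.≟ + 0) e)))

    ∈-vertex-zeros : ∀ v a → a ∈ lookup vertex-zeros v ⇔ dot (ρ a) (lookup vertex v) ≡ + 0
    ∈-vertex-zeros v a = ≡.subst (λ p → a ∈ p ⇔ dot (ρ a) (lookup vertex v) ≡ + 0) (≡.sym (lookup-map v zeros vertex)) (∈-zeros (lookup vertex v) a)

    ∈-standard : ∀ {d} (φ : Vec (Fin 4) d) a → a ∈ standard-face φ ⇔ (∀ k → lookup (ρ a) (lookup φ k) ≡ + 0)
    ∈-standard φ a = mk⇔ (λ m → to-all φ (≡.trans (≡.sym (lookup-map a (test φ) root)) (∈⇒lookup m)))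
                         (λ z → lookup⇒∈ (standard-face φ) (≡.trans (lookup-map a (test φ) root) (from-all φ z)))
      where
      test : ∀ {d} → Vec (Fin 4) d → Coord → Bool
      test φ r = Vec.foldr (λ _ → Bool) (λ l b → does (lookup r l ℤ.≟ + 0) ∧ b) true φ
      to-all : ∀ {d} (φ : Vec (Fin 4) d) → test φ (ρ a) ≡ true → ∀ k → lookup (ρ a) (lookup φ k) ≡ + 0
      to-all (l ∷ φ) e k with lookup (ρ a) l ℤ.≟ + 0
      to-all (l ∷ φ) e zero | yes p = p
      to-all (l ∷ φ) e (suc k) | yes p = to-all φ e k
      from-all : ∀ {d} (φ : Vec (Fin 4) d) → (∀ k → lookup (ρ a) (lookup φ k) ≡ + 0) → test φ (ρ a) ≡ true
      from-all [] z = ≡.refl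
      from-all (l ∷ φ) z rewrite dec-true (lookup (ρ a) l ℤ.≟ + 0) (z zero) = from-all φ (λ k → z (suc k))

    -- The chamber varies in the induction: each reflection is absorbed by moving across the
    -- corresponding wall, until the face is spanned by rays of the current chamber.
    face-sound : ∀ {d F} → Face d F → ∀ {B} (W : Weighted B t) S → Rep W F S → IsFlatOfDim α d S
    face-sound (standard φ inj) {B} W S rep = face-flat B (lookup φ) (λ {i} {j} → toWitness {a? = injective? φ} inj i j) S member
      where
      member : ∀ i → i ∈ S ⇔ (∀ k → H α i (ray B (lookup φ k)))
      member i with τ-surjective W i
      ... | a , ≡.refl = mk⇔
        (λ i∈ k → from (root-zero W a (ray B (lookup φ k))) (trans (eval-ray B (ρ a) (lookup φ k)) (reflexive (≡.cong ι (to (∈-standard φ a) (from (rep a) i∈) k)))))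
        (λ h → to (rep a) (from (∈-standard φ a) (λ k → ι-zero⁻¹ _ (trans (sym (eval-ray B (ρ a) (lookup φ k))) (to (root-zero W a (ray B (lookup φ k))) (h k))))))
    face-sound (reflected {F = F} k face) {B} W S rep = face-sound face W′ S rep′
      where
      W′ : Weighted (next (cross B k)) t
      W′ = weighted-next W (cross B k)
      image-π : ∀ a → lookup (image k F) (π k a) ≡ lookup F a
      image-π a = ≡.trans (lookup∘tabulate (λ a → lookup F (π k a)) (π k a)) (≡.cong (lookup F) (involutive k a))
      rep′ : Rep W′ F S
      rep′ a = mk⇔ (λ m → ≡.subst (_∈ S) (≡.sym (τ-next W (cross B k) W′ a)) (to (rep (π k a)) (lookup⇒∈ (image k F) (≡.trans (image-π a) (∈⇒lookup m)))))
                   (λ m → lookup⇒∈ F (≡.trans (≡.sym (image-π a)) (∈⇒lookup (from (rep (π k a)) (≡.subst (_∈ S) (τ-next W (cross B k) W′ a) m)))))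

    -- Being a flat supplies, for each hyperplane outside `S`, a point of the flat off it. Small
    -- multiples of such points are added one hyperplane at a time, without returning to those
    -- already avoided.
    generic-point : ∀ S → IsFlat α S → Σ[ x ∈ V ] (⋂ α S x × ∀ i → ¬ (i ∈ S) → ¬ H α i x)
    generic-point S flat with go (allFin n)
      where
      off : ∀ i → ¬ (i ∈ S) → Σ[ y ∈ V ] (⋂ α S y × ¬ H α i y)
      off i i∉ with dec {Σ[ y ∈ V ] (⋂ α S y × ¬ H α i y)}
      ... | yes p = p
      ... | no none = contradiction (flat i (λ {y} y∈ → decide y y∈)) i∉
        where
        decide : ∀ y → ⋂ α S y → H α i y
        decide y y∈ with dec {H α i y}
        ... | yes h = h
        ... | no nh = contradiction (y , y∈ , nh) none
      Good : List (Fin n) → V → Set ℓ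
      Good is x = ⋂ α S x × All (λ i → ¬ (i ∈ S) → ¬ H α i x) is
      extend : ∀ i is x → Good is x → ∃[ y ] (⋂ α S y × ¬ H α i y) → H α i x → Σ[ x ∈ V ] Good (i ∷ is) x
      extend i is x (x∈ , rest) (y , y∈ , hy) hx = x′ , in-S , (λ _ h → off-H h) ∷ proj₂ (proj₂ w)
        where
        keep : ∀ {j} → (¬ (j ∈ S) → ¬ H α j x) → Eventually (λ s → ¬ (j ∈ S) → ¬ H α j (x +ᵥ s *ᵥ y))
        keep {j} f with dec {⟨ α j , x ⟩ ≈ 0#}
        ... | yes z = ev-true λ _ _ j∉ → contradiction z (f j∉)
        ... | no nz = ev-map (λ _ r _ → r) (ev-≉ (α j) x y nz)
        liftAll : ∀ {is} → All (λ j → ¬ (j ∈ S) → ¬ H α j x) is → Eventually (λ s → All (λ j → ¬ (j ∈ S) → ¬ H α j (x +ᵥ s *ᵥ y)) is)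
        liftAll [] = ev-true λ _ _ → []
        liftAll (p ∷ ps) = ev-map (λ _ (a , b) → a ∷ b) (ev-∧ (keep p) (liftAll ps))
        w : ∃[ s ] (0# < s × All (λ j → ¬ (j ∈ S) → ¬ H α j (x +ᵥ s *ᵥ y)) is)
        w = ev-witness (liftAll rest)
        x′ : V
        x′ = x +ᵥ proj₁ w *ᵥ y
        in-S : ⋂ α S x′
        in-S j j∈ = trans (⟨⟩-move (α j) x (proj₁ w) y) (trans (+-cong (x∈ j j∈) (trans (*-congˡ (y∈ j j∈)) (zeroʳ _))) (+-identityˡ 0#))
        off-H : ¬ H α i x′
        off-H h = hy (*-≈0 (≉-pos (proj₁ (proj₂ w))) (trans (sym (trans (+-congʳ hx) (+-identityˡ _))) (trans (sym (⟨⟩-move (α i) x (proj₁ w) y)) h)))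
      go : ∀ is → Σ[ x ∈ V ] Good is x
      go [] = 0ᵥ , (λ i _ → ⟨⟩-0 (α i)) , []
      go (i ∷ is) = step (go is)
        where
        step : Σ[ x ∈ V ] Good is x → Σ[ x ∈ V ] Good (i ∷ is) x
        step (x , good@(x∈ , rest)) with i ∈? S | dec {H α i x}
        ... | _ | no h = x , x∈ , (λ _ → h) ∷ rest
        ... | yes i∈ | yes _ = x , x∈ , (λ i∉ → contradiction i∈ i∉) ∷ rest
        ... | no i∉ | yes h = extend i is x good (off i i∉) h
    ... | x , x∈ , rest = x , x∈ , λ i → All.lookup rest (∈-allFin i)

  -- The summation in the definition of μ-acc uses a local function, which is
  -- recovered here by unification.
  private
    unfold : ∀ S (rec : ∀ {T} → T ⊂ S → Acc _⊂_ T) → S ≢ ∅ → Σ[ b ∈ (Subset n → ℤ) ] Arr.μ-acc α S (acc rec) ≡ ℤ.- Arr.sumℤ α (map b (Arr.flats α))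
    unfold S rec ne with ≡-dec Bool._≟_ S ∅
    ... | yes e = contradiction e ne
    ... | no _  = _ , ≡.refl

    unfold-⊂ : ∀ S (rec : ∀ {T} → T ⊂ S → Acc _⊂_ T) ne T → T ⊂ S → Σ[ a ∈ Acc _⊂_ T ] proj₁ (unfold S rec ne) T ≡ Arr.μ-acc α T a
    unfold-⊂ S rec ne T T⊂S with ≡-dec Bool._≟_ S ∅
    ... | yes e = contradiction e ne
    ... | no _ with T ⊂? S
    ... | yes p = rec p , ≡.refl
    ... | no n = contradiction T⊂S n

    unfold-⊄ : ∀ S (rec : ∀ {T} → T ⊂ S → Acc _⊂_ T) ne T → ¬ (T ⊂ S) → proj₁ (unfold S rec ne) T ≡ + 0
    unfold-⊄ S rec ne T T⊄S with ≡-dec Bool._≟_ S ∅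
    ... | yes e = contradiction e ne
    ... | no _ with T ⊂? S
    ... | yes p = contradiction p T⊄S
    ... | no n = ≡.refl

    μ-acc-∅ : ∀ a → Arr.μ-acc α ∅ a ≡ + 1
    μ-acc-∅ (acc rec) with ≡-dec Bool._≟_ (∅ {n}) ∅
    ... | yes _ = ≡.refl
    ... | no ne = contradiction ≡.refl ne

    below-⊂ : ∀ f g → set g ⊂ set f → Below.below f g ≡ μᴰ g
    below-⊂ f g p rewrite dec-true (set g ⊂? set f) p = ≡.refl

    below-⊄ : ∀ f g → ¬ (set g ⊂ set f) → Below.below f g ≡ + 0
    below-⊄ f g n rewrite dec-false (set g ⊂? set f) n = ≡.refl

  abstract
    fromℤ-constant : ∀ k → fromℤ (constantℤ (+ 1) k) ≈ constant 1# k
    fromℤ-constant ℕ.zero = +-identityʳ 1#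
    fromℤ-constant (ℕ.suc k) = refl

    fromℤ-linearFactors : ∀ es k → fromℤ (foldr linearFactorℤ (constantℤ (+ 1)) es k) ≈ foldr linearFactor (constant 1#) (map fromℤ es) k
    fromℤ-linearFactors [] k = fromℤ-constant k
    fromℤ-linearFactors (e ∷ es) ℕ.zero = trans (fromℤ-neg (e ℤ.* p)) (-‿cong (trans (fromℤ-* e p) (*-congˡ (fromℤ-linearFactors es 0))))
      where
      p : ℤ
      p = foldr linearFactorℤ (constantℤ (+ 1)) es 0
    fromℤ-linearFactors (e ∷ es) (ℕ.suc k) = trans (fromℤ-+ (p k) (ℤ.- (e ℤ.* p (ℕ.suc k)))) (+-cong (fromℤ-linearFactors es k)
        (trans (fromℤ-neg (e ℤ.* p (ℕ.suc k))) (-‿cong (trans (fromℤ-* e (p (ℕ.suc k))) (*-congˡ (fromℤ-linearFactors es (ℕ.suc k)))))))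
      where
      p : ℕ → ℤ
      p = foldr linearFactorℤ (constantℤ (+ 1)) es

  module _ {B₀ : Base} (W₀ : Weighted B₀ t) where

    private
      Inv : Base → Set ℓ
      Inv B = Weighted B t × ∀ v → ∃[ v′ ] ∃[ s ] (s ≉ 0# × ∀ f → f · point B (lookup vertex v) ≈ s * f · point B₀ (lookup vertex v′))

    abstract
      private
        inv-step : ∀ {x B} k (X : Crossing B k) → wall B k · x < 0# → Inv B → Inv (next X)
        inv-step {x} {B} k X _ (W , inv) = weighted-next W X , move
          where
          move : ∀ v → ∃[ v′ ] ∃[ s ] (s ≉ 0# × ∀ f → f · point (next X) (lookup vertex v) ≈ s * f · point B₀ (lookup vertex v′))
          move v with vertex-closed k v
          ... | v₁ , inj₁ e = let (v′ , s , s≉0 , eq) = inv v₁ in v′ , s , s≉0 , λ f →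
                trans (point-next W X (lookup vertex v) f) (trans (reflexive (≡.cong (λ u → f · point B u) e)) (eq f))
          ... | v₁ , inj₂ e = let (v′ , s , s≉0 , eq) = inv v₁ in v′ , - 1# * s , *-≉0 -1≉0 s≉0 , λ f →
                trans (point-next W X (lookup vertex v) f) (trans (reflexive (≡.cong (λ u → f · point B u) e)) (trans (point-neg B (lookup vertex v₁) f) (trans (*-congˡ (eq f)) (sym (*-assoc _ _ _)))))

        -- All rays met along the gallery remain proportional to entries of the finite list of
        -- vertices, so the hyperplanes through a ray can be read off from that list.
        rays-vertex : ∀ {B} → Inv B → ∀ l → ∃[ v ] ∀ a → a ∈ lookup vertex-zeros v ⇔ (proj₁ (root-form W₀ a) · ray B l ≈ 0#)
        rays-vertex {B} (W , inv) l with simple-vertex l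
        ... | v , e with inv v
        ... | v′ , s , s≉0 , eq = v′ , λ a → mk⇔
              (λ m → trans (ray-point a) (trans (*-congˡ (trans (value a) (reflexive (≡.cong ι (to (∈-vertex-zeros v′ a) m))))) (zeroʳ s)))
              (λ z → from (∈-vertex-zeros v′ a) (ι-zero⁻¹ _ (trans (sym (value a)) (*-≈0 s≉0 (trans (sym (ray-point a)) z)))))
          where
          value : ∀ a → proj₁ (root-form W₀ a) · point B₀ (lookup vertex v′) ≈ ι (dot (ρ a) (lookup vertex v′))
          value a = trans (proj₂ (root-form W₀ a) _) (eval-point B₀ (ρ a) (lookup vertex v′))
          ray-point : ∀ a → proj₁ (root-form W₀ a) · ray B l ≈ s * proj₁ (root-form W₀ a) · point B₀ (lookup vertex v′)
          ray-point a = trans (sym (point-unit B l (proj₁ (root-form W₀ a)))) (trans (reflexive (≡.cong (λ u → proj₁ (root-form W₀ a) · point B u) (≡.sym e))) (eq (proj₁ (root-form W₀ a))))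

        -- Only the rays with a nonzero coordinate at `x` impose conditions. The empty list of rays
        -- corresponds to the zero subspace, and each further ray intersects the set found so far
        -- with the zero set of a vertex.
        collect : ∀ {B} → Inv B → ∀ x (ls : List (Fin 4)) →
                  Any (λ f → ∀ a → a ∈ set f ⇔ All (λ l → wall B l · x ≉ 0# → proj₁ (root-form W₀ a) · ray B l ≈ 0#) ls) faces
        collect inv x [] = Any.map (λ {f} e a → mk⇔ (λ _ → []) (λ _ → ≡.subst (a ∈_) e ∈⊤)) space-flat
        collect {B} inv x (l ∷ ls) with dec {wall B l · x ≈ 0#}
        ... | yes z = Any.map (λ h a → mk⇔ (λ m → (λ nz → contradiction z nz) ∷ to (h a) m) (λ { (_ ∷ ps) → from (h a) ps })) (collect inv x ls)
        ... | no nz = add (rays-vertex inv l) (List.find (collect inv x ls))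
          where
          add : ∃[ v ] (∀ a → a ∈ lookup vertex-zeros v ⇔ (proj₁ (root-form W₀ a) · ray B l ≈ 0#)) →
                ∃[ f ] (f List.∈ faces × ∀ a → a ∈ set f ⇔ All (λ l → wall B l · x ≉ 0# → proj₁ (root-form W₀ a) · ray B l ≈ 0#) ls) →
                Any (λ f → ∀ a → a ∈ set f ⇔ All (λ l → wall B l · x ≉ 0# → proj₁ (root-form W₀ a) · ray B l ≈ 0#) (l ∷ ls)) faces
          add (v , hv) (f , f∈ , hf) = Any.map (λ {f′} e a → mk⇔
              (λ m → let (m₁ , m₂) = x∈p∩q⁻ (set f) (lookup vertex-zeros v) (≡.subst (a ∈_) (≡.sym e) m) in (λ _ → to (hv a) m₂) ∷ to (hf a) m₁)
              (λ { (p ∷ ps) → ≡.subst (a ∈_) e (x∈p∩q⁺ (from (hf a) ps , from (hv a) (p nz))) }))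
            (All.lookup ∩-closed f∈ v)

      -- A generic point of the flat lies in the closure of some chamber. As a hyperplane has one
      -- sign on the chamber, it contains the point exactly if it contains every ray that occurs in
      -- the expansion of the point, and `collect` identifies the corresponding face.
      flat-complete : ∀ S → IsFlat α S → Any (λ f → Rep W₀ (set f) S) faces
      flat-complete S flat with generic-point S flat
      ... | x , x∈ , off with Walk.walk x Inv (λ k X p → inv-step {x} k X p) {B₀} (W₀ , λ v → v , 1# , 1≉0 , λ f → sym (*-identityˡ _))
      ... | B , inv , closed = Any.map (λ h a → mk⇔ (λ m → in-S a (forward a (to (h a) m))) (λ m → from (h a) (backward a (x∈ (τ W₀ a) m)))) (collect inv x (allFin 4))
        where
        F : Fin N → Form
        F a = proj₁ (root-form W₀ a)
        forward : ∀ a → All (λ l → wall B l · x ≉ 0# → F a · ray B l ≈ 0#) (allFin 4) → H α (τ W₀ a) x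
        forward a ps = ·≈0⇒H (F a) x (trans (expand-· B (F a) x) (sum-zero (λ l → wall B l · x * F a · ray B l) term))
          where
          term : ∀ l → wall B l · x * F a · ray B l ≈ 0#
          term l with dec {wall B l · x ≈ 0#}
          ... | yes z = trans (*-congʳ z) (zeroˡ _)
          ... | no nz = trans (*-congˡ (All.lookup ps (∈-allFin l) nz)) (zeroʳ _)
        backward : ∀ a → H α (τ W₀ a) x → All (λ l → wall B l · x ≉ 0# → F a · ray B l ≈ 0#) (allFin 4)
        backward a h with positive-form B (τ W₀ a)
        ... | p , e , nn = All.tabulate λ {l} _ nz → idx-≡-zero p (F a) e (ray B l) (*-≈0 nz (products l))
          where
          products : ∀ l → wall B l · x * p · ray B l ≈ 0#
          products = sum-zero⁻¹ (λ l → wall B l · x * p · ray B l) (λ l → *-nonneg (closed l) (nn l)) (trans (sym (expand-· B p x)) (H⇒·≈0 p x (≡.subst (λ i → H α i x) (≡.sym e) h)))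
        in-S : ∀ a → H α (τ W₀ a) x → τ W₀ a ∈ S
        in-S a h with τ W₀ a ∈? S
        ... | yes m = m
        ... | no m = contradiction h (off (τ W₀ a) m)

      private
        σ : Fin n → Fin N
        σ i = proj₁ (τ-surjective W₀ i)

        τσ : ∀ i → τ W₀ (σ i) ≡ i
        τσ i = proj₂ (τ-surjective W₀ i)

        στ : ∀ a → σ (τ W₀ a) ≡ a
        στ a = τ-injective W₀ (σ (τ W₀ a)) a (τσ (τ W₀ a))

        σ-injective : Injective _≡_ _≡_ σ
        σ-injective {i} {j} e = ≡.trans (≡.sym (τσ i)) (≡.trans (≡.cong (τ W₀) e) (τσ j))

      count-hyperplanes : n ≡ N
      count-hyperplanes = ℕ.≤-antisym (Fin.injective⇒≤ σ-injective) (Fin.injective⇒≤ (λ {a} {b} → τ-injective W₀ a b))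

      T : Subset N → Subset n
      T F = tabulate (λ i → lookup F (σ i))

      T-rep : ∀ F → Rep W₀ F (T F)
      T-rep F a = mk⇔ (λ m → lookup⇒∈ (T F) (≡.trans eq (∈⇒lookup m))) (λ m → lookup⇒∈ F (≡.trans (≡.sym eq) (∈⇒lookup m)))
        where
        eq : lookup (T F) (τ W₀ a) ≡ lookup F a
        eq = ≡.trans (lookup∘tabulate (λ i → lookup F (σ i)) (τ W₀ a)) (≡.cong (lookup F) (στ a))

      T-∈ : ∀ F i → i ∈ T F ⇔ σ i ∈ F
      T-∈ F i = mk⇔ (λ m → from (T-rep F (σ i)) (≡.subst (_∈ T F) (≡.sym (τσ i)) m)) (λ m → ≡.subst (_∈ T F) (τσ i) (to (T-rep F (σ i)) m))

      rep⇒T : ∀ F S → Rep W₀ F S → S ≡ T F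
      rep⇒T F S rep = ⊆-antisym
        (λ {i} m → from (T-∈ F i) (from (rep (σ i)) (≡.subst (_∈ S) (≡.sym (τσ i)) m)))
        (λ {i} m → ≡.subst (_∈ S) (τσ i) (to (rep (σ i)) (to (T-∈ F i) m)))

      T-injective : ∀ F G → T F ≡ T G → F ≡ G
      T-injective F G e = ⊆-antisym (λ {a} m → from (T-rep G a) (≡.subst (τ W₀ a ∈_) e (to (T-rep F a) m)))
                                    (λ {a} m → from (T-rep F a) (≡.subst (τ W₀ a ∈_) (≡.sym e) (to (T-rep G a) m)))

      T-card : ∀ F → ∣ T F ∣ ≡ ∣ F ∣
      T-card F = ℕ.≤-antisym (injection-≤ σ σ-injective (T F) F (λ i → to (T-∈ F i)))
                             (injection-≤ (τ W₀) (λ {a} {b} → τ-injective W₀ a b) F (T F) (λ a → to (T-rep F a)))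

      T-∅ : ∀ F → T F ≡ ∅ → F ≡ ∅
      T-∅ F e = ⊆-antisym (λ {a} m → ⊥-elim (∉⊥ (≡.subst (τ W₀ a ∈_) e (to (T-rep F a) m)))) (λ m → ⊥-elim (∉⊥ m))

      ∅-T : T ∅ ≡ ∅
      ∅-T = ⊆-antisym (λ {i} m → ⊥-elim (∉⊥ (to (T-∈ ∅ i) m))) (λ m → ⊥-elim (∉⊥ m))

      T-⊂ : ∀ F G → F ⊂ G → T F ⊂ T G
      T-⊂ F G (sub , a , a∈ , a∉) = (λ {i} m → from (T-∈ G i) (sub (to (T-∈ F i) m))) , τ W₀ a , to (T-rep G a) a∈ , λ m → a∉ (from (T-rep F a) m)

      T-⊂⁻ : ∀ F G → T F ⊂ T G → F ⊂ G
      T-⊂⁻ F G (sub , i , i∈ , i∉) = (λ {a} m → from (T-rep G a) (sub (to (T-rep F a) m))) , σ i , to (T-∈ G i) i∈ , λ m → i∉ (from (T-∈ F i) m)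

      select : ∀ {p} {P : Subset n → Set p} (P? : ∀ S → Dec (P S)) {Q : Flat → Set} (Q? : ∀ f → Dec (Q f)) →
               (∀ S → P S → IsFlat α S) → (∀ f → f List.∈ faces → P (T (set f)) ⇔ Q f) →
               filter P? (allSubsets n) ↭ map (λ f → T (set f)) (filter Q? faces)
      select {P = P} P? {Q} Q? flat equiv = unique-↭ (Unique.filter⁺ P? (allSubsets-unique n))
          (AllPairs.map⁺ (AllPairs.filter⁺ Q? (AllPairs.map (λ {f} {g} ne e → ne (T-injective (set f) (set g) e)) flats-unique)))
          (λ {S} m → into S (proj₂ (∈-filter⁻ P? {xs = allSubsets n} m))) (λ {S} m → back S (∈-map⁻ (λ f → T (set f)) m))
        where
        into : ∀ S → P S → S List.∈ map (λ f → T (set f)) (filter Q? faces)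
        into S p with List.find (flat-complete S (flat S p))
        ... | f , f∈ , rep with rep⇒T (set f) S rep
        ... | ≡.refl = ∈-map⁺ (λ f → T (set f)) (∈-filter⁺ Q? f∈ (to (equiv f f∈) p))
        back : ∀ S → ∃[ f ] (f List.∈ filter Q? faces × S ≡ T (set f)) → S List.∈ filter P? (allSubsets n)
        back S (f , f∈ , ≡.refl) with ∈-filter⁻ Q? {xs = faces} f∈
        ... | f∈′ , q = ∈-filter⁺ P? (allSubsets-complete S) (from (equiv f f∈′) q)

      T-flat : ∀ (f : Flat) → IsFlatOfDim α (dim f) (T (set f))
      T-flat (d , F , face) = face-sound face W₀ (T F) (T-rep F)

      T-dim : ∀ (f : Flat) {k} → HasDim (⋂ α (T (set f))) k → dim f ≡ k
      T-dim f h = HasDim-unique (proj₂ (T-flat f)) h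

      flats-↭ : Arr.flats α ↭ map (λ f → T (set f)) faces
      flats-↭ = ≡.subst (λ fs → Arr.flats α ↭ map (λ f → T (set f)) fs) (List.filter-all (λ _ → yes ≡.refl) (All.universal (λ _ → ≡.refl) faces))
        (select (λ S → em {IsFlat α S}) {Q = λ _ → true ≡ true} (λ _ → yes ≡.refl) (λ _ p → p) (λ f _ → mk⇔ (λ _ → ≡.refl) (λ _ → proj₁ (T-flat f))))

      h-faces : ∀ w → Arr.h α w ≡ length (lines faces w)
      h-faces w = ≡.trans (↭-length (select (λ S → em {IsLine α S × ∣ S ∣ ≡ w}) (λ f → (dim f ℕ.≟ 2) ×-dec (∣ set f ∣ ℕ.≟ w)) (λ _ p → proj₁ (proj₁ p))
          (λ f _ → mk⇔ (λ ((_ , d) , c) → T-dim f d , ≡.trans (≡.sym (T-card (set f))) c)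
                       (λ (d , c) → ≡.subst (λ k → IsFlatOfDim α k (T (set f))) d (T-flat f) , ≡.trans (T-card (set f)) c))))
        (List.length-map (λ f → T (set f)) (lines faces w))

      grünbaumShephard : Arr.GrünbaumShephard α
      grünbaumShephard = ≡.subst₂ ℕ._<_ (≡.sym (≡.cong sumℕ (≡.trans (List.map-cong h-faces (drop 3 (upTo (ℕ.suc n)))) (≡.cong (λ m → map (λ w → length (lines faces w)) (drop 3 (upTo (ℕ.suc m)))) count-hyperplanes)))) (≡.sym (h-faces 2)) few-triple

      private
        -- Induction along strict inclusion of sets of roots. All accessibility proofs `a` of the
        -- image are allowed because the unfolding of `μ-acc` chooses those on which it recurses.
        μ-faces : ∀ f → f List.∈ faces → Acc _⊂_ (set f) → ∀ a → Arr.μ-acc α (T (set f)) a ≡ μᴰ f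
        μ-faces f f∈ (acc rs) (acc rec) = cases (≡-dec Bool._≟_ (T (set f)) ∅)
          where
          cases : Dec (T (set f) ≡ ∅) → Arr.μ-acc α (T (set f)) (acc rec) ≡ μᴰ f
          cases (yes e) = ≡.trans (≡.subst (λ S → ∀ a → Arr.μ-acc α S a ≡ + 1) (≡.sym e) μ-acc-∅ (acc rec)) (≡.sym (All.lookup μ-empty f∈ (T-∅ (set f) e)))
          cases (no ne) = ≡.trans (proj₂ (unfold (T (set f)) rec ne)) (≡.trans (≡.cong (λ s → ℤ.- s) sums)
                        (≡.sym (All.lookup μ-nonempty f∈ (λ e → ne (≡.trans (≡.cong T e) ∅-T)))))
            where
            b : Subset n → ℤ
            b = proj₁ (unfold (T (set f)) rec ne)
            pointwise : ∀ g → g List.∈ faces → b (T (set g)) ≡ Below.below f g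
            pointwise g g∈ = go (set g ⊂? set f)
              where
              go : Dec (set g ⊂ set f) → b (T (set g)) ≡ Below.below f g
              go (yes p) = let (a , e) = unfold-⊂ (T (set f)) rec ne (T (set g)) (T-⊂ (set g) (set f) p)
                           in ≡.trans e (≡.trans (μ-faces g g∈ (rs p) a) (≡.sym (below-⊂ f g p)))
              go (no n) = ≡.trans (unfold-⊄ (T (set f)) rec ne (T (set g)) (λ p → n (T-⊂⁻ (set g) (set f) p))) (≡.sym (below-⊄ f g n))
            sums : Arr.sumℤ α (map b (Arr.flats α)) ≡ sumℤ (map (Below.below f) faces)
            sums = ≡.trans (sumℤ-↭ (map⁺ b flats-↭)) (≡.cong sumℤ (≡.trans (≡.sym (List.map-∘ faces)) (List.map-cong-local (All.tabulate λ {g} g∈ → pointwise g g∈))))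

      χ-faces : ∀ k → Arr.χ α k ≡ χᴰ k
      χ-faces k = ≡.trans (sumℤ-↭ (map⁺ (Arr.μ α) sel)) (≡.cong sumℤ (≡.trans (≡.sym (List.map-∘ (filter (λ f → dim f ℕ.≟ k) faces)))
          (List.map-cong-local (All.tabulate λ {f} f∈ → μ-faces f (proj₁ (∈-filter⁻ (λ f → dim f ℕ.≟ k) {xs = faces} f∈)) (⊂-wellFounded (set f)) (⊂-wellFounded (T (set f)))))))
        where
        sel : filter (λ S → em {HasDim (⋂ α S) k}) (Arr.flats α) ↭ map (λ f → T (set f)) (filter (λ f → dim f ℕ.≟ k) faces)
        sel = unique-↭ (Unique.filter⁺ (λ S → em {HasDim (⋂ α S) k}) (Unique.filter⁺ (λ S → em {IsFlat α S}) (allSubsets-unique n)))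
          (AllPairs.map⁺ (AllPairs.filter⁺ (λ f → dim f ℕ.≟ k) (AllPairs.map (λ {f} {g} ne e → ne (T-injective (set f) (set g) e)) flats-unique)))
          (λ {S} m → into S m) (λ {S} m → back S (∈-map⁻ (λ f → T (set f)) m))
          where
          into : ∀ S → S List.∈ filter (λ S → em {HasDim (⋂ α S) k}) (Arr.flats α) → S List.∈ map (λ f → T (set f)) (filter (λ f → dim f ℕ.≟ k) faces)
          into S m with ∈-filter⁻ (λ S → em {HasDim (⋂ α S) k}) {xs = Arr.flats α} m
          ... | m′ , h with ∈-filter⁻ (λ S → em {IsFlat α S}) {xs = allSubsets n} m′
          ... | _ , flat with List.find (flat-complete S flat)
          ... | f , f∈ , rep with rep⇒T (set f) S rep
          ... | ≡.refl = ∈-map⁺ (λ f → T (set f)) (∈-filter⁺ (λ f → dim f ℕ.≟ k) f∈ (T-dim f h))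
          back : ∀ S → ∃[ f ] (f List.∈ filter (λ f → dim f ℕ.≟ k) faces × S ≡ T (set f)) → S List.∈ filter (λ S → em {HasDim (⋂ α S) k}) (Arr.flats α)
          back S (f , f∈ , ≡.refl) with ∈-filter⁻ (λ f → dim f ℕ.≟ k) {xs = faces} f∈
          ... | _ , ≡.refl = ∈-filter⁺ (λ S → em {HasDim (⋂ α S) k}) (∈-filter⁺ (λ S → em {IsFlat α S}) (allSubsets-complete (T (set f))) (proj₁ (T-flat f))) (proj₂ (T-flat f))

      splits : Arr.SplitsOverℝ (λ k → fromℤ (Arr.χ α k))
      splits = 1# , map fromℤ exponents , λ k → trans (reflexive (≡.cong fromℤ (≡.trans (χ-faces k) (χ-splits k)))) (fromℤ-linearFactors exponents k)

-- The isomorphism with a reflection arrangement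

module CellIsomorphism {ℓ : Level} (R : Reals ℓ) {n : ℕ} (α : Fin n → OverReals.V R) (arr : OverReals.IsArrangement R α)
  (simplicial : OverReals.Simplicial R α) (irreducible : OverReals.Irreducible R α)
  (weight≤6 : ∀ S → OverReals.IsVertex R α S → ∣ S ∣ ℕ.≤ 6) (D : RootData.Datum) (valid : RootData.Valid D) where

  open RootData
  open OrderedField R
  open LinearAlgebra R
  open SimplicialCones R α arr
  open Crossings R α arr simplicial
  open EdgeWeights R α arr simplicial irreducible weight≤6
  open RootCoordinates R α arr simplicial irreducible weight≤6 D valid
  open Datum D using (N; normal; codual; factor; simple)
  open Derived D using (ρ)
  open Valid valid
  open import Data.Integer.Base as ℤ using (ℤ; +[1+_])
  open import Data.Product.Base
  open import Data.Sum.Base as Sum using (inj₁; inj₂)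
  open import Data.Vec.Base using (lookup)
  import Relation.Binary.PropositionalEquality as ≡
  open ≡ using (_≡_; _≢_)
  open import Relation.Binary.Reasoning.Setoid setoid

  module _ {B₀ : Base} (W₀ : Weighted B₀ t) (β : Fin N → V) (β≈ : ∀ a k → β a k ≈ ι (lookup (lookup normal a) k)) where

    private
      c : ℝ
      c = ι +[1+ factor ]

      F : Fin N → Form
      F a = proj₁ (root-form W₀ a)

      u : Fin 4 → V
      u l k = ι (lookup (lookup codual l) k)

      -- `Φ` sends the rays of the chamber to the vectors dual to the simple roots up to the factor
      -- `c`. Each normal of the reflection arrangement at `Φ x` then takes `c` times the value of
      -- the corresponding hyperplane form at `x`; `Ψ` is the inverse linear map.
      Φ Ψ : V → V
      Φ x = combination (λ l → wall B₀ l · x) u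
      Ψ z = combination (λ l → c ⁻¹ * ⟨ β (lookup simple l) , z ⟩) (ray B₀)

      -- Corresponding points have equal sign vectors, the factor `c` being positive. Cells are
      -- compared through this relation, which covers both `Φ x` and the preimages `Ψ z`.
      _~_ : V → V → Set ℓ
      x ~ x′ = ∀ a → ⟨ β a , x′ ⟩ ≈ c * F a · x

    abstract
      private
        c-pos : 0# < c
        c-pos = ιℕ-pos factor

        β-u : ∀ a l → ⟨ β a , u l ⟩ ≈ c * ι (lookup (ρ a) l)
        β-u a l = trans (⟨⟩-cong (β a) (λ k → ι (lookup (lookup normal a) k)) (u l) (u l) (β≈ a) (λ _ → refl))
          (trans (sym (ι-dot (lookup normal a) (lookup codual l))) (trans (reflexive (≡.cong ι (realised a l))) (ι-* +[1+ factor ] (lookup (ρ a) l))))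

        Φ-~ : ∀ x → x ~ Φ x
        Φ-~ x a = trans (⟨⟩-combination (β a) (λ l → wall B₀ l · x) u)
          (trans (Σ-cong (λ l → wall B₀ l · x * ⟨ β a , u l ⟩) (λ l → c * (ι (lookup (ρ a) l) * wall B₀ l · x)) (λ l → trans (*-congˡ (β-u a l)) (regroup (wall B₀ l · x) c (ι (lookup (ρ a) l)))))
          (trans (sym (*-distribˡ-Σ c (λ l → ι (lookup (ρ a) l) * wall B₀ l · x))) (*-congˡ (sym (proj₂ (root-form W₀ a) x)))))
          where
          regroup : ∀ w c r → w * (c * r) ≈ c * (r * w)
          regroup = solve 3 (λ w c r → w :* (c :* r) := c :* (r :* w)) refl

        ~-neg : ∀ {x x′} → x ~ x′ → (-ᵥ x) ~ (-ᵥ x′)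
        ~-neg {x} {x′} r a = trans (⟨⟩-neg (β a) x′) (trans (-‿cong (r a)) (trans (-‿distribʳ-* c _) (*-congˡ (sym F-neg))))
          where
          F-neg : F a · (-ᵥ x) ≈ - (F a · x)
          F-neg = trans (·-cong (F a) (-ᵥ x) ((- 1#) *ᵥ x) (λ k → sym (-1*x≈-x (x k)))) (trans (·-* (F a) (- 1#) x) (-1*x≈-x _))

        simple-value : ∀ {x x′} → x ~ x′ → ∀ l → ⟨ β (lookup simple l) , x′ ⟩ ≈ c * wall B₀ l · x
        simple-value {x} r l = trans (r (lookup simple l)) (*-congˡ (trans (proj₂ (root-form W₀ (lookup simple l)) x) (trans (reflexive (≡.cong (λ v → eval B₀ v x) (simple-root l))) (eval-unit B₀ l x))))

        wall-Ψ : ∀ z l → wall B₀ l · Ψ z ≈ c ⁻¹ * ⟨ β (lookup simple l) , z ⟩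
        wall-Ψ z l = trans (·-combination (wall B₀ l) (λ l → c ⁻¹ * ⟨ β (lookup simple l) , z ⟩) (ray B₀))
          (trans (Σ-cong (λ m → c ⁻¹ * ⟨ β (lookup simple m) , z ⟩ * wall B₀ l · ray B₀ m) (λ m → c ⁻¹ * ⟨ β (lookup simple m) , z ⟩ * δ m l) (λ m → *-congˡ (trans (dual B₀ l m) (δ-sym l m))))
                 (sum-δʳ l (λ m → c ⁻¹ * ⟨ β (lookup simple m) , z ⟩)))

        dual-sum : ∀ k k′ → sum (λ l → β (lookup simple l) k * u l k′) ≈ c * δ k k′
        dual-sum k k′ = trans (Σ-cong (λ l → β (lookup simple l) k * u l k′) (λ l → ι (lookup (lookup normal (lookup simple l)) k ℤ.* lookup (lookup codual l) k′))
            (λ l → trans (*-congʳ (β≈ (lookup simple l) k)) (sym (ι-* (lookup (lookup normal (lookup simple l)) k) (lookup (lookup codual l) k′)))))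
          (trans (sym (ι-sum₄ (λ l → lookup (lookup normal (lookup simple l)) k ℤ.* lookup (lookup codual l) k′))) (trans (reflexive (≡.cong ι (Valid.dual-basis valid k k′)))
            (trans (ι-* +[1+ factor ] (lookup (unit k) k′)) (*-congˡ (ι-unit k k′)))))

        ΦΨ : ∀ z → Φ (Ψ z) ≈ᵥ z
        ΦΨ z k′ = begin
          sum (λ l → wall B₀ l · Ψ z * u l k′)
            ≈⟨ Σ-cong (λ l → wall B₀ l · Ψ z * u l k′) (λ l → sum (λ k → c ⁻¹ * z k * (β (lookup simple l) k * u l k′))) (λ l → trans (*-congʳ (wall-Ψ z l)) (term l)) ⟩
          sum (λ l → sum (λ k → c ⁻¹ * z k * (β (lookup simple l) k * u l k′)))
            ≈⟨ ∑-comm (λ l k → c ⁻¹ * z k * (β (lookup simple l) k * u l k′)) ⟩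
          sum (λ k → sum (λ l → c ⁻¹ * z k * (β (lookup simple l) k * u l k′)))
            ≈⟨ Σ-cong (λ k → sum (λ l → c ⁻¹ * z k * (β (lookup simple l) k * u l k′))) (λ k → z k * δ k k′)
                 (λ k → trans (sym (*-distribˡ-Σ (c ⁻¹ * z k) (λ l → β (lookup simple l) k * u l k′))) (trans (*-congˡ (dual-sum k k′)) (trans (regroup (c ⁻¹) (z k) c (δ k k′)) (trans (*-congʳ (inv-*′ (≉-pos c-pos))) (*-identityˡ _))))) ⟩
          sum (λ k → z k * δ k k′)
            ≈⟨ sum-δʳ k′ z ⟩
          z k′ ∎
          where
          regroup : ∀ i z c d → i * z * (c * d) ≈ i * c * (z * d)
          regroup = solve 4 (λ i z c d → i :* z :* (c :* d) := i :* c :* (z :* d)) refl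
          regroup′ : ∀ i b z w → (i * w) * (b * z) ≈ i * z * (b * w)
          regroup′ = solve 4 (λ i b z w → (i :* w) :* (b :* z) := i :* z :* (b :* w)) refl
          swap-last : ∀ i s w → i * s * w ≈ i * w * s
          swap-last = solve 3 (λ i s w → i :* s :* w := i :* w :* s) refl
          term : ∀ l → c ⁻¹ * ⟨ β (lookup simple l) , z ⟩ * u l k′ ≈ sum (λ k → c ⁻¹ * z k * (β (lookup simple l) k * u l k′))
          term l = trans (swap-last (c ⁻¹) _ (u l k′)) (trans (*-distribˡ-Σ (c ⁻¹ * u l k′) (λ k → β (lookup simple l) k * z k))
            (Σ-cong (λ k → c ⁻¹ * u l k′ * (β (lookup simple l) k * z k)) (λ k → c ⁻¹ * z k * (β (lookup simple l) k * u l k′)) (λ k → regroup′ (c ⁻¹) (β (lookup simple l) k) (z k) (u l k′))))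

        Ψ-~ : ∀ z → Ψ z ~ z
        Ψ-~ z a = trans (⟨⟩-congʳ (β a) z (Φ (Ψ z)) (λ k → sym (ΦΨ z k))) (Φ-~ (Ψ z) a)

        Φ-nonzero : ∀ x → ¬ (x ≈ᵥ 0ᵥ) → ¬ (Φ x ≈ᵥ 0ᵥ)
        Φ-nonzero x nz z = nz (kernel B₀ x λ l → *-≈0 (≉-pos c-pos) (trans (sym (simple-value {x} {Φ x} (Φ-~ x) l)) (trans (⟨⟩-congʳ (β (lookup simple l)) (Φ x) 0ᵥ z) (⟨⟩-0 (β (lookup simple l))))))

        Ψ-nonzero : ∀ z → ¬ (z ≈ᵥ 0ᵥ) → ¬ (Ψ z ≈ᵥ 0ᵥ)
        Ψ-nonzero z nz e = nz λ k → trans (sym (ΦΨ z k)) (sum-zero (λ l → wall B₀ l · Ψ z * u l k) (λ l → trans (*-congʳ (H⇒·≈0 (wall B₀ l) (Ψ z) (trans (⟨⟩-congʳ (α (idx (wall B₀ l))) (Ψ z) 0ᵥ e) (⟨⟩-0 (α (idx (wall B₀ l))))))) (zeroˡ _)))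

        ≼-to : ∀ {x x′ y y′} → x ~ x′ → y ~ y′ → _≼_ α x y → _≼_ β x′ y′
        ≼-to {x} {x′} {y} {y′} rx ry le a =
            (λ p → <-respʳ (sym (ry a)) (*-pos c-pos (proj₁ (≼-form {x} {y} le (F a)) (*-cancel-pos c-pos (<-respʳ (rx a) p)))))
          , (λ p → <-respˡ (sym (ry a)) (*-pos-neg c-pos (proj₂ (≼-form {x} {y} le (F a)) (*-cancel-neg c-pos (<-respˡ (rx a) p)))))

        ≼-from : ∀ {x x′ y y′} → x ~ x′ → y ~ y′ → _≼_ β x′ y′ → _≼_ α x y
        ≼-from {x} {x′} {y} {y′} rx ry le i with τ-surjective W₀ i
        ... | a , ≡.refl with ≉⇒<> (scale≉0 (F a))
        ... | inj₁ s = (λ p → *-cancel-pos s (<-respʳ (·-def (F a) y) (pos (<-respʳ (sym (·-def (F a) x)) (*-pos s p)))))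
                     , (λ p → *-cancel-neg s (<-respˡ (·-def (F a) y) (neg′ (<-respˡ (sym (·-def (F a) x)) (*-pos-neg s p)))))
          where
          pos : 0# < F a · x → 0# < F a · y
          pos p = *-cancel-pos c-pos (<-respʳ (ry a) (proj₁ (le a) (<-respʳ (sym (rx a)) (*-pos c-pos p))))
          neg′ : F a · x < 0# → F a · y < 0#
          neg′ p = *-cancel-neg c-pos (<-respˡ (ry a) (proj₂ (le a) (<-respˡ (sym (rx a)) (*-pos-neg c-pos p))))
        ... | inj₂ s = (λ p → *-cancel-pos (neg-pos s) (<-respʳ (flip y) (neg-pos (neg′ (<-respˡ (sym (·-def (F a) x)) (*-neg-pos s p))))))
                     , (λ p → *-cancel-neg (neg-pos s) (<-respˡ (flip y) (pos-neg (pos (<-respʳ (sym (·-def (F a) x)) (*-neg-neg s p))))))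
          where
          pos : 0# < F a · x → 0# < F a · y
          pos p = *-cancel-pos c-pos (<-respʳ (ry a) (proj₁ (le a) (<-respʳ (sym (rx a)) (*-pos c-pos p))))
          neg′ : F a · x < 0# → F a · y < 0#
          neg′ p = *-cancel-neg c-pos (<-respˡ (ry a) (proj₂ (le a) (<-respˡ (sym (rx a)) (*-pos-neg c-pos p))))
          flip : ∀ x → - (F a · x) ≈ - scale (F a) * ⟨ α (τ W₀ a) , x ⟩
          flip x = trans (-‿cong (·-def (F a) x)) (-‿distribˡ-* _ _)

        ⊑-to : ∀ {x y : Point} {x′ y′ : Point} → proj₁ x ~ proj₁ x′ → proj₁ y ~ proj₁ y′ → _⊑_ α x y → _⊑_ β x′ y′
        ⊑-to {x} {y} {x′} {y′} rx ry = Sum.map (≼-to {proj₁ x} {proj₁ x′} {proj₁ y} {proj₁ y′} rx ry) (≼-to { -ᵥ proj₁ x} { -ᵥ proj₁ x′} {proj₁ y} {proj₁ y′} (~-neg {proj₁ x} {proj₁ x′} rx) ry)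

        ⊑-from : ∀ {x y : Point} {x′ y′ : Point} → proj₁ x ~ proj₁ x′ → proj₁ y ~ proj₁ y′ → _⊑_ β x′ y′ → _⊑_ α x y
        ⊑-from {x} {y} {x′} {y′} rx ry = Sum.map (≼-from {proj₁ x} {proj₁ x′} {proj₁ y} {proj₁ y′} rx ry) (≼-from { -ᵥ proj₁ x} { -ᵥ proj₁ x′} {proj₁ y} {proj₁ y′} (~-neg {proj₁ x} {proj₁ x′} rx) ry)

        same-to : ∀ {x y : Point} {x′ y′ : Point} → proj₁ x ~ proj₁ x′ → proj₁ y ~ proj₁ y′ → SameCell α x y → SameCell β x′ y′
        same-to {x , _} {y , _} {x′ , _} {y′ , _} rx ry = Sum.map (λ (p , q) → ≼-to {x} {x′} {y} {y′} rx ry p , ≼-to {y} {y′} {x} {x′} ry rx q)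
          (λ (p , q) → ≼-to { -ᵥ x} { -ᵥ x′} {y} {y′} (~-neg {x} {x′} rx) ry p , ≼-to {y} {y′} { -ᵥ x} { -ᵥ x′} ry (~-neg {x} {x′} rx) q)

        same-from : ∀ {x y : Point} {x′ y′ : Point} → proj₁ x ~ proj₁ x′ → proj₁ y ~ proj₁ y′ → SameCell β x′ y′ → SameCell α x y
        same-from {x , _} {y , _} {x′ , _} {y′ , _} rx ry = Sum.map (λ (p , q) → ≼-from {x} {x′} {y} {y′} rx ry p , ≼-from {y} {y′} {x} {x′} ry rx q)
          (λ (p , q) → ≼-from { -ᵥ x} { -ᵥ x′} {y} {y′} (~-neg {x} {x′} rx) ry p , ≼-from {y} {y′} { -ᵥ x} { -ᵥ x′} ry (~-neg {x} {x′} rx) q)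

      isomorphic : Isomorphic α β
      isomorphic = to , record
        { isOrderMonomorphism = record
          { isOrderHomomorphism = record
            { cong = λ {x} {y} → same-to {x} {y} {to x} {to y} (Φ-~ (proj₁ x)) (Φ-~ (proj₁ y))
            ; mono = λ {x} {y} → ⊑-to {x} {y} {to x} {to y} (Φ-~ (proj₁ x)) (Φ-~ (proj₁ y)) }
          ; injective = λ {x} {y} → same-from {x} {y} {to x} {to y} (Φ-~ (proj₁ x)) (Φ-~ (proj₁ y))
          ; cancel = λ {x} {y} → ⊑-from {x} {y} {to x} {to y} (Φ-~ (proj₁ x)) (Φ-~ (proj₁ y)) }
        ; surjective = λ z → (Ψ (proj₁ z) , Ψ-nonzero (proj₁ z) (proj₂ z)) , λ {x} → same-to {x} {_ , Ψ-nonzero (proj₁ z) (proj₂ z)} {to x} {z} (Φ-~ (proj₁ x)) (Ψ-~ (proj₁ z)) }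
        where
        to : Point → Point
        to (x , nz) = Φ x , Φ-nonzero x nz

open RootData using (Datum; unit)
open A₄-and-D₄
open import Data.Fin.Base using (Fin; suc)
import Data.Fin.Properties as Fin
open import Data.Fin.Patterns
open import Data.Fin.Subset using (∣_∣)
open import Data.Integer.Base as ℤ using (ℤ; +_; -[1+_])
import Data.Integer.Properties as ℤ
import Data.Nat.Base as ℕ
import Data.Nat.Properties as ℕ
open import Data.List.Base using (List; []; _∷_; length; allFin; filter; lookup)
open import Data.List.Membership.Propositional using (_∈_)
open import Data.List.Membership.Propositional.Properties using (∈-filter⁻)
open import Data.List.Relation.Unary.All as All using ()
open import Data.List.Relation.Unary.AllPairs using (_∷_)
open import Data.List.Relation.Unary.Any as Any using (here; there)
open import Data.List.Relation.Unary.Unique.Propositional using (Unique)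
import Data.List.Relation.Unary.Unique.Propositional.Properties as Unique
open import Data.Product.Base using (∃-syntax; _,_; proj₂)
open import Data.Sum.Base using (inj₁; inj₂)
import Data.Vec.Base as Vec
open import Relation.Nullary using (yes; no; contradiction)
open import Relation.Nullary.Decidable using (toWitness; True)
import Relation.Binary.PropositionalEquality as ≡
open ≡ using (_≡_; _≢_; ≢-sym)
open FiniteSets

-- Hyperplanes through the intersection of two walls

module Pencils {ℓ : Level} (R : Reals ℓ) {n : ℕ} (α : Fin n → OverReals.V R) (arr : OverReals.IsArrangement R α)
  (simplicial : OverReals.Simplicial R α) (irreducible : OverReals.Irreducible R α)
  (weight≤6 : ∀ S → OverReals.IsVertex R α S → ∣ S ∣ ℕ.≤ 6) where

  open OrderedField R
  open SimplicialCones R α arr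
  open ChamberCones R α arr using (chamber-base)
  open LocalStructure R α arr simplicial
  open EdgeWeights R α arr simplicial irreducible weight≤6

  abstract
    -- A hyperplane through the intersection is supported on the rays `l` and `m`. Support on one of
    -- them alone means a wall, and support on both an edge, whose hyperplane is unique by
    -- `mid-idx`.
    pencil-≤3 : ∀ B {l m} → l ≢ m → count (allFin n) (λ k → (∀ {x} → H α (idx (wall B l)) x × H α (idx (wall B m)) x → H α k x)) ℕ.≤ 3
    pencil-≤3 B {l} {m} l≢m = bound dec
      where
      through : List (Fin n)
      through = filter (λ k → em {∀ {x} → H α (idx (wall B l)) x × H α (idx (wall B m)) x → H α k x}) (allFin n)
      unique-through : Unique through
      unique-through = Unique.filter⁺ (λ k → em {∀ {x} → H α (idx (wall B l)) x × H α (idx (wall B m)) x → H α k x}) (Unique.allFin⁺ n)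
      supp : ∀ k → k ∈ through → Supp₂ B l m (form k 1# 1≉0)
      supp k k∈ r r≢l r≢m = H⇒·≈0 (form k 1# 1≉0) (ray B r)
        (proj₂ (∈-filter⁻ (λ k → em {∀ {x} → H α (idx (wall B l)) x × H α (idx (wall B m)) x → H α k x}) {xs = allFin n} k∈) {ray B r}
          (·≈0⇒H (wall B l) (ray B r) (wall-≢ B (≢-sym r≢l)) , ·≈0⇒H (wall B m) (ray B r) (wall-≢ B (≢-sym r≢m))))
      cases : ∀ k → k ∈ through → k ≡ idx (wall B l) ⊎ k ≡ idx (wall B m) ⊎ Mid B l m (form k 1# 1≉0)
      cases k k∈ with dec {form k 1# 1≉0 · ray B l ≈ 0#} | dec {form k 1# 1≉0 · ray B m ≈ 0#}
      ... | no p | no q = inj₂ (inj₂ (p , q , supp k k∈))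
      ... | yes p | _ = inj₂ (inj₁ (only-ray B (form k 1# 1≉0) m λ r r≢m → at r r≢m))
        where
        at : ∀ r → r ≢ m → form k 1# 1≉0 · ray B r ≈ 0#
        at r r≢m with r Fin.≟ l
        ... | yes ≡.refl = p
        ... | no r≢l = supp k k∈ r r≢l r≢m
      ... | no _ | yes q = inj₁ (only-ray B (form k 1# 1≉0) l λ r r≢l → at r r≢l)
        where
        at : ∀ r → r ≢ l → form k 1# 1≉0 · ray B r ≈ 0#
        at r r≢l with r Fin.≟ m
        ... | yes ≡.refl = q
        ... | no r≢m = supp k k∈ r r≢l r≢m
      bound : Relation.Nullary.Dec (∃[ f ] Mid B l m f) → length through ℕ.≤ 3
      bound (yes (f , mf)) = length-mono-unique {ys = idx (wall B l) ∷ idx (wall B m) ∷ idx f ∷ []} unique-through (λ {k} k∈ → place k (cases k k∈))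
        where
        place : ∀ k → k ≡ idx (wall B l) ⊎ k ≡ idx (wall B m) ⊎ Mid B l m (form k 1# 1≉0) → k ∈ (idx (wall B l) ∷ idx (wall B m) ∷ idx f ∷ [])
        place k (inj₁ e) = here e
        place k (inj₂ (inj₁ e)) = there (here e)
        place k (inj₂ (inj₂ mk)) = there (there (here (mid-idx B l≢m (form k 1# 1≉0) f mk mf)))
      bound (no none) = ℕ.m≤n⇒m≤1+n (length-mono-unique {ys = idx (wall B l) ∷ idx (wall B m) ∷ []} unique-through (λ {k} k∈ → place k (cases k k∈)))
        where
        place : ∀ k → k ≡ idx (wall B l) ⊎ k ≡ idx (wall B m) ⊎ Mid B l m (form k 1# 1≉0) → k ∈ (idx (wall B l) ∷ idx (wall B m) ∷ [])
        place k (inj₁ e) = here e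
        place k (inj₂ (inj₁ e)) = there (here e)
        place k (inj₂ (inj₂ mk)) = contradiction (_ , mk) none

    simplyLaced : SimplyLaced α
    simplyLaced (p , p≉0) chamber i j i≢j wi wj with chamber-base p chamber simplicial i
    ... | B , _ , complete with complete i wi | complete j wj
    ... | l , ≡.refl | m , ≡.refl = pencil-≤3 B {l} {m} (λ { ≡.refl → i≢j ≡.refl })

-- The listed normals agree with the reflection arrangements

module Normals {ℓ : Level} (R : Reals ℓ) where

  open OrderedField R
  open OverReals R using (e)
  private
    module A = Datum A₄
    module D = Datum D₄

  -- The last row expresses the fifth coordinate as minus the sum of the other four.
  unit-5 : Fin 5 → Fin 4 → ℤ
  unit-5 0F = Vec.lookup (unit 0F)
  unit-5 1F = Vec.lookup (unit 1F)
  unit-5 2F = Vec.lookup (unit 2F)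
  unit-5 3F = Vec.lookup (unit 3F)
  unit-5 4F _ = -[1+ 0 ]

  abstract
    e≈ : ∀ i k → e i k ≈ ι (Vec.lookup (unit i) k)
    e≈ 0F 0F = refl
    e≈ 0F 1F = refl
    e≈ 0F 2F = refl
    e≈ 0F 3F = refl
    e≈ 1F 0F = refl
    e≈ 1F 1F = refl
    e≈ 1F 2F = refl
    e≈ 1F 3F = refl
    e≈ 2F 0F = refl
    e≈ 2F 1F = refl
    e≈ 2F 2F = refl
    e≈ 2F 3F = refl
    e≈ 3F 0F = refl
    e≈ 3F 1F = refl
    e≈ 3F 2F = refl
    e≈ 3F 3F = refl

    coordinate≈ : ∀ i k → coordinate i k ≈ ι (unit-5 i k)
    coordinate≈ 0F = e≈ 0F
    coordinate≈ 1F = e≈ 1F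
    coordinate≈ 2F = e≈ 2F
    coordinate≈ 3F = e≈ 3F
    coordinate≈ 4F k = refl

    difference : ∀ {x y} a b → x ≈ ι a → y ≈ ι b → ∀ {c} → c ≡ a ℤ.- b → x - y ≈ ι c
    difference a b p q ≡.refl = trans (+-cong p (trans (-‿cong q) (sym (ι-neg b)))) (sym (ι-+ a (ℤ.- b)))

    total : ∀ {x y} a b → x ≈ ι a → y ≈ ι b → ∀ {c} → c ≡ a ℤ.+ b → x + y ≈ ι c
    total a b p q ≡.refl = trans (+-cong p q) (sym (ι-+ a b))

    A-entry : ∀ a i j → True (Fin.all? λ k → Vec.lookup (Vec.lookup A.normal a) k ℤ.≟ unit-5 i k ℤ.- unit-5 j k) →
              ∀ k → coordinate i k - coordinate j k ≈ ι (Vec.lookup (Vec.lookup A.normal a) k)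
    A-entry a i j w k = difference (unit-5 i k) (unit-5 j k) (coordinate≈ i k) (coordinate≈ j k) (toWitness w k)

    D-entry⁻ : ∀ a i j → True (Fin.all? λ k → Vec.lookup (Vec.lookup D.normal a) k ℤ.≟ Vec.lookup (unit i) k ℤ.- Vec.lookup (unit j) k) →
               ∀ k → e i k - e j k ≈ ι (Vec.lookup (Vec.lookup D.normal a) k)
    D-entry⁻ a i j w k = difference (Vec.lookup (unit i) k) (Vec.lookup (unit j) k) (e≈ i k) (e≈ j k) (toWitness w k)

    D-entry⁺ : ∀ a i j → True (Fin.all? λ k → Vec.lookup (Vec.lookup D.normal a) k ℤ.≟ Vec.lookup (unit i) k ℤ.+ Vec.lookup (unit j) k) →
               ∀ k → e i k + e j k ≈ ι (Vec.lookup (Vec.lookup D.normal a) k)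
    D-entry⁺ a i j w k = total (Vec.lookup (unit i) k) (Vec.lookup (unit j) k) (e≈ i k) (e≈ j k) (toWitness w k)

    A₄-normals≈ : ∀ a k → 𝒜A₄ a k ≈ ι (Vec.lookup (Vec.lookup A.normal a) k)
    A₄-normals≈ 0F = A-entry 0F 0F 1F _
    A₄-normals≈ 1F = A-entry 1F 0F 2F _
    A₄-normals≈ 2F = A-entry 2F 0F 3F _
    A₄-normals≈ 3F = A-entry 3F 0F 4F _
    A₄-normals≈ 4F = A-entry 4F 1F 2F _
    A₄-normals≈ 5F = A-entry 5F 1F 3F _
    A₄-normals≈ 6F = A-entry 6F 1F 4F _
    A₄-normals≈ 7F = A-entry 7F 2F 3F _
    A₄-normals≈ 8F = A-entry 8F 2F 4F _
    A₄-normals≈ 9F = A-entry 9F 3F 4F _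

    D₄-normals≈ : ∀ a k → 𝒜D₄ a k ≈ ι (Vec.lookup (Vec.lookup D.normal a) k)
    D₄-normals≈ 0F = D-entry⁻ 0F 0F 1F _
    D₄-normals≈ 1F = D-entry⁺ 1F 0F 1F _
    D₄-normals≈ 2F = D-entry⁻ 2F 0F 2F _
    D₄-normals≈ 3F = D-entry⁺ 3F 0F 2F _
    D₄-normals≈ 4F = D-entry⁻ 4F 0F 3F _
    D₄-normals≈ 5F = D-entry⁺ 5F 0F 3F _
    D₄-normals≈ 6F = D-entry⁻ 6F 1F 2F _
    D₄-normals≈ 7F = D-entry⁺ 7F 1F 2F _
    D₄-normals≈ 8F = D-entry⁻ 8F 1F 3F _
    D₄-normals≈ 9F = D-entry⁺ 9F 1F 3F _
    D₄-normals≈ (suc 9F) = D-entry⁻ (suc 9F) 2F 3F _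
    D₄-normals≈ (suc (suc 9F)) = D-entry⁺ (suc (suc 9F)) 2F 3F _

-- The classification and its consequences

theorem3 : ∀ {ℓ} (R : Reals ℓ) → let open OverReals R in
    ∀ {n : ℕ} (α : Vector V n) →
    IsArrangement α → Irreducible α → Simplicial α → IsMaxVertexWeight α 6 →
    (Isomorphic α 𝒜A₄ ⊎ Isomorphic α 𝒜D₄)
    × SimplyLaced α × GrünbaumShephard α × SplitsOverℝ (λ k → fromℤ (χ α k))
theorem3 R α arr irreducible simplicial (_ , weight≤6) = conclude (Classification.tree R α arr simplicial irreducible weight≤6)
  where
  open OverReals R
  open SimplicialCones R α arr using (Base)
  open Classification R α arr simplicial irreducible weight≤6 using (Tree)
  open Pencils R α arr simplicial irreducible weight≤6 using (simplyLaced)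
  module A = IntersectionLattice R α arr simplicial irreducible weight≤6 A₄ A₄-valid
  module D = IntersectionLattice R α arr simplicial irreducible weight≤6 D₄ D₄-valid
  conclude : ∃[ B ] Tree B → (Isomorphic α 𝒜A₄ ⊎ Isomorphic α 𝒜D₄) × SimplyLaced α × GrünbaumShephard α × SplitsOverℝ (λ k → fromℤ (χ α k))
  conclude (B , inj₁ W) = inj₁ (CellIsomorphism.isomorphic R α arr simplicial irreducible weight≤6 A₄ A₄-valid W 𝒜A₄ (Normals.A₄-normals≈ R))
                        , simplyLaced , A.grünbaumShephard W , A.splits W
  conclude (B , inj₂ W) = inj₂ (CellIsomorphism.isomorphic R α arr simplicial irreducible weight≤6 D₄ D₄-valid W 𝒜D₄ (Normals.D₄-normals≈ R))
                        , simplyLaced , D.grünbaumShephard W , D.splits W
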